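{- Let $n$ be even and consider the stable roommates problem on $n$ people in which each person independently ranks the other $n-1$ people according to a uniformly random ordering. Let $X$ be the number of stable matchings. Then for all sufficiently large even $n$, \[ \mathbb{P}(X \geq 1) \leq n^{ -1/17}. \]
   Context: A matching is a perfect matching of the $n$ people, and $M(i)$ denotes the partner of $i$ in a matching $M$. A matching $M$ is stable if there is no pair $\{i,j\}$ of people who are not matched to each other in $M$ such that $i$ prefers $j$ to $M(i)$ and $j$ prefers $i$ to $M(j)$. -}

module Defs where

open import Data.Nat as ℕ using (ℕ; zero; suc; _∸_)
open import Data.Fin as Fin using (Fin; _<_)
open import Data.Fin.Properties using (_≟_; _<?_; all?; any?)
open import Data.Vec as Vec using (Vec; []; _∷_; lookup)
open import Data.List as List using (List; [_]; concatMap; length; filter)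
open import Data.List.Base using (allFin)
open import Data.Product using (Σ; ∃; _×_; _,_)
open import Relation.Nullary using (Dec; yes; no; ¬_)
open import Relation.Nullary.Decidable using (map′; _×-dec_; _→-dec_; ¬?)
open import Relation.Unary using (Pred; Decidable)
open import Relation.Binary.PropositionalEquality using (_≡_; _≢_)

-- People are Fin n.  A preference list of person i is a vector of length
-- n-1 listing people, most preferred first.
PrefList : ℕ → Set
PrefList n = Vec (Fin n) (n ∸ 1)

Profile : ℕ → Set
Profile n = Vec (PrefList n) n

-- A list for person i is a valid ranking of the other n-1 people iff
-- its entries are pairwise distinct and none of them is i
-- (then it lists every other person exactly once).
ValidList : ∀ {n} → Fin n → PrefList n → Set
ValidList i l = (∀ p q → lookup l p ≡ lookup l q → p ≡ q) × (∀ p → lookup l p ≢ i)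

ValidProfile : ∀ {n} → Profile n → Set
ValidProfile P = ∀ i → ValidList i (lookup P i)

Prefers : ∀ {n} → Profile n → Fin n → Fin n → Fin n → Set
Prefers P i j k =
  ∃ λ p → ∃ λ q → (p < q) × (lookup (lookup P i) p ≡ j) × (lookup (lookup P i) q ≡ k)

-- A perfect matching, given as the partner function M(i) = lookup M i:
-- a fixed-point-free involution.
IsMatching : ∀ {n} → Vec (Fin n) n → Set
IsMatching M = ∀ i → (lookup M (lookup M i) ≡ i) × (lookup M i ≢ i)

Stable : ∀ {n} → Profile n → Vec (Fin n) n → Set
Stable P M = ∀ i j → j ≢ lookup M i →
  ¬ (Prefers P i j (lookup M i) × Prefers P j i (lookup M j))

HasStableMatching : ∀ {n} → Profile n → Set
HasStableMatching {n} P = ∃ λ (M : Vec (Fin n) n) → IsMatching M × Stable P M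

∃Vec? : ∀ {n} k {p} {P : Pred (Vec (Fin n) k) p} → Decidable P → Dec (∃ P)
∃Vec? zero P? with P? []
... | yes p = yes ([] , p)
... | no ¬p = no λ { ([] , p) → ¬p p }
∃Vec? (suc k) {P = P} P? =
  map′ (λ { (x , v , p) → (x ∷ v , p) }) (λ { (x ∷ v , p) → (x , v , p) })
       (any? (λ x → ∃Vec? k (λ v → P? (x ∷ v))))

validList? : ∀ {n} (i : Fin n) (l : PrefList n) → Dec (ValidList i l)
validList? i l =
  all? (λ p → all? (λ q → (lookup l p ≟ lookup l q) →-dec (p ≟ q)))
  ×-dec all? (λ p → ¬? (lookup l p ≟ i))

validProfile? : ∀ {n} (P : Profile n) → Dec (ValidProfile P)
validProfile? P = all? (λ i → validList? i (lookup P i))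

prefers? : ∀ {n} (P : Profile n) i j k → Dec (Prefers P i j k)
prefers? P i j k = any? (λ p → any? (λ q →
  (p <? q) ×-dec (lookup (lookup P i) p ≟ j) ×-dec (lookup (lookup P i) q ≟ k)))

isMatching? : ∀ {n} (M : Vec (Fin n) n) → Dec (IsMatching M)
isMatching? M = all? (λ i → (lookup M (lookup M i) ≟ i) ×-dec ¬? (lookup M i ≟ i))

stable? : ∀ {n} (P : Profile n) M → Dec (Stable P M)
stable? P M = all? (λ i → all? (λ j → ¬? (j ≟ lookup M i) →-dec
  ¬? (prefers? P i j (lookup M i) ×-dec prefers? P j i (lookup M j))))

hasStableMatching? : ∀ {n} (P : Profile n) → Dec (HasStableMatching P)
hasStableMatching? {n} P = ∃Vec? n (λ M → isMatching? M ×-dec stable? P M)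

allVecs : ∀ {A : Set} → List A → (k : ℕ) → List (Vec A k)
allVecs xs zero    = [ [] ]
allVecs xs (suc k) = concatMap (λ x → List.map (x ∷_) (allVecs xs k)) xs

allProfiles : (n : ℕ) → List (Profile n)
allProfiles n = allVecs (allVecs (allFin n) (n ∸ 1)) n

-- Number of valid profiles (= ((n-1)!)^n): the uniform sample space.
validCount : ℕ → ℕ
validCount n = length (filter validProfile? (allProfiles n))

stableCount : ℕ → ℕ
stableCount n =
  length (filter (λ P → validProfile? P ×-dec hasStableMatching? P) (allProfiles n))

-- Let every person i give independent uniform scores X i j in Fin L to the others, L huge; lower scores are better, and
-- sorting the scores yields uniform rankings.  The expected number of stable matchings is O(1): for a fixed matching M,
-- a pair of unmatched persons whose partners have scores a and b fails to block with probability 1 − a b / L², and the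
-- resulting sum over the scores of the partners is controlled by repeated summation by parts.
--
-- Now let M be stable, let s i be the person whom i likes best among those accepting i (those who score i at least as well
-- as their partner under M), and φ i = M (s i).  A cycle of φ is a rotation: replacing M i by s i along it gives another
-- stable matching, so y disjoint short cycles that do not interfere give 2 ^ y stable matchings.  Conditionally on the scores
-- of the partners and of the persons s i, the map s is nearly a product measure; exchanging the images of u and of φ ^ k u
-- creates a cycle of length k, and weighting the cycles of length k by 1 / k shows that having exactly j short cycles is at
-- most half as likely as having j + 1, as long as j is at most a constant multiple of the logarithm of n.  Hence, up to
-- events of small mass, a matrix with a stable matching has at least a power of n of them, and the bound on the expectation
-- makes such matrices rare.

module Submission where

open import Defs
open import Data.Nat as ℕ using (ℕ; zero; suc; _+_; _*_; _^_; _∸_; _≤_; _<_; z≤n; s≤s; NonZero; >-nonZero; _/_; pred; _!; ⌊_/2⌋; ⌈_/2⌉)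
open import Data.Nat.Properties
open import Data.Nat.DivMod
open import Data.Nat.Divisibility using (_∣_; divides; ∣-trans; m∣m*n; m≤n⇒m!∣n!)
open import Data.Nat.ListAction using (sum)
open import Data.Nat.Tactic.RingSolver using (solve-∀)
open import Data.Fin as Fin using (Fin; zero; suc; toℕ; fromℕ<; punchOut; punchIn)
import Data.Fin.Properties as FinP
open import Data.Vec as Vec using (Vec; []; _∷_; lookup; tabulate; zipWith; _[_]≔_)
import Data.Vec.Properties as VecP
open import Data.List as List using (List; []; _∷_; concatMap; filter; length; foldr; _++_)
open import Data.Bool using (Bool; true; false)
open import Data.Product using (∃; _×_; _,_; proj₁; proj₂)
import Data.Product.Properties as ProdP
open import Data.Sum using (_⊎_; inj₁; inj₂)
open import Data.Empty using (⊥; ⊥-elim)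
open import Data.Unit using (tt)
open import Function using (_∘_; id)
open import Relation.Nullary using (Dec; yes; no; ¬_)
open import Relation.Nullary.Decidable using (_×-dec_; _⊎-dec_; ¬?; _→-dec_)
open import Relation.Binary.Definitions using (tri<; tri≈; tri>)
open import Relation.Binary.PropositionalEquality hiding (J)

-- Finite sums and products

-- The number of stable matchings of a matrix is never conditioned on. Each pair of a matrix and a
-- stable matching carries a cost of at least `2 ^ J` divided by that number: `2 ^ (J ∸ y)` when `y`
-- rotations are available, `2 ^ J` after an exceptional event. The stable matchings of one matrix
-- thus pay `2 ^ J` together, and a bound on the total cost of one matching, times the number (2h -
-- 1)!! of matchings, counts the solvable matrices. So the mean of `2 ^ (J ∸ y)` must be small,
-- which repeated halving gives; the double factorial cancels against a Gaussian moment. All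
-- probabilities are integer counts with denominators cleared, and a factor 49/50 stands for each
-- error tending to 0. The exponent: let n be about g^80 with g = 2^(5r). Persons on short cycles
-- must be so few that no two of them block each other, which limits the length to g^26. The
-- harmonic sum up to there is at least 65 r, which permits 28 r rotations, and 2^(28r) exceeds g^5
-- = 2^(25r) by more than the factors of order r. The probability is of order g^(-5), that is
-- n^(-1/16); passing to 1/17 absorbs the constants.

data U : Set where
  fin : ℕ → U
  vec : U → ℕ → U
  _⊗_ : U → U → U

El : U → Set
El (fin n)   = Fin n
El (vec u n) = Vec (El u) n
El (u ⊗ v)   = El u × El v

_≟u_ : ∀ {u} (a b : El u) → Dec (a ≡ b)
_≟u_ {fin n}   = FinP._≟_
_≟u_ {vec u n} = VecP.≡-dec (_≟u_ {u})
_≟u_ {u ⊗ v}   = ProdP.≡-dec (_≟u_ {u}) (_≟u_ {v})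

-- Summation follows the code of the index type, so a sum over vectors or pairs is by definition an
-- iterated sum; exchanging sums and induction on the length of a vector then need no enumeration.
∑ : (u : U) → (El u → ℕ) → ℕ
∑ (fin zero)      f = 0
∑ (fin (suc n))   f = f zero + ∑ (fin n) (λ i → f (suc i))
∑ (vec u zero)    f = f []
∑ (vec u (suc n)) f = ∑ u λ a → ∑ (vec u n) λ v → f (a ∷ v)
∑ (u ⊗ v)         f = ∑ u λ a → ∑ v λ b → f (a , b)

∑-cong : ∀ u {f g : El u → ℕ} → (∀ a → f a ≡ g a) → ∑ u f ≡ ∑ u g
∑-cong (fin zero)      e = refl
∑-cong (fin (suc n))   e = cong₂ _+_ (e zero) (∑-cong (fin n) (λ i → e (suc i)))
∑-cong (vec u zero)    e = e []
∑-cong (vec u (suc n)) e = ∑-cong u λ a → ∑-cong (vec u n) λ v → e (a ∷ v)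
∑-cong (u ⊗ v)         e = ∑-cong u λ a → ∑-cong v λ b → e (a , b)

∑-mono : ∀ u {f g : El u → ℕ} → (∀ a → f a ≤ g a) → ∑ u f ≤ ∑ u g
∑-mono (fin zero)      e = z≤n
∑-mono (fin (suc n))   e = +-mono-≤ (e zero) (∑-mono (fin n) (λ i → e (suc i)))
∑-mono (vec u zero)    e = e []
∑-mono (vec u (suc n)) e = ∑-mono u λ a → ∑-mono (vec u n) λ v → e (a ∷ v)
∑-mono (u ⊗ v)         e = ∑-mono u λ a → ∑-mono v λ b → e (a , b)

∑-0 : ∀ u → ∑ u (λ _ → 0) ≡ 0
∑-0 (fin zero)      = refl
∑-0 (fin (suc n))   = ∑-0 (fin n)
∑-0 (vec u zero)    = refl
∑-0 (vec u (suc n)) = trans (∑-cong u λ a → ∑-0 (vec u n)) (∑-0 u)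
∑-0 (u ⊗ v)         = trans (∑-cong u λ a → ∑-0 v) (∑-0 u)

∑-+ : ∀ u (f g : El u → ℕ) → ∑ u (λ a → f a + g a) ≡ ∑ u f + ∑ u g
∑-+ (fin zero)      f g = refl
∑-+ (fin (suc n))   f g = trans (cong (f zero + g zero +_) (∑-+ (fin n) (f ∘ suc) (g ∘ suc)))
  (lem (f zero) (g zero) (∑ (fin n) (f ∘ suc)) (∑ (fin n) (g ∘ suc)))
  where lem : ∀ a b c d → a + b + (c + d) ≡ a + c + (b + d)
        lem = solve-∀
∑-+ (vec u zero)    f g = refl
∑-+ (vec u (suc n)) f g = trans (∑-cong u λ a → ∑-+ (vec u n) _ _) (∑-+ u _ _)
∑-+ (u ⊗ v)         f g = trans (∑-cong u λ a → ∑-+ v _ _) (∑-+ u _ _)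

∑-*ˡ : ∀ u c (f : El u → ℕ) → ∑ u (λ a → c * f a) ≡ c * ∑ u f
∑-*ˡ (fin zero)      c f = sym (*-zeroʳ c)
∑-*ˡ (fin (suc n))   c f = trans (cong (c * f zero +_) (∑-*ˡ (fin n) c (f ∘ suc)))
                             (sym (*-distribˡ-+ c (f zero) _))
∑-*ˡ (vec u zero)    c f = refl
∑-*ˡ (vec u (suc n)) c f = trans (∑-cong u λ a → ∑-*ˡ (vec u n) c _) (∑-*ˡ u c _)
∑-*ˡ (u ⊗ v)         c f = trans (∑-cong u λ a → ∑-*ˡ v c _) (∑-*ˡ u c _)

∑-*ʳ : ∀ u c (f : El u → ℕ) → ∑ u (λ a → f a * c) ≡ ∑ u f * c
∑-*ʳ u c f = trans (∑-cong u λ a → *-comm (f a) c) (trans (∑-*ˡ u c f) (*-comm c _))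

∑-swap : ∀ u v (f : El u → El v → ℕ) → ∑ u (λ a → ∑ v (f a)) ≡ ∑ v (λ b → ∑ u (λ a → f a b))
∑-swap (fin zero)      v f = sym (∑-0 v)
∑-swap (fin (suc n))   v f = trans (cong (∑ v (f zero) +_) (∑-swap (fin n) v (f ∘ suc))) (sym (∑-+ v _ _))
∑-swap (vec u zero)    v f = refl
∑-swap (vec u (suc n)) v f = trans (∑-cong u λ a → ∑-swap (vec u n) v λ w → f (a ∷ w)) (∑-swap u v _)
∑-swap (u ⊗ u′)        v f = trans (∑-cong u λ a → ∑-swap u′ v λ b → f (a , b)) (∑-swap u v _)

card : U → ℕ
card u = ∑ u (λ _ → 1)

∑-const : ∀ u c → ∑ u (λ _ → c) ≡ c * card u
∑-const u c = trans (∑-cong u λ _ → sym (*-identityʳ c)) (∑-*ˡ u c _)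

card-fin : ∀ n → card (fin n) ≡ n
card-fin zero    = refl
card-fin (suc n) = cong suc (card-fin n)

card-vec : ∀ u n → card (vec u n) ≡ card u ^ n
card-vec u zero    = refl
card-vec u (suc n) = trans (∑-cong u λ _ → card-vec u n)
  (trans (∑-const u _) (*-comm (card u ^ n) (card u)))

∑-constF : ∀ n c → ∑ (fin n) (λ _ → c) ≡ n * c
∑-constF n c = trans (∑-const (fin n) c) (trans (cong (c *_) (card-fin n)) (*-comm c n))

𝟙 : ∀ {p} {P : Set p} → Dec P → ℕ
𝟙 (yes _) = 1
𝟙 (no _)  = 0

module _ {p} {P : Set p} where
  𝟙-yes : (d : Dec P) → P → 𝟙 d ≡ 1
  𝟙-yes (yes _) _ = refl
  𝟙-yes (no ¬p) p = ⊥-elim (¬p p)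

  𝟙-no : (d : Dec P) → ¬ P → 𝟙 d ≡ 0
  𝟙-no (yes p) ¬p = ⊥-elim (¬p p)
  𝟙-no (no _)  _  = refl

  𝟙≤1 : (d : Dec P) → 𝟙 d ≤ 1
  𝟙≤1 (yes _) = ≤-refl
  𝟙≤1 (no _)  = z≤n

  𝟙*≤ : (d : Dec P) {a b : ℕ} → (P → a ≤ b) → 𝟙 d * a ≤ b
  𝟙*≤ (yes p) {a} h = ≤-trans (≤-reflexive (+-identityʳ a)) (h p)
  𝟙*≤ (no _) h = z≤n

  𝟙*≤𝟙* : (d : Dec P) {a b : ℕ} → (P → a ≤ b) → 𝟙 d * a ≤ 𝟙 d * b
  𝟙*≤𝟙* (yes p) h = +-monoˡ-≤ 0 (h p)
  𝟙*≤𝟙* (no _)  h = z≤n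

  𝟙≤ : (d : Dec P) {b : ℕ} → (P → 1 ≤ b) → 𝟙 d ≤ b
  𝟙≤ (yes p) h = h p
  𝟙≤ (no _)  h = z≤n

𝟙-mono : ∀ {p q} {P : Set p} {Q : Set q} (d : Dec P) (e : Dec Q) → (P → Q) → 𝟙 d ≤ 𝟙 e
𝟙-mono d e f = 𝟙≤ d λ p → ≤-reflexive (sym (𝟙-yes e (f p)))

𝟙-cong : ∀ {p q} {P : Set p} {Q : Set q} (d : Dec P) (e : Dec Q) → (P → Q) → (Q → P) → 𝟙 d ≡ 𝟙 e
𝟙-cong d e f g = ≤-antisym (𝟙-mono d e f) (𝟙-mono e d g)

𝟙-× : ∀ {p q} {P : Set p} {Q : Set q} (d : Dec P) (e : Dec Q) → 𝟙 (d ×-dec e) ≡ 𝟙 d * 𝟙 e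
𝟙-× (yes p) (yes q) = refl
𝟙-× (yes p) (no q)  = refl
𝟙-× (no p)  (yes q) = refl
𝟙-× (no p)  (no q)  = refl

𝟙-split : ∀ {p q} {P : Set p} {Q : Set q} (d : Dec P) (e : Dec Q) → 𝟙 d ≡ 𝟙 (d ×-dec e) + 𝟙 (d ×-dec ¬? e)
𝟙-split (yes p) (yes q) = refl
𝟙-split (yes p) (no q)  = refl
𝟙-split (no p)  (yes q) = refl
𝟙-split (no p)  (no q)  = refl

f≤∑ : ∀ u (f : El u → ℕ) a → f a ≤ ∑ u f
f≤∑ (fin (suc n))   f zero    = m≤m+n _ _
f≤∑ (fin (suc n))   f (suc i) = ≤-trans (f≤∑ (fin n) (f ∘ suc) i) (m≤n+m _ _)
f≤∑ (vec u zero)    f []      = ≤-refl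
f≤∑ (vec u (suc n)) f (a ∷ v) = ≤-trans (f≤∑ (vec u n) (λ w → f (a ∷ w)) v) (f≤∑ u _ a)
f≤∑ (u ⊗ v)         f (a , b) = ≤-trans (f≤∑ v (λ w → f (a , w)) b) (f≤∑ u _ a)

private
  ∑-cong0 : ∀ u {f : El u → ℕ} → (∀ a → f a ≡ 0) → ∑ u f ≡ 0
  ∑-cong0 u e = trans (∑-cong u e) (∑-0 u)

∑-zero : ∀ u {f : El u → ℕ} → (∀ a → f a ≡ 0) → ∑ u f ≡ 0
∑-zero = ∑-cong0

∑-single : ∀ u (f : El u → ℕ) a → (∀ b → b ≢ a → f b ≡ 0) → ∑ u f ≡ f a
∑-single (fin (suc n))   f zero    h = trans (cong (f zero +_) (∑-zero (fin n) λ i → h (suc i) λ ())) (+-identityʳ _)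
∑-single (fin (suc n))   f (suc i) h = trans (cong (_+ ∑ (fin n) (f ∘ suc)) (h zero λ ()))
  (∑-single (fin n) (f ∘ suc) i λ j j≢i → h (suc j) (j≢i ∘ FinP.suc-injective))
∑-single (vec u zero)    f []      h = refl
∑-single (vec u (suc n)) f (a ∷ v) h = trans
  (∑-single u _ a λ b b≢a → ∑-zero (vec u n) λ w → h (b ∷ w) (b≢a ∘ VecP.∷-injectiveˡ))
  (∑-single (vec u n) (λ w → f (a ∷ w)) v λ w w≢v → h (a ∷ w) (w≢v ∘ VecP.∷-injectiveʳ))
∑-single (u ⊗ v)         f (a , b) h = trans
  (∑-single u _ a λ c c≢a → ∑-zero v λ d → h (c , d) (c≢a ∘ cong proj₁))
  (∑-single v (λ d → f (a , d)) b λ d d≢b → h (a , d) (d≢b ∘ cong proj₂))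

∑-δ : ∀ u (f : El u → ℕ) a → ∑ u (λ b → 𝟙 (_≟u_ {u} b a) * f b) ≡ f a
∑-δ u f a = trans (∑-single u _ a λ b b≢a → cong (_* f b) (𝟙-no (_≟u_ {u} b a) b≢a))
  (trans (cong (_* f a) (𝟙-yes (_≟u_ {u} a a) refl)) (*-identityˡ _))

-- Both sides are the sum over the pairs (a , b) with `b ≡ g a`, taken in the two orders.
∑-bij : ∀ u v (g : El u → El v) (h : El v → El u) → (∀ a → h (g a) ≡ a) → (∀ b → g (h b) ≡ b) →
        (f : El v → ℕ) → ∑ u (λ a → f (g a)) ≡ ∑ v f
∑-bij u v g h hg gh f = begin
  ∑ u (λ a → f (g a))                                   ≡⟨ ∑-cong u (λ a → sym (∑-δ v f (g a))) ⟩
  ∑ u (λ a → ∑ v (λ b → 𝟙 (_≟u_ {v} b (g a)) * f b))    ≡⟨ ∑-swap u v _ ⟩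
  ∑ v (λ b → ∑ u (λ a → 𝟙 (_≟u_ {v} b (g a)) * f b))    ≡⟨ ∑-cong v (λ b → ∑-cong u λ a → cong (_* f b)
      (𝟙-cong (_≟u_ {v} b (g a)) (_≟u_ {u} a (h b)) (λ e → sym (trans (cong h e) (hg a))) (λ e → sym (trans (cong g e) (gh b))))) ⟩
  ∑ v (λ b → ∑ u (λ a → 𝟙 (_≟u_ {u} a (h b)) * f b))    ≡⟨ ∑-cong v (λ b → ∑-δ u (λ _ → f b) (h b)) ⟩
  ∑ v f ∎
  where open ≡-Reasoning

private
  +-pos : ∀ {A : Set} m r → 0 < m + r → (0 < m → A) → (0 < r → A) → A
  +-pos (suc m) r p f g = f (s≤s z≤n)
  +-pos zero    r p f g = g p

∑-pos : ∀ u (f : El u → ℕ) → 0 < ∑ u f → ∃ λ a → 0 < f a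
∑-pos (fin (suc n)) f p = +-pos (f zero) (∑ (fin n) (f ∘ suc)) p (λ q → zero , q)
  (λ q → suc (proj₁ (∑-pos (fin n) (f ∘ suc) q)) , proj₂ (∑-pos (fin n) (f ∘ suc) q))
∑-pos (vec u zero)    f p = [] , p
∑-pos (vec u (suc n)) f p =
  proj₁ (∑-pos u _ p) ∷ proj₁ (∑-pos (vec u n) _ (proj₂ (∑-pos u _ p))) , proj₂ (∑-pos (vec u n) _ (proj₂ (∑-pos u _ p)))
∑-pos (u ⊗ v) f p =
  (proj₁ (∑-pos u _ p) , proj₁ (∑-pos v _ (proj₂ (∑-pos u _ p)))) , proj₂ (∑-pos v _ (proj₂ (∑-pos u _ p)))

∑-unique≤1 : ∀ u {p} {P : El u → Set p} (d : ∀ a → Dec (P a)) → (∀ a b → P a → P b → a ≡ b) → ∑ u (λ a → 𝟙 (d a)) ≤ 1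
∑-unique≤1 u {P = P} d uniq with ∑ u (λ a → 𝟙 (d a)) in eq
... | zero  = z≤n
... | suc m = ≤-trans (≤-reflexive (sym eq)) (go (∑-pos u (λ a → 𝟙 (d a)) (≤-trans (s≤s z≤n) (≤-reflexive (sym eq)))))
  where
  go : (∃ λ a → 0 < 𝟙 (d a)) → ∑ u (λ a → 𝟙 (d a)) ≤ 1
  go (a , q) = ≤-trans (≤-reflexive (∑-single u _ a λ b b≢a → 𝟙-no (d b) λ pb → b≢a (uniq b a pb pa))) (𝟙≤1 (d a))
    where pa : P a
          pa with d a
          ... | yes p = p
          ... | no _ = ⊥-elim (n≮0 q)

∏ : (n : ℕ) → (Fin n → ℕ) → ℕ
∏ zero    f = 1
∏ (suc n) f = f zero * ∏ n (λ i → f (suc i))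

∏-cong : ∀ n {f g : Fin n → ℕ} → (∀ i → f i ≡ g i) → ∏ n f ≡ ∏ n g
∏-cong zero    e = refl
∏-cong (suc n) e = cong₂ _*_ (e zero) (∏-cong n (λ i → e (suc i)))

∏-mono : ∀ n {f g : Fin n → ℕ} → (∀ i → f i ≤ g i) → ∏ n f ≤ ∏ n g
∏-mono zero    e = ≤-refl
∏-mono (suc n) e = *-mono-≤ (e zero) (∏-mono n (λ i → e (suc i)))

∏-* : ∀ n (f g : Fin n → ℕ) → ∏ n (λ i → f i * g i) ≡ ∏ n f * ∏ n g
∏-* zero    f g = refl
∏-* (suc n) f g = trans (cong (f zero * g zero *_) (∏-* n (f ∘ suc) (g ∘ suc)))
  (lem (f zero) (g zero) (∏ n (f ∘ suc)) (∏ n (g ∘ suc)))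
  where lem : ∀ a b c d → a * b * (c * d) ≡ a * c * (b * d)
        lem = solve-∀

∏-const : ∀ n c → ∏ n (λ _ → c) ≡ c ^ n
∏-const zero c = refl
∏-const (suc n) c = cong (c *_) (∏-const n c)

∏-1 : ∀ n {f : Fin n → ℕ} → (∀ i → f i ≡ 1) → ∏ n f ≡ 1
∏-1 zero e = refl
∏-1 (suc n) e = cong₂ _*_ (e zero) (∏-1 n (e ∘ suc))

∑-∏ : ∀ u n (f : Fin n → El u → ℕ) → ∑ (vec u n) (λ v → ∏ n (λ i → f i (lookup v i))) ≡ ∏ n (λ i → ∑ u (f i))
∑-∏ u zero    f = refl
∑-∏ u (suc n) f = begin
  ∑ u (λ a → ∑ (vec u n) (λ v → f zero a * ∏ n (λ i → f (suc i) (lookup v i))))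
    ≡⟨ ∑-cong u (λ a → trans (∑-*ˡ (vec u n) (f zero a) _) (cong (f zero a *_) (∑-∏ u n (f ∘ suc)))) ⟩
  ∑ u (λ a → f zero a * ∏ n (λ i → ∑ u (f (suc i))))   ≡⟨ ∑-*ʳ u _ (f zero) ⟩
  ∑ u (f zero) * ∏ n (λ i → ∑ u (f (suc i))) ∎
  where open ≡-Reasoning

-- The product over pairs i < j. The entries (i , j) and (j , i) of a score matrix enter conditions
-- together, so these pairs are its independent blocks.
∏₂ : (n : ℕ) → (Fin n → Fin n → ℕ) → ℕ
∏₂ zero    f = 1
∏₂ (suc n) f = ∏ n (λ j → f zero (suc j)) * ∏₂ n (λ i j → f (suc i) (suc j))

∏₂-cong : ∀ n {f g : Fin n → Fin n → ℕ} → (∀ i j → i Fin.< j → f i j ≡ g i j) → ∏₂ n f ≡ ∏₂ n g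
∏₂-cong zero    e = refl
∏₂-cong (suc n) e = cong₂ _*_ (∏-cong n λ j → e zero (suc j) (s≤s z≤n)) (∏₂-cong n λ i j i<j → e (suc i) (suc j) (s≤s i<j))

∏₂-mono : ∀ n {f g : Fin n → Fin n → ℕ} → (∀ i j → i Fin.< j → f i j ≤ g i j) → ∏₂ n f ≤ ∏₂ n g
∏₂-mono zero    e = ≤-refl
∏₂-mono (suc n) e = *-mono-≤ (∏-mono n λ j → e zero (suc j) (s≤s z≤n)) (∏₂-mono n λ i j i<j → e (suc i) (suc j) (s≤s i<j))

∏₂-* : ∀ n (f g : Fin n → Fin n → ℕ) → ∏₂ n (λ i j → f i j * g i j) ≡ ∏₂ n f * ∏₂ n g
∏₂-* zero    f g = refl
∏₂-* (suc n) f g = trans (cong₂ _*_ (∏-* n _ _) (∏₂-* n _ _)) (lem (∏ n _) (∏ n _) (∏₂ n _) (∏₂ n _))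
  where lem : ∀ a b c d → a * b * (c * d) ≡ a * c * (b * d)
        lem = solve-∀

private
  ∏-pos : ∀ n {f : Fin n → ℕ} → 0 < ∏ n f → ∀ i → 0 < f i
  ∏-pos (suc n) {f} h zero = 0<ˡ (f zero) h
    where 0<ˡ : ∀ a {b} → 0 < a * b → 0 < a
          0<ˡ (suc a) _ = s≤s z≤n
  ∏-pos (suc n) {f} h (suc i) = ∏-pos n (0<ʳ (f zero) h) i
    where 0<ʳ : ∀ a {b} → 0 < a * b → 0 < b
          0<ʳ a {zero} q = ⊥-elim (n≮0 (≤-trans q (≤-reflexive (*-zeroʳ a))))
          0<ʳ a {suc b} _ = s≤s z≤n

  *-posˡ : ∀ a {b} → 0 < a * b → 0 < a
  *-posˡ (suc a) _ = s≤s z≤n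
  *-posʳ : ∀ a {b} → 0 < a * b → 0 < b
  *-posʳ a {zero} q = ⊥-elim (n≮0 (≤-trans q (≤-reflexive (*-zeroʳ a))))
  *-posʳ a {suc b} _ = s≤s z≤n

𝟙-pos : ∀ {p} {P : Set p} (d : Dec P) → 0 < 𝟙 d → P
𝟙-pos (yes p) _ = p

∏₂-pos : ∀ n {f : Fin n → Fin n → ℕ} → 0 < ∏₂ n f → ∀ i j → i Fin.< j → 0 < f i j
∏₂-pos (suc n) h zero    (suc j) _ = ∏-pos n (*-posˡ (∏ n _) h) j
∏₂-pos (suc n) h (suc i) (suc j) (s≤s q) = ∏₂-pos n (*-posʳ (∏ n _) h) i j q

∏₂-1 : ∀ n {f : Fin n → Fin n → ℕ} → (∀ i j → i Fin.< j → f i j ≡ 1) → ∏₂ n f ≡ 1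
∏₂-1 zero    e = refl
∏₂-1 (suc n) e = cong₂ _*_ (∏-1 n λ j → e zero (suc j) (s≤s z≤n)) (∏₂-1 n λ i j i<j → e (suc i) (suc j) (s≤s i<j))

∏₂-≤1 : ∀ n {f : Fin n → Fin n → ℕ} → (∀ i j → i Fin.< j → f i j ≤ 1) → ∏₂ n f ≤ 1
∏₂-≤1 n h = ≤-trans (∏₂-mono n h) (≤-reflexive (∏₂-1 n λ _ _ _ → refl))

-- Replacing one factor, cross-multiplied: this form remains valid when factors vanish.
∏-change : ∀ n (f g : Fin n → ℕ) a → (∀ i → i ≢ a → f i ≡ g i) → ∏ n f * g a ≡ ∏ n g * f a
∏-change (suc n) f g zero h = trans (cong (λ x → f zero * x * g zero) (∏-cong n λ i → h (suc i) λ ())) (lem (f zero) (∏ n (g ∘ suc)) (g zero))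
  where lem : ∀ a b c → a * b * c ≡ c * b * a
        lem = solve-∀
∏-change (suc n) f g (suc a) h = trans (lem (f zero) (∏ n (f ∘ suc)) (g (suc a))) (trans (cong₂ _*_ (h zero λ ()) (∏-change n (f ∘ suc) (g ∘ suc) a λ i i≢ → h (suc i) (i≢ ∘ FinP.suc-injective)))
    (sym (lem (g zero) (∏ n (g ∘ suc)) (f (suc a)))))
  where lem : ∀ a b c → a * b * c ≡ a * (b * c)
        lem = solve-∀

∏₂-change : ∀ n (f g : Fin n → Fin n → ℕ) a b → a Fin.< b → (∀ i j → i Fin.< j → ¬ (i ≡ a × j ≡ b) → f i j ≡ g i j) → ∏₂ n f * g a b ≡ ∏₂ n g * f a b
∏₂-change (suc n) f g zero (suc b) _ h = begin
  ∏ n (λ j → f zero (suc j)) * ∏₂ n (λ i j → f (suc i) (suc j)) * g zero (suc b) ≡⟨ cong (λ x → ∏ n (λ j → f zero (suc j)) * x * g zero (suc b)) (∏₂-cong n λ i j i<j → h (suc i) (suc j) (s≤s i<j) λ ()) ⟩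
  ∏ n (λ j → f zero (suc j)) * G * g zero (suc b) ≡⟨ lem (∏ n (λ j → f zero (suc j))) G (g zero (suc b)) ⟩
  ∏ n (λ j → f zero (suc j)) * g zero (suc b) * G ≡⟨ cong (_* G) (∏-change n (λ j → f zero (suc j)) (λ j → g zero (suc j)) b λ j j≢ → h zero (suc j) (s≤s z≤n) λ (_ , e) → j≢ (FinP.suc-injective e)) ⟩
  ∏ n (λ j → g zero (suc j)) * f zero (suc b) * G ≡⟨ lem (∏ n (λ j → g zero (suc j))) (f zero (suc b)) G ⟩
  ∏ n (λ j → g zero (suc j)) * G * f zero (suc b) ∎
  where
  open ≡-Reasoning
  G = ∏₂ n (λ i j → g (suc i) (suc j))
  lem : ∀ a b c → a * b * c ≡ a * c * b
  lem = solve-∀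
∏₂-change (suc n) f g (suc a) (suc b) (s≤s a<b) h = begin
  ∏ n (λ j → f zero (suc j)) * ∏₂ n (λ i j → f (suc i) (suc j)) * g (suc a) (suc b) ≡⟨ *-assoc (∏ n _) _ _ ⟩
  ∏ n (λ j → f zero (suc j)) * (∏₂ n (λ i j → f (suc i) (suc j)) * g (suc a) (suc b)) ≡⟨ cong₂ _*_ (∏-cong n λ j → h zero (suc j) (s≤s z≤n) λ ())
     (∏₂-change n _ _ a b a<b λ i j i<j ne → h (suc i) (suc j) (s≤s i<j) λ (e , e′) → ne (FinP.suc-injective e , FinP.suc-injective e′)) ⟩
  ∏ n (λ j → g zero (suc j)) * (∏₂ n (λ i j → g (suc i) (suc j)) * f (suc a) (suc b)) ≡⟨ sym (*-assoc (∏ n _) _ _) ⟩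
  ∏ n (λ j → g zero (suc j)) * ∏₂ n (λ i j → g (suc i) (suc j)) * f (suc a) (suc b) ∎
  where open ≡-Reasoning

∏₂-change-sym : ∀ n (f g : Fin n → Fin n → ℕ) → (∀ i j → f i j ≡ f j i) → (∀ i j → g i j ≡ g j i) → ∀ a b → a ≢ b →
  (∀ i j → ¬ (i ≡ a × j ≡ b) → ¬ (i ≡ b × j ≡ a) → f i j ≡ g i j) → ∏₂ n f * g a b ≡ ∏₂ n g * f a b
∏₂-change-sym n f g fs gs a b a≢b h with FinP.<-cmp a b
... | tri< a<b _ _ = ∏₂-change n f g a b a<b λ i j i<j ne → h i j ne λ { (refl , refl) → <-asym i<j a<b }
... | tri≈ _ e _ = ⊥-elim (a≢b e)
... | tri> _ _ b<a = trans (cong (∏₂ n f *_) (gs a b)) (trans (∏₂-change n f g b a b<a λ i j i<j ne → h i j (λ { (refl , refl) → <-asym i<j b<a }) ne)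
    (cong (∏₂ n g *_) (fs b a)))

columns : ∀ u n m (F : Vec (Vec (El u) (suc n)) m → ℕ) →
  ∑ (vec (vec u (suc n)) m) F ≡ ∑ (vec u m) λ b → ∑ (vec (vec u n) m) λ X → F (zipWith _∷_ b X)
columns u n zero    F = refl
columns u n (suc m) F = ∑-cong u λ a → trans (∑-cong (vec u n) λ v → columns u n m (λ X → F ((a ∷ v) ∷ X)))
  (∑-swap (vec u n) (vec u m) λ v b → ∑ (vec (vec u n) m) λ X → F ((a ∷ v) ∷ zipWith _∷_ b X))

private
  look-z : ∀ {A : Set} {n m} (b : Vec A m) (X : Vec (Vec A n) m) j → lookup (lookup (zipWith _∷_ b X) j) zero ≡ lookup b j
  look-z b X j = cong (λ v → lookup v zero) (VecP.lookup-zipWith _∷_ j b X)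
  look-s : ∀ {A : Set} {n m} (b : Vec A m) (X : Vec (Vec A n) m) i j → lookup (lookup (zipWith _∷_ b X) i) (suc j) ≡ lookup (lookup X i) j
  look-s b X i j = cong (λ v → lookup v (suc j)) (VecP.lookup-zipWith _∷_ i b X)

-- Peeling off the first row and column leaves the pairs (0 , j) independent of the remaining
-- matrix. Diagonal entries are unconstrained and yield `card u ^ n`.
matrix-sum : ∀ u n (c : Fin n → Fin n → El u → El u → ℕ) →
  ∑ (vec (vec u n) n) (λ X → ∏₂ n (λ i j → c i j (lookup (lookup X i) j) (lookup (lookup X j) i))) ≡
  card u ^ n * ∏₂ n (λ i j → ∑ u λ a → ∑ u λ b → c i j a b)
matrix-sum u zero    c = refl
matrix-sum u (suc n) c = begin
  ∑ u (λ a → ∑ (vec u n) λ r → ∑ (vec (vec u (suc n)) n) λ Xs → F r Xs) ≡⟨ trans (∑-const u _) (*-comm _ (card u)) ⟩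
  card u * ∑ (vec u n) (λ r → ∑ (vec (vec u (suc n)) n) λ Xs → F r Xs) ≡⟨ cong (card u *_) (∑-cong (vec u n) λ r → trans (columns u n n (F r)) (∑-cong (vec u n) λ b →
      trans (∑-cong (vec (vec u n) n) λ X → cong₂ _*_ (∏-cong n λ j → cong (c zero (suc j) (lookup r j)) (look-z b X j))
             (∏₂-cong n λ i j _ → cong₂ (c (suc i) (suc j)) (look-s b X i j) (look-s b X j i))) (trans (∑-*ˡ (vec (vec u n) n) (∏ n (λ j → c zero (suc j) (lookup r j) (lookup b j))) (λ X → ∏₂ n (λ i j → c (suc i) (suc j) (lookup (lookup X i) j) (lookup (lookup X j) i)))) (cong (∏ n (λ j → c zero (suc j) (lookup r j) (lookup b j)) *_)
               (matrix-sum u n λ i j → c (suc i) (suc j)))))) ⟩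
  card u * ∑ (vec u n) (λ r → ∑ (vec u n) λ b → ∏ n (λ j → c zero (suc j) (lookup r j) (lookup b j)) * K) ≡⟨ cong (card u *_) (trans (∑-cong (vec u n) λ r → trans (∑-*ʳ (vec u n) K _) (cong (_* K) (∑-∏ u n λ j b → c zero (suc j) (lookup r j) b)))
        (trans (∑-*ʳ (vec u n) K _) (cong (_* K) (∑-∏ u n λ j a → ∑ u λ b → c zero (suc j) a b)))) ⟩
  card u * (P * (card u ^ n * Q)) ≡⟨ lem (card u) P (card u ^ n) Q ⟩
  card u ^ suc n * (P * Q) ∎
  where
  open ≡-Reasoning
  F : Vec (El u) n → Vec (Vec (El u) (suc n)) n → ℕ
  F r Xs = ∏ n (λ j → c zero (suc j) (lookup r j) (lookup (lookup Xs j) zero)) *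
           ∏₂ n (λ i j → c (suc i) (suc j) (lookup (lookup Xs i) (suc j)) (lookup (lookup Xs j) (suc i)))
  P = ∏ n (λ j → ∑ u λ a → ∑ u λ b → c zero (suc j) a b)
  Q = ∏₂ n (λ i j → ∑ u λ a → ∑ u λ b → c (suc i) (suc j) a b)
  K = card u ^ n * Q
  lem : ∀ a b c d → a * (b * (c * d)) ≡ a * c * (b * d)
  lem = solve-∀

count≤ : ∀ L (t : Fin L) → ∑ (fin L) (λ a → 𝟙 (a FinP.≤? t)) ≡ suc (toℕ t)
count≤ (suc L) zero = cong₂ _+_ (𝟙-yes (zero {L} FinP.≤? zero {L}) z≤n) (∑-zero (fin L) λ i → 𝟙-no (suc i FinP.≤? zero {L}) λ ())
count≤ (suc L) (suc t) = cong₂ _+_ (𝟙-yes (zero {L} FinP.≤? suc t) z≤n) (trans (∑-cong (fin L) λ i → 𝟙-cong (suc i FinP.≤? suc t) (i FinP.≤? t) ℕ.s≤s⁻¹ s≤s) (count≤ L t))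

count≡ : ∀ L (t : Fin L) → ∑ (fin L) (λ a → 𝟙 (a FinP.≟ t)) ≡ 1
count≡ L t = trans (∑-cong (fin L) λ a → sym (*-identityʳ (𝟙 (a FinP.≟ t)))) (∑-δ (fin L) (λ _ → 1) t)

count-rect : ∀ L {p q} {P : Fin L → Set p} {Q : Fin L → Set q} (P? : ∀ a → Dec (P a)) (Q? : ∀ b → Dec (Q b)) →
  ∑ (fin L) (λ a → ∑ (fin L) λ b → 𝟙 (P? a ×-dec Q? b)) ≡ ∑ (fin L) (λ a → 𝟙 (P? a)) * ∑ (fin L) (λ b → 𝟙 (Q? b))
count-rect L P? Q? = trans (∑-cong (fin L) λ a → trans (∑-cong (fin L) λ b → 𝟙-× (P? a) (Q? b)) (∑-*ˡ (fin L) (𝟙 (P? a)) _)) (∑-*ʳ (fin L) _ _)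

_≟F_ : ∀ {n} (i j : Fin n) → Dec (i ≡ j)
_≟F_ = FinP._≟_

vec-ext : ∀ {A : Set} {n} (v w : Vec A n) → (∀ i → lookup v i ≡ lookup w i) → v ≡ w
vec-ext []      []      e = refl
vec-ext (a ∷ v) (b ∷ w) e = cong₂ _∷_ (e zero) (vec-ext v w (e ∘ suc))

upd-same : ∀ {A : Set} {n} (s : Vec A n) v j → lookup (s [ v ]≔ j) v ≡ j
upd-same s v j = VecP.lookup∘update v s j

upd-other : ∀ {A : Set} {n} (s : Vec A n) v j {i} → i ≢ v → lookup (s [ v ]≔ j) i ≡ lookup s i
upd-other s v j {i} i≢v = VecP.lookup∘update′ i≢v s j

upd-upd : ∀ {A : Set} {n} (s : Vec A n) v j → (s [ v ]≔ j) [ v ]≔ lookup s v ≡ s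
upd-upd s v j = vec-ext _ _ λ i → lem i (i ≟F v)
  where
  lem : ∀ i → Dec (i ≡ v) → lookup ((s [ v ]≔ j) [ v ]≔ lookup s v) i ≡ lookup s i
  lem i (yes refl) = upd-same (s [ i ]≔ j) i _
  lem i (no i≢v)   = trans (upd-other (s [ v ]≔ j) v _ i≢v) (upd-other s v j i≢v)

-- Short cycles of random maps

record Matching (n : ℕ) : Set where
  field
    M : Fin n → Fin n
    MM : ∀ i → M (M i) ≡ i
    M≢ : ∀ i → M i ≢ i

  -- In the application `s i` is the person whom `i` likes best among those accepting `i`, so two
  -- persons choosing each other would block `M`; hence the ban on 2-cycles.
  Legal : Vec (Fin n) n → Set
  Legal s = ∀ i → lookup s i ≢ i × lookup s i ≢ M i × lookup s (lookup s i) ≢ i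

-- `wt k` is `D / k` with `D` a common multiple, so that a cycle counts `D` whatever its length.
-- Length 1 has weight 0: a fixed point of `φ` would mean `s i ≡ M i`, which `Legal` excludes.
record CycleWeights : Set where
  field
    ℓ D : ℕ
    {{D≢0}} : NonZero D
    wt : ℕ → ℕ
    wt1 : wt 1 ≡ 0
    wtD : ∀ k → 2 ≤ k → k ≤ ℓ → k * wt k ≡ D

  D>0 : 0 < D
  D>0 = ℕ.>-nonZero⁻¹ D

  wt≤D : ∀ k → 1 ≤ k → k ≤ ℓ → k * wt k ≤ D
  wt≤D (suc zero) _ _ = ≤-trans (≤-reflexive (trans (+-identityʳ (wt 1)) wt1)) z≤n
  wt≤D (suc (suc k)) _ h = ≤-reflexive (wtD (suc (suc k)) (s≤s (s≤s z≤n)) h)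

-- `res` says that `w s` divided by the product of the `z (s i)` loses at most a factor 49/50 when
-- one value changes between legal maps: nearly a product measure, with `z j` as the weight of the
-- value `j`. `8R≤S` makes every single value a small part of the total.
record Weighting (n : ℕ) : Set where
  field
    matching : Matching n
    cycleWeights : CycleWeights
  open Matching matching public
  open CycleWeights cycleWeights public
  field
    n>0 : 0 < n
    z : Fin n → ℕ
    R : ℕ
    z≤R : ∀ i → z i ≤ R
    z>0 : ∀ i → 0 < z i
    w : Vec (Fin n) n → ℕ
    legal : ∀ s → w s ≢ 0 → Legal s
    8R≤S : 8 * R ≤ ∑ (fin n) z
    S>0 : 0 < ∑ (fin n) z
    res : ∀ s v j → Legal s → Legal (s [ v ]≔ j) → 49 * (w s * z j) ≤ 50 * (w (s [ v ]≔ j) * z (lookup s v))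

∑ℕ : ℕ → (ℕ → ℕ) → ℕ
∑ℕ T f = ∑ (fin T) (λ i → f (toℕ i))

f≤∑ℕ : ∀ T (f : ℕ → ℕ) {t} → t < T → f t ≤ ∑ℕ T f
f≤∑ℕ T f {t} t<T = ≤-trans (≤-reflexive (cong f (sym (FinP.toℕ-fromℕ< t<T)))) (f≤∑ (fin T) (λ i → f (toℕ i)) (fromℕ< t<T))

∑ℕ-mono : ∀ T {f g : ℕ → ℕ} → (∀ t → t < T → f t ≤ g t) → ∑ℕ T f ≤ ∑ℕ T g
∑ℕ-mono T h = ∑-mono (fin T) λ i → h (toℕ i) (FinP.toℕ<n i)

∑ℕ-cong : ∀ T {f g : ℕ → ℕ} → (∀ t → t < T → f t ≡ g t) → ∑ℕ T f ≡ ∑ℕ T g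
∑ℕ-cong T h = ∑-cong (fin T) λ i → h (toℕ i) (FinP.toℕ<n i)

∑ℕ-single : ∀ T (f : ℕ → ℕ) {t} → t < T → (∀ r → r < T → r ≢ t → f r ≡ 0) → ∑ℕ T f ≡ f t
∑ℕ-single T f {t} t<T h = trans (∑-single (fin T) _ (fromℕ< t<T) λ i i≢ → h (toℕ i) (FinP.toℕ<n i)
    λ e → i≢ (FinP.toℕ-injective (trans e (sym (FinP.toℕ-fromℕ< t<T)))))
  (cong f (FinP.toℕ-fromℕ< t<T))

module Iterate {n : ℕ} (matching : Matching n) where

  open Matching matching

  private X = Vec (Fin n) n

  φ : X → Fin n → Fin n
  φ s v = M (lookup s v)

  it : X → ℕ → Fin n → Fin n
  it s zero    v = v
  it s (suc t) v = φ s (it s t v)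

  it-+ : ∀ s a b v → it s (a + b) v ≡ it s a (it s b v)
  it-+ s zero    b v = refl
  it-+ s (suc a) b v = cong (φ s) (it-+ s a b v)

  it-comm : ∀ s a b v → it s a (it s b v) ≡ it s b (it s a v)
  it-comm s a b v = trans (sym (it-+ s a b v)) (trans (cong (λ t → it s t v) (+-comm a b)) (it-+ s b a v))

  it-agree : ∀ s s′ u t → (∀ {r} → r < t → lookup s′ (it s r u) ≡ lookup s (it s r u)) → it s′ t u ≡ it s t u
  it-agree s s′ u zero    h = refl
  it-agree s s′ u (suc t) h = trans (cong (φ s′) (it-agree s s′ u t λ r<t → h (m<n⇒m<1+n r<t))) (cong M (h (n<1+n t)))

  it-upd : ∀ s v k u t → (∀ {r} → r < t → it s r u ≢ v) → it (s [ v ]≔ k) t u ≡ it s t u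
  it-upd s v k u t fr = it-agree s _ u t λ r<t → upd-other s v k (fr r<t)

  -- The first `t` steps from `u` do not use the image of `v`, so this stretch of the path survives
  -- a change of `s v`.
  Fresh : X → ℕ → Fin n → Fin n → Set
  Fresh s t u v = ∀ {r} → r < t → it s r u ≢ v

  opaque
    fresh? : ∀ s t u v → Dec (Fresh s t u v)
    fresh? s t u v = allUpTo? (λ r → ¬? (it s r u ≟F v)) t

  fresh-upd : ∀ s v k u t → Fresh s t u v → Fresh (s [ v ]≔ k) t u v
  fresh-upd s v k u t fr {r} r<t e = fr r<t (trans (sym (it-upd s v k u r λ q → fr (<-trans q r<t))) e)

  -- Time 0 is exempt from the minimality, so that for `a ≡ b` this is the exact period.
  Hit : X → ℕ → Fin n → Fin n → Set
  Hit s k a b = it s k a ≡ b × (∀ {r} → r < k → 0 < r → it s r a ≢ b)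

  opaque
    hit? : ∀ s k a b → Dec (Hit s k a b)
    hit? s k a b = (it s k a ≟F b) ×-dec allUpTo? (λ r → (0 <? r) →-dec ¬? (it s r a ≟F b)) k

  Per : X → ℕ → Fin n → Set
  Per s k a = Hit s k a a

  per? : ∀ s k a → Dec (Per s k a)
  per? s k a = hit? s k a a

  per-unique : ∀ s k k′ a → 0 < k → 0 < k′ → Per s k a → Per s k′ a → k ≡ k′
  per-unique s k k′ a 0<k 0<k′ (e , m) (e′ , m′) with <-cmp k k′
  ... | tri< k<k′ _ _ = ⊥-elim (m′ k<k′ 0<k e)
  ... | tri≈ _ q _ = q
  ... | tri> _ _ k′<k = ⊥-elim (m k′<k 0<k′ e′)

  -- Walking on to the end of the cycle turns an early return of `φ s a` into an early return of
  -- `a`.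
  per-φ : ∀ s k a → 0 < k → Per s k a → Per s k (φ s a)
  per-φ s (suc k) a _ (e , m) = trans (it-comm s (suc k) 1 a) (cong (φ s) e) , λ {r} r<k 0<r q →
    m r<k 0<r (trans (sym (trans (cong (it s k) (it-comm s r 1 a)) (trans (it-comm s k 1 (it s r a))
        (trans (it-comm s (suc k) r a) (cong (it s r) e)))))
      (trans (cong (it s k) q) (trans (it-comm s k 1 a) e)))

  per-it : ∀ s k t a → 0 < k → Per s k a → Per s k (it s t a)
  per-it s k zero    a 0<k p = p
  per-it s k (suc t) a 0<k p = per-φ s k (it s t a) 0<k (per-it s k t a 0<k p)

  first-hit : ∀ s t a b → 0 < t → it s t a ≡ b → ∃ λ k → 0 < k × k ≤ t × Hit s k a b
  first-hit s t a b 0<t e = let k , 0<k , k<m , h = least (suc t) (t , n<1+n t , 0<t , e) in k , 0<k , ℕ.s≤s⁻¹ k<m , h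
    where
    least : ∀ m → (∃ λ r → r < m × 0 < r × it s r a ≡ b) → ∃ λ k → 0 < k × k < m × Hit s k a b
    least (suc m) (r , r<m , 0<r , q) with anyUpTo? (λ r → (0 <? r) ×-dec (it s r a ≟F b)) m
    ... | yes (r′ , r′<m , 0<r′ , q′) = let k , 0<k , k<m , h = least m (r′ , r′<m , 0<r′ , q′) in k , 0<k , m<n⇒m<1+n k<m , h
    ... | no none = m , subst (0 <_) r≡m 0<r , n<1+n m , subst (λ x → it s x a ≡ b) r≡m q , λ {x} x<m 0<x e → none (x , x<m , 0<x , e)
      where r≡m : r ≡ m
            r≡m with <-cmp r m
            ... | tri< r<m′ _ _ = ⊥-elim (none (r , r<m′ , 0<r , q))
            ... | tri≈ _ x _ = x
            ... | tri> _ _ x = ⊥-elim (<⇒≱ x (ℕ.s≤s⁻¹ r<m))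

-- Resampling one value of the map

module Switching {n : ℕ} (d : Weighting n) where

  open Weighting d
  open Iterate matching public

  X : Set
  X = Vec (Fin n) n

  uX : U
  uX = vec (fin n) n

  S : ℕ
  S = ∑ (fin n) z

  -- The weight of the preimages of `v`: these are the values that would close a 2-cycle if `s v`
  -- were set to them. Resampling `s v` requires that they leave enough room, hence `Light`.
  J : X → Fin n → ℕ
  J s v = ∑ (fin n) λ j → 𝟙 (lookup s j ≟F v) * z j

  Light : Fin n → X → Set
  Light v s = 4 * J s v ≤ S

  opaque
    light? : ∀ v s → Dec (Light v s)
    light? v s = 4 * J s v ≤? S

  NL : X → Set
  NL s = ∀ v → Light v s

  opaque
    nl? : ∀ s → Dec (NL s)
    nl? s = FinP.all? (λ v → light? v s)

  sum-J : ∀ s → ∑ (fin n) (J s) ≡ S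
  sum-J s = trans (∑-swap (fin n) (fin n) _) (∑-cong (fin n) λ j →
    trans (∑-cong (fin n) λ v → cong (_* z j) (𝟙-cong (lookup s j ≟F v) (v ≟F lookup s j) sym sym))
          (∑-δ (fin n) (λ _ → z j) (lookup s j)))

  μ : (X → ℕ) → ℕ
  μ F = ∑ uX λ s → w s * F s

  μ-mono : ∀ {F G} → (∀ s → Legal s → F s ≤ G s) → μ F ≤ μ G
  μ-mono {F} {G} h = ∑-mono uX λ s → lem s (w s) refl
    where
    lem : ∀ s m → w s ≡ m → w s * F s ≤ w s * G s
    lem s zero e rewrite e = z≤n
    lem s (suc m) e = *-monoʳ-≤ (w s) (h s (legal s λ e′ → 1+n≢0 (trans (sym e) e′)))

  μ-+ : ∀ F G → μ (λ s → F s + G s) ≡ μ F + μ G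
  μ-+ F G = trans (∑-cong uX λ s → *-distribˡ-+ (w s) (F s) (G s)) (∑-+ uX _ _)

  μ-* : ∀ c F → μ (λ s → c * F s) ≡ c * μ F
  μ-* c F = trans (∑-cong uX λ s → lem (w s) c (F s)) (∑-*ˡ uX c _)
    where lem : ∀ a b c → a * (b * c) ≡ b * (a * c)
          lem = solve-∀

  μ-∑ : ∀ u (F : El u → X → ℕ) → μ (λ s → ∑ u (λ a → F a s)) ≡ ∑ u (λ a → μ (F a))
  μ-∑ u F = trans (∑-cong uX λ s → sym (∑-*ˡ u (w s) _)) (∑-swap uX u _)

  T₁ : ℕ
  T₁ = μ (λ _ → 1)

  okP : X → Fin n → Fin n → Set
  okP s v j = j ≢ v × j ≢ M v × lookup s j ≢ v

  ok? : ∀ s v j → Dec (okP s v j)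
  ok? s v j = ¬? (j ≟F v) ×-dec ¬? (j ≟F M v) ×-dec ¬? (lookup s j ≟F v)

  ok-legal : ∀ s v j → Legal s → okP s v j → Legal (s [ v ]≔ j)
  ok-legal s v j L (j≢v , j≢Mv , sj≢v) i with i ≟F v
  ... | yes refl rewrite upd-same s i j | upd-other s i j j≢v = j≢v , j≢Mv , sj≢v
  ... | no i≢v rewrite upd-other s v j i≢v with lookup s i ≟F v
  ...   | no q rewrite upd-other s v j q = L i
  ...   | yes q = proj₁ (L i) , proj₁ (proj₂ (L i)) , λ e →
            sj≢v (subst (λ x → lookup s x ≡ v) (sym (trans (sym (upd-same s v j)) (trans (cong (lookup (s [ v ]≔ j)) (sym q)) e))) q)

  private
    z≤ok : ∀ s v j → z j ≤ 𝟙 (ok? s v j) * z j + (𝟙 (j ≟F v) * z j + (𝟙 (j ≟F M v) * z j + 𝟙 (lookup s j ≟F v) * z j))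
    z≤ok s v j = ≤-trans (≤-reflexive (sym (*-identityˡ (z j)))) (≤-trans (*-monoˡ-≤ (z j) one)
      (≤-reflexive (lem (𝟙 (ok? s v j)) (𝟙 (j ≟F v)) (𝟙 (j ≟F M v)) (𝟙 (lookup s j ≟F v)) (z j))))
      where
      lem : ∀ a b c d e → (a + (b + (c + d))) * e ≡ a * e + (b * e + (c * e + d * e))
      lem = solve-∀
      one : 1 ≤ 𝟙 (ok? s v j) + (𝟙 (j ≟F v) + (𝟙 (j ≟F M v) + 𝟙 (lookup s j ≟F v)))
      one with j ≟F v | j ≟F M v | lookup s j ≟F v
      ... | yes _ | _ | _ = s≤s z≤n
      ... | no _ | yes _ | _ = s≤s z≤n
      ... | no _ | no _ | yes _ = s≤s z≤n
      ... | no _ | no _ | no _ = s≤s z≤n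

    -- The forbidden values `v`, `M v` and the preimages of `v` weigh at most R + R + S/4, hence at
    -- most S/2.
    S≤2ok : ∀ s v → Light v s → S ≤ 2 * ∑ (fin n) (λ j → 𝟙 (ok? s v j) * z j)
    S≤2ok s v l = *-cancelˡ-≤ 2 (+-cancelʳ-≤ (2 * S) _ _ (begin
      2 * S + 2 * S     ≡⟨ lem₁ S ⟩
      4 * S             ≤⟨ *-monoʳ-≤ 4 b1 ⟩
      4 * (O + (z v + (z (M v) + J s v))) ≤⟨ *-monoʳ-≤ 4 (+-monoʳ-≤ O (+-mono-≤ (z≤R v) (+-monoˡ-≤ (J s v) (z≤R (M v))))) ⟩
      4 * (O + (R + (R + J s v))) ≡⟨ lem₂ O R (J s v) ⟩
      2 * (2 * O) + (8 * R + 4 * J s v) ≤⟨ +-monoʳ-≤ (2 * (2 * O)) (+-mono-≤ 8R≤S l) ⟩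
      2 * (2 * O) + (S + S) ≡⟨ cong (2 * (2 * O) +_) (lem₃ S) ⟩
      2 * (2 * O) + 2 * S ∎))
      where
      open ≤-Reasoning
      O = ∑ (fin n) (λ j → 𝟙 (ok? s v j) * z j)
      lem₁ : ∀ a → 2 * a + 2 * a ≡ 4 * a
      lem₁ = solve-∀
      lem₃ : ∀ a → a + a ≡ 2 * a
      lem₃ = solve-∀
      lem₂ : ∀ a b c → 4 * (a + (b + (b + c))) ≡ 2 * (2 * a) + (8 * b + 4 * c)
      lem₂ = solve-∀
      b1 : S ≤ O + (z v + (z (M v) + J s v))
      b1 = ≤-trans (∑-mono (fin n) (z≤ok s v)) (≤-reflexive
        (trans (∑-+ (fin n) _ _) (cong (O +_) (trans (∑-+ (fin n) _ _) (cong₂ _+_ (∑-δ (fin n) z v)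
          (trans (∑-+ (fin n) _ _) (cong (_+ J s v) (∑-δ (fin n) z (M v)))))))))

  -- Re-randomising the single value s v: legal changes of s v cover at least half of S, and res bounds the loss of weight.
  resample : ∀ v (F : X → Fin n → ℕ) (G : X → ℕ) B →
    (∀ s j k → F s j ≤ F (s [ v ]≔ k) j) → (∀ s → ∑ (fin n) (λ j → F s j * z j) ≤ B * G s) →
    S * μ (λ s → 𝟙 (light? v s) * F s (lookup s v)) ≤ 3 * B * μ G
  resample v F G B inv bnd = *-cancelˡ-≤ 49 (begin
    49 * (S * μ (λ s → 𝟙 (light? v s) * F s (lookup s v)))
      ≡⟨ trans (sym (*-assoc 49 S _)) (sym (∑-*ˡ uX (49 * S) _)) ⟩
    ∑ uX (λ s → 49 * S * (w s * (𝟙 (light? v s) * F s (lookup s v))))  ≤⟨ ∑-mono uX step ⟩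
    ∑ uX (λ s → ∑ (fin n) λ j → 100 * (w (s [ v ]≔ j) * z (lookup s v) * F (s [ v ]≔ j) (lookup s v)))
      -- Exchanging the old value with the fresh one is an involution; it makes the revealed value
      -- the free variable `j`.
      ≡⟨ ∑-bij (uX ⊗ fin n) (uX ⊗ fin n) g g gg gg (λ (s , j) → 100 * (w s * z j * F s j)) ⟩
    ∑ uX (λ s → ∑ (fin n) λ j → 100 * (w s * z j * F s j)) ≤⟨ ∑-mono uX fin-step ⟩
    ∑ uX (λ s → 100 * B * (w s * G s))    ≡⟨ ∑-*ˡ uX (100 * B) _ ⟩
    -- The losses are 2 for the forbidden values and 50/49 for the weight; 100/49 is rounded up to
    -- 3.
    100 * B * μ G                         ≤⟨ *-monoˡ-≤ (μ G) (*-monoˡ-≤ B (m≤m+n 100 47)) ⟩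
    147 * B * μ G                         ≡⟨ lem₃ B (μ G) ⟩
    49 * (3 * B * μ G) ∎)
    where
    open ≤-Reasoning
    lem₃ : ∀ a b → 147 * a * b ≡ 49 * (3 * a * b)
    lem₃ = solve-∀
    g : X × Fin n → X × Fin n
    g (s , j) = s [ v ]≔ j , lookup s v
    gg : ∀ a → g (g a) ≡ a
    gg (s , j) = cong₂ _,_ (upd-upd s v j) (upd-same s v j)
    fin-step : ∀ s → ∑ (fin n) (λ j → 100 * (w s * z j * F s j)) ≤ 100 * B * (w s * G s)
    fin-step s = begin
      ∑ (fin n) (λ j → 100 * (w s * z j * F s j)) ≡⟨ ∑-cong (fin n) (λ j → lem (w s) (z j) (F s j)) ⟩
      ∑ (fin n) (λ j → 100 * w s * (F s j * z j)) ≡⟨ ∑-*ˡ (fin n) (100 * w s) _ ⟩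
      100 * w s * ∑ (fin n) (λ j → F s j * z j)   ≤⟨ *-monoʳ-≤ (100 * w s) (bnd s) ⟩
      100 * w s * (B * G s)                       ≡⟨ lem₂ (w s) B (G s) ⟩
      100 * B * (w s * G s) ∎
      where lem : ∀ a b c → 100 * (a * b * c) ≡ 100 * a * (c * b)
            lem = solve-∀
            lem₂ : ∀ a b c → 100 * a * (b * c) ≡ 100 * b * (a * c)
            lem₂ = solve-∀
    step : ∀ s → 49 * S * (w s * (𝟙 (light? v s) * F s (lookup s v))) ≤
                 ∑ (fin n) λ j → 100 * (w (s [ v ]≔ j) * z (lookup s v) * F (s [ v ]≔ j) (lookup s v))
    step s = go (w s) refl
      where
      f = F s (lookup s v)
      lem : ∀ a b c d → a * b * (c * d) ≡ a * (b * (c * d))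
      lem = solve-∀
      lem4 : ∀ a b c d e → 49 * (2 * (d * e)) * (a * (b * c)) ≡ d * (2 * (49 * (a * e)) * (b * c))
      lem4 = solve-∀
      go : ∀ m → w s ≡ m → 49 * S * (w s * (𝟙 (light? v s) * f)) ≤
           ∑ (fin n) λ j → 100 * (w (s [ v ]≔ j) * z (lookup s v) * F (s [ v ]≔ j) (lookup s v))
      go zero e rewrite e | *-zeroʳ (49 * S) = z≤n
      go (suc m) e with light? v s
      ... | no _ rewrite *-zeroʳ (w s) | *-zeroʳ (49 * S) = z≤n
      ... | yes l = begin
        49 * S * (w s * (1 * f))   ≤⟨ *-monoˡ-≤ (w s * (1 * f)) (*-monoʳ-≤ 49 (S≤2ok s v l)) ⟩
        49 * (2 * O) * (w s * (1 * f)) ≡⟨ lem₅ O (w s) f ⟩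
        O * (98 * w s * f)         ≡⟨ sym (∑-*ʳ (fin n) (98 * w s * f) _) ⟩
        ∑ (fin n) (λ j → 𝟙 (ok? s v j) * z j * (98 * w s * f)) ≤⟨ ∑-mono (fin n) each ⟩
        ∑ (fin n) (λ j → 100 * (w (s [ v ]≔ j) * z (lookup s v) * F (s [ v ]≔ j) (lookup s v))) ∎
        where
        O = ∑ (fin n) (λ j → 𝟙 (ok? s v j) * z j)
        Ls : Legal s
        Ls = legal s λ e′ → 1+n≢0 (trans (sym e) e′)
        lem₅ : ∀ a b c → 49 * (2 * a) * (b * (1 * c)) ≡ a * (98 * b * c)
        lem₅ = solve-∀
        lem₆ : ∀ a b c → a * (98 * b * c) ≡ 2 * (49 * (b * a)) * c
        lem₆ = solve-∀
        lem₇ : ∀ a c → 2 * (50 * a) * c ≡ 100 * (a * c)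
        lem₇ = solve-∀
        each : ∀ j → 𝟙 (ok? s v j) * z j * (98 * w s * f) ≤ 100 * (w (s [ v ]≔ j) * z (lookup s v) * F (s [ v ]≔ j) (lookup s v))
        each j with ok? s v j
        ... | no _ = z≤n
        ... | yes o = begin
          (z j + 0) * (98 * w s * f)                ≡⟨ cong (_* (98 * w s * f)) (+-identityʳ (z j)) ⟩
          z j * (98 * w s * f)                      ≡⟨ lem₆ (z j) (w s) f ⟩
          2 * (49 * (w s * z j)) * f                ≤⟨ *-mono-≤ (*-monoʳ-≤ 2 (res s v j Ls (ok-legal s v j Ls o))) (inv s (lookup s v) j) ⟩
          2 * (50 * (w (s [ v ]≔ j) * z (lookup s v))) * F (s [ v ]≔ j) (lookup s v) ≡⟨ lem₇ (w (s [ v ]≔ j) * z (lookup s v)) _ ⟩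
          100 * (w (s [ v ]≔ j) * z (lookup s v) * F (s [ v ]≔ j) (lookup s v)) ∎

  𝟙NL : X → ℕ
  𝟙NL s = 𝟙 (nl? s)

  -- The same with a site that depends on s: the families P v describe what is known before s v is revealed.
  site-resample : ∀ {p} (P : Fin n → X → Fin n → Set p) (P? : ∀ v s j → Dec (P v s j))
    (q : Fin n → X → ℕ) (G : X → ℕ) B (E : X → ℕ) →
    (∀ v s j k → P v s j → P v (s [ v ]≔ k) j) →
    (∀ v s → ∑ (fin n) (λ j → 𝟙 (P? v s j) * z j) ≤ B * q v s) →
    (∀ s → ∑ (fin n) (λ v → q v s) ≤ G s) →
    (∀ s → Legal s → E s ≤ ∑ (fin n) (λ v → 𝟙 (P? v s (lookup s v)))) →
    S * μ (λ s → 𝟙NL s * E s) ≤ 3 * B * μ G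
  site-resample P P? q G B E inv bnd qG cover = begin
    S * μ (λ s → 𝟙NL s * E s)
      ≤⟨ *-monoʳ-≤ S (μ-mono λ s L → le s L) ⟩
    S * μ (λ s → ∑ (fin n) (λ v → 𝟙 (light? v s) * 𝟙 (P? v s (lookup s v))))
      ≡⟨ cong (S *_) (μ-∑ (fin n) _) ⟩
    S * ∑ (fin n) (λ v → μ (λ s → 𝟙 (light? v s) * 𝟙 (P? v s (lookup s v))))  ≡⟨ sym (∑-*ˡ (fin n) S _) ⟩
    ∑ (fin n) (λ v → S * μ (λ s → 𝟙 (light? v s) * 𝟙 (P? v s (lookup s v))))
      ≤⟨ ∑-mono (fin n) (λ v → resample v (λ s j → 𝟙 (P? v s j)) (q v) B
           (λ s j k → 𝟙-mono (P? v s j) (P? v (s [ v ]≔ k) j) (inv v s j k)) (bnd v)) ⟩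
    ∑ (fin n) (λ v → 3 * B * μ (q v))  ≡⟨ ∑-*ˡ (fin n) (3 * B) _ ⟩
    3 * B * ∑ (fin n) (λ v → μ (q v))  ≡⟨ cong (3 * B *_) (sym (μ-∑ (fin n) q)) ⟩
    3 * B * μ (λ s → ∑ (fin n) (λ v → q v s))  ≤⟨ *-monoʳ-≤ (3 * B) (μ-mono λ s _ → qG s) ⟩
    3 * B * μ G ∎
    where
    open ≤-Reasoning
    le : ∀ s → Legal s → 𝟙NL s * E s ≤ ∑ (fin n) (λ v → 𝟙 (light? v s) * 𝟙 (P? v s (lookup s v)))
    le s L = 𝟙*≤ (nl? s) λ nl → ≤-trans (cover s L) (≤-reflexive (∑-cong (fin n) λ v →
      sym (trans (cong (_* 𝟙 (P? v s (lookup s v))) (𝟙-yes (light? v s) (nl v))) (*-identityˡ _))))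

  private
    -- A second moment: the weight of the pairs with equal images, which is the sum of the squares
    -- of the `J s v`.
    Tq : X → ℕ
    Tq s = ∑ (fin n) λ j′ → ∑ (fin n) λ j → z j * z j′ * 𝟙 (lookup s j ≟F lookup s j′)

    hv : X → ℕ
    hv s = ∑ (fin n) λ v → 𝟙 (¬? (light? v s))

    -- The `J s v` add up to `S`. This breaks a circle: resampling at `j′` needs `j′` light, while
    -- `heavy-mass` has yet to show that heavy points are rare.
    hv≤4 : ∀ s → hv s ≤ 4
    hv≤4 s = *-cancelˡ-≤ S {{>-nonZero S>0}} (begin
      S * hv s ≡⟨ sym (∑-*ˡ (fin n) S _) ⟩
      ∑ (fin n) (λ v → S * 𝟙 (¬? (light? v s))) ≤⟨ ∑-mono (fin n) each ⟩
      ∑ (fin n) (λ v → 4 * J s v) ≡⟨ trans (∑-*ˡ (fin n) 4 _) (cong (4 *_) (sum-J s)) ⟩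
      4 * S ≡⟨ *-comm 4 S ⟩
      S * 4 ∎)
      where
      open ≤-Reasoning
      each : ∀ v → S * 𝟙 (¬? (light? v s)) ≤ 4 * J s v
      each v with light? v s
      ... | yes _ rewrite *-zeroʳ S = z≤n
      ... | no ¬l rewrite *-identityʳ S = <⇒≤ (≰⇒> ¬l)

    heavy≤Tq : ∀ s v → J s v * J s v ≤ Tq s
    heavy≤Tq s v = begin
      J s v * J s v ≡⟨ sym (∑-*ˡ (fin n) (J s v) _) ⟩
      ∑ (fin n) (λ j′ → J s v * (𝟙 (lookup s j′ ≟F v) * z j′)) ≡⟨ ∑-cong (fin n) (λ j′ → sym (∑-*ʳ (fin n) _ _)) ⟩
      ∑ (fin n) (λ j′ → ∑ (fin n) λ j → 𝟙 (lookup s j ≟F v) * z j * (𝟙 (lookup s j′ ≟F v) * z j′))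
        ≤⟨ ∑-mono (fin n) (λ j′ → ∑-mono (fin n) λ j → each j′ j) ⟩
      Tq s ∎
      where
      open ≤-Reasoning
      each : ∀ j′ j → 𝟙 (lookup s j ≟F v) * z j * (𝟙 (lookup s j′ ≟F v) * z j′) ≤ z j * z j′ * 𝟙 (lookup s j ≟F lookup s j′)
      each j′ j with lookup s j ≟F v | lookup s j′ ≟F v
      ... | no _ | _ = z≤n
      ... | yes _ | no _ rewrite *-zeroʳ (z j + 0) = z≤n
      ... | yes p | yes q rewrite 𝟙-yes (lookup s j ≟F lookup s j′) (trans p (sym q)) = ≤-reflexive (lem (z j) (z j′))
        where lem : ∀ a b → (a + 0) * (b + 0) ≡ a * b * 1
              lem = solve-∀

    pair : ∀ j′ j → S * μ (λ s → 𝟙 (¬? (j ≟F j′)) * (𝟙 (light? j′ s) * 𝟙 (lookup s j ≟F lookup s j′))) ≤ 3 * R * T₁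
    pair j′ j with j ≟F j′
    ... | yes _ = ≤-trans (≤-reflexive (trans (cong (S *_) (trans (∑-cong uX λ s → *-zeroʳ (w s)) (∑-0 uX))) (*-zeroʳ S))) z≤n
    ... | no j≢j′ = ≤-trans (≤-reflexive (cong (S *_) (∑-cong uX λ s → cong (w s *_) (+-identityʳ _))))
        (resample j′ (λ s k → 𝟙 (lookup s j ≟F k)) (λ _ → 1) R
        (λ s k l → 𝟙-mono (lookup s j ≟F k) (lookup (s [ j′ ]≔ l) j ≟F k) (trans (upd-other s j′ l j≢j′)))
        λ s → ≤-trans (≤-reflexive (trans (∑-cong (fin n) λ k → cong (_* z k) (𝟙-cong (lookup s j ≟F k) (k ≟F lookup s j) sym sym))
                (∑-δ (fin n) z (lookup s j)))) (≤-trans (z≤R _) (≤-reflexive (sym (*-identityʳ R)))))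

    Tq≤ : ∀ s → Tq s ≤ 5 * (R * S) + ∑ (fin n) (λ j′ → ∑ (fin n) λ j → z j * z j′ * (𝟙 (¬? (j ≟F j′)) * (𝟙 (light? j′ s) * 𝟙 (lookup s j ≟F lookup s j′))))
    Tq≤ s = begin
      Tq s ≤⟨ ∑-mono (fin n) (λ j′ → ≤-trans (∑-mono (fin n) λ j → each j′ j) (≤-reflexive
               (trans (∑-+ (fin n) _ _) (cong (_+ Q j′) (trans (∑-+ (fin n) _ _) (cong₂ _+_ (∑-δ (fin n) (λ j → z j * z j′) j′)
                 (∑-*ʳ (fin n) (z j′ * 𝟙 (¬? (light? j′ s))) z))))))) ⟩
      ∑ (fin n) (λ j′ → z j′ * z j′ + S * (z j′ * 𝟙 (¬? (light? j′ s))) + Q j′) ≡⟨ trans (∑-+ (fin n) _ _) (cong (_+ ∑ (fin n) Q) (∑-+ (fin n) _ _)) ⟩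
      ∑ (fin n) (λ j′ → z j′ * z j′) + ∑ (fin n) (λ j′ → S * (z j′ * 𝟙 (¬? (light? j′ s)))) + ∑ (fin n) Q
        ≤⟨ +-monoˡ-≤ (∑ (fin n) Q) (+-mono-≤ (≤-trans (∑-mono (fin n) λ j′ → *-monoˡ-≤ (z j′) (z≤R j′)) (≤-reflexive (∑-*ˡ (fin n) R z)))
           (≤-trans (∑-mono (fin n) λ j′ → *-monoʳ-≤ S (*-monoˡ-≤ (𝟙 (¬? (light? j′ s))) (z≤R j′)))
             (≤-trans (≤-reflexive (trans (∑-*ˡ (fin n) S _) (cong (S *_) (∑-*ˡ (fin n) R _)))) (*-monoʳ-≤ S (*-monoʳ-≤ R (hv≤4 s)))))) ⟩
      R * S + S * (R * 4) + ∑ (fin n) Q ≡⟨ cong (_+ ∑ (fin n) Q) (lem R S) ⟩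
      5 * (R * S) + ∑ (fin n) Q ∎
      where
      open ≤-Reasoning
      Q : Fin n → ℕ
      Q j′ = ∑ (fin n) λ j → z j * z j′ * (𝟙 (¬? (j ≟F j′)) * (𝟙 (light? j′ s) * 𝟙 (lookup s j ≟F lookup s j′)))
      lem : ∀ r t → r * t + t * (r * 4) ≡ 5 * (r * t)
      lem = solve-∀
      lemA : ∀ a b → a * b * 1 ≡ 1 * (a * b) + 0
      lemA = solve-∀
      each : ∀ j′ j → z j * z j′ * 𝟙 (lookup s j ≟F lookup s j′) ≤
        𝟙 (j ≟F j′) * (z j * z j′) + z j * (z j′ * 𝟙 (¬? (light? j′ s))) + z j * z j′ * (𝟙 (¬? (j ≟F j′)) * (𝟙 (light? j′ s) * 𝟙 (lookup s j ≟F lookup s j′)))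
      each j′ j with j ≟F j′ | light? j′ s
      ... | yes _ | _ = ≤-trans (*-monoʳ-≤ (z j * z j′) (𝟙≤1 _)) (≤-trans (≤-reflexive (lemA (z j) (z j′))) (≤-trans (+-monoʳ-≤ (1 * (z j * z j′)) z≤n) (m≤m+n _ _)))
      ... | no _ | no _ = ≤-trans (*-monoʳ-≤ (z j * z j′) (𝟙≤1 _)) (≤-trans (≤-reflexive (*-assoc (z j) (z j′) 1)) (m≤m+n _ _))
      ... | no _ | yes _ = ≤-trans (*-monoʳ-≤ (z j * z j′) (≤-reflexive (sym (lem1 _)))) (m≤n+m _ _)
        where lem1 : ∀ a → 1 * (1 * a) ≡ a
              lem1 = solve-∀

  -- Second moment method. A heavy point forces `Tq` above S²/16, while its mean is at most 8RS: RS
  -- from the diagonal, 4RS from heavy `j′`, 3RS from resampling at light ones. Hence 128 = 16 · 8.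
  heavy-mass : S * μ (λ s → 𝟙 (¬? (nl? s))) ≤ 128 * R * T₁
  heavy-mass = *-cancelˡ-≤ (S * S) {{>-nonZero (*-mono-≤ S>0 S>0)}} (begin
    S * S * (S * μ (λ s → 𝟙 (¬? (nl? s))))    ≡⟨ lem₁ S _ ⟩
    S * (S * S * μ (λ s → 𝟙 (¬? (nl? s))))    ≡⟨ cong (S *_) (sym (μ-* (S * S) _)) ⟩
    S * μ (λ s → S * S * 𝟙 (¬? (nl? s)))      ≤⟨ *-monoʳ-≤ S (μ-mono λ s _ → pt s) ⟩
    S * μ (λ s → 16 * (5 * (R * S) * 1 + P s))      ≡⟨ cong (S *_) (trans (μ-* 16 _) (cong (16 *_) (trans (μ-+ _ _) (cong (_+ μ P) (μ-* (5 * (R * S)) _))))) ⟩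
    S * (16 * (5 * (R * S) * T₁ + μ P)) ≡⟨ lem₂ S R T₁ (μ P) ⟩
    80 * R * S * S * T₁ + 16 * (S * μ P) ≤⟨ +-monoʳ-≤ (80 * R * S * S * T₁) (*-monoʳ-≤ 16 Pb) ⟩
    80 * R * S * S * T₁ + 16 * (3 * R * T₁ * (S * S)) ≡⟨ lem₃ S R T₁ ⟩
    S * S * (128 * R * T₁) ∎)
    where
    open ≤-Reasoning
    P : X → ℕ
    P s = ∑ (fin n) (λ j′ → ∑ (fin n) λ j → z j * z j′ * (𝟙 (¬? (j ≟F j′)) * (𝟙 (light? j′ s) * 𝟙 (lookup s j ≟F lookup s j′))))
    lem₁ : ∀ a b → a * a * (a * b) ≡ a * (a * a * b)
    lem₁ = solve-∀
    lem₂ : ∀ s r t p → s * (16 * (5 * (r * s) * t + p)) ≡ 80 * r * s * s * t + 16 * (s * p)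
    lem₂ = solve-∀
    lem₃ : ∀ s r t → 80 * r * s * s * t + 16 * (3 * r * t * (s * s)) ≡ s * s * (128 * r * t)
    lem₃ = solve-∀
    Pb : S * μ P ≤ 3 * R * T₁ * (S * S)
    Pb = begin
      S * μ P ≡⟨ cong (S *_) (trans (μ-∑ (fin n) _) (∑-cong (fin n) λ j′ → trans (μ-∑ (fin n) _) (∑-cong (fin n) λ j → μ-* (z j * z j′) _))) ⟩
      S * ∑ (fin n) (λ j′ → ∑ (fin n) λ j → z j * z j′ * A j′ j) ≡⟨ trans (sym (∑-*ˡ (fin n) S _)) (∑-cong (fin n) λ j′ → sym (∑-*ˡ (fin n) S _)) ⟩
      ∑ (fin n) (λ j′ → ∑ (fin n) λ j → S * (z j * z j′ * A j′ j)) ≤⟨ ∑-mono (fin n) (λ j′ → ∑-mono (fin n) λ j →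
          ≤-trans (≤-reflexive (lem4 S (z j * z j′) (A j′ j))) (*-monoʳ-≤ (z j * z j′) (pair j′ j))) ⟩
      ∑ (fin n) (λ j′ → ∑ (fin n) λ j → z j * z j′ * (3 * R * T₁)) ≡⟨ ∑-cong (fin n) (λ j′ → trans (∑-*ʳ (fin n) (3 * R * T₁) _) (cong (_* (3 * R * T₁)) (∑-*ʳ (fin n) (z j′) z))) ⟩
      ∑ (fin n) (λ j′ → S * z j′ * (3 * R * T₁)) ≡⟨ trans (∑-*ʳ (fin n) (3 * R * T₁) _) (cong (_* (3 * R * T₁)) (∑-*ˡ (fin n) S z)) ⟩
      S * S * (3 * R * T₁) ≡⟨ *-comm (S * S) _ ⟩
      3 * R * T₁ * (S * S) ∎
      where
      A : Fin n → Fin n → ℕ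
      A j′ j = μ (λ s → 𝟙 (¬? (j ≟F j′)) * (𝟙 (light? j′ s) * 𝟙 (lookup s j ≟F lookup s j′)))
      lem4 : ∀ a b c → a * (b * c) ≡ b * (a * c)
      lem4 = solve-∀
    pt : ∀ s → S * S * 𝟙 (¬? (nl? s)) ≤ 16 * (5 * (R * S) * 1 + P s)
    pt s with nl? s
    ... | yes _ = ≤-trans (≤-reflexive (*-zeroʳ (S * S))) z≤n
    ... | no ¬nl with FinP.¬∀⟶∃¬ n (λ v → Light v s) (λ v → light? v s) ¬nl
    ...   | v , ¬l = begin
      S * S * 1 ≡⟨ *-identityʳ _ ⟩
      S * S ≤⟨ *-mono-≤ (<⇒≤ (≰⇒> ¬l)) (<⇒≤ (≰⇒> ¬l)) ⟩
      4 * J s v * (4 * J s v) ≡⟨ lem5 (J s v) ⟩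
      16 * (J s v * J s v) ≤⟨ *-monoʳ-≤ 16 (≤-trans (heavy≤Tq s v) (Tq≤ s)) ⟩
      16 * (5 * (R * S) + P s) ≡⟨ cong (λ x → 16 * (x + P s)) (sym (*-identityʳ (5 * (R * S)))) ⟩
      16 * (5 * (R * S) * 1 + P s) ∎
      where lem5 : ∀ a → 4 * a * (4 * a) ≡ 16 * (a * a)
            lem5 = solve-∀

  M-inj : ∀ {i j} → M i ≡ M j → i ≡ j
  M-inj {i} {j} e = trans (sym (MM i)) (trans (cong M e) (MM j))

  -- The event that, once everything but the image of the site σ s is known (Ex), that image is a prescribed point.
  pin : ∀ {p} (σ : X → Fin n) (Ex : Fin n → X → Set p) (Ex? : ∀ v s → Dec (Ex v s)) (tg : Fin n → X → Fin n)
    (G : X → ℕ) →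
    (∀ v s k → σ s ≡ v → Ex v s → σ (s [ v ]≔ k) ≡ v × Ex v (s [ v ]≔ k) × tg v (s [ v ]≔ k) ≡ tg v s) →
    (∀ s → Ex (σ s) s → 1 ≤ G s) →
    ∀ {e} {E : X → Set e} (E? : ∀ s → Dec (E s)) →
    (∀ s → Legal s → E s → Ex (σ s) s × lookup s (σ s) ≡ tg (σ s) s) →
    S * μ (λ s → 𝟙NL s * 𝟙 (E? s)) ≤ 3 * R * μ G
  pin σ Ex Ex? tg G inv exG {E = E} E? cover = site-resample P P? q G R (λ s → 𝟙 (E? s)) pinv pbnd pq pcov
    where
    P : Fin n → X → Fin n → Set _
    P v s j = σ s ≡ v × Ex v s × j ≡ tg v s
    P? : ∀ v s j → Dec (P v s j)
    P? v s j = (σ s ≟F v) ×-dec Ex? v s ×-dec (j ≟F tg v s)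
    q : Fin n → X → ℕ
    q v s = 𝟙 (v ≟F σ s) * G s
    pinv : ∀ v s j k → P v s j → P v (s [ v ]≔ k) j
    pinv v s j k (a , b , c) = let a′ , b′ , c′ = inv v s k a b in a′ , b′ , trans c (sym c′)
    each : ∀ v s j → 𝟙 (P? v s j) ≤ 𝟙 (j ≟F tg v s) * q v s
    each v s j = 𝟙≤ (P? v s j) λ { (refl , b , c) →
      ≤-trans (exG s b) (≤-reflexive (sym (trans (cong₂ _*_ (𝟙-yes (j ≟F tg v s) c) (cong (_* G s) (𝟙-yes (v ≟F σ s) refl))) (lem (G s))))) }
      where lem : ∀ a → 1 * (1 * a) ≡ a
            lem = solve-∀
    pbnd : ∀ v s → ∑ (fin n) (λ j → 𝟙 (P? v s j) * z j) ≤ R * q v s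
    pbnd v s = begin
      ∑ (fin n) (λ j → 𝟙 (P? v s j) * z j) ≤⟨ ∑-mono (fin n) (λ j → *-monoˡ-≤ (z j) (each v s j)) ⟩
      ∑ (fin n) (λ j → 𝟙 (j ≟F tg v s) * q v s * z j) ≡⟨ ∑-cong (fin n) (λ j → *-assoc (𝟙 (j ≟F tg v s)) (q v s) (z j)) ⟩
      ∑ (fin n) (λ j → 𝟙 (j ≟F tg v s) * (q v s * z j)) ≡⟨ ∑-δ (fin n) (λ j → q v s * z j) (tg v s) ⟩
      q v s * z (tg v s) ≤⟨ *-monoʳ-≤ (q v s) (z≤R _) ⟩
      q v s * R ≡⟨ *-comm (q v s) R ⟩
      R * q v s ∎
      where open ≤-Reasoning
    pq : ∀ s → ∑ (fin n) (λ v → q v s) ≤ G s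
    pq s = ≤-reflexive (∑-δ (fin n) (λ _ → G s) (σ s))
    pcov : ∀ s → Legal s → 𝟙 (E? s) ≤ ∑ (fin n) (λ v → 𝟙 (P? v s (lookup s v)))
    pcov s L = 𝟙≤ (E? s) λ e → let b , c = cover s L e in
      ≤-trans (≤-reflexive (sym (𝟙-yes (P? (σ s) s (lookup s (σ s))) (refl , b , c)))) (f≤∑ (fin n) (λ v → 𝟙 (P? v s (lookup s v))) (σ s))

  -- The site is the end of a path. Freshness keeps the path, and with it the site, in place when
  -- the image at the site is resampled.
  pin-path : ∀ {p} t u (Ex : Fin n → X → Set p) (Ex? : ∀ v s → Dec (Ex v s)) (tg : Fin n → X → Fin n) (G : X → ℕ) →
    (∀ v s k → it s t u ≡ v → Fresh s t u v → Ex v s → Ex v (s [ v ]≔ k) × tg v (s [ v ]≔ k) ≡ tg v s) →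
    (∀ s → Ex (it s t u) s → 1 ≤ G s) →
    ∀ {e} {E : X → Set e} (E? : ∀ s → Dec (E s)) →
    (∀ s → Legal s → E s → Fresh s t u (it s t u) × Ex (it s t u) s × lookup s (it s t u) ≡ tg (it s t u) s) →
    S * μ (λ s → 𝟙NL s * 𝟙 (E? s)) ≤ 3 * R * μ G
  pin-path t u Ex Ex? tg G inv exG E? cover = pin (λ s → it s t u) (λ v s → Fresh s t u v × Ex v s)
    (λ v s → fresh? s t u v ×-dec Ex? v s) tg G
    (λ v s k e (fr , x) → let x′ , g′ = inv v s k e fr x in
      trans (it-upd s v k u t fr) e , (fresh-upd s v k u t fr , x′) , g′)
    (λ s (_ , x) → exG s x) E? (λ s L e → let a , b , c = cover s L e in (a , b) , c)

  -- An earlier visit to the last vertex before `b` would have led to `b` sooner.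
  hit-pred : ∀ s k a b → Hit s (suc k) a b → Fresh s k a (it s k a) × lookup s (it s k a) ≡ M b
  hit-pred s k a b (e , m) = (λ {r} r<k q → m (s≤s r<k) (s≤s z≤n) (trans (cong (φ s) q) e)) , trans (sym (MM _)) (cong M e)

  hit-mass : ∀ k a b → S * μ (λ s → 𝟙NL s * 𝟙 (hit? s (suc k) a b)) ≤ 3 * R * T₁
  hit-mass k a b = pin-path k a (λ _ _ → b ≡ b) (λ _ _ → yes refl) (λ _ _ → M b) (λ _ → 1)
    (λ _ _ _ _ _ _ → refl , refl) (λ _ _ → ≤-refl) (λ s → hit? s (suc k) a b)
    (λ s _ h → let f , e = hit-pred s k a b h in f , refl , e)

  -- Decomposition along light configurations: the exceptional mass is controlled by heavy-mass.
  μ-light-split : ∀ (F : X → ℕ) c → (∀ s → F s ≤ c) → S * μ F ≤ S * μ (λ s → 𝟙NL s * F s) + c * (128 * R * T₁)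
  μ-light-split F c Fc = begin
    S * μ F ≤⟨ *-monoʳ-≤ S (μ-mono λ s _ → each s) ⟩
    S * μ (λ s → 𝟙NL s * F s + c * 𝟙 (¬? (nl? s))) ≡⟨ cong (S *_) (trans (μ-+ _ _) (cong (μ (λ s → 𝟙NL s * F s) +_) (μ-* c _))) ⟩
    S * (μ (λ s → 𝟙NL s * F s) + c * μ (λ s → 𝟙 (¬? (nl? s)))) ≡⟨ lem S (μ (λ s → 𝟙NL s * F s)) c _ ⟩
    S * μ (λ s → 𝟙NL s * F s) + c * (S * μ (λ s → 𝟙 (¬? (nl? s)))) ≤⟨ +-monoʳ-≤ _ (*-monoʳ-≤ c heavy-mass) ⟩
    S * μ (λ s → 𝟙NL s * F s) + c * (128 * R * T₁) ∎
    where
    open ≤-Reasoning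
    lem : ∀ s a c b → s * (a + c * b) ≡ s * a + c * (s * b)
    lem = solve-∀
    each : ∀ s → F s ≤ 𝟙NL s * F s + c * 𝟙 (¬? (nl? s))
    each s with nl? s
    ... | yes _ = ≤-trans (≤-reflexive (sym (+-identityʳ (F s)))) (m≤m+n _ _)
    ... | no _ = ≤-trans (Fc s) (≤-reflexive (sym (*-identityʳ c)))

  hit-mass′ : ∀ k a b → S * μ (λ s → 𝟙 (hit? s (suc k) a b)) ≤ 131 * R * T₁
  hit-mass′ k a b = begin
    S * μ (λ s → 𝟙 (hit? s (suc k) a b)) ≤⟨ μ-light-split _ 1 (λ s → 𝟙≤1 _) ⟩
    S * μ (λ s → 𝟙NL s * 𝟙 (hit? s (suc k) a b)) + 1 * (128 * R * T₁) ≤⟨ +-monoˡ-≤ _ (hit-mass k a b) ⟩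
    3 * R * T₁ + 1 * (128 * R * T₁) ≡⟨ lem R T₁ ⟩
    131 * R * T₁ ∎
    where open ≤-Reasoning
          lem : ∀ a b → 3 * a * b + 1 * (128 * a * b) ≡ 131 * a * b
          lem = solve-∀

  -- Both a and M a lie on short cycles: either the cycle of a passes through M a, or the two cycles are disjoint.
  module Linked (ℓ : ℕ) where

    SameC : X → ℕ → Fin n → Set
    SameC s k a = Per s (suc k) a × ∃ λ t → t < k × it s t a ≡ M a

    opaque
      same? : ∀ s k a → Dec (SameC s k a)
      same? s k a = per? s (suc k) a ×-dec anyUpTo? (λ t → it s t a ≟F M a) k

    OffC : X → ℕ → ℕ → Fin n → Set
    OffC s k l a = Per s (suc k) a × Per s (suc l) (M a) × Fresh s (suc l) (M a) (it s k a)

    opaque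
      off? : ∀ s k l a → Dec (OffC s k l a)
      off? s k l a = per? s (suc k) a ×-dec per? s (suc l) (M a) ×-dec fresh? s (suc l) (M a) (it s k a)

    per-pred : ∀ s k a → Per s (suc k) a → Fresh s k a (it s k a) × lookup s (it s k a) ≡ M a
    per-pred s k a = hit-pred s k a a

    -- Two rare coincidences: the path from `a` meets `M a`, and its last vertex is sent back to
    -- `a`. The first does not involve the image of that last vertex, so the two estimates multiply.
    same-mass : ∀ k a → k ≤ ℓ → S * (S * μ (λ s → 𝟙NL s * 𝟙 (same? s k a))) ≤ 3 * R * (ℓ * (131 * R * T₁))
    same-mass k a k≤ℓ = begin
      S * (S * μ (λ s → 𝟙NL s * 𝟙 (same? s k a)))
        ≤⟨ *-monoʳ-≤ S (pin-path k a (λ v s → ∃ λ t → t < k × it s t a ≡ M a) (λ v s → anyUpTo? (λ t → it s t a ≟F M a) k)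
             (λ _ _ → M a) H inv (λ s x → H≥1 s x) (λ s → same? s k a)
             (λ s _ (p , x) → let f , e = per-pred s k a p in f , x , e)) ⟩
      S * (3 * R * μ H) ≡⟨ lem S (3 * R) (μ H) ⟩
      3 * R * (S * μ H) ≡⟨ cong (λ x → 3 * R * (S * x)) (μ-∑ (fin ℓ) _) ⟩
      3 * R * (S * ∑ (fin ℓ) (λ i → μ (λ s → 𝟙 (hit? s (suc (toℕ i)) a (M a))))) ≡⟨ cong (3 * R *_) (sym (∑-*ˡ (fin ℓ) S _)) ⟩
      3 * R * ∑ (fin ℓ) (λ i → S * μ (λ s → 𝟙 (hit? s (suc (toℕ i)) a (M a)))) ≤⟨ *-monoʳ-≤ (3 * R) (∑-mono (fin ℓ) λ i → hit-mass′ (toℕ i) a (M a)) ⟩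
      3 * R * ∑ (fin ℓ) (λ i → 131 * R * T₁) ≡⟨ cong (3 * R *_) (∑-constF ℓ _) ⟩
      3 * R * (ℓ * (131 * R * T₁)) ∎
      where
      open ≤-Reasoning
      lem : ∀ a b c → a * (b * c) ≡ b * (a * c)
      lem = solve-∀
      H : X → ℕ
      H s = ∑ℕ ℓ (λ i → 𝟙 (hit? s (suc i) a (M a)))
      inv : ∀ v s j → it s k a ≡ v → Fresh s k a v → (∃ λ t → t < k × it s t a ≡ M a) →
            (∃ λ t → t < k × it (s [ v ]≔ j) t a ≡ M a) × M a ≡ M a
      inv v s j _ fr (t , t<k , e) = (t , t<k , trans (it-upd s v j a t λ r<t → fr (<-trans r<t t<k)) e) , refl
      H≥1 : ∀ s → (∃ λ t → t < k × it s t a ≡ M a) → 1 ≤ H s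
      H≥1 s (zero , _ , e) = ⊥-elim (M≢ a (sym e))
      H≥1 s (suc t , t<k , e) with first-hit s (suc t) a (M a) (s≤s z≤n) e
      ... | suc k′ , _ , k′≤t , h = ≤-trans (≤-reflexive (sym (𝟙-yes (hit? s (suc k′) a (M a)) h)))
            (f≤∑ℕ ℓ (λ i → 𝟙 (hit? s (suc i) a (M a))) (≤-trans k′≤t (≤-trans (<⇒≤ t<k) k≤ℓ)))

    -- The last vertex of the cycle of `a` is off the cycle of `M a`; resampling its image leaves
    -- the latter intact, and again two factors R/S arise.
    off-mass : ∀ k l a → S * (S * μ (λ s → 𝟙NL s * 𝟙 (off? s k l a))) ≤ 3 * R * (131 * R * T₁)
    off-mass k l a = begin
      S * (S * μ (λ s → 𝟙NL s * 𝟙 (off? s k l a)))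
        ≤⟨ *-monoʳ-≤ S (pin-path k a (λ v s → Per s (suc l) (M a) × Fresh s (suc l) (M a) v)
             (λ v s → per? s (suc l) (M a) ×-dec fresh? s (suc l) (M a) v)
             (λ _ _ → M a) (λ s → 𝟙 (per? s (suc l) (M a))) inv (λ s (p , _) → ≤-reflexive (sym (𝟙-yes (per? s (suc l) (M a)) p)))
             (λ s → off? s k l a)
             (λ s _ (p , x) → let f , e = per-pred s k a p in f , x , e)) ⟩
      S * (3 * R * μ (λ s → 𝟙 (per? s (suc l) (M a)))) ≡⟨ lem S (3 * R) _ ⟩
      3 * R * (S * μ (λ s → 𝟙 (per? s (suc l) (M a)))) ≤⟨ *-monoʳ-≤ (3 * R) (hit-mass′ l (M a) (M a)) ⟩
      3 * R * (131 * R * T₁) ∎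
      where
      open ≤-Reasoning
      lem : ∀ a b c → a * (b * c) ≡ b * (a * c)
      lem = solve-∀
      inv : ∀ v s j → it s k a ≡ v → Fresh s k a v → Per s (suc l) (M a) × Fresh s (suc l) (M a) v →
        (Per (s [ v ]≔ j) (suc l) (M a) × Fresh (s [ v ]≔ j) (suc l) (M a) v) × M a ≡ M a
      inv v s j _ _ ((e , m) , fr) = ((trans (it-upd s v j (M a) (suc l) fr) e ,
        λ {r} r<l 0<r q → m r<l 0<r (trans (sym (it-upd s v j (M a) r λ x → fr (<-trans x r<l))) q)) ,
        fresh-upd s v j (M a) (suc l) fr) , refl

    Short : X → Fin n → Set
    Short s a = ∃ λ k → k < ℓ × Per s (suc k) a

    opaque
      short? : ∀ s a → Dec (Short s a)
      short? s a = anyUpTo? (λ k → per? s (suc k) a) ℓ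

    -- If the last vertex before `a` is on the cycle of `M a`, then so is `a`, and `M a` is met on
    -- the way round from `a`.
    linked-cases : ∀ s a → Legal s → Short s a → Short s (M a) →
      1 ≤ ∑ℕ ℓ (λ k → 𝟙 (same? s k a)) + ∑ℕ ℓ (λ k → ∑ℕ ℓ (λ l → 𝟙 (off? s k l a)))
    linked-cases s a L (k , k<ℓ , p) (l , l<ℓ , p′) with fresh? s (suc l) (M a) (it s k a)
    ... | yes fr = ≤-trans (≤-trans (≤-reflexive (sym (𝟙-yes (off? s k l a) (p , p′ , fr))))
           (≤-trans (f≤∑ℕ ℓ (λ l → 𝟙 (off? s k l a)) l<ℓ) (f≤∑ℕ ℓ (λ k → ∑ℕ ℓ (λ l → 𝟙 (off? s k l a))) k<ℓ))) (m≤n+m _ _)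
    ... | no ¬fr = ≤-trans (≤-trans (≤-reflexive (sym (𝟙-yes (same? s k a) (p , sm))))
           (f≤∑ℕ ℓ (λ k → 𝟙 (same? s k a)) k<ℓ)) (m≤m+n _ _)
      where
      hitr : ∃ λ r → r < suc l × it s r (M a) ≡ it s k a
      hitr with anyUpTo? (λ r → it s r (M a) ≟F it s k a) (suc l)
      ... | yes x = x
      ... | no ¬x = ⊥-elim (¬fr λ {r} r<l e → ¬x (r , r<l , e))
      r = proj₁ hitr
      back : it s (l ∸ r) a ≡ M a
      back = begin
        it s (l ∸ r) a                       ≡⟨ cong (it s (l ∸ r)) (sym (proj₁ p)) ⟩
        it s (l ∸ r) (it s (suc k) a)        ≡⟨ cong (λ x → it s (l ∸ r) (φ s x)) (sym (proj₂ (proj₂ hitr))) ⟩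
        it s (l ∸ r) (it s (suc r) (M a))    ≡⟨ sym (it-+ s (l ∸ r) (suc r) (M a)) ⟩
        it s (l ∸ r + suc r) (M a)           ≡⟨ cong (λ x → it s x (M a)) (trans (+-suc (l ∸ r) r) (cong suc (m∸n+n≡m (ℕ.s≤s⁻¹ (proj₁ (proj₂ hitr)))))) ⟩
        it s (suc l) (M a)                   ≡⟨ proj₁ p′ ⟩
        M a ∎
        where open ≡-Reasoning
      go : ∀ t → it s t a ≡ M a → ∃ λ t → t < k × it s t a ≡ M a
      go zero e = ⊥-elim (M≢ a (sym e))
      go (suc t) e with first-hit s (suc t) a (M a) (s≤s z≤n) e
      ... | t′ , 0<t′ , _ , h@(e′ , m) with <-cmp t′ k
      ...   | tri< t′<k _ _ = t′ , t′<k , e′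
      -- As the last vertex of the cycle, `M a` would have the image `M a` under `s`, a fixed point.
      ...   | tri≈ _ refl _ = ⊥-elim (proj₁ (L (M a)) (trans (sym (cong (lookup s) e′)) (proj₂ (per-pred s t′ a p))))
      ...   | tri> _ _ k<t′ with t′ ∸ suc k in eq
      ...     | zero = ⊥-elim (M≢ a (trans (sym e′) (trans (cong (λ x → it s x a) (≤-antisym (m∸n≡0⇒m≤n eq) k<t′)) (proj₁ p))))
      ...     | suc d = ⊥-elim (m (≤-trans (s≤s (≤-reflexive (sym eq))) (∸-suc<  k<t′)) (s≤s z≤n) (trans (trans (cong (it s (suc d)) (sym (proj₁ p)))
                 (trans (sym (it-+ s (suc d) (suc k) a)) (cong (λ x → it s x a) (trans (cong (_+ suc k) (sym eq)) (m∸n+n≡m k<t′))))) e′))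
        where ∸-suc< : ∀ {a b} → b < a → suc (a ∸ suc b) ≤ a
              ∸-suc< {suc a} {b} (s≤s q) = s≤s (m∸n≤m a b)
      sm : ∃ λ t → t < k × it s t a ≡ M a
      sm = go (l ∸ r) back

    linkedN : X → ℕ
    linkedN s = ∑ (fin n) λ a → 𝟙 (short? s a) * 𝟙 (short? s (M a))

    -- There are `n` starting points and, in either case, a factor `ℓ * ℓ` for the times. Each costs
    -- 3 · 131 times (R/S)², whence 786 = 2 · 3 · 131.
    linked-mass : S * (S * μ (λ s → 𝟙NL s * linkedN s)) ≤ 786 * (n * (ℓ * ℓ)) * (R * R) * T₁
    linked-mass = begin
      S * (S * μ (λ s → 𝟙NL s * linkedN s)) ≤⟨ *-monoʳ-≤ S (*-monoʳ-≤ S (μ-mono λ s L → pt s L)) ⟩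
      S * (S * μ (λ s → ∑ (fin n) λ a → ∑ℕ ℓ (λ k → 𝟙NL s * 𝟙 (same? s k a)) + ∑ℕ ℓ (λ k → ∑ℕ ℓ (λ l → 𝟙NL s * 𝟙 (off? s k l a)))))
        ≡⟨ cong (λ x → S * (S * x)) (trans (μ-∑ (fin n) _) (∑-cong (fin n) λ a → trans (μ-+ _ _) (cong₂ _+_ (μ-∑ (fin ℓ) _)
             (trans (μ-∑ (fin ℓ) _) (∑-cong (fin ℓ) λ k → μ-∑ (fin ℓ) _))))) ⟩
      S * (S * ∑ (fin n) (λ a → A a + B a)) ≡⟨ push (fin n) _ ⟩
      ∑ (fin n) (λ a → S * (S * (A a + B a))) ≤⟨ ∑-mono (fin n) ab ⟩
      ∑ (fin n) (λ a → C) ≡⟨ ∑-constF n C ⟩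
      n * C ≡⟨ lem n ℓ R T₁ ⟩
      786 * (n * (ℓ * ℓ)) * (R * R) * T₁ ∎
      where
      open ≤-Reasoning
      C = ℓ * (3 * R * (ℓ * (131 * R * T₁))) + ℓ * (ℓ * (3 * R * (131 * R * T₁)))
      lem : ∀ n l r t → n * (l * (3 * r * (l * (131 * r * t))) + l * (l * (3 * r * (131 * r * t)))) ≡ 786 * (n * (l * l)) * (r * r) * t
      lem = solve-∀
      push : ∀ u (f : El u → ℕ) → S * (S * ∑ u f) ≡ ∑ u (λ a → S * (S * f a))
      push u f = trans (cong (S *_) (sym (∑-*ˡ u S f))) (sym (∑-*ˡ u S _))
      A B : Fin n → ℕ
      A a = ∑ (fin ℓ) (λ k → μ (λ s → 𝟙NL s * 𝟙 (same? s (toℕ k) a)))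
      B a = ∑ (fin ℓ) (λ k → ∑ (fin ℓ) (λ l → μ (λ s → 𝟙NL s * 𝟙 (off? s (toℕ k) (toℕ l) a))))
      dist : ∀ s a b → s * (s * (a + b)) ≡ s * (s * a) + s * (s * b)
      dist = solve-∀
      ab : ∀ a → S * (S * (A a + B a)) ≤ C
      ab a = begin
        S * (S * (A a + B a)) ≡⟨ dist S (A a) (B a) ⟩
        S * (S * A a) + S * (S * B a) ≡⟨ cong₂ _+_ (push (fin ℓ) _) (trans (push (fin ℓ) _) (∑-cong (fin ℓ) λ k → push (fin ℓ) _)) ⟩
        _ ≤⟨ +-mono-≤ (∑-mono (fin ℓ) λ k → same-mass (toℕ k) a (<⇒≤ (FinP.toℕ<n k)))
                      (∑-mono (fin ℓ) λ k → ∑-mono (fin ℓ) λ l → off-mass (toℕ k) (toℕ l) a) ⟩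
        _ ≡⟨ cong₂ _+_ (∑-constF ℓ _) (trans (∑-cong (fin ℓ) λ k → ∑-constF ℓ _) (∑-constF ℓ _)) ⟩
        C ∎
      pt : ∀ s → Legal s → 𝟙NL s * linkedN s ≤ ∑ (fin n) λ a → ∑ℕ ℓ (λ k → 𝟙NL s * 𝟙 (same? s k a)) + ∑ℕ ℓ (λ k → ∑ℕ ℓ (λ l → 𝟙NL s * 𝟙 (off? s k l a)))
      pt s L = ≤-trans (≤-reflexive (sym (∑-*ˡ (fin n) (𝟙NL s) _))) (∑-mono (fin n) λ a → begin
        𝟙NL s * (𝟙 (short? s a) * 𝟙 (short? s (M a))) ≤⟨ *-monoʳ-≤ (𝟙NL s) (≤-trans (≤-reflexive (sym (𝟙-× (short? s a) (short? s (M a)))))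
             (𝟙≤ (short? s a ×-dec short? s (M a)) λ (p , q) → linked-cases s a L p q)) ⟩
        𝟙NL s * (∑ℕ ℓ (λ k → 𝟙 (same? s k a)) + ∑ℕ ℓ (λ k → ∑ℕ ℓ (λ l → 𝟙 (off? s k l a)))) ≡⟨ *-distribˡ-+ (𝟙NL s) _ _ ⟩
        _ ≡⟨ cong₂ _+_ (sym (∑-*ˡ (fin ℓ) (𝟙NL s) _)) (trans (sym (∑-*ˡ (fin ℓ) (𝟙NL s) _)) (∑-cong (fin ℓ) λ k → sym (∑-*ˡ (fin ℓ) (𝟙NL s) _))) ⟩
        ∑ℕ ℓ (λ k → 𝟙NL s * 𝟙 (same? s k a)) + ∑ℕ ℓ (λ k → ∑ℕ ℓ (λ l → 𝟙NL s * 𝟙 (off? s k l a))) ∎)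

    shortN : X → ℕ
    shortN s = ∑ (fin n) λ a → 𝟙 (short? s a)

    short-mass : S * μ (λ s → 𝟙NL s * shortN s) ≤ 3 * R * (n * ℓ) * T₁
    short-mass = begin
      S * μ (λ s → 𝟙NL s * shortN s) ≤⟨ *-monoʳ-≤ S (μ-mono λ s _ → ≤-trans (≤-reflexive (sym (∑-*ˡ (fin n) (𝟙NL s) _)))
          (∑-mono (fin n) λ a → ≤-trans (*-monoʳ-≤ (𝟙NL s) (pt s a)) (≤-reflexive (sym (∑-*ˡ (fin ℓ) (𝟙NL s) _))))) ⟩
      S * μ (λ s → ∑ (fin n) λ a → ∑ℕ ℓ (λ k → 𝟙NL s * 𝟙 (per? s (suc k) a)))
        ≡⟨ cong (S *_) (trans (μ-∑ (fin n) _) (∑-cong (fin n) λ a → μ-∑ (fin ℓ) _)) ⟩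
      S * ∑ (fin n) (λ a → ∑ (fin ℓ) λ k → μ (λ s → 𝟙NL s * 𝟙 (per? s (suc (toℕ k)) a)))
        ≡⟨ trans (sym (∑-*ˡ (fin n) S _)) (∑-cong (fin n) λ a → sym (∑-*ˡ (fin ℓ) S _)) ⟩
      _ ≤⟨ ∑-mono (fin n) (λ a → ∑-mono (fin ℓ) λ k → hit-mass (toℕ k) a a) ⟩
      ∑ (fin n) (λ a → ∑ (fin ℓ) λ k → 3 * R * T₁) ≡⟨ trans (∑-cong (fin n) λ a → ∑-constF ℓ _) (∑-constF n _) ⟩
      n * (ℓ * (3 * R * T₁)) ≡⟨ lem n ℓ R T₁ ⟩
      3 * R * (n * ℓ) * T₁ ∎
      where
      open ≤-Reasoning
      lem : ∀ n l r t → n * (l * (3 * r * t)) ≡ 3 * r * (n * l) * t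
      lem = solve-∀
      pt : ∀ s a → 𝟙 (short? s a) ≤ ∑ℕ ℓ (λ k → 𝟙 (per? s (suc k) a))
      pt s a = 𝟙≤ (short? s a) λ (k , k<ℓ , p) → ≤-trans (≤-reflexive (sym (𝟙-yes (per? s (suc k) a) p)))
                 (f≤∑ℕ ℓ (λ k → 𝟙 (per? s (suc k) a)) k<ℓ)

  -- Exceptional starting points of a switch

  T : ℕ
  T = ℓ + ℓ

  -- In `E₁` the path from `u` meets itself. The other events would make a switch illegal. With
  -- `M (it s 1 u)` equal to `s u` and `p` the path: it meets `M u` (`E₂`) or `s u` (`E₃`), some
  -- `s (p k)` is mapped to `u` (`E₄`), or `s (s u)` is on the path (`E₅`). Each event prescribes a
  -- single image, so `pin` applies.
  E₁ : X → Fin n → ℕ → ℕ → Set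
  E₁ s u t r = r ≤ t × it s (suc t) u ≡ it s r u × Fresh s t u (it s t u)
  opaque
    e₁? : ∀ s u t r → Dec (E₁ s u t r)
    e₁? s u t r = (r ≤? t) ×-dec (it s (suc t) u ≟F it s r u) ×-dec fresh? s t u (it s t u)

  E₂ : X → Fin n → ℕ → Set
  E₂ s u t = it s (suc t) u ≡ M u × Fresh s t u (it s t u)
  opaque
    e₂? : ∀ s u t → Dec (E₂ s u t)
    e₂? s u t = (it s (suc t) u ≟F M u) ×-dec fresh? s t u (it s t u)

  E₃ : X → Fin n → ℕ → Set
  E₃ s u t = it s (suc (suc t)) u ≡ M (it s 1 u) × Fresh s (suc t) u (it s (suc t) u)
  opaque
    e₃? : ∀ s u t → Dec (E₃ s u t)
    e₃? s u t = (it s (suc (suc t)) u ≟F M (it s 1 u)) ×-dec fresh? s (suc t) u (it s (suc t) u)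

  E₄ : X → Fin n → ℕ → Set
  E₄ s u k = lookup s (M (it s (suc k) u)) ≡ u × Fresh s (suc k) u (M (it s (suc k) u))
  opaque
    e₄? : ∀ s u k → Dec (E₄ s u k)
    e₄? s u k = (lookup s (M (it s (suc k) u)) ≟F u) ×-dec fresh? s (suc k) u (M (it s (suc k) u))

  E₅ : X → Fin n → ℕ → Set
  E₅ s u t = it s (suc (suc t)) u ≡ lookup s (M (it s 1 u)) × M (it s 1 u) ≢ it s (suc t) u × Fresh s (suc t) u (it s (suc t) u)
  opaque
    e₅? : ∀ s u t → Dec (E₅ s u t)
    e₅? s u t = (it s (suc (suc t)) u ≟F lookup s (M (it s 1 u))) ×-dec ¬? (M (it s 1 u) ≟F it s (suc t) u) ×-dec fresh? s (suc t) u (it s (suc t) u)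

  look-φ : ∀ s v b → φ s v ≡ b → lookup s v ≡ M b
  look-φ s v b e = trans (sym (MM _)) (cong M e)

  m₁ : ∀ u t r → S * μ (λ s → 𝟙NL s * 𝟙 (e₁? s u t r)) ≤ 3 * R * T₁
  m₁ u t r = pin-path t u (λ _ _ → r ≤ t) (λ _ _ → r ≤? t) (λ _ s → M (it s r u)) (λ _ → 1)
    (λ v s k _ fr r≤t → r≤t , cong M (it-upd s v k u r λ x → fr (≤-trans x r≤t))) (λ _ _ → ≤-refl) (λ s → e₁? s u t r)
    (λ s _ (r≤t , e , fr) → fr , r≤t , look-φ s (it s t u) _ e)

  m₂ : ∀ u t → S * μ (λ s → 𝟙NL s * 𝟙 (e₂? s u t)) ≤ 3 * R * T₁
  m₂ u t = pin-path t u (λ _ _ → t ≡ t) (λ _ _ → yes refl) (λ _ s → u) (λ _ → 1)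
    (λ _ _ _ _ _ _ → refl , refl) (λ _ _ → ≤-refl) (λ s → e₂? s u t)
    (λ s _ (e , fr) → fr , refl , trans (look-φ s (it s t u) _ e) (MM u))

  m₃ : ∀ u t → S * μ (λ s → 𝟙NL s * 𝟙 (e₃? s u t)) ≤ 3 * R * T₁
  m₃ u t = pin-path (suc t) u (λ _ _ → t ≡ t) (λ _ _ → yes refl) (λ _ s → it s 1 u) (λ _ → 1)
    (λ v s k _ fr _ → refl , it-upd s v k u 1 λ { {zero} _ → fr (s≤s z≤n) ; {suc _} (s≤s ()) }) (λ _ _ → ≤-refl) (λ s → e₃? s u t)
    (λ s _ (e , fr) → fr , refl , trans (look-φ s (it s (suc t) u) _ e) (MM _))

  m₄ : ∀ u k → S * μ (λ s → 𝟙NL s * 𝟙 (e₄? s u k)) ≤ 3 * R * T₁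
  m₄ u k = pin (λ s → M (it s (suc k) u)) (λ v s → Fresh s (suc k) u v) (λ v s → fresh? s (suc k) u v) (λ _ _ → u) (λ _ → 1)
    (λ v s j e fr → trans (cong M (it-upd s v j u (suc k) fr)) e , fresh-upd s v j u (suc k) fr , refl)
    (λ _ _ → ≤-refl) (λ s → e₄? s u k) (λ s _ (e , fr) → fr , e)

  m₅ : ∀ u t → S * μ (λ s → 𝟙NL s * 𝟙 (e₅? s u t)) ≤ 3 * R * T₁
  m₅ u t = pin-path (suc t) u (λ v s → M (it s 1 u) ≢ v) (λ v s → ¬? (M (it s 1 u) ≟F v)) (λ _ s → M (lookup s (M (it s 1 u)))) (λ _ → 1)
    (λ v s k _ fr ne → let q = it-upd s v k u 1 (λ { {zero} _ → fr (s≤s z≤n) ; {suc _} (s≤s ()) }) in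
      (λ e → ne (trans (sym (cong M q)) e)) , cong M (trans (cong (lookup (s [ v ]≔ k)) (cong M q)) (upd-other s v k ne)))
    (λ _ _ → ≤-refl) (λ s → e₅? s u t)
    (λ s _ (e , ne , fr) → fr , ne , look-φ s (it s (suc t) u) _ e)

  opaque
    bd : X → Fin n → ℕ
    bd s u = ∑ℕ T (λ t → ∑ℕ T (λ r → 𝟙 (e₁? s u t r))) + (∑ℕ (suc ℓ) (λ t → 𝟙 (e₂? s u t)) +
             (∑ℕ ℓ (λ t → 𝟙 (e₃? s u t)) + (∑ℕ (suc ℓ) (λ k → 𝟙 (e₄? s u k)) + ∑ℕ ℓ (λ t → 𝟙 (e₅? s u t)))))

    bd-def : ∀ s u → bd s u ≡ ∑ℕ T (λ t → ∑ℕ T (λ r → 𝟙 (e₁? s u t r))) + (∑ℕ (suc ℓ) (λ t → 𝟙 (e₂? s u t)) +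
               (∑ℕ ℓ (λ t → 𝟙 (e₃? s u t)) + (∑ℕ (suc ℓ) (λ k → 𝟙 (e₄? s u k)) + ∑ℕ ℓ (λ t → 𝟙 (e₅? s u t)))))
    bd-def s u = refl

  evc : ℕ
  evc = T * T + (suc ℓ + (ℓ + (suc ℓ + ℓ)))

  bd-mass : ∀ u → S * μ (λ s → 𝟙NL s * bd s u) ≤ evc * (3 * R * T₁)
  bd-mass u = begin
    S * μ (λ s → 𝟙NL s * bd s u) ≡⟨ cong (S *_) (trans (∑-cong uX λ s → cong (λ x → w s * (𝟙NL s * x)) (bd-def s u)) (trans (split _ _) (cong₂ _+_ refl (trans (split _ _) (cong₂ _+_ refl
       (trans (split _ _) (cong₂ _+_ refl (split _ _)))))))) ⟩
    S * (A₁ + (A₂ + (A₃ + (A₄ + A₅)))) ≡⟨ dist S A₁ A₂ A₃ A₄ A₅ ⟩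
    S * A₁ + (S * A₂ + (S * A₃ + (S * A₄ + S * A₅)))
      ≤⟨ +-mono-≤ b₁ (+-mono-≤ (b (suc ℓ) _ (m₂ u)) (+-mono-≤ (b ℓ _ (m₃ u)) (+-mono-≤ (b (suc ℓ) _ (m₄ u)) (b ℓ _ (m₅ u))))) ⟩
    T * T * C + (suc ℓ * C + (ℓ * C + (suc ℓ * C + ℓ * C))) ≡⟨ lem (T * T) (suc ℓ) ℓ C ⟩
    evc * C ∎
    where
    open ≤-Reasoning
    C = 3 * R * T₁
    split : ∀ (F G : X → ℕ) → μ (λ s → 𝟙NL s * (F s + G s)) ≡ μ (λ s → 𝟙NL s * F s) + μ (λ s → 𝟙NL s * G s)
    split F G = trans (∑-cong uX λ s → cong (w s *_) (*-distribˡ-+ (𝟙NL s) (F s) (G s))) (μ-+ _ _)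
    A₁ = μ (λ s → 𝟙NL s * ∑ℕ T (λ t → ∑ℕ T (λ r → 𝟙 (e₁? s u t r))))
    A₂ = μ (λ s → 𝟙NL s * ∑ℕ (suc ℓ) (λ t → 𝟙 (e₂? s u t)))
    A₃ = μ (λ s → 𝟙NL s * ∑ℕ ℓ (λ t → 𝟙 (e₃? s u t)))
    A₄ = μ (λ s → 𝟙NL s * ∑ℕ (suc ℓ) (λ t → 𝟙 (e₄? s u t)))
    A₅ = μ (λ s → 𝟙NL s * ∑ℕ ℓ (λ t → 𝟙 (e₅? s u t)))
    dist : ∀ s a b c d e → s * (a + (b + (c + (d + e)))) ≡ s * a + (s * b + (s * c + (s * d + s * e)))
    dist = solve-∀
    lem : ∀ a b c d → a * d + (b * d + (c * d + (b * d + c * d))) ≡ (a + (b + (c + (b + c)))) * d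
    lem = solve-∀
    b : ∀ m (F : ℕ → X → ℕ) → (∀ t → S * μ (λ s → 𝟙NL s * F t s) ≤ C) → S * μ (λ s → 𝟙NL s * ∑ℕ m (λ t → F t s)) ≤ m * C
    b m F h = begin
      S * μ (λ s → 𝟙NL s * ∑ℕ m (λ t → F t s)) ≡⟨ cong (S *_) (trans (∑-cong uX λ s → cong (w s *_) (sym (∑-*ˡ (fin m) (𝟙NL s) _))) (μ-∑ (fin m) _)) ⟩
      S * ∑ (fin m) (λ i → μ (λ s → 𝟙NL s * F (toℕ i) s)) ≡⟨ sym (∑-*ˡ (fin m) S _) ⟩
      _ ≤⟨ ∑-mono (fin m) (λ i → h (toℕ i)) ⟩
      ∑ (fin m) (λ _ → C) ≡⟨ ∑-constF m C ⟩
      m * C ∎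
    b₁ : S * A₁ ≤ T * T * C
    b₁ = begin
      S * A₁ ≡⟨ cong (S *_) (trans (∑-cong uX λ s → cong (w s *_) (sym (∑-*ˡ (fin T) (𝟙NL s) _))) (μ-∑ (fin T) _)) ⟩
      S * ∑ (fin T) (λ t → μ (λ s → 𝟙NL s * ∑ℕ T (λ r → 𝟙 (e₁? s u (toℕ t) r)))) ≡⟨ sym (∑-*ˡ (fin T) S _) ⟩
      _ ≤⟨ ∑-mono (fin T) (λ t → b T (λ r s → 𝟙 (e₁? s u (toℕ t) r)) (m₁ u (toℕ t))) ⟩
      ∑ (fin T) (λ _ → T * C) ≡⟨ ∑-constF T (T * C) ⟩
      T * (T * C) ≡⟨ sym (*-assoc T T C) ⟩
      T * T * C ∎

  private
    ∑ℕ0 : ∀ m (f : ℕ → ℕ) → ∑ℕ m f ≡ 0 → ∀ {t} → t < m → f t ≡ 0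
    ∑ℕ0 m f e t<m = n≤0⇒n≡0 (≤-trans (f≤∑ℕ m f t<m) (≤-reflexive e))
    𝟙0 : ∀ {p} {P : Set p} (d : Dec P) → 𝟙 d ≡ 0 → ¬ P
    𝟙0 d e p = 1+n≢0 (trans (sym (𝟙-yes d p)) e)

  module Good (s : X) (u : Fin n) (g : bd s u ≡ 0) where
    private
      g₀ = trans (sym (bd-def s u)) g
      g′ = m+n≡0⇒n≡0 (∑ℕ T (λ t → ∑ℕ T (λ r → 𝟙 (e₁? s u t r)))) g₀
      g″ = m+n≡0⇒n≡0 (∑ℕ (suc ℓ) (λ t → 𝟙 (e₂? s u t))) g′
      g‴ = m+n≡0⇒n≡0 (∑ℕ ℓ (λ t → 𝟙 (e₃? s u t))) g″

    n₁ : ∀ {t r} → t < T → r < T → ¬ E₁ s u t r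
    n₁ {t} {r} t<T r<T = 𝟙0 (e₁? s u t r) (∑ℕ0 T (λ r → 𝟙 (e₁? s u t r)) (∑ℕ0 T (λ t → ∑ℕ T (λ r → 𝟙 (e₁? s u t r))) (m+n≡0⇒m≡0 _ g₀) t<T) r<T)
    n₂ : ∀ {t} → t < suc ℓ → ¬ E₂ s u t
    n₂ {t} h = 𝟙0 (e₂? s u t) (∑ℕ0 (suc ℓ) (λ t → 𝟙 (e₂? s u t)) (m+n≡0⇒m≡0 _ g′) h)
    n₃ : ∀ {t} → t < ℓ → ¬ E₃ s u t
    n₃ {t} h = 𝟙0 (e₃? s u t) (∑ℕ0 ℓ (λ t → 𝟙 (e₃? s u t)) (m+n≡0⇒m≡0 _ g″) h)
    n₄ : ∀ {t} → t < suc ℓ → ¬ E₄ s u t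
    n₄ {t} h = 𝟙0 (e₄? s u t) (∑ℕ0 (suc ℓ) (λ t → 𝟙 (e₄? s u t)) (m+n≡0⇒m≡0 _ g‴) h)
    n₅ : ∀ {t} → t < ℓ → ¬ E₅ s u t
    n₅ {t} h = 𝟙0 (e₅? s u t) (∑ℕ0 ℓ (λ t → 𝟙 (e₅? s u t)) (m+n≡0⇒n≡0 (∑ℕ (suc ℓ) (λ k → 𝟙 (e₄? s u k))) g‴) h)

    dist : ∀ t → t ≤ T → Fresh s t u (it s t u)
    dist zero    _   ()
    dist (suc t) t<T {r} r<t e = n₁ t<T (≤-<-trans (ℕ.s≤s⁻¹ r<t) t<T) (ℕ.s≤s⁻¹ r<t , sym e , dist t (<⇒≤ t<T))

  -- Exchanging two images

  sw : Fin n → Fin n → X → X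
  sw u v s = (s [ u ]≔ lookup s v) [ v ]≔ lookup s u

  sw-v : ∀ u v s → lookup (sw u v s) v ≡ lookup s u
  sw-v u v s = upd-same (s [ u ]≔ lookup s v) v _

  sw-u : ∀ u v s → lookup (sw u v s) u ≡ lookup s v
  sw-u u v s with u ≟F v
  ... | yes refl = sw-v u u s
  ... | no u≢v = trans (upd-other (s [ u ]≔ lookup s v) v _ u≢v) (upd-same s u _)

  sw-o : ∀ u v s {i} → i ≢ u → i ≢ v → lookup (sw u v s) i ≡ lookup s i
  sw-o u v s i≢u i≢v = trans (upd-other (s [ u ]≔ lookup s v) v _ i≢v) (upd-other s u _ i≢u)

  sw-sw : ∀ u v s → sw u v (sw u v s) ≡ s
  sw-sw u v s = vec-ext _ _ λ i → go i (i ≟F u) (i ≟F v)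
    where
    go : ∀ i → Dec (i ≡ u) → Dec (i ≡ v) → lookup (sw u v (sw u v s)) i ≡ lookup s i
    go i (yes refl) _ = trans (sw-u i v (sw i v s)) (sw-v i v s)
    go i (no _) (yes refl) = trans (sw-v u i (sw u i s)) (sw-u u i s)
    go i (no a) (no b) = trans (sw-o u v (sw u v s) a b) (sw-o u v s a b)

  -- Each vertex of a cycle of length `k` receives `wt k`, so a short cycle contributes `k * wt k`,
  -- that is `D`, to `Ŷ`.
  Yv : X → Fin n → ℕ
  Yv s v = ∑ℕ ℓ (λ k → wt (suc k) * 𝟙 (per? s (suc k) v))

  Ŷ : X → ℕ
  Ŷ s = ∑ (fin n) (Yv s)

  -- Exchanging the images of u and of the k-th vertex of the path from u (k = suc k₁ ≥ 2) closes up one new cycle of length k.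
  module Split (s : X) (u : Fin n) (g : bd s u ≡ 0) (k₁ : ℕ) (1≤k₁ : 1 ≤ k₁) (k≤ℓ : suc k₁ ≤ ℓ) where
    open Good s u g
    k = suc k₁
    p : ℕ → Fin n
    p t = it s t u
    s′ : X
    s′ = sw u (p k) s

    p-inj< : ∀ {a b} → a < b → b ≤ T → p a ≢ p b
    p-inj< a<b b≤T = dist _ b≤T a<b

    p-inj : ∀ {a b} → a ≤ T → b ≤ T → p a ≡ p b → a ≡ b
    p-inj {a} {b} a≤T b≤T e with <-cmp a b
    ... | tri< h _ _ = ⊥-elim (p-inj< h b≤T e)
    ... | tri≈ _ h _ = h
    ... | tri> _ _ h = ⊥-elim (p-inj< h a≤T (sym e))

    ℓ≤T : ℓ ≤ T
    ℓ≤T = m≤m+n ℓ ℓ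
    k≤T : k ≤ T
    k≤T = ≤-trans k≤ℓ ℓ≤T

    u≢pk : u ≢ p k
    u≢pk = p-inj< {0} {k} (s≤s z≤n) k≤T

    sk<T : suc k ≤ T
    sk<T = ≤-trans (≤-reflexive (+-comm 1 k)) (+-mono-≤ k≤ℓ (≤-trans (≤-trans 1≤k₁ (n≤1+n k₁)) k≤ℓ))

    module Lawful (L : Legal s) where
      j j′ : Fin n
      j = lookup s u
      j′ = lookup s (p k)
      ej : j ≡ M (p 1)
      ej = look-φ s u _ refl
      ej′ : j′ ≡ M (p (suc k))
      ej′ = look-φ s (p k) _ refl
      s₁ : X
      s₁ = s [ u ]≔ j′
      l1 : j′ ≢ u
      l1 e = n₂ (s≤s k≤ℓ) (trans (sym (MM _)) (cong M (trans (sym ej′) e)) , dist k k≤T)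
      l2 : j′ ≢ M u
      l2 e = p-inj< {0} {suc k} (s≤s z≤n) sk<T (sym (M-inj (trans (sym ej′) e)))
      l3 : lookup s j′ ≢ u
      l3 e with fresh? s (suc k) u (M (p (suc k)))
      ... | yes fr = n₄ (s≤s k≤ℓ) (trans (cong (lookup s) (sym ej′)) e , fr)
      ... | no ¬fr with anyUpTo? (λ r → p r ≟F M (p (suc k))) (suc k)
      ...   | no none = ¬fr λ {r} r<k q → none (r , r<k , q)
      ...   | yes (r , r<k , q) = n₂ (≤-trans r<k (s≤s k≤ℓ)) (cong M (trans (cong (lookup s) (trans q (sym ej′))) e) , dist r (≤-trans (ℕ.s≤s⁻¹ r<k) k≤T))
      legal₁ : Legal s₁
      legal₁ = ok-legal s u j′ L (l1 , l2 , l3)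
      l4 : j ≢ p k
      l4 e = at k₁ 1≤k₁ refl
        where at : ∀ m → 1 ≤ m → m ≡ k₁ → ⊥
              at (suc m) _ refl = n₃ (≤-trans (n≤1+n _) k≤ℓ) (trans (sym e) ej , dist (suc m) (≤-trans (n≤1+n _) k≤T))
      l5 : j ≢ M (p k)
      l5 e = p-inj< {1} {k} (s≤s 1≤k₁) k≤T (M-inj (trans (sym ej) e))
      l6 : lookup s j ≢ p k
      l6 e = at k₁ 1≤k₁ refl
        where
        at : ∀ m → 1 ≤ m → m ≡ k₁ → ⊥
        at (suc m) _ refl with M (p 1) ≟F p (suc m)
        ... | no ne = n₅ (≤-trans (n≤1+n _) k≤ℓ) (trans (sym e) (cong (lookup s) ej) , ne , dist (suc m) (≤-trans (n≤1+n _) k≤T))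
        at (suc zero) _ refl | yes q = M≢ (p 1) q
        at (suc (suc m)) _ refl | yes q = n₃ (≤-trans (n≤1+n _) (≤-trans (n≤1+n _) k≤ℓ)) (sym q , dist (suc m) (≤-trans (n≤1+n _) (≤-trans (n≤1+n _) k≤T)))
      j≢u : j ≢ u
      j≢u = proj₁ (L u)
      legal′ : Legal s′
      legal′ = ok-legal s₁ (p k) j legal₁ (l4 , l5 , λ e → l6 (trans (sym (upd-other s u j′ j≢u)) e))

      -- The switch consists of two changes of a single value, through the legal map `s₁`. The
      -- factors `z j` and `z j′` cancel.
      weight : ∀ c₁ c₂ → c₁ ≡ 49 * 49 → c₂ ≡ 50 * 50 → c₁ * w s ≤ c₂ * w s′
      weight _ _ refl refl = *-cancelʳ-≤ _ _ (z j′ * z j) {{>-nonZero (*-mono-≤ (z>0 j′) (z>0 j))}} (begin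
        2401 * w s * (z j′ * z j)               ≡⟨ lem₁ (w s) (z j′) (z j) ⟩
        49 * (49 * (w s * z j′)) * z j          ≤⟨ *-monoˡ-≤ (z j) (*-monoʳ-≤ 49 (res s u j′ L legal₁)) ⟩
        49 * (50 * (w s₁ * z j)) * z j          ≡⟨ lem₂ (w s₁) (z j) ⟩
        50 * (49 * (w s₁ * z j)) * z j          ≤⟨ *-monoˡ-≤ (z j) (*-monoʳ-≤ 50 (res s₁ (p k) j legal₁ legal′)) ⟩
        50 * (50 * (w s′ * z (lookup s₁ (p k)))) * z j ≡⟨ cong (λ x → 50 * (50 * (w s′ * z x)) * z j) (upd-other s u j′ (u≢pk ∘ sym)) ⟩
        50 * (50 * (w s′ * z j′)) * z j         ≡⟨ lem₃ (w s′) (z j′) (z j) ⟩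
        2500 * w s′ * (z j′ * z j) ∎)
        where
        open ≤-Reasoning
        lem₁ : ∀ a b c → 2401 * a * (b * c) ≡ 49 * (49 * (a * b)) * c
        lem₁ = solve-∀
        lem₂ : ∀ a c → 49 * (50 * (a * c)) * c ≡ 50 * (49 * (a * c)) * c
        lem₂ = solve-∀
        lem₃ : ∀ a b c → 50 * (50 * (a * b)) * c ≡ 2500 * a * (b * c)
        lem₃ = solve-∀

    φ′u : φ s′ u ≡ p (suc k)
    φ′u = cong M (sw-u u (p k) s)
    φ′k : φ s′ (p k) ≡ p 1
    φ′k = cong M (sw-v u (p k) s)
    φ′o : ∀ {i} → i ≢ u → i ≢ p k → φ s′ i ≡ φ s i
    φ′o a b = cong M (sw-o u (p k) s a b)

    cyc : ∀ t → t < k → it s′ t (p 1) ≡ p (suc t)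
    cyc zero    _   = refl
    cyc (suc t) t<k = trans (cong (φ s′) (cyc t (<-trans (n<1+n t) t<k)))
      (φ′o (λ e → p-inj< {0} {suc t} (s≤s z≤n) (≤-trans (<⇒≤ t<k) k≤T) (sym e)) (p-inj< t<k k≤T))

    per-p1 : Per s′ k (p 1)
    per-p1 = trans (cong (φ s′) (cyc k₁ (n<1+n k₁))) φ′k , λ {r} r<k 0<r e →
      p-inj< {1} {suc r} (s≤s 0<r) (≤-trans r<k k≤T) (sym (trans (sym (cyc r r<k)) e))

    closed : ∀ t → ∃ λ r → r < k × it s′ t (p 1) ≡ p (suc r)
    closed zero = 0 , s≤s z≤n , refl
    closed (suc t) with closed t
    ... | r , r<k , e with suc r ≟ k
    ...   | yes refl = 0 , s≤s z≤n , trans (cong (φ s′) e) φ′k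
    ...   | no r≢ = suc r , ≤∧≢⇒< r<k r≢ , trans (cong (φ s′) e) (φ′o (λ q → p-inj< {0} {suc r} (s≤s z≤n) (≤-trans r<k k≤T) (sym q))
              (p-inj< (≤∧≢⇒< r<k r≢) k≤T))

    per-on : ∀ r → r < k → Per s′ k (p (suc r))
    per-on r r<k = subst (Per s′ k) (cyc r r<k) (per-it s′ k r (p 1) (s≤s z≤n) per-p1)

    -- After the exchange `u` jumps to `p (suc k)` and follows the old path. That path is simple for
    -- `ℓ + ℓ` steps, so `u` does not return within `ℓ` steps; this is why `T` is twice `ℓ`.
    tail : ∀ t → suc t ≤ ℓ → it s′ (suc t) u ≡ p (suc t + k)
    tail zero    _ = φ′u
    tail (suc t) t<ℓ = trans (cong (φ s′) (tail t (≤-trans (n≤1+n _) t<ℓ)))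
      (φ′o (λ e → p-inj< {0} {suc t + k} (s≤s z≤n) (+-mono-≤ (≤-trans (n≤1+n _) t<ℓ) k≤ℓ) (sym e))
           (λ e → p-inj< {k} {suc t + k} (m≤n+m (suc k) t ∙ ≤-reflexive (+-suc t k)) (+-mono-≤ (≤-trans (n≤1+n _) t<ℓ) k≤ℓ) (sym e)))
      where _∙_ = ≤-trans

    no-per : ∀ a t → a ≤ ℓ → 0 < t → t ≤ ℓ → it s t (p a) ≢ p a
    no-per a t a≤ℓ 0<t t≤ℓ e = p-inj< {a} {t + a} (+-monoˡ-≤ a 0<t) (+-mono-≤ t≤ℓ a≤ℓ) (sym (trans (it-+ s t a u) e))

    back : ∀ s₀ k′ v r → it s₀ k′ v ≡ v → it s₀ k′ (it s₀ r v) ≡ it s₀ r v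
    back s₀ k′ v r e = trans (it-comm s₀ k′ r v) (cong (it s₀ r) e)

    -- Neither `u` nor `p k` was on a short cycle, as the path through them is simple for long
    -- enough; so no old short cycle notices the exchange.
    old⇒new : ∀ v k′ → 0 < k′ → k′ ≤ ℓ → Per s k′ v → Per s′ k′ v
    old⇒new v k′ 0<k′ k′≤ℓ (e , m) = trans (same k′) e , λ {r} r<k 0<r q → m r<k 0<r (trans (sym (same r)) q)
      where
      same : ∀ t → it s′ t v ≡ it s t v
      same t = it-agree s s′ v t λ {r} _ → sw-o u (p k) s
        (λ q → no-per 0 k′ z≤n 0<k′ k′≤ℓ (subst (λ x → it s k′ x ≡ x) q (back s k′ v r e)))
        (λ q → no-per k k′ k≤ℓ 0<k′ k′≤ℓ (subst (λ x → it s k′ x ≡ x) q (back s k′ v r e)))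

    -- A new short cycle avoids `u` by `tail`, and it avoids `p k` unless it is the cycle just
    -- created.
    new⇒old : ∀ v k′ → 0 < k′ → k′ ≤ ℓ → (∀ r → r < k → v ≢ p (suc r)) → Per s′ k′ v → Per s k′ v
    new⇒old v (suc k″) _ k′≤ℓ off (e , m) = trans (same k′ ≤-refl) e , λ {r} r<k 0<r q → m r<k 0<r (trans (sym (same r (<⇒≤ r<k))) q)
      where
      k′ = suc k″
      noU : ∀ r → it s′ r v ≢ u
      noU r q = p-inj< {0} {k′ + k} (s≤s z≤n) (+-mono-≤ k′≤ℓ k≤ℓ) (sym (trans (sym (tail k″ k′≤ℓ)) (subst (λ x → it s′ k′ x ≡ x) q (back s′ k′ v r e))))
      noK : ∀ r → r < k′ → it s′ r v ≢ p k
      noK r r<k′ q with closed (k′ ∸ suc r)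
      ... | r′ , r′<k , q′ = off r′ r′<k (begin
        v ≡⟨ sym e ⟩
        it s′ k′ v ≡⟨ cong (λ x → it s′ x v) (sym (m∸n+n≡m r<k′)) ⟩
        it s′ (k′ ∸ suc r + suc r) v ≡⟨ it-+ s′ (k′ ∸ suc r) (suc r) v ⟩
        it s′ (k′ ∸ suc r) (φ s′ (it s′ r v)) ≡⟨ cong (λ x → it s′ (k′ ∸ suc r) (φ s′ x)) q ⟩
        it s′ (k′ ∸ suc r) (φ s′ (p k)) ≡⟨ cong (it s′ (k′ ∸ suc r)) φ′k ⟩
        it s′ (k′ ∸ suc r) (p 1) ≡⟨ q′ ⟩
        p (suc r′) ∎)
        where open ≡-Reasoning
      same : ∀ t → t ≤ k′ → it s t v ≡ it s′ t v
      same t t≤k′ = it-agree s′ s v t λ {r} r<t → sym (sw-o u (p k) s (noU r) (noK r (≤-trans r<t t≤k′)))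

    on? : ∀ v → Dec (∃ λ r → r < k × v ≡ p (suc r))
    on? v = anyUpTo? (λ r → v ≟F p (suc r)) k

    Yv-split : ∀ v → Yv s′ v ≡ Yv s v + wt k * ∑ℕ k (λ r → 𝟙 (v ≟F p (suc r)))
    Yv-split v with on? v
    ... | yes (r , r<k , refl) = begin
      Yv s′ v ≡⟨ ∑ℕ-single ℓ (λ k → wt (suc k) * 𝟙 (per? s′ (suc k) v)) k≤ℓ (λ k′ _ ne → trans (cong (wt (suc k′) *_)
          (𝟙-no (per? s′ (suc k′) v) λ q → ne (suc-injective (per-unique s′ (suc k′) k v (s≤s z≤n) (s≤s z≤n) q (per-on r r<k))))) (*-zeroʳ (wt (suc k′)))) ⟩
      wt k * 𝟙 (per? s′ k v) ≡⟨ cong (wt k *_) (𝟙-yes (per? s′ k v) (per-on r r<k)) ⟩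
      wt k * 1 ≡⟨ cong (wt k *_) (sym (trans (∑ℕ-single k (λ r → 𝟙 (v ≟F p (suc r))) r<k λ r′ r′<k ne → 𝟙-no (v ≟F p (suc r′))
            λ q → ne (suc-injective (sym (p-inj (≤-trans r<k k≤T) (≤-trans r′<k k≤T) q)))) (𝟙-yes (v ≟F p (suc r)) refl))) ⟩
      wt k * ∑ℕ k (λ r → 𝟙 (v ≟F p (suc r))) ≡⟨ cong (_+ wt k * ∑ℕ k (λ r → 𝟙 (v ≟F p (suc r)))) (sym (trans (∑ℕ-cong ℓ λ k′ k′<ℓ → trans (cong (wt (suc k′) *_)
            (𝟙-no (per? s (suc k′) v) λ q → no-per (suc r) (suc k′) (≤-trans r<k k≤ℓ) (s≤s z≤n) k′<ℓ (proj₁ q))) (*-zeroʳ (wt (suc k′)))) (∑-0 (fin ℓ)))) ⟩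
      Yv s v + wt k * ∑ℕ k (λ r → 𝟙 (v ≟F p (suc r))) ∎
      where open ≡-Reasoning
    ... | no ¬on = begin
      Yv s′ v ≡⟨ ∑ℕ-cong ℓ (λ k′ k′<ℓ → cong (wt (suc k′) *_) (𝟙-cong (per? s′ (suc k′) v) (per? s (suc k′) v)
           (new⇒old v (suc k′) (s≤s z≤n) k′<ℓ λ r r<k q → ¬on (r , r<k , q)) (old⇒new v (suc k′) (s≤s z≤n) k′<ℓ))) ⟩
      Yv s v ≡⟨ sym (+-identityʳ _) ⟩
      Yv s v + 0 ≡⟨ cong (Yv s v +_) (sym (trans (cong (wt k *_) (trans (∑ℕ-cong k λ r r<k → 𝟙-no (v ≟F p (suc r)) λ q → ¬on (r , r<k , q)) (∑-0 (fin k)))) (*-zeroʳ (wt k)))) ⟩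
      Yv s v + wt k * ∑ℕ k (λ r → 𝟙 (v ≟F p (suc r))) ∎
      where open ≡-Reasoning

    Ŷ-split : Ŷ s′ ≡ Ŷ s + D
    Ŷ-split = begin
      Ŷ s′ ≡⟨ trans (∑-cong (fin n) Yv-split) (∑-+ (fin n) _ _) ⟩
      Ŷ s + ∑ (fin n) (λ v → wt k * ∑ℕ k (λ r → 𝟙 (v ≟F p (suc r)))) ≡⟨ cong (Ŷ s +_) (trans (∑-*ˡ (fin n) (wt k) _) (trans (cong (wt k *_) (trans (∑-swap (fin n) (fin k) (λ v r → 𝟙 (v ≟F p (suc (toℕ r)))))
          (trans (∑-cong (fin k) λ r → trans (∑-cong (fin n) λ v → sym (*-identityʳ (𝟙 (v ≟F p (suc (toℕ r)))))) (∑-δ (fin n) (λ _ → 1) (p (suc (toℕ r))))) (trans (∑-constF k 1) (*-identityʳ k)))))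
            (trans (*-comm (wt k) k) (wtD k (s≤s 1≤k₁) k≤ℓ)))) ⟩
      Ŷ s + D ∎
      where open ≡-Reasoning

  opaque
    -- The number of short cycles, obtained as a floor. Rounding costs one unit, which is the second
    -- `suc` in `switch-count`.
    y : X → ℕ
    y s = Ŷ s / D

    y-step : ∀ s s′ → Ŷ s′ ≡ Ŷ s + D → y s′ ≡ suc (y s)
    y-step s s′ e = trans (cong (_/ D) e) (trans (+-distrib-/-∣ʳ (Ŷ s) (divides 1 (sym (+-identityʳ D)))) (trans (cong (y s +_) (n/n≡1 D)) (+-comm (y s) 1)))

    Ŷ<y : ∀ s → Ŷ s ≤ suc (y s) * D
    Ŷ<y s = ≤-trans (≤-reflexive (m≡m%n+[m/n]*n (Ŷ s) D)) (+-monoˡ-≤ (y s * D) (<⇒≤ (m%n<n (Ŷ s) D)))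

    y-def : ∀ s → y s ≡ Ŷ s / D
    y-def s = refl

  -- Halving from j short cycles to j + 1

  Hs : ℕ
  Hs = ∑ℕ ℓ (λ k → wt (suc k))

  -- At least nine tenths of the starting points are then free of exceptional events and allow every
  -- switch.
  Calm : X → Set
  Calm s = NL s × 10 * ∑ (fin n) (bd s) ≤ n

  calm? : ∀ s → Dec (Calm s)
  calm? s = nl? s ×-dec (10 * ∑ (fin n) (bd s) ≤? n)

  -- Markov's inequality for the number of exceptional events, after heavy maps are set aside. The
  -- 30 is 10 for the tenth times 3 from resampling.
  rough-mass : S * μ (λ s → 𝟙 (¬? (calm? s))) ≤ (128 + 30 * evc) * (R * T₁)
  rough-mass = begin
    S * μ (λ s → 𝟙 (¬? (calm? s))) ≤⟨ *-monoʳ-≤ S (μ-mono λ s _ → pt s) ⟩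
    S * μ (λ s → 𝟙 (¬? (nl? s)) + Q s) ≡⟨ trans (cong (S *_) (μ-+ _ _)) (*-distribˡ-+ S _ _) ⟩
    S * μ (λ s → 𝟙 (¬? (nl? s))) + S * μ Q ≤⟨ +-mono-≤ heavy-mass Qb ⟩
    128 * R * T₁ + 10 * (evc * (3 * R * T₁)) ≡⟨ lem evc R T₁ ⟩
    (128 + 30 * evc) * (R * T₁) ∎
    where
    open ≤-Reasoning
    lem : ∀ e r t → 128 * r * t + 10 * (e * (3 * r * t)) ≡ (128 + 30 * e) * (r * t)
    lem = solve-∀
    Q : X → ℕ
    Q s = 𝟙NL s * 𝟙 (¬? (10 * ∑ (fin n) (bd s) ≤? n))
    pt : ∀ s → 𝟙 (¬? (calm? s)) ≤ 𝟙 (¬? (nl? s)) + Q s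
    pt s with nl? s | 10 * ∑ (fin n) (bd s) ≤? n
    ... | no _ | _ = s≤s z≤n
    ... | yes _ | yes _ = z≤n
    ... | yes _ | no _ = ≤-refl
    Qb : S * μ Q ≤ 10 * (evc * (3 * R * T₁))
    Qb = *-cancelˡ-≤ n {{>-nonZero n>0}} (begin
      n * (S * μ Q) ≡⟨ lem′ n S (μ Q) ⟩
      S * (n * μ Q) ≡⟨ cong (S *_) (sym (μ-* n Q)) ⟩
      S * μ (λ s → n * Q s) ≤⟨ *-monoʳ-≤ S (μ-mono λ s _ → each s) ⟩
      S * μ (λ s → 10 * ∑ (fin n) (λ u → 𝟙NL s * bd s u)) ≡⟨ cong (S *_) (trans (μ-* 10 _) (cong (10 *_) (μ-∑ (fin n) _))) ⟩
      S * (10 * ∑ (fin n) (λ u → μ (λ s → 𝟙NL s * bd s u))) ≡⟨ lem′ S 10 _ ⟩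
      10 * (S * ∑ (fin n) (λ u → μ (λ s → 𝟙NL s * bd s u))) ≡⟨ cong (10 *_) (sym (∑-*ˡ (fin n) S _)) ⟩
      10 * ∑ (fin n) (λ u → S * μ (λ s → 𝟙NL s * bd s u)) ≤⟨ *-monoʳ-≤ 10 (∑-mono (fin n) bd-mass) ⟩
      10 * ∑ (fin n) (λ u → evc * (3 * R * T₁)) ≡⟨ cong (10 *_) (∑-constF n _) ⟩
      10 * (n * (evc * (3 * R * T₁))) ≡⟨ lem′ 10 n _ ⟩
      n * (10 * (evc * (3 * R * T₁))) ∎)
      where
      lem′ : ∀ a b c → a * (b * c) ≡ b * (a * c)
      lem′ = solve-∀
      each : ∀ s → n * Q s ≤ 10 * ∑ (fin n) (λ u → 𝟙NL s * bd s u)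
      each s with 10 * ∑ (fin n) (bd s) ≤? n
      ... | yes _ = ≤-trans (≤-reflexive (trans (cong (n *_) (*-zeroʳ (𝟙NL s))) (*-zeroʳ n))) z≤n
      ... | no ¬p = begin
        n * (𝟙NL s * 1) ≡⟨ lem″ n (𝟙NL s) ⟩
        𝟙NL s * n ≤⟨ *-monoʳ-≤ (𝟙NL s) (<⇒≤ (≰⇒> ¬p)) ⟩
        𝟙NL s * (10 * ∑ (fin n) (bd s)) ≡⟨ trans (lem′ (𝟙NL s) 10 _) (cong (10 *_) (sym (∑-*ˡ (fin n) (𝟙NL s) _))) ⟩
        10 * ∑ (fin n) (λ u → 𝟙NL s * bd s u) ∎
        where lem″ : ∀ a b → a * (b * 1) ≡ b * a
              lem″ = solve-∀

  N Ng B : ℕ → ℕ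
  N j = μ (λ s → 𝟙 (y s ≟ j))
  Ng j = μ (λ s → 𝟙 (y s ≟ j) * 𝟙 (calm? s))
  B j = μ (λ s → 𝟙 (y s ≟ j) * 𝟙 (¬? (calm? s)))

  N-split : ∀ j → N j ≡ Ng j + B j
  N-split j = trans (∑-cong uX λ s → cong (w s *_) (trans (𝟙-split (y s ≟ j) (calm? s))
    (cong₂ _+_ (𝟙-× (y s ≟ j) (calm? s)) (𝟙-× (y s ≟ j) (¬? (calm? s)))))) (μ-+ _ _)

  good : X → Fin n → ℕ
  good s u = 𝟙 (bd s u ≟ 0)

  A : ℕ → ℕ
  A j = μ (λ s → 𝟙 (y s ≟ j) * ∑ (fin n) (λ u → ∑ℕ ℓ (λ k → wt (suc k) * good s u)))

  many-good : ∀ j → 9 * n * Hs * Ng j ≤ 10 * A j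
  many-good j = begin
    9 * n * Hs * Ng j ≡⟨ sym (μ-* (9 * n * Hs) _) ⟩
    μ (λ s → 9 * n * Hs * (𝟙 (y s ≟ j) * 𝟙 (calm? s))) ≤⟨ μ-mono (λ s _ → each s) ⟩
    μ (λ s → 10 * (𝟙 (y s ≟ j) * ∑ (fin n) (λ u → ∑ℕ ℓ (λ k → wt (suc k) * good s u)))) ≡⟨ μ-* 10 _ ⟩
    10 * A j ∎
    where
    open ≤-Reasoning
    sum-good : ∀ s → ∑ (fin n) (λ u → ∑ℕ ℓ (λ k → wt (suc k) * good s u)) ≡ Hs * ∑ (fin n) (good s)
    sum-good s = trans (∑-cong (fin n) λ u → ∑-*ʳ (fin ℓ) (good s u) (λ i → wt (suc (toℕ i)))) (∑-*ˡ (fin n) Hs (good s))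
    count : ∀ s → Calm s → 9 * n ≤ 10 * ∑ (fin n) (good s)
    count s (_ , c) = +-cancelʳ-≤ n _ _ (begin
      9 * n + n ≡⟨ lem n ⟩
      10 * n ≡⟨ cong (10 *_) (sym (card-fin n)) ⟩
      10 * card (fin n) ≤⟨ *-monoʳ-≤ 10 (≤-trans (∑-mono (fin n) one) (≤-reflexive (∑-+ (fin n) _ _))) ⟩
      10 * (∑ (fin n) (good s) + ∑ (fin n) (bd s)) ≡⟨ *-distribˡ-+ 10 (∑ (fin n) (good s)) _ ⟩
      10 * ∑ (fin n) (good s) + 10 * ∑ (fin n) (bd s) ≤⟨ +-monoʳ-≤ (10 * ∑ (fin n) (good s)) c ⟩
      10 * ∑ (fin n) (good s) + n ∎)
      where
      lem : ∀ n → 9 * n + n ≡ 10 * n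
      lem = solve-∀
      one : ∀ u → 1 ≤ good s u + bd s u
      one u with bd s u
      ... | zero = s≤s z≤n
      ... | suc _ = s≤s z≤n
    lem₁ : ∀ n h a → 9 * n * h * (a * 1) ≡ a * (9 * n * h)
    lem₁ = solve-∀
    lem₂ : ∀ h g a → a * (10 * g * h) ≡ 10 * (a * (h * g))
    lem₂ = solve-∀
    each : ∀ s → 9 * n * Hs * (𝟙 (y s ≟ j) * 𝟙 (calm? s)) ≤ 10 * (𝟙 (y s ≟ j) * ∑ (fin n) (λ u → ∑ℕ ℓ (λ k → wt (suc k) * good s u)))
    each s rewrite sum-good s with calm? s
    ... | no _ = ≤-trans (≤-reflexive (trans (cong (9 * n * Hs *_) (*-zeroʳ (𝟙 (y s ≟ j)))) (*-zeroʳ (9 * n * Hs)))) z≤n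
    ... | yes c = begin
      9 * n * Hs * (𝟙 (y s ≟ j) * 1) ≡⟨ lem₁ n Hs (𝟙 (y s ≟ j)) ⟩
      𝟙 (y s ≟ j) * (9 * n * Hs) ≤⟨ *-monoʳ-≤ (𝟙 (y s ≟ j)) (*-monoˡ-≤ Hs (count s c)) ⟩
      𝟙 (y s ≟ j) * (10 * ∑ (fin n) (good s) * Hs) ≡⟨ lem₂ Hs (∑ (fin n) (good s)) (𝟙 (y s ≟ j)) ⟩
      10 * (𝟙 (y s ≟ j) * (Hs * ∑ (fin n) (good s))) ∎

  -- A switch re-randomises two values, so c₁ / c₂ will be (49 / 50)².
  module _ (c₁ c₂ : ℕ) (c₂>0 : 0 < c₂)
    (cw : ∀ s u → bd s u ≡ 0 → ∀ k₁ → 1 ≤ k₁ → suc k₁ ≤ ℓ → Legal s → c₁ * w s ≤ c₂ * w (sw u (it s (suc k₁) u) s)) where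

    -- For fixed `u` a switch is recovered from the new map and `v = p k`, because `sw u v` is an
    -- involution, and `v` lies on a cycle of length `k` of the new map. So for each `u` the weights
    -- `wt k` of the switches into a map sum to at most its `Ŷ`.
    switch-count : ∀ j → c₁ * A j ≤ c₂ * (n * (suc (suc j) * D)) * N (suc j)
    switch-count j = begin
      c₁ * A j ≡⟨ cong (c₁ *_) (trans (∑-cong uX λ s → cong (w s *_) (trans (sym (∑-*ˡ (fin n) (𝟙 (y s ≟ j)) _)) (∑-cong (fin n) λ u → sym (∑-*ˡ (fin ℓ) (𝟙 (y s ≟ j)) _))))
          (trans (μ-∑ (fin n) (λ u s → ∑ (fin ℓ) (λ i → 𝟙 (y s ≟ j) * (wt (suc (toℕ i)) * good s u)))) (∑-cong (fin n) λ u → μ-∑ (fin ℓ) (λ i s → 𝟙 (y s ≟ j) * (wt (suc (toℕ i)) * good s u))))) ⟩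
      c₁ * ∑ (fin n) (λ u → ∑ (fin ℓ) (λ i → μ (λ s → 𝟙 (y s ≟ j) * (wt (suc (toℕ i)) * good s u))))
        ≡⟨ trans (sym (∑-*ˡ (fin n) c₁ _)) (∑-cong (fin n) λ u → sym (∑-*ˡ (fin ℓ) c₁ _)) ⟩
      ∑ (fin n) (λ u → ∑ (fin ℓ) (λ i → c₁ * μ (λ s → 𝟙 (y s ≟ j) * (wt (suc (toℕ i)) * good s u))))
        ≤⟨ ∑-mono (fin n) (λ u → ∑-mono (fin ℓ) λ i → one u (toℕ i) (FinP.toℕ<n i)) ⟩
      ∑ (fin n) (λ u → ∑ (fin ℓ) (λ i → c₂ * μ (λ s → 𝟙 (y s ≟ suc j) * (∑ (fin n) λ v → wt (suc (toℕ i)) * 𝟙 (per? s (suc (toℕ i)) v)))))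
        ≡⟨ trans (∑-cong (fin n) λ u → ∑-*ˡ (fin ℓ) c₂ _) (∑-constF n _) ⟩
      n * (c₂ * ∑ (fin ℓ) (λ i → μ (λ s → 𝟙 (y s ≟ suc j) * (∑ (fin n) λ v → wt (suc (toℕ i)) * 𝟙 (per? s (suc (toℕ i)) v)))))
        ≡⟨ cong (λ x → n * (c₂ * x)) (sym (μ-∑ (fin ℓ) _)) ⟩
      n * (c₂ * μ (λ s → ∑ (fin ℓ) (λ i → 𝟙 (y s ≟ suc j) * (∑ (fin n) λ v → wt (suc (toℕ i)) * 𝟙 (per? s (suc (toℕ i)) v)))))
        ≤⟨ *-monoʳ-≤ n (*-monoʳ-≤ c₂ (μ-mono λ s _ → top s)) ⟩
      n * (c₂ * μ (λ s → suc (suc j) * D * 𝟙 (y s ≟ suc j))) ≡⟨ cong (λ x → n * (c₂ * x)) (μ-* (suc (suc j) * D) _) ⟩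
      n * (c₂ * (suc (suc j) * D * N (suc j))) ≡⟨ lem c₂ n (suc (suc j) * D) (N (suc j)) ⟩
      c₂ * (n * (suc (suc j) * D)) * N (suc j) ∎
      where
      open ≤-Reasoning
      lem : ∀ c n a b → n * (c * (a * b)) ≡ c * (n * a) * b
      lem = solve-∀
      top : ∀ s → ∑ (fin ℓ) (λ i → 𝟙 (y s ≟ suc j) * (∑ (fin n) λ v → wt (suc (toℕ i)) * 𝟙 (per? s (suc (toℕ i)) v))) ≤ suc (suc j) * D * 𝟙 (y s ≟ suc j)
      top s = begin
        ∑ (fin ℓ) (λ i → 𝟙 (y s ≟ suc j) * (∑ (fin n) λ v → wt (suc (toℕ i)) * 𝟙 (per? s (suc (toℕ i)) v)))
          ≡⟨ trans (∑-*ˡ (fin ℓ) (𝟙 (y s ≟ suc j)) _) (cong (𝟙 (y s ≟ suc j) *_) (∑-swap (fin ℓ) (fin n) (λ i v → wt (suc (toℕ i)) * 𝟙 (per? s (suc (toℕ i)) v)))) ⟩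
        𝟙 (y s ≟ suc j) * Ŷ s ≤⟨ 𝟙*≤𝟙* (y s ≟ suc j) (λ e → ≤-trans (Ŷ<y s) (≤-reflexive (cong (λ x → suc x * D) e))) ⟩
        𝟙 (y s ≟ suc j) * (suc (suc j) * D) ≡⟨ *-comm (𝟙 (y s ≟ suc j)) _ ⟩
        suc (suc j) * D * 𝟙 (y s ≟ suc j) ∎
      one : ∀ u k → k < ℓ → c₁ * μ (λ s → 𝟙 (y s ≟ j) * (wt (suc k) * good s u)) ≤
            c₂ * μ (λ s → 𝟙 (y s ≟ suc j) * (∑ (fin n) λ v → wt (suc k) * 𝟙 (per? s (suc k) v)))
      one u zero _ = ≤-trans (≤-reflexive (trans (cong (c₁ *_) (trans (∑-cong uX λ s → trans (cong (λ x → w s * (𝟙 (y s ≟ j) * (x * good s u))) wt1) (trans (cong (w s *_) (*-zeroʳ (𝟙 (y s ≟ j)))) (*-zeroʳ (w s)))) (∑-0 uX))) (*-zeroʳ c₁))) z≤n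
      one u k₁@(suc _) k<ℓ = begin
        c₁ * μ (λ s → 𝟙 (y s ≟ j) * (wt k * good s u)) ≡⟨ sym (∑-*ˡ uX c₁ _) ⟩
        ∑ uX (λ s → c₁ * (w s * (𝟙 (y s ≟ j) * (wt k * good s u)))) ≤⟨ ∑-mono uX move ⟩
        ∑ uX (λ s → ∑ (fin n) λ v → h v (sw u v s)) ≡⟨ ∑-swap uX (fin n) _ ⟩
        ∑ (fin n) (λ v → ∑ uX λ s → h v (sw u v s)) ≡⟨ ∑-cong (fin n) (λ v → ∑-bij uX uX (sw u v) (sw u v) (sw-sw u v) (sw-sw u v) (h v)) ⟩
        ∑ (fin n) (λ v → ∑ uX (h v)) ≡⟨ ∑-swap (fin n) uX h ⟩
        ∑ uX (λ s → ∑ (fin n) λ v → h v s) ≡⟨ ∑-cong uX (λ s → trans (∑-cong (fin n) λ v → lem″ c₂ (w s) (𝟙 (y s ≟ suc j)) (wt k) (𝟙 (per? s k v))) (trans (∑-*ˡ (fin n) (c₂ * w s * 𝟙 (y s ≟ suc j)) _) (lem‴ c₂ (w s) (𝟙 (y s ≟ suc j)) _))) ⟩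
        ∑ uX (λ s → c₂ * (w s * (𝟙 (y s ≟ suc j) * (∑ (fin n) λ v → wt k * 𝟙 (per? s k v))))) ≡⟨ ∑-*ˡ uX c₂ _ ⟩
        c₂ * μ (λ s → 𝟙 (y s ≟ suc j) * (∑ (fin n) λ v → wt k * 𝟙 (per? s k v))) ∎
        where
        k = suc k₁
        h : Fin n → X → ℕ
        h v s = c₂ * w s * (𝟙 (y s ≟ suc j) * (wt k * 𝟙 (per? s k v)))
        lem″ : ∀ e a b c d → e * a * (b * (c * d)) ≡ e * a * b * (c * d)
        lem″ = solve-∀
        lem‴ : ∀ e a b c → e * a * b * c ≡ e * (a * (b * c))
        lem‴ = solve-∀
        move : ∀ s → c₁ * (w s * (𝟙 (y s ≟ j) * (wt k * good s u))) ≤ ∑ (fin n) λ v → h v (sw u v s)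
        move s = go (w s) refl (y s ≟ j) (bd s u ≟ 0)
          where
          zl : ∀ c a x {b} → a ≡ 0 → c * (a * x) ≤ b
          zl c a x refl rewrite *-zeroʳ c = z≤n
          zm : ∀ c a x {b} → c * (a * (0 * x)) ≤ b
          zm c a x rewrite *-zeroʳ a | *-zeroʳ c = z≤n
          zn : ∀ c a x {b} → c * (a * (1 * (x * 0))) ≤ b
          zn c a x rewrite *-zeroʳ x | *-zeroʳ a | *-zeroʳ c = z≤n
          go : ∀ m → w s ≡ m → (d : Dec (y s ≡ j)) (e : Dec (bd s u ≡ 0)) → c₁ * (w s * (𝟙 d * (wt k * 𝟙 e))) ≤ ∑ (fin n) λ v → h v (sw u v s)
          go zero e d d′ = zl c₁ (w s) (𝟙 d * (wt k * 𝟙 d′)) e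
          go (suc m) e (no _) d′ = zm c₁ (w s) (wt k * 𝟙 d′)
          go (suc m) e (yes _) (no _) = zn c₁ (w s) (wt k)
          go (suc m) e (yes yj) (yes g) = ≤-trans (begin
              c₁ * (w s * (1 * (wt k * 1))) ≡⟨ lem₁ c₁ (w s) (wt k) ⟩
              c₁ * w s * wt k ≤⟨ *-monoˡ-≤ (wt k) (cw s u g k₁ (s≤s z≤n) k<ℓ (legal s λ e′ → 1+n≢0 (trans (sym e) e′))) ⟩
              c₂ * w s′ * wt k ≡⟨ lem₂ (c₂ * w s′) (wt k) ⟩
              c₂ * w s′ * (1 * (wt k * 1)) ≡⟨ cong₂ (λ a b → c₂ * w s′ * (a * (wt k * b))) (sym (𝟙-yes (y s′ ≟ suc j) (trans (y-step s s′ (Split.Ŷ-split s u g k₁ (s≤s z≤n) k<ℓ)) (cong suc yj))))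
                   (sym (𝟙-yes (per? s′ k pk) (Split.per-on s u g k₁ (s≤s z≤n) k<ℓ k₁ (n<1+n k₁)))) ⟩
              h pk s′ ∎) (f≤∑ (fin n) (λ v → h v (sw u v s)) pk)
            where
            pk = it s k u
            s′ = sw u pk s
            lem₁ : ∀ c a b → c * (a * (1 * (b * 1))) ≡ c * a * b
            lem₁ = solve-∀
            lem₂ : ∀ a b → a * b ≡ a * (1 * (b * 1))
            lem₂ = solve-∀

    module _ (J : ℕ) (hcond : 20 * c₂ * (suc J * D) ≤ 9 * c₁ * Hs) where

      -- Switches of weight at least 9/10 of `n * Hs` lead out of a calm map with `j` cycles, and at
      -- most `n * (j + 2) * D` into a map with `j + 1`. `hcond` makes the quotient, after the loss
      -- `c₁ / c₂`, at least 2.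
      halve : ∀ j → j < J → 2 * Ng j ≤ N (suc j)
      halve j j<J = *-cancelˡ-≤ (n * (9 * c₁ * Hs)) {{>-nonZero (*-mono-≤ n>0 (≤-trans pos hcond))}} (begin
        n * (9 * c₁ * Hs) * (2 * Ng j) ≡⟨ lem₁ c₁ n Hs (Ng j) ⟩
        2 * c₁ * (9 * n * Hs * Ng j) ≤⟨ *-monoʳ-≤ (2 * c₁) (many-good j) ⟩
        2 * c₁ * (10 * A j) ≡⟨ lem₂ c₁ (A j) ⟩
        20 * (c₁ * A j) ≤⟨ *-monoʳ-≤ 20 (switch-count j) ⟩
        20 * (c₂ * (n * (suc (suc j) * D)) * N (suc j)) ≤⟨ *-monoʳ-≤ 20 (*-monoˡ-≤ (N (suc j)) (*-monoʳ-≤ c₂ (*-monoʳ-≤ n (*-monoˡ-≤ D (s≤s j<J))))) ⟩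
        20 * (c₂ * (n * (suc J * D)) * N (suc j)) ≡⟨ lem₃ c₂ n (suc J * D) (N (suc j)) ⟩
        n * (20 * c₂ * (suc J * D)) * N (suc j) ≤⟨ *-monoˡ-≤ (N (suc j)) (*-monoʳ-≤ n hcond) ⟩
        n * (9 * c₁ * Hs) * N (suc j) ∎)
        where
        open ≤-Reasoning
        lem₁ : ∀ c n h g → n * (9 * c * h) * (2 * g) ≡ 2 * c * (9 * n * h * g)
        lem₁ = solve-∀
        lem₂ : ∀ c a → 2 * c * (10 * a) ≡ 20 * (c * a)
        lem₂ = solve-∀
        lem₃ : ∀ c n a b → 20 * (c * (n * a) * b) ≡ n * (20 * c * a) * b
        lem₃ = solve-∀
        pos : 1 ≤ 20 * c₂ * (suc J * D)
        pos = *-mono-≤ (*-mono-≤ {1} {20} (s≤s z≤n) c₂>0) (*-mono-≤ (s≤s (z≤n {J})) (ℕ.>-nonZero⁻¹ D))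

      private
        bs : X → ℕ → ℕ → ℕ
        bs s j zero    = 0
        bs s j (suc d) = 𝟙 (y s ≟ j) * 𝟙 (¬? (calm? s)) + bs s (suc j) d

        bs0 : ∀ s j d → y s < j → bs s j d ≡ 0
        bs0 s j zero    h = refl
        bs0 s j (suc d) h = cong₂ _+_ (cong (_* 𝟙 (¬? (calm? s))) (𝟙-no (y s ≟ j) (<⇒≢ h))) (bs0 s (suc j) d (m<n⇒m<1+n h))

        -- A rough map sits at the single level `y s`, so the losses at all levels together count it
        -- once.
        bs≤ : ∀ s j d → bs s j d ≤ 𝟙 (¬? (calm? s))
        bs≤ s j zero    = z≤n
        bs≤ s j (suc d) with y s ≟ j
        ... | yes e = ≤-reflexive (trans (cong₂ _+_ (+-identityʳ _) (bs0 s (suc j) d (s≤s (≤-reflexive e)))) (+-identityʳ _))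
        ... | no _ = bs≤ s (suc j) d

        Bs : ℕ → ℕ → ℕ
        Bs j d = μ (λ s → bs s j d)

        down : ∀ d j → j + d ≡ J → 2 ^ d * N j ≤ T₁ + 2 ^ J * Bs j d
        down zero j e = ≤-trans (≤-reflexive (+-identityʳ (N j))) (≤-trans (μ-mono λ s _ → 𝟙≤1 (y s ≟ j)) (m≤m+n _ _))
        down (suc d) j e = begin
          2 ^ suc d * N j ≡⟨ cong (2 ^ suc d *_) (N-split j) ⟩
          2 ^ suc d * (Ng j + B j) ≡⟨ lem (2 ^ d) (Ng j) (B j) ⟩
          2 ^ d * (2 * Ng j) + 2 ^ suc d * B j ≤⟨ +-mono-≤ (*-monoʳ-≤ (2 ^ d) (halve j (≤-trans (≤-trans (≤-reflexive (+-comm 1 j)) (+-monoʳ-≤ j (s≤s z≤n))) (≤-reflexive e))))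
               (*-monoˡ-≤ (B j) (^-monoʳ-≤ 2 (≤-trans (m≤n+m (suc d) j) (≤-reflexive e)))) ⟩
          2 ^ d * N (suc j) + 2 ^ J * B j ≤⟨ +-monoˡ-≤ (2 ^ J * B j) (down d (suc j) (trans (sym (+-suc j d)) e)) ⟩
          T₁ + 2 ^ J * Bs (suc j) d + 2 ^ J * B j ≡⟨ lem′ T₁ (2 ^ J) (Bs (suc j) d) (B j) ⟩
          T₁ + 2 ^ J * (B j + Bs (suc j) d) ≡⟨ cong (λ x → T₁ + 2 ^ J * x) (sym (μ-+ _ _)) ⟩
          T₁ + 2 ^ J * Bs j (suc d) ∎
          where
          open ≤-Reasoning
          lem : ∀ a b c → (a + (a + 0)) * (b + c) ≡ a * (2 * b) + (a + (a + 0)) * c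
          lem = solve-∀
          lem′ : ∀ t a b c → t + a * b + a * c ≡ t + a * (c + b)
          lem′ = solve-∀

      -- Level `j` is halved `J ∸ j` times on the way up to `J`, which compensates its weight
      -- `2 ^ (J ∸ j)`. The `J` levels below `J`, and the maps from `J` on, contribute one copy of
      -- the same bound each.
      descent : μ (λ s → 2 ^ (J ∸ y s)) ≤ suc J * (T₁ + 2 ^ J * μ (λ s → 𝟙 (¬? (calm? s))))
      descent = begin
        μ (λ s → 2 ^ (J ∸ y s)) ≤⟨ μ-mono (λ s _ → pt s) ⟩
        μ (λ s → 1 + ∑ℕ J (λ j → 2 ^ (J ∸ j) * 𝟙 (y s ≟ j))) ≡⟨ trans (μ-+ _ _) (cong (T₁ +_) (trans (μ-∑ (fin J) _) (∑-cong (fin J) λ i → μ-* (2 ^ (J ∸ toℕ i)) _))) ⟩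
        T₁ + ∑ℕ J (λ j → 2 ^ (J ∸ j) * N j) ≤⟨ +-mono-≤ (m≤m+n T₁ _) (∑ℕ-mono J λ j j<J → ≤-trans (down (J ∸ j) j (m+[n∸m]≡n (<⇒≤ j<J)))
            (+-monoʳ-≤ T₁ (*-monoʳ-≤ (2 ^ J) (μ-mono λ s _ → bs≤ s j (J ∸ j))))) ⟩
        K + ∑ℕ J (λ _ → K) ≡⟨ cong (K +_) (∑-constF J K) ⟩
        suc J * K ∎
        where
        open ≤-Reasoning
        K = T₁ + 2 ^ J * μ (λ s → 𝟙 (¬? (calm? s)))
        pt : ∀ s → 2 ^ (J ∸ y s) ≤ 1 + ∑ℕ J (λ j → 2 ^ (J ∸ j) * 𝟙 (y s ≟ j))
        pt s with y s <? J
        ... | yes h = ≤-trans (≤-trans (≤-reflexive (sym (trans (cong (2 ^ (J ∸ y s) *_) (𝟙-yes (y s ≟ y s) refl)) (*-identityʳ _))))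
                        (f≤∑ℕ J (λ j → 2 ^ (J ∸ j) * 𝟙 (y s ≟ j)) h)) (n≤1+n _)
        ... | no h = ≤-trans (≤-reflexive (cong (2 ^_) (m≤n⇒m∸n≡0 (≮⇒≥ h)))) (s≤s z≤n)

-- Rotations and stable matchings

∑-inj : ∀ u v {p q} {P : El u → Set p} {Q : El v → Set q} (P? : ∀ a → Dec (P a)) (Q? : ∀ b → Dec (Q b)) (g : El u → El v) →
  (∀ a → P a → Q (g a)) → (∀ a a′ → P a → P a′ → g a ≡ g a′ → a ≡ a′) → ∑ u (λ a → 𝟙 (P? a)) ≤ ∑ v (λ b → 𝟙 (Q? b))
∑-inj u v P? Q? g PQ inj = begin
  ∑ u (λ a → 𝟙 (P? a)) ≡⟨ ∑-cong u (λ a → sym (∑-δ v (λ _ → 𝟙 (P? a)) (g a))) ⟩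
  ∑ u (λ a → ∑ v (λ b → 𝟙 (_≟u_ {v} b (g a)) * 𝟙 (P? a))) ≡⟨ ∑-swap u v _ ⟩
  ∑ v (λ b → ∑ u (λ a → 𝟙 (_≟u_ {v} b (g a)) * 𝟙 (P? a))) ≡⟨ ∑-cong v (λ b → ∑-cong u λ a → sym (𝟙-× (_≟u_ {v} b (g a)) (P? a))) ⟩
  ∑ v (λ b → ∑ u (λ a → 𝟙 (_≟u_ {v} b (g a) ×-dec P? a))) ≤⟨ ∑-mono v each ⟩
  ∑ v (λ b → 𝟙 (Q? b)) ∎
  where
  open ≤-Reasoning
  each : ∀ b → ∑ u (λ a → 𝟙 (_≟u_ {v} b (g a) ×-dec P? a)) ≤ 𝟙 (Q? b)
  each b with Q? b
  ... | yes _ = ∑-unique≤1 u (λ a → _≟u_ {v} b (g a) ×-dec P? a) λ a a′ (e , p) (e′ , p′) → inj a a′ p p′ (trans (sym e) e′)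
  ... | no ¬q = ≤-reflexive (∑-zero u λ a → 𝟙-no (_≟u_ {v} b (g a) ×-dec P? a) λ { (refl , p) → ¬q (PQ a p) })

StableFor : ∀ {n} → (Fin n → Fin n → ℕ) → Vec (Fin n) n → Set
StableFor sc N = (∀ a → lookup N (lookup N a) ≡ a × lookup N a ≢ a) ×
  (∀ a b → b ≢ a → b ≢ lookup N a → ¬ (sc a b < sc a (lookup N a) × sc b a < sc b (lookup N b)))

stableFor? : ∀ {n} (sc : Fin n → Fin n → ℕ) N → Dec (StableFor sc N)
stableFor? sc N = FinP.all? (λ a → (lookup N (lookup N a) ≟F a) ×-dec ¬? (lookup N a ≟F a)) ×-dec
  FinP.all? (λ a → FinP.all? λ b → ¬? (b ≟F a) →-dec (¬? (b ≟F lookup N a) →-dec ¬? ((sc a b <? sc a (lookup N a)) ×-dec (sc b a <? sc b (lookup N b)))))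

module Rot {n : ℕ} (matching : Matching n) (cycleWeights : CycleWeights) (s : Vec (Fin n) n) where

  open Matching matching
  open CycleWeights cycleWeights
  open Iterate matching

  Short : Fin n → Set
  Short a = ∃ λ k → k < ℓ × Per s (suc k) a

  short? : ∀ a → Dec (Short a)
  short? a = anyUpTo? (λ k → per? s (suc k) a) ℓ

  Yv : Fin n → ℕ
  Yv v = ∑ℕ ℓ (λ k → wt (suc k) * 𝟙 (per? s (suc k) v))

  Mask : Set
  Mask = Vec (Fin 2) n

  uMask : U
  uMask = vec (fin 2) n

  one : Fin 2
  one = suc zero

  -- These are the unions of short cycles of `φ`, as 0-1 vectors so that they can be summed over.
  Closed : Mask → Set
  Closed c = ∀ a → (lookup c a ≡ one → Short a) × (Short a → lookup c (φ s a) ≡ lookup c a)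

  Sub : Mask → Mask → Set
  Sub c r = ∀ a → lookup c a ≡ one → lookup r a ≡ one

  closed? : ∀ c → Dec (Closed c)
  closed? c = FinP.all? λ a → ((lookup c a ≟F one) →-dec short? a) ×-dec (short? a →-dec (lookup c (φ s a) ≟F lookup c a))

  sub? : ∀ c r → Dec (Sub c r)
  sub? c r = FinP.all? λ a → (lookup c a ≟F one) →-dec (lookup r a ≟F one)

  short-φ : ∀ a → Short a → Short (φ s a)
  short-φ a (k , k<ℓ , p) = k , k<ℓ , per-φ s (suc k) a (s≤s z≤n) p

  short-it : ∀ t a → Short a → Short (it s t a)
  short-it zero a h = h
  short-it (suc t) a h = short-φ _ (short-it t a h)

  closed-it : ∀ c → Closed c → ∀ t a → Short a → lookup c (it s t a) ≡ lookup c a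
  closed-it c C zero    a h = refl
  closed-it c C (suc t) a h = trans (proj₂ (C (it s t a)) (short-it t a h)) (closed-it c C t a h)

  -- The predecessor on a short cycle; elsewhere the value is a dummy.
  pr : Fin n → Fin n
  pr b with short? b
  ... | yes (k , _) = it s k b
  ... | no _ = b

  φ-pr : ∀ b → Short b → φ s (pr b) ≡ b
  φ-pr b h with short? b
  ... | yes (k , _ , p) = proj₁ p
  ... | no ¬h = ⊥-elim (¬h h)

  pr-it : ∀ b → Short b → ∃ λ t → pr b ≡ it s t b
  pr-it b h with short? b
  ... | yes (k , _ , p) = k , refl
  ... | no ¬h = ⊥-elim (¬h h)

  -- Equal images have equal periods, and the remaining steps of the cycle undo `φ`.
  φ-inj : ∀ a b → Short a → Short b → φ s a ≡ φ s b → a ≡ b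
  φ-inj a b (k , _ , p) (k′ , _ , p′) e = trans (sym (lem a k p)) (trans (cong₂ (it s) kk e) (lem b k′ p′))
    where
    lem : ∀ a k → Per s (suc k) a → it s k (φ s a) ≡ a
    lem a k p = trans (it-comm s k 1 a) (proj₁ p)
    kk : k ≡ k′
    kk = suc-injective (per-unique s (suc k) (suc k′) (φ s a) (s≤s z≤n) (s≤s z≤n) (per-φ s (suc k) a (s≤s z≤n) p)
           (subst (Per s (suc k′)) (sym e) (per-φ s (suc k′) b (s≤s z≤n) p′)))

  short-pr : ∀ b → Short b → Short (pr b)
  short-pr b h = let t , e = pr-it b h in subst Short (sym e) (short-it t b h)

  pr-φ : ∀ b → Short b → pr (φ s b) ≡ b
  pr-φ b h = φ-inj (pr (φ s b)) b (short-pr (φ s b) (short-φ b h)) h (φ-pr (φ s b) (short-φ b h))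

  closed-pr : ∀ c → Closed c → ∀ b → Short b → lookup c (pr b) ≡ lookup c b
  closed-pr c C b h = let t , e = pr-it b h in trans (cong (lookup c) e) (closed-it c C t b h)

  weight : Mask → ℕ
  weight r = ∑ (fin n) λ v → 𝟙 (lookup r v ≟F one) * Yv v

  private
    z≢o : ∀ {ℓ} {A : Set ℓ} → zero ≡ one → A
    z≢o ()

    empty : Mask
    empty = tabulate (λ _ → zero)

    empty-closed : Closed empty
    empty-closed a = (λ e → z≢o (trans (sym (VecP.lookup∘tabulate _ a)) e)) ,
                     (λ _ → trans (VecP.lookup∘tabulate _ (φ s a)) (sym (VecP.lookup∘tabulate _ a)))

    bit : ∀ (b : Fin 2) → b ≡ zero ⊎ b ≡ one
    bit zero = inj₁ refl
    bit (suc zero) = inj₂ refl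

    yv-short : ∀ v → 0 < Yv v → Short v
    yv-short v h = let i , q = ∑-pos (fin ℓ) _ h in toℕ i , FinP.toℕ<n i , pick (toℕ i) (per? s (suc (toℕ i)) v) q
      where pick : ∀ i (d : Dec (Per s (suc i) v)) → 0 < wt (suc i) * 𝟙 d → Per s (suc i) v
            pick i (yes p) _ = p
            pick i (no _) q = ⊥-elim (n≮0 (≤-trans q (≤-reflexive (*-zeroʳ (wt (suc i))))))

  del : ∀ {A : Set} → Dec A → Fin 2 → Fin 2
  del (yes _) _ = zero
  del (no _) b = b

  ins : ∀ {A : Set} → Dec A → Fin 2 → Fin 2
  ins (yes _) _ = one
  ins (no _) b = b

  -- Peeling off one orbit at a time: each orbit contributes at most D to the weight and doubles the number of closed sets.
  many-closed : ∀ j r → Closed r → j * D ≤ weight r → 2 ^ j ≤ ∑ uMask (λ c → 𝟙 (closed? c ×-dec sub? c r))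
  many-closed zero r R h = ≤-trans (≤-reflexive (sym (𝟙-yes (closed? empty ×-dec sub? empty r) (empty-closed ,
      λ a e → z≢o (trans (sym (VecP.lookup∘tabulate _ a)) e))))) (f≤∑ uMask (λ c → 𝟙 (closed? c ×-dec sub? c r)) empty)
  many-closed (suc j) r Rc h = begin
    2 ^ suc j ≡⟨ cong (2 ^ j +_) (+-identityʳ _) ⟩
    2 ^ j + 2 ^ j ≤⟨ +-mono-≤ ih ih ⟩
    ∑ uMask (λ c → 𝟙 (closed? c ×-dec sub? c r′)) + ∑ uMask (λ c → 𝟙 (closed? c ×-dec sub? c r′))
      -- Closed subsets of `r` are split by whether they contain `v`. Each class receives those of
      -- `r′` injectively, with the orbit of `v` added or left out.
      ≤⟨ +-mono-≤ (∑-inj uMask uMask (λ c → closed? c ×-dec sub? c r′) (λ c → (closed? c ×-dec sub? c r) ×-dec (lookup c v ≟F one)) add add-ok add-inj)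
                  (∑-mono uMask λ c → 𝟙-mono (closed? c ×-dec sub? c r′) ((closed? c ×-dec sub? c r) ×-dec ¬? (lookup c v ≟F one)) λ (C , B) →
                     (C , λ a e → proj₁ (r′-one a (B a e))) , λ e → proj₂ (r′-one v (B v e)) (0 , s≤s z≤n , refl)) ⟩
    ∑ uMask (λ c → 𝟙 ((closed? c ×-dec sub? c r) ×-dec (lookup c v ≟F one))) + ∑ uMask (λ c → 𝟙 ((closed? c ×-dec sub? c r) ×-dec ¬? (lookup c v ≟F one)))
      ≡⟨ sym (trans (∑-cong uMask λ c → 𝟙-split (closed? c ×-dec sub? c r) (lookup c v ≟F one)) (∑-+ uMask _ _)) ⟩
    ∑ uMask (λ c → 𝟙 (closed? c ×-dec sub? c r)) ∎
    where
    open ≤-Reasoning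
    found : ∃ λ v → 0 < 𝟙 (lookup r v ≟F one) * Yv v
    found = ∑-pos (fin n) (λ v → 𝟙 (lookup r v ≟F one) * Yv v) (≤-trans (*-mono-≤ (s≤s (z≤n {j})) D>0) h)
    v : Fin n
    v = proj₁ found
    pick : (d : Dec (lookup r v ≡ one)) → 0 < 𝟙 d * Yv v → lookup r v ≡ one
    pick (yes e) _ = e
    pick (no _) ()
    rv : lookup r v ≡ one
    rv = pick (lookup r v ≟F one) (proj₂ found)
    sv : Short v
    sv = proj₁ (Rc v) rv
    k : ℕ
    k = suc (proj₁ sv)
    kp : Per s k v
    kp = proj₂ (proj₂ sv)
    Orb : Fin n → Set
    Orb a = ∃ λ t → t < k × it s t v ≡ a
    orb? : ∀ a → Dec (Orb a)
    orb? a = anyUpTo? (λ t → it s t v ≟F a) k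
    orb-φ : ∀ a → Orb a → Orb (φ s a)
    orb-φ a (t , t<k , e) with suc t ≟ k
    ... | yes q = 0 , s≤s z≤n , trans (sym (proj₁ kp)) (trans (cong (λ x → it s x v) (sym q)) (cong (φ s) e))
    ... | no q = suc t , ≤∧≢⇒< t<k q , cong (φ s) e
    orb-φ⁻ : ∀ a → Short a → Orb (φ s a) → Orb a
    orb-φ⁻ a h (zero , _ , e) = proj₁ sv , n<1+n _ , φ-inj _ a (short-it (proj₁ sv) v sv) h (trans (proj₁ kp) e)
    orb-φ⁻ a h (suc t , t<k , e) = t , <-trans (n<1+n t) t<k , φ-inj _ a (short-it t v sv) h e
    orb-short : ∀ a → Orb a → Short a
    orb-short a (t , _ , e) = subst Short e (short-it t v sv)
    orb-r : ∀ a → Orb a → lookup r a ≡ one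
    orb-r a (t , _ , e) = trans (cong (lookup r) (sym e)) (trans (closed-it r Rc t v sv) rv)
    r′ : Mask
    r′ = tabulate λ a → del (orb? a) (lookup r a)
    add : Mask → Mask
    add c = tabulate λ a → ins (orb? a) (lookup c a)
    r′-look : ∀ a → lookup r′ a ≡ del (orb? a) (lookup r a)
    r′-look a = VecP.lookup∘tabulate _ a
    add-look : ∀ c a → lookup (add c) a ≡ ins (orb? a) (lookup c a)
    add-look c a = VecP.lookup∘tabulate _ a
    del-one : ∀ {A : Set} (d : Dec A) b → del d b ≡ one → b ≡ one × ¬ A
    del-one (no ¬o) b e = e , ¬o
    r′-one : ∀ a → lookup r′ a ≡ one → lookup r a ≡ one × ¬ Orb a
    r′-one a e = del-one (orb? a) (lookup r a) (trans (sym (r′-look a)) e)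
    same : ∀ (f : ∀ {A : Set} → Dec A → Fin 2 → Fin 2) c a → Closed c → Short a →
      (∀ {A B : Set} (d : Dec A) (e : Dec B) b → (A → B) → (B → A) → f d b ≡ f e b) →
      f (orb? (φ s a)) (lookup c (φ s a)) ≡ f (orb? a) (lookup c a)
    same f c a C h ext = trans (ext (orb? (φ s a)) (orb? a) _ (orb-φ⁻ a h) (orb-φ a)) (cong (f (orb? a)) (proj₂ (C a) h))
    del-ext : ∀ {A B : Set} (d : Dec A) (e : Dec B) b → (A → B) → (B → A) → del d b ≡ del e b
    del-ext (yes _) (yes _) b f g = refl
    del-ext (yes a) (no ¬b) b f g = ⊥-elim (¬b (f a))
    del-ext (no ¬a) (yes b′) b f g = ⊥-elim (¬a (g b′))
    del-ext (no _) (no _) b f g = refl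
    ins-ext : ∀ {A B : Set} (d : Dec A) (e : Dec B) b → (A → B) → (B → A) → ins d b ≡ ins e b
    ins-ext (yes _) (yes _) b f g = refl
    ins-ext (yes a) (no ¬b) b f g = ⊥-elim (¬b (f a))
    ins-ext (no ¬a) (yes b′) b f g = ⊥-elim (¬a (g b′))
    ins-ext (no _) (no _) b f g = refl
    r′-closed : Closed r′
    r′-closed a = (λ e → proj₁ (Rc a) (proj₁ (r′-one a e))) , λ h → trans (r′-look (φ s a)) (trans (same del r a Rc h del-ext) (sym (r′-look a)))
    lost : weight r ≤ weight r′ + D
    lost = begin
      weight r ≤⟨ ∑-mono (fin n) (λ a → each a (orb? a) refl) ⟩
      ∑ (fin n) (λ a → 𝟙 (lookup r′ a ≟F one) * Yv a + wt k * ∑ℕ k (λ t → 𝟙 (a ≟F it s t v))) ≡⟨ ∑-+ (fin n) _ _ ⟩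
      weight r′ + ∑ (fin n) (λ a → wt k * ∑ℕ k (λ t → 𝟙 (a ≟F it s t v))) ≡⟨ cong (weight r′ +_) (trans (∑-*ˡ (fin n) (wt k) _)
         (cong (wt k *_) (trans (∑-swap (fin n) (fin k) (λ a t → 𝟙 (a ≟F it s (toℕ t) v))) (trans (∑-cong (fin k) λ t → trans (∑-cong (fin n) λ a → sym (*-identityʳ (𝟙 (a ≟F it s (toℕ t) v))))
            (∑-δ (fin n) (λ _ → 1) (it s (toℕ t) v))) (trans (∑-constF k 1) (*-identityʳ k)))))) ⟩
      weight r′ + wt k * k ≤⟨ +-monoʳ-≤ (weight r′) (≤-trans (≤-reflexive (*-comm (wt k) k)) (wt≤D k (s≤s z≤n) (proj₁ (proj₂ sv)))) ⟩
      weight r′ + D ∎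
      where
      each : ∀ a (d : Dec (Orb a)) → orb? a ≡ d → 𝟙 (lookup r a ≟F one) * Yv a ≤ 𝟙 (lookup r′ a ≟F one) * Yv a + wt k * ∑ℕ k (λ t → 𝟙 (a ≟F it s t v))
      each a (no ¬o) eq = ≤-trans (≤-reflexive (cong (_* Yv a) (𝟙-cong (lookup r a ≟F one) (lookup r′ a ≟F one)
                (λ e → trans (r′-look a) (trans (cong (λ d → del d (lookup r a)) eq) e)) (λ e → proj₁ (r′-one a e))))) (m≤m+n _ _)
      each a (yes (t , t<k , refl)) _ = ≤-trans (≤-trans (*-monoˡ-≤ (Yv a) (𝟙≤1 (lookup r a ≟F one))) (≤-trans (≤-reflexive (trans (+-identityʳ _) Yva))
                (*-monoʳ-≤ (wt k) (≤-trans (≤-reflexive (sym (𝟙-yes (a ≟F it s t v) refl))) (f≤∑ℕ k (λ t → 𝟙 (a ≟F it s t v)) t<k))))) (m≤n+m _ _)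
        where
        pa : Per s k (it s t v)
        pa = per-it s k t v (s≤s z≤n) kp
        Yva : Yv (it s t v) ≡ wt k * 1
        Yva = trans (∑ℕ-single ℓ (λ k → wt (suc k) * 𝟙 (per? s (suc k) (it s t v))) (proj₁ (proj₂ sv)) (λ k′ _ ne → trans (cong (wt (suc k′) *_)
           (𝟙-no (per? s (suc k′) (it s t v)) λ q → ne (suc-injective (per-unique s (suc k′) k (it s t v) (s≤s z≤n) (s≤s z≤n) q pa)))) (*-zeroʳ (wt (suc k′)))))
           (cong (wt k *_) (𝟙-yes (per? s k (it s t v)) pa))
    ih : 2 ^ j ≤ ∑ uMask (λ c → 𝟙 (closed? c ×-dec sub? c r′))
    ih = many-closed j r′ r′-closed (+-cancelʳ-≤ D _ _ (≤-trans (≤-reflexive (+-comm (j * D) D)) (≤-trans h lost)))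
    add-ok : ∀ c → Closed c × Sub c r′ → (Closed (add c) × Sub (add c) r) × lookup (add c) v ≡ one
    add-ok c (C , B) = ((λ a → (λ e → one⇒ a (orb? a) (trans (sym (add-look c a)) e)) ,
                               λ h → trans (add-look c (φ s a)) (trans (same ins c a C h ins-ext) (sym (add-look c a)))) ,
                        λ a e → sb a (orb? a) (trans (sym (add-look c a)) e)) ,
                       trans (add-look c v) (hv (orb? v))
      where
      hv : (d : Dec (Orb v)) → ins d (lookup c v) ≡ one
      hv (yes _) = refl
      hv (no ¬o) = ⊥-elim (¬o (0 , s≤s z≤n , refl))
      one⇒ : ∀ a (d : Dec (Orb a)) → ins d (lookup c a) ≡ one → Short a
      one⇒ a (yes o) _ = orb-short a o
      one⇒ a (no _) q = proj₁ (C a) q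
      sb : ∀ a (d : Dec (Orb a)) → ins d (lookup c a) ≡ one → lookup r a ≡ one
      sb a (yes o) _ = orb-r a o
      sb a (no _) q = proj₁ (r′-one a (B a q))
    add-inj : ∀ c c′ → Closed c × Sub c r′ → Closed c′ × Sub c′ r′ → add c ≡ add c′ → c ≡ c′
    add-inj c c′ (C , B) (C′ , B′) e = vec-ext c c′ λ a → go a (orb? a) (trans (sym (add-look c a)) (trans (cong (λ x → lookup x a) e) (add-look c′ a)))
      where
      off : ∀ c → Sub c r′ → ∀ a → Orb a → lookup c a ≡ zero
      off c B a o with bit (lookup c a)
      ... | inj₁ q = q
      ... | inj₂ q = ⊥-elim (proj₂ (r′-one a (B a q)) o)
      go : ∀ a (d : Dec (Orb a)) → ins d (lookup c a) ≡ ins d (lookup c′ a) → lookup c a ≡ lookup c′ a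
      go a (no _) q = q
      go a (yes o) _ = trans (off c B a o) (sym (off c′ B′ a o))

  private
    toBit : ∀ {A : Set} → Dec A → Fin 2
    toBit (yes _) = one
    toBit (no _) = zero

  full : Mask
  full = tabulate λ a → toBit (short? a)

  private
    full-one : ∀ a → Short a → lookup full a ≡ one
    full-one a h = trans (VecP.lookup∘tabulate _ a) (go (short? a))
      where go : (d : Dec (Short a)) → toBit d ≡ one
            go (yes _) = refl
            go (no ¬h) = ⊥-elim (¬h h)

    full-short : ∀ a → lookup full a ≡ one → Short a
    full-short a e = go (short? a) (trans (sym (VecP.lookup∘tabulate _ a)) e)
      where go : (d : Dec (Short a)) → toBit d ≡ one → Short a
            go (yes h) _ = h

    full-closed : Closed full
    full-closed a = full-short a , λ h → trans (full-one (φ s a) (short-φ a h)) (sym (full-one a h))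

    full-weight : ∑ (fin n) Yv ≤ weight full
    full-weight = ∑-mono (fin n) λ v → each v (Yv v) refl
      where
      each : ∀ v m → Yv v ≡ m → Yv v ≤ 𝟙 (lookup full v ≟F one) * Yv v
      each v zero e rewrite e = z≤n
      each v (suc m) e = ≤-reflexive (sym (trans (cong (_* Yv v) (𝟙-yes (lookup full v ≟F one) (full-one v (yv-short v (≤-trans (s≤s z≤n) (≤-reflexive (sym e))))))) (+-identityʳ _)))

  closed-count : ∀ j → j * D ≤ ∑ (fin n) Yv → 2 ^ j ≤ ∑ uMask (λ c → 𝟙 (closed? c))
  closed-count j h = ≤-trans (many-closed j full full-closed (≤-trans h full-weight))
    (∑-mono uMask λ c → 𝟙-mono (closed? c ×-dec sub? c full) (closed? c) proj₁)

  module RotStable (sc : Fin n → Fin n → ℕ)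
    (st : ∀ a b → b ≢ a → b ≢ M a → ¬ (sc a b ≤ sc a (M a) × sc b a ≤ sc b (M b)))
    (s≢ : ∀ a → lookup s a ≢ a × lookup s a ≢ M a)
    (acc : ∀ a → sc (lookup s a) a ≤ sc (lookup s a) (M (lookup s a)))
    (best : ∀ a j → j ≢ a → j ≢ M a → j ≢ lookup s a → sc j a ≤ sc j (M j) → sc a (lookup s a) < sc a j)
    where

    module _
      (unlinked : ∀ a → Short a → Short (M a) → ⊥)
      (calm : ∀ a b → Short a → Short b → b ≢ a → b ≢ M a → ¬ (sc a b < sc a (lookup s a) × sc b a < sc b (lookup s b)))
      where

      -- A person on a chosen cycle moves to `s a`. If instead `M a` is on one, its predecessor `b`
      -- has `s b ≡ a` and comes to `a`. All others keep their partners; `unlinked` keeps the first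
      -- two cases apart.
      partner : ∀ a {P Q : Set} → Dec P → Dec Q → Fin n
      partner a (yes _) _       = lookup s a
      partner a (no _)  (yes _) = pr (M a)
      partner a (no _)  (no _)  = M a

      N : Mask → Fin n → Fin n
      N c a = partner a (lookup c a ≟F one) (lookup c (M a) ≟F one)

      module _ (c : Mask) (C : Closed c) where

        In : Fin n → Set
        In a = lookup c a ≡ one

        in-short : ∀ {a} → In a → Short a
        in-short = proj₁ (C _)

        N-in : ∀ a → In a → N c a ≡ lookup s a
        N-in a i with lookup c a ≟F one
        ... | yes _ = refl
        ... | no ¬i = ⊥-elim (¬i i)

        N-dual : ∀ a → In (M a) → N c a ≡ pr (M a)
        N-dual a i with lookup c a ≟F one | lookup c (M a) ≟F one
        ... | yes i′ | _ = ⊥-elim (unlinked a (in-short i′) (in-short i))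
        ... | no _ | yes _ = refl
        ... | no _ | no ¬i = ⊥-elim (¬i i)

        N-out : ∀ a → ¬ In a → ¬ In (M a) → N c a ≡ M a
        N-out a ¬i ¬i′ with lookup c a ≟F one | lookup c (M a) ≟F one
        ... | yes i | _ = ⊥-elim (¬i i)
        ... | no _ | yes i = ⊥-elim (¬i′ i)
        ... | no _ | no _ = refl

        in-φ : ∀ a → In a → In (φ s a)
        in-φ a i = trans (proj₂ (C a) (in-short i)) i

        in-pr : ∀ a → In a → In (pr a)
        in-pr a i = trans (closed-pr c C a (in-short i)) i

        s-pr : ∀ a → Short a → lookup s (pr a) ≡ M a
        s-pr a h = trans (sym (MM _)) (cong M (φ-pr a h))

        data Kind (a : Fin n) : Set where
          inside  : In a → Kind a
          dual    : In (M a) → Kind a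
          outside : ¬ In a → ¬ In (M a) → Kind a

        kind : ∀ a → Kind a
        kind a with lookup c a ≟F one | lookup c (M a) ≟F one
        ... | yes i | _ = inside i
        ... | no _ | yes i = dual i
        ... | no ¬i | no ¬i′ = outside ¬i ¬i′

        invol : ∀ a → N c (N c a) ≡ a
        invol a with kind a
        ... | inside i = trans (cong (N c) (N-in a i)) (trans (N-dual (lookup s a) (in-φ a i)) (pr-φ a (in-short i)))
        ... | dual i = trans (cong (N c) (N-dual a i)) (trans (N-in (pr (M a)) (in-pr (M a) i)) (trans (s-pr (M a) (in-short i)) (MM a)))
        ... | outside ¬i ¬i′ = trans (cong (N c) (N-out a ¬i ¬i′)) (trans (N-out (M a) ¬i′ (λ i → ¬i (subst In (MM a) i))) (MM a))

        fixfree : ∀ a → N c a ≢ a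
        fixfree a e with kind a
        ... | inside i = proj₁ (s≢ a) (trans (sym (N-in a i)) e)
        ... | dual i = proj₁ (s≢ a) (trans (cong (lookup s) (sym (trans (sym (N-dual a i)) e))) (trans (s-pr (M a) (in-short i)) (MM a)))
        ... | outside ¬i ¬i′ = M≢ a (trans (sym (N-out a ¬i ¬i′)) e)

        -- Persons outside the chosen cycles never lose: a new partner comes from someone they
        -- accept, by `acc`.
        sc-le : ∀ a → ¬ In a → sc a (N c a) ≤ sc a (M a)
        sc-le a ¬i with kind a
        ... | inside i = ⊥-elim (¬i i)
        ... | outside ¬i₁ ¬i₂ = ≤-reflexive (cong (sc a) (N-out a ¬i₁ ¬i₂))
        ... | dual i = ≤-trans (≤-reflexive (cong (sc a) (N-dual a i)))
                (subst (λ x → sc x (pr (M a)) ≤ sc x (M x)) (trans (s-pr (M a) (in-short i)) (MM a)) (acc (pr (M a))))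

        -- As `b` does not lose, a `b` who now prefers `a` already accepted `a` under `M`; then
        -- `best` puts `s a` ahead of `b` in the eyes of `a`.
        half : ∀ a b → In a → ¬ In b → b ≢ N c a → ¬ (sc a b < sc a (N c a) × sc b a < sc b (N c b)) ⊎ b ≡ a
        half a b i ¬i b≢ with b ≟F a | b ≟F M a
        ... | yes e | _ = inj₂ e
        ... | no b≢a | yes refl = inj₁ λ (_ , q) → <⇒≱ q (≤-trans (sc-le (M a) ¬i) (≤-reflexive (cong (sc (M a)) (MM a))))
        ... | no b≢a | no b≢M = inj₁ λ (p , q) → <-asym (subst (λ x → sc a b < sc a x) (N-in a i) p)
              (best a b b≢a b≢M (λ e → b≢ (trans e (sym (N-in a i)))) (<⇒≤ (≤-trans q (sc-le b ¬i))))

        -- Pairs inside the chosen cycles are covered by `calm`, mixed pairs by `half`, the others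
        -- by the stability of `M`.
        stable : ∀ a b → b ≢ a → b ≢ N c a → ¬ (sc a b < sc a (N c a) × sc b a < sc b (N c b))
        stable a b b≢a b≢N (p , q) = go (lookup c a ≟F one) (lookup c b ≟F one) (b ≟F M a)
          where
          left : ¬ (sc a b < sc a (N c a) × sc b a < sc b (N c b)) ⊎ b ≡ a → ⊥
          left (inj₁ h) = h (p , q)
          left (inj₂ e) = b≢a e
          right : ¬ (sc b a < sc b (N c b) × sc a b < sc a (N c a)) ⊎ a ≡ b → ⊥
          right (inj₁ h) = h (q , p)
          right (inj₂ e) = b≢a (sym e)
          go : Dec (In a) → Dec (In b) → Dec (b ≡ M a) → ⊥
          go (yes i) (no ¬j) _ = left (half a b i ¬j b≢N)
          go (no ¬i) (yes j) _ = right (half b a j ¬i (λ e → b≢N (trans (sym (invol b)) (cong (N c) (sym e)))))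
          go (yes i) (yes j) (yes e) = unlinked a (in-short i) (subst Short e (in-short j))
          go (yes i) (yes j) (no b≢M) = calm a b (in-short i) (in-short j) b≢a b≢M
                  (subst (λ x → sc a b < sc a x) (N-in a i) p , subst (λ x → sc b a < sc b x) (N-in b j) q)
          go (no ¬i) (no ¬j) (no b≢M) = st a b b≢a b≢M (<⇒≤ (≤-trans p (sc-le a ¬i)) , <⇒≤ (≤-trans q (sc-le b ¬j)))
          go (no ¬i) (no ¬j) (yes e) = b≢N (trans e (sym (N-out a ¬i (λ i → ¬j (subst In (sym e) i)))))

      Nv : Mask → Vec (Fin n) n
      Nv c = tabulate (N c)

      N-inj : ∀ c c′ → Closed c → Closed c′ → (∀ a → N c a ≡ N c′ a) → ∀ a → lookup c a ≡ one → lookup c′ a ≡ one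
      N-inj c c′ C C′ e a i with kind c′ C′ a
      ... | inside i′ = i′
      ... | dual i′ = ⊥-elim (unlinked a (in-short c C i) (in-short c′ C′ i′))
      ... | outside ¬i ¬i′ = ⊥-elim (proj₂ (s≢ a) (trans (sym (N-in c C a i)) (trans (e a) (N-out c′ C′ a ¬i ¬i′))))

      bits : ∀ (x y : Fin 2) → (x ≡ one → y ≡ one) → (y ≡ one → x ≡ one) → x ≡ y
      bits zero zero f g = refl
      bits zero (suc zero) f g = g refl
      bits (suc zero) y f g = sym (f refl)

      rot-count : ∀ j → j * D ≤ ∑ (fin n) Yv → 2 ^ j ≤ ∑ (vec (fin n) n) (λ N → 𝟙 (stableFor? sc N))
      rot-count j h = ≤-trans (closed-count j h) (∑-inj uMask (vec (fin n) n) closed? (stableFor? sc) Nv ok inj)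
        where
        look : ∀ c a → lookup (Nv c) a ≡ N c a
        look c a = VecP.lookup∘tabulate (N c) a
        ok : ∀ c → Closed c → StableFor sc (Nv c)
        ok c C = (λ a → trans (look c (lookup (Nv c) a)) (trans (cong (N c) (look c a)) (invol c C a)) , λ e → fixfree c C a (trans (sym (look c a)) e)) ,
          λ a b b≢a b≢N (p , q) → stable c C a b b≢a (λ e → b≢N (trans e (sym (look c a))))
            (subst (λ x → sc a b < sc a x) (look c a) p , subst (λ x → sc b a < sc b x) (look c b) q)
        inj : ∀ c c′ → Closed c → Closed c′ → Nv c ≡ Nv c′ → c ≡ c′
        inj c c′ C C′ e = vec-ext c c′ λ a → bits (lookup c a) (lookup c′ a) (N-inj c c′ C C′ same a) (N-inj c′ c C′ C (λ a → sym (same a)) a)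
          where same : ∀ a → N c a ≡ N c′ a
                same a = trans (sym (look c a)) (trans (cong (λ v → lookup v a) e) (look c′ a))

∑ℕ-last : ∀ T (f : ℕ → ℕ) → ∑ℕ (suc T) f ≡ ∑ℕ T f + f T
∑ℕ-last zero    f = +-comm (f 0) 0
∑ℕ-last (suc T) f = trans (cong (f 0 +_) (∑ℕ-last T (f ∘ suc))) (sym (+-assoc (f 0) _ _))

∑ℕ-shift : ∀ T (f : ℕ → ℕ) → f T ≡ 0 → ∑ℕ T f ≡ f 0 + ∑ℕ T (f ∘ suc)
∑ℕ-shift T f e = trans (sym (trans (cong (∑ℕ T f +_) e) (+-identityʳ _))) (sym (∑ℕ-last T f))

-- Iterated summation

tri : ℕ → ℕ
tri zero    = 0
tri (suc d) = tri d + d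

module Op (B : ℕ) where

  Sup : (ℕ → ℕ) → Set
  Sup f = ∀ r → B ≤ r → f r ≡ 0

  -- K f S is the sum of f over all arguments exceeding S; iterating it counts tuples of positive integers by their sum.
  K : (ℕ → ℕ) → ℕ → ℕ
  K f S = ∑ℕ B (λ d → f (suc (S + d)))

  Ks : ℕ → (ℕ → ℕ) → ℕ → ℕ
  Ks zero    f = f
  Ks (suc m) f = K (Ks m f)

  K-mono : ∀ {f g} → (∀ r → f r ≤ g r) → ∀ S → K f S ≤ K g S
  K-mono h S = ∑-mono (fin B) λ i → h _

  K-cong : ∀ {f g} → (∀ r → f r ≡ g r) → ∀ S → K f S ≡ K g S
  K-cong h S = ∑-cong (fin B) λ i → h _

  K-+ : ∀ f g S → K (λ r → f r + g r) S ≡ K f S + K g S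
  K-+ f g S = ∑-+ (fin B) _ _

  K-* : ∀ c f S → K (λ r → c * f r) S ≡ c * K f S
  K-* c f S = ∑-*ˡ (fin B) c _

  sup-K : ∀ {f} → Sup f → Sup (K f)
  sup-K s r B≤r = ∑-zero (fin B) λ i → s _ (≤-trans B≤r (≤-trans (m≤m+n r _) (n≤1+n _)))

  sup-Ks : ∀ m {f} → Sup f → Sup (Ks m f)
  sup-Ks zero s = s
  sup-Ks (suc m) s = sup-K (sup-Ks m s)

  Ks-mono : ∀ m {f g} → (∀ r → f r ≤ g r) → ∀ S → Ks m f S ≤ Ks m g S
  Ks-mono zero h = h
  Ks-mono (suc m) h = K-mono (Ks-mono m h)

  Ks-+ : ∀ m f g S → Ks m (λ r → f r + g r) S ≡ Ks m f S + Ks m g S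
  Ks-+ zero f g S = refl
  Ks-+ (suc m) f g S = trans (K-cong (Ks-+ m f g) S) (K-+ (Ks m f) (Ks m g) S)

  Ks-* : ∀ m c f S → Ks m (λ r → c * f r) S ≡ c * Ks m f S
  Ks-* zero c f S = refl
  Ks-* (suc m) c f S = trans (K-cong (Ks-* m c f) S) (K-* c (Ks m f) S)

  private
    far : ∀ S → B ≤ suc (S + B)
    far S = ≤-trans (m≤n+m B S) (n≤1+n _)

    weighted-shift : ∀ (c : ℕ → ℕ) f → Sup f → ∀ S → ∑ℕ B (λ d → c d * f (suc (S + d))) ≡ c 0 * f (suc S) + ∑ℕ B (λ d → c (suc d) * f (suc (suc S + d)))
    weighted-shift c f s S = trans (∑ℕ-shift B (λ d → c d * f (suc (S + d))) (trans (cong (c B *_) (s _ (far S))) (*-zeroʳ (c B))))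
      (cong₂ _+_ (cong (λ x → c 0 * f (suc x)) (+-identityʳ S)) (∑ℕ-cong B λ d _ → cong (λ x → c (suc d) * f (suc x)) (+-suc S d)))

  K-step : ∀ f → Sup f → ∀ S → K f S ≡ f (suc S) + K f (suc S)
  K-step f s S = begin
    K f S ≡⟨ ∑ℕ-cong B {λ d → f (suc (S + d))} {λ d → 1 * f (suc (S + d))} (λ d _ → sym (*-identityˡ _)) ⟩
    ∑ℕ B (λ d → 1 * f (suc (S + d))) ≡⟨ weighted-shift (λ _ → 1) f s S ⟩
    1 * f (suc S) + ∑ℕ B (λ d → 1 * f (suc (suc S + d))) ≡⟨ cong₂ _+_ (*-identityˡ _) (∑ℕ-cong B {λ d → 1 * f (suc (suc S + d))} {λ d → f (suc (suc S + d))} (λ d _ → *-identityˡ _)) ⟩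
    f (suc S) + K f (suc S) ∎
    where open ≡-Reasoning

  -- Backward induction from the end of the support: a function is fixed by its differences.
  determined : ∀ X X′ (Y : ℕ → ℕ) → Sup X → Sup X′ → (∀ S → X S ≡ Y S + X (suc S)) → (∀ S → X′ S ≡ Y S + X′ (suc S)) → ∀ S → X S ≡ X′ S
  determined X X′ Y s s′ h h′ S = go B S (m≤n+m B S)
    where
    go : ∀ k S → B ≤ S + k → X S ≡ X′ S
    go zero S le = trans (s S (≤-trans le (≤-reflexive (+-identityʳ S)))) (sym (s′ S (≤-trans le (≤-reflexive (+-identityʳ S)))))
    go (suc k) S le = trans (h S) (trans (cong (Y S +_) (go k (suc S) (≤-trans le (≤-reflexive (+-suc S k))))) (sym (h′ S)))

  Mom : (ℕ → ℕ) → (ℕ → ℕ) → ℕ → ℕ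
  Mom c f S = ∑ℕ B (λ d → c d * f (suc (S + d)))

  sup-Mom : ∀ c {f} → Sup f → Sup (Mom c f)
  sup-Mom c s r B≤r = ∑-zero (fin B) λ i → trans (cong (c (toℕ i) *_) (s _ (≤-trans B≤r (≤-trans (m≤m+n r _) (n≤1+n _))))) (*-zeroʳ (c (toℕ i)))

  -- The factor `d` is a sum of `d` ones and costs one more summation; a triangular number, in
  -- `mom₂`, costs two.
  mom₁ : ∀ f → Sup f → ∀ S → Mom id f S ≡ K (K f) S
  mom₁ f s = determined (Mom id f) (K (K f)) (λ S → K f (suc S)) (sup-Mom id s) (sup-K (sup-K s))
    (λ S → trans (weighted-shift id f s S) (∑-+ (fin B) _ _)) (K-step (K f) (sup-K s))

  mom₂ : ∀ f → Sup f → ∀ S → Mom tri f S ≡ K (K (K f)) S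
  mom₂ f s = determined (Mom tri f) (K (K (K f))) (λ S → K (K f) (suc S)) (sup-Mom tri s) (sup-K (sup-K (sup-K s)))
    (λ S → trans (weighted-shift tri f s S) (trans (∑-cong (fin B) λ i → *-distribʳ-+ (f (suc (suc S + toℕ i))) (tri (toℕ i)) (toℕ i)) (trans (∑-+ (fin B) _ _)
        (trans (cong (Mom tri f (suc S) +_) (mom₁ f s (suc S))) (+-comm _ (K (K f) (suc S)))))))
    (K-step (K (K f)) (sup-K (sup-K s)))

  K-id : ∀ f → Sup f → ∀ S → K (λ r → r * f r) S ≡ S * K f S + (K f S + K (K f) S)
  K-id f s S = begin
    ∑ℕ B (λ d → suc (S + d) * f (suc (S + d))) ≡⟨ ∑ℕ-cong B (λ d _ → lem S d (f (suc (S + d)))) ⟩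
    ∑ℕ B (λ d → S * f (suc (S + d)) + (f (suc (S + d)) + d * f (suc (S + d)))) ≡⟨ trans (∑-+ (fin B) _ _) (cong₂ _+_ (∑-*ˡ (fin B) S _) (trans (∑-+ (fin B) _ _) (cong (K f S +_) (mom₁ f s S)))) ⟩
    S * K f S + (K f S + K (K f) S) ∎
    where
    open ≡-Reasoning
    lem : ∀ s d x → suc (s + d) * x ≡ s * x + (x + d * x)
    lem = solve-∀

  -- The commutator of iterated summation with multiplication by the argument; both integrations by
  -- parts below rest on it.
  Ks-id : ∀ m f → Sup f → ∀ S → Ks m (λ r → r * f r) S ≡ S * Ks m f S + m * (Ks m f S + Ks (suc m) f S)
  Ks-id zero f s S = sym (+-identityʳ _)
  Ks-id (suc m) f s S = begin
    K (Ks m (λ r → r * f r)) S ≡⟨ K-cong (Ks-id m f s) S ⟩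
    K (λ r → r * F r + m * (F r + K F r)) S ≡⟨ trans (K-+ (λ r → r * F r) (λ r → m * (F r + K F r)) S) (cong₂ _+_ (K-id F (sup-Ks m s) S) (trans (K-* m (λ r → F r + K F r) S) (cong (m *_) (K-+ F (K F) S)))) ⟩
    S * K F S + (K F S + K (K F) S) + m * (K F S + K (K F) S) ≡⟨ lem (S * K F S) (K F S + K (K F) S) m ⟩
    S * K F S + suc m * (K F S + K (K F) S) ∎
    where
    open ≡-Reasoning
    F = Ks m f
    lem : ∀ a b m → a + b + m * b ≡ a + suc m * b
    lem = solve-∀

  Ks-suc : ∀ m f S → Ks m (λ r → f (suc r)) S ≡ Ks m f (suc S)
  Ks-suc zero f S = refl
  Ks-suc (suc m) f S = ∑ℕ-cong B λ d _ → Ks-suc m f (suc (S + d))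

  Ks-anti : ∀ m f → Sup f → f 1 ≤ f 0 → Ks m f 1 ≤ Ks m f 0
  Ks-anti zero f s h = h
  Ks-anti (suc m) f s h = ≤-trans (m≤n+m _ _) (≤-reflexive (sym (K-step (Ks m f) (sup-Ks m s) 0)))

  -- Integration by parts for weights h with h(S) − h(S+1) ≥ S h(S) / N′.
  J-step : ∀ h N′ → Sup h → (∀ S → S * h S + N′ * h (suc S) ≤ N′ * h S) → h 1 ≤ h 0 → ∀ m → suc m * Ks (suc (suc m)) h 0 ≤ N′ * Ks m h 0
  J-step h N′ s diff h10 m = +-cancelʳ-≤ (N′ * Ks (suc m) h 1) _ _ (begin
    suc m * Ks (suc (suc m)) h 0 + N′ * Ks (suc m) h 1 ≤⟨ +-monoˡ-≤ _ (*-monoʳ-≤ (suc m) (m≤n+m (Ks (suc (suc m)) h 0) (Ks (suc m) h 0))) ⟩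
    suc m * (Ks (suc m) h 0 + Ks (suc (suc m)) h 0) + N′ * Ks (suc m) h 1 ≡⟨ cong₂ _+_ (sym (Ks-id (suc m) h s 0)) (trans (cong (N′ *_) (sym (Ks-suc (suc m) h 0))) (sym (Ks-* (suc m) N′ _ 0))) ⟩
    Ks (suc m) (λ r → r * h r) 0 + Ks (suc m) (λ r → N′ * h (suc r)) 0 ≡⟨ sym (Ks-+ (suc m) _ _ 0) ⟩
    Ks (suc m) (λ r → r * h r + N′ * h (suc r)) 0 ≤⟨ Ks-mono (suc m) diff 0 ⟩
    Ks (suc m) (λ r → N′ * h r) 0 ≡⟨ Ks-* (suc m) N′ h 0 ⟩
    N′ * Ks (suc m) h 0 ≡⟨ cong (N′ *_) (K-step (Ks m h) (sup-Ks m s) 0) ⟩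
    N′ * (Ks m h 1 + Ks (suc m) h 1) ≤⟨ *-monoʳ-≤ N′ (+-monoˡ-≤ _ (Ks-anti m h s h10)) ⟩
    N′ * (Ks m h 0 + Ks (suc m) h 1) ≡⟨ *-distribˡ-+ N′ _ _ ⟩
    N′ * Ks m h 0 + N′ * Ks (suc m) h 1 ∎)
    where open ≤-Reasoning

  -- On the support the argument is at most `σ`. Iteration over `m` gives the volume bound of a
  -- simplex.
  J-bounded : ∀ h σ → Sup h → (∀ S → S * h S ≤ σ * h S) → ∀ m → m * Ks (suc m) h 0 ≤ σ * Ks m h 0
  J-bounded h σ s b m = begin
    m * Ks (suc m) h 0 ≤⟨ *-monoʳ-≤ m (m≤n+m _ (Ks m h 0)) ⟩
    m * (Ks m h 0 + Ks (suc m) h 0) ≡⟨ sym (Ks-id m h s 0) ⟩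
    Ks m (λ r → r * h r) 0 ≤⟨ Ks-mono m b 0 ⟩
    Ks m (λ r → σ * h r) 0 ≡⟨ Ks-* m σ h 0 ⟩
    σ * Ks m h 0 ∎
    where open ≤-Reasoning

  private
    -- Brings a square into a form that `mom₂` can sum. The constants are such that equality holds
    -- for `d` equal to 1 and 2.
    sq-tri : ∀ d → suc d * suc d ≤ 4 + 5 * tri d
    sq-tri zero = s≤s z≤n
    sq-tri (suc zero) = ≤-refl
    sq-tri (suc (suc zero)) = ≤-refl
    sq-tri (suc (suc (suc d))) = ≤-trans (≤-reflexive (lem d)) (≤-trans (+-mono-≤ (sq-tri (suc (suc d))) (≤-trans (m≤m+n (7 + 2 * d) (3 + 3 * d)) (≤-reflexive (lem′ d)))) (≤-reflexive (lem″ (tri (suc (suc d))) d)))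
      where
      lem : ∀ d → (4 + d) * (4 + d) ≡ (3 + d) * (3 + d) + (7 + 2 * d)
      lem = solve-∀
      lem′ : ∀ d → 7 + 2 * d + (3 + 3 * d) ≡ 5 * (2 + d)
      lem′ = solve-∀
      lem″ : ∀ t d → 4 + 5 * t + 5 * (2 + d) ≡ 4 + 5 * (t + (2 + d))
      lem″ = solve-∀

  -- Summation over one coordinate t from 1 to `L` with weight N + 8t², the price that `e-recover`
  -- charges for a square.
  O : ℕ → ℕ → (ℕ → ℕ) → ℕ → ℕ
  O L N f S = ∑ℕ L (λ a → (N + 8 * (suc a * suc a)) * f (S + suc a))

  ∑ℕ-extend : ∀ L (f : ℕ → ℕ) {T} → L ≤ T → ∑ℕ L f ≤ ∑ℕ T f
  ∑ℕ-extend zero f h = z≤n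
  ∑ℕ-extend (suc L) f (s≤s h) = +-monoʳ-≤ (f 0) (∑ℕ-extend L (f ∘ suc) h)

  O-bound : ∀ L N f → L ≤ B → Sup f → ∀ S → O L N f S ≤ (N + 32) * K f S + 40 * Ks 3 f S
  O-bound L N f L≤B s S = begin
    O L N f S ≤⟨ ∑ℕ-extend L (λ a → (N + 8 * (suc a * suc a)) * f (S + suc a)) L≤B ⟩
    ∑ℕ B (λ a → (N + 8 * (suc a * suc a)) * f (S + suc a)) ≤⟨ ∑ℕ-mono B (λ a _ → ≤-trans (*-monoˡ-≤ (f (S + suc a)) (+-monoʳ-≤ N (*-monoʳ-≤ 8 (sq-tri a))))
         (≤-reflexive (trans (cong (λ x → (N + 8 * (4 + 5 * tri a)) * f x) (+-suc S a)) (lem N (tri a) (f (suc (S + a))))))) ⟩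
    ∑ℕ B (λ a → (N + 32) * f (suc (S + a)) + 40 * (tri a * f (suc (S + a)))) ≡⟨ trans (∑-+ (fin B) _ _) (cong₂ _+_ (∑-*ˡ (fin B) (N + 32) _) (trans (∑-*ˡ (fin B) 40 _) (cong (40 *_) (mom₂ f s S)))) ⟩
    (N + 32) * K f S + 40 * Ks 3 f S ∎
    where
    open ≤-Reasoning
    lem : ∀ n t x → (n + 8 * (4 + 5 * t)) * x ≡ (n + 32) * x + 40 * (t * x)
    lem = solve-∀

  Os : ℕ → ℕ → ℕ → (ℕ → ℕ) → ℕ → ℕ
  Os zero    L N f = f
  Os (suc j) L N f = Os j L N (O L N f)

  O-mono : ∀ L N {f g} → (∀ r → f r ≤ g r) → ∀ S → O L N f S ≤ O L N g S
  O-mono L N h S = ∑-mono (fin L) λ i → *-monoʳ-≤ (N + 8 * (suc (toℕ i) * suc (toℕ i))) (h _)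

  Os-mono : ∀ j L N {f g} → (∀ r → f r ≤ g r) → ∀ S → Os j L N f S ≤ Os j L N g S
  Os-mono zero L N h = h
  Os-mono (suc j) L N h = Os-mono j L N (O-mono L N h)

  O-lin : ∀ L N c d f g S → O L N (λ r → c * f r + d * g r) S ≡ c * O L N f S + d * O L N g S
  O-lin L N c d f g S = trans (∑-cong (fin L) λ i → lem (N + 8 * (suc (toℕ i) * suc (toℕ i))) c (f (S + suc (toℕ i))) d (g (S + suc (toℕ i))))
    (trans (∑-+ (fin L) _ _) (cong₂ _+_ (∑-*ˡ (fin L) c _) (∑-*ˡ (fin L) d _)))
    where lem : ∀ w c x d y → w * (c * x + d * y) ≡ c * (w * x) + d * (w * y)
          lem = solve-∀

  O-cong : ∀ L N {f g} → (∀ r → f r ≡ g r) → ∀ S → O L N f S ≡ O L N g S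
  O-cong L N h S = ∑-cong (fin L) λ i → cong ((N + 8 * (suc (toℕ i) * suc (toℕ i))) *_) (h _)

  Os-cong : ∀ j L N {f g} → (∀ r → f r ≡ g r) → ∀ S → Os j L N f S ≡ Os j L N g S
  Os-cong zero L N h = h
  Os-cong (suc j) L N h = Os-cong j L N (O-cong L N h)

  Os-lin : ∀ j L N c d f g S → Os j L N (λ r → c * f r + d * g r) S ≡ c * Os j L N f S + d * Os j L N g S
  Os-lin zero L N c d f g S = refl
  Os-lin (suc j) L N c d f g S = trans (Os-cong j L N (O-lin L N c d f g) S) (Os-lin j L N c d (O L N f) (O L N g) S)

  module _ (h : ℕ → ℕ) (sh : Sup h) (N N′ L n : ℕ) (L≤B : L ≤ B)
    (J2 : ∀ m → suc m * Ks (suc (suc m)) h 0 ≤ N′ * Ks m h 0) where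

    X : ℕ
    X = n * (N + 32) + 40 * N′

    -- Each `O` becomes one `K` with factor `N + 32`, or three with factor 40. `J2` removes the two
    -- extra ones at the price N′/n, since at least `n` are present. So the factor per coordinate is
    -- X/n.
    Os-bound : ∀ j m → n ≤ m + j → n ^ j * Os j L N (Ks m h) 0 ≤ X ^ j * Ks (m + j) h 0
    Os-bound zero m le = ≤-reflexive (cong (λ x → 1 * Ks x h 0) (sym (+-identityʳ m)))
    Os-bound (suc j) m le = begin
      n ^ suc j * Os j L N (O L N (Ks m h)) 0 ≤⟨ *-monoʳ-≤ (n ^ suc j) (≤-trans (Os-mono j L N (O-bound L N (Ks m h) L≤B (sup-Ks m sh)) 0) (≤-reflexive (Os-lin j L N (N + 32) 40 _ _ 0))) ⟩
      n ^ suc j * ((N + 32) * Os j L N (Ks (suc m) h) 0 + 40 * Os j L N (Ks (3 + m) h) 0) ≡⟨ lem n (n ^ j) (N + 32) _ 40 _ ⟩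
      n * (N + 32) * (n ^ j * Os j L N (Ks (suc m) h) 0) + n * 40 * (n ^ j * Os j L N (Ks (3 + m) h) 0)
        ≤⟨ +-mono-≤ (*-monoʳ-≤ (n * (N + 32)) (Os-bound j (suc m) le′)) (*-monoʳ-≤ (n * 40) (Os-bound j (3 + m) (≤-trans le′ (≤-trans (n≤1+n _) (n≤1+n _))))) ⟩
      n * (N + 32) * (X ^ j * Ks (suc m + j) h 0) + n * 40 * (X ^ j * Ks (3 + m + j) h 0) ≡⟨ lem₂ (n * (N + 32)) (X ^ j) (Ks (suc m + j) h 0) n (Ks (3 + m + j) h 0) ⟩
      X ^ j * (n * (N + 32) * Ks (suc m + j) h 0 + 40 * (n * Ks (3 + m + j) h 0)) ≤⟨ *-monoʳ-≤ (X ^ j) (+-monoʳ-≤ (n * (N + 32) * Ks (suc m + j) h 0) (*-monoʳ-≤ 40 (≤-trans (*-monoˡ-≤ (Ks (3 + m + j) h 0) (≤-trans le′ (n≤1+n _))) (J2 (suc (m + j)))))) ⟩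
      X ^ j * (n * (N + 32) * Ks (suc m + j) h 0 + 40 * (N′ * Ks (suc m + j) h 0)) ≡⟨ lem₃ (X ^ j) (n * (N + 32)) (Ks (suc m + j) h 0) N′ ⟩
      X * X ^ j * Ks (suc m + j) h 0 ≡⟨ cong (λ x → X ^ suc j * Ks x h 0) (sym (+-suc m j)) ⟩
      X ^ suc j * Ks (m + suc j) h 0 ∎
      where
      open ≤-Reasoning
      le′ : n ≤ suc m + j
      le′ = ≤-trans le (≤-reflexive (+-suc m j))
      lem : ∀ n p a x b y → n * p * (a * x + b * y) ≡ n * a * (p * x) + n * b * (p * y)
      lem = solve-∀
      lem₂ : ∀ a p x n y → a * (p * x) + n * 40 * (p * y) ≡ p * (a * x + 40 * (n * y))
      lem₂ = solve-∀
      lem₃ : ∀ p a x c → p * (a * x + 40 * (c * x)) ≡ (a + 40 * c) * p * x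
      lem₃ = solve-∀

-- A discrete exponential

^-distrib-* : ∀ a b k → (a * b) ^ k ≡ a ^ k * b ^ k
^-distrib-* a b zero = refl
^-distrib-* a b (suc k) = trans (cong (a * b *_) (^-distrib-* a b k)) (lem a b (a ^ k) (b ^ k))
  where lem : ∀ a b c d → a * b * (c * d) ≡ a * c * (b * d)
        lem = solve-∀

-- Bernoulli's inequality for 1 - 1/(m+1), with denominators cleared.
bernoulli : ∀ m k → suc m ^ k * (suc m ∸ k) ≤ m ^ k * suc m
bernoulli m zero = ≤-refl
bernoulli m (suc k) = begin
  suc m * suc m ^ k * (m ∸ k) ≡⟨ lem (suc m) (suc m ^ k) (m ∸ k) ⟩
  suc m ^ k * (suc m * (m ∸ k)) ≤⟨ *-monoʳ-≤ (suc m ^ k) (step (k ≤? m)) ⟩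
  suc m ^ k * (m * (suc m ∸ k)) ≡⟨ lem′ (suc m ^ k) m (suc m ∸ k) ⟩
  m * (suc m ^ k * (suc m ∸ k)) ≤⟨ *-monoʳ-≤ m (bernoulli m k) ⟩
  m * (m ^ k * suc m) ≡⟨ sym (*-assoc m _ _) ⟩
  m * m ^ k * suc m ∎
  where
  open ≤-Reasoning
  lem : ∀ a b c → a * b * c ≡ b * (a * c)
  lem = solve-∀
  lem′ : ∀ a b c → a * (b * c) ≡ b * (a * c)
  lem′ = solve-∀
  step : Dec (k ≤ m) → suc m * (m ∸ k) ≤ m * (suc m ∸ k)
  step (no k≰m) = ≤-trans (≤-reflexive (trans (cong (suc m *_) (m≤n⇒m∸n≡0 (<⇒≤ (≰⇒> k≰m)))) (*-zeroʳ (suc m)))) z≤n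
  step (yes k≤m) = ≤-trans (+-monoˡ-≤ (m * (m ∸ k)) (m∸n≤m m k)) (≤-reflexive (trans (lem″ m (m ∸ k)) (cong (m *_) (sym (+-∸-assoc 1 k≤m)))))
    where lem″ : ∀ m d → m + m * d ≡ m * suc d
          lem″ = solve-∀

half-pow : ∀ m k → k + k ≤ suc m → suc m ^ k ≤ 2 * m ^ k
half-pow m k h = *-cancelʳ-≤ _ _ (suc m) (begin
  suc m ^ k * suc m ≤⟨ *-monoʳ-≤ (suc m ^ k) le ⟩
  suc m ^ k * (2 * (suc m ∸ k)) ≡⟨ lem (suc m ^ k) (suc m ∸ k) ⟩
  2 * (suc m ^ k * (suc m ∸ k)) ≤⟨ *-monoʳ-≤ 2 (bernoulli m k) ⟩
  2 * (m ^ k * suc m) ≡⟨ sym (*-assoc 2 (m ^ k) (suc m)) ⟩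
  2 * m ^ k * suc m ∎)
  where
  open ≤-Reasoning
  lem : ∀ a b → a * (2 * b) ≡ 2 * (a * b)
  lem = solve-∀
  le : suc m ≤ 2 * (suc m ∸ k)
  le = +-cancelʳ-≤ (k + k) _ _ (≤-trans (+-monoʳ-≤ (suc m) h) (≤-reflexive (trans (cong₂ _+_ (sym e) (sym e)) (lem′ (suc m ∸ k) k))))
    where
    e : suc m ∸ k + k ≡ suc m
    e = m∸n+n≡m (≤-trans (m≤m+n k k) h)
    lem′ : ∀ a k → a + k + (a + k) ≡ 2 * a + (k + k)
    lem′ = solve-∀

-- The constant 4 takes the place of Euler's number: each half of the exponent costs a factor 2 by
-- `half-pow`.
pow-suc : ∀ m n → n ≤ m → suc m ^ n ≤ 4 * m ^ n
pow-suc m n h = begin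
  suc m ^ n ≡⟨ cong (suc m ^_) (sym (⌊n/2⌋+⌈n/2⌉≡n n)) ⟩
  suc m ^ (⌊ n /2⌋ + ⌈ n /2⌉) ≡⟨ ^-distribˡ-+-* (suc m) ⌊ n /2⌋ ⌈ n /2⌉ ⟩
  suc m ^ ⌊ n /2⌋ * suc m ^ ⌈ n /2⌉ ≤⟨ *-mono-≤ (half-pow m ⌊ n /2⌋ (≤-trans (+-monoʳ-≤ ⌊ n /2⌋ (⌊n/2⌋≤⌈n/2⌉ n)) (≤-trans (≤-reflexive (⌊n/2⌋+⌈n/2⌉≡n n)) (≤-trans h (n≤1+n m)))))
       (half-pow m ⌈ n /2⌉ (≤-trans (≤-reflexive refl) (≤-trans (+-monoˡ-≤ ⌈ n /2⌉ (up n)) (s≤s (≤-trans (≤-reflexive (⌊n/2⌋+⌈n/2⌉≡n n)) h))))) ⟩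
  2 * m ^ ⌊ n /2⌋ * (2 * m ^ ⌈ n /2⌉) ≡⟨ lem (m ^ ⌊ n /2⌋) (m ^ ⌈ n /2⌉) ⟩
  4 * (m ^ ⌊ n /2⌋ * m ^ ⌈ n /2⌉) ≡⟨ cong (4 *_) (trans (sym (^-distribˡ-+-* m ⌊ n /2⌋ ⌈ n /2⌉)) (cong (m ^_) (⌊n/2⌋+⌈n/2⌉≡n n))) ⟩
  4 * m ^ n ∎
  where
  open ≤-Reasoning
  lem : ∀ a b → 2 * a * (2 * b) ≡ 4 * (a * b)
  lem = solve-∀
  up : ∀ n → ⌈ n /2⌉ ≤ suc ⌊ n /2⌋
  up zero = z≤n
  up (suc zero) = ≤-refl
  up (suc (suc n)) = s≤s (up n)

pow-shift : ∀ n c → (n + c) ^ n ≤ 4 ^ c * n ^ n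
pow-shift n zero = ≤-reflexive (trans (cong (_^ n) (+-identityʳ n)) (sym (*-identityˡ _)))
pow-shift n (suc c) = begin
  (n + suc c) ^ n ≡⟨ cong (_^ n) (+-suc n c) ⟩
  suc (n + c) ^ n ≤⟨ pow-suc (n + c) n (m≤m+n n c) ⟩
  4 * (n + c) ^ n ≤⟨ *-monoʳ-≤ 4 (pow-shift n c) ⟩
  4 * (4 ^ c * n ^ n) ≡⟨ sym (*-assoc 4 (4 ^ c) _) ⟩
  4 ^ suc c * n ^ n ∎
  where open ≤-Reasoning

-- e k / N^Kx is the discrete exponential (1 − 1/N)^k, cleared of denominators; it behaves as such for k ≤ Kx.
module Exp (N₁ Kx : ℕ) where

  N : ℕ
  N = suc N₁

  e : ℕ → ℕ
  e k = N₁ ^ k * N ^ (Kx ∸ k)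

  e-step : ∀ k → suc k ≤ Kx → e (suc k) * N ≡ e k * N₁
  e-step k h = trans (lem N₁ (N₁ ^ k) (N ^ (Kx ∸ suc k)) N) (cong (λ x → N₁ ^ k * N ^ x * N₁) (sym (+-∸-assoc 1 h)))
    where lem : ∀ a b c d → a * b * c * d ≡ b * (d * c) * a
          lem = solve-∀

  e-lower : ∀ a b → b + a ≤ Kx → (N ∸ a) * e b ≤ N * e (b + a)
  e-lower zero b h = ≤-reflexive (cong (λ x → N * e x) (sym (+-identityʳ b)))
  e-lower (suc a) b h = *-cancelˡ-≤ N (begin
    N * ((N₁ ∸ a) * e b) ≡⟨ sym (*-assoc N (N₁ ∸ a) (e b)) ⟩
    N * (N₁ ∸ a) * e b ≤⟨ *-monoˡ-≤ (e b) (sub (a ≤? N₁)) ⟩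
    N₁ * (N ∸ a) * e b ≡⟨ *-assoc N₁ _ _ ⟩
    N₁ * ((N ∸ a) * e b) ≤⟨ *-monoʳ-≤ N₁ (e-lower a b (≤-trans (+-monoʳ-≤ b (n≤1+n a)) h)) ⟩
    N₁ * (N * e (b + a)) ≡⟨ lem N₁ N (e (b + a)) ⟩
    N * (e (b + a) * N₁) ≡⟨ cong (N *_) (sym (e-step (b + a) (≤-trans (≤-reflexive (sym (+-suc b a))) h))) ⟩
    N * (e (suc (b + a)) * N) ≡⟨ cong (N *_) (trans (*-comm _ N) (cong (λ x → N * e x) (sym (+-suc b a)))) ⟩
    N * (N * e (b + suc a)) ∎)
    where
    open ≤-Reasoning
    lem : ∀ a b c → a * (b * c) ≡ b * (c * a)
    lem = solve-∀
    sub : Dec (a ≤ N₁) → N * (N₁ ∸ a) ≤ N₁ * (N ∸ a)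
    sub (no q) = ≤-trans (≤-reflexive (trans (cong (N *_) (m≤n⇒m∸n≡0 (<⇒≤ (≰⇒> q)))) (*-zeroʳ N))) z≤n
    sub (yes q) = ≤-trans (+-monoˡ-≤ (N₁ * (N₁ ∸ a)) (m∸n≤m N₁ a)) (≤-reflexive (trans (lem″ N₁ (N₁ ∸ a)) (cong (N₁ *_) (sym (+-∸-assoc 1 q)))))
      where lem″ : ∀ m d → m + m * d ≡ m * suc d
            lem″ = solve-∀

  e-upper : ∀ s k → k + s ≤ Kx → e (k + s) * (N + s) ≤ N * e k
  e-upper zero k h = ≤-reflexive (trans (cong₂ (λ x y → e x * y) (+-identityʳ k) (+-identityʳ N)) (*-comm (e k) N))
  e-upper (suc s) k h = *-cancelʳ-≤ _ _ N (begin
    e (k + suc s) * (N + suc s) * N ≡⟨ trans (cong (λ x → e x * (N + suc s) * N) (+-suc k s)) (lem (e (suc (k + s))) (N + suc s) N) ⟩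
    e (suc (k + s)) * N * (N + suc s) ≡⟨ cong (_* (N + suc s)) (e-step (k + s) (≤-trans (≤-reflexive (sym (+-suc k s))) h)) ⟩
    e (k + s) * N₁ * (N + suc s) ≤⟨ ≤-trans (≤-reflexive (*-assoc (e (k + s)) N₁ _)) (*-monoʳ-≤ (e (k + s)) (≤-trans (m≤m+n (N₁ * (N + suc s)) (suc s)) (≤-reflexive (lem′ N₁ s)))) ⟩
    e (k + s) * ((N + s) * N) ≡⟨ sym (*-assoc (e (k + s)) (N + s) N) ⟩
    e (k + s) * (N + s) * N ≤⟨ *-monoˡ-≤ N (e-upper s k (≤-trans (+-monoʳ-≤ k (n≤1+n s)) h)) ⟩
    N * e k * N ∎)
    where
    open ≤-Reasoning
    lem : ∀ a b c → a * b * c ≡ a * c * b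
    lem = solve-∀
    lem′ : ∀ m s → m * (suc m + suc s) + suc s ≡ (suc m + s) * suc m
    lem′ = solve-∀

  e-mono : ∀ k s → k + s ≤ Kx → e (k + s) ≤ e k
  e-mono k s h = *-cancelʳ-≤ _ _ N (≤-trans (≤-trans (*-monoʳ-≤ (e (k + s)) (m≤m+n N s)) (e-upper s k h)) (≤-reflexive (*-comm N (e k))))

  e-anti : ∀ {k l} → k ≤ l → l ≤ Kx → e l ≤ e k
  e-anti {k} {l} k≤l h = subst (λ x → e x ≤ e k) (m+[n∸m]≡n k≤l) (e-mono k (l ∸ k) (≤-trans (≤-reflexive (m+[n∸m]≡n k≤l)) h))

  e-halve : ∀ j k → k + j * N ≤ Kx → 2 ^ j * e (k + j * N) ≤ e k
  e-halve zero k h = ≤-reflexive (trans (*-identityˡ _) (cong e (+-identityʳ k)))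
  e-halve (suc j) k h = ≤-trans (begin
    2 ^ suc j * e (k + suc j * N) ≡⟨ cong₂ (λ x y → x * e y) (*-comm 2 (2 ^ j)) (lem k N (j * N)) ⟩
    2 ^ j * 2 * e (k + j * N + N) ≡⟨ *-assoc (2 ^ j) 2 _ ⟩
    2 ^ j * (2 * e (k + j * N + N)) ≤⟨ *-monoʳ-≤ (2 ^ j) (once (k + j * N) (≤-trans (≤-reflexive (sym (lem k N (j * N)))) h)) ⟩
    2 ^ j * e (k + j * N) ∎) (e-halve j k (≤-trans (+-monoʳ-≤ k (m≤n+m (j * N) N)) h))
    where
    open ≤-Reasoning
    lem : ∀ a b c → a + (b + c) ≡ a + c + b
    lem = solve-∀
    once : ∀ k → k + N ≤ Kx → 2 * e (k + N) ≤ e k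
    once k h = *-cancelˡ-≤ N (≤-trans (≤-reflexive (lem′ N (e (k + N)))) (e-upper N k h))
      where lem′ : ∀ n x → n * (2 * x) ≡ x * (n + n)
            lem′ = solve-∀

  -- Enlarging the exponent by `b` is paid for by 1 + 8b/N. Up to b = N/2 this is (1 - b/N)(1 +
  -- 8b/N) ≥ 1. Beyond, `b` is cut into halves: two factors of at least 1/2 are lost, while 1 + 8b/N
  -- is at least 5.
  e-recover : ∀ H → N ≡ H + H → ∀ k b → b ≤ N → k + b ≤ Kx → e k * N ≤ e (k + b) * (N + 8 * b)
  e-recover H NH k b b≤N h = go (b ≤? H)
    where
    open ≤-Reasoning
    go : Dec (b ≤ H) → e k * N ≤ e (k + b) * (N + 8 * b)
    go (yes b≤H) = *-cancelˡ-≤ N (begin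
      N * (e k * N) ≡⟨ lem (e k) N ⟩
      N * N * e k ≤⟨ *-monoˡ-≤ (e k) key ⟩
      (N + 8 * b) * (N ∸ b) * e k ≡⟨ *-assoc (N + 8 * b) (N ∸ b) (e k) ⟩
      (N + 8 * b) * ((N ∸ b) * e k) ≤⟨ *-monoʳ-≤ (N + 8 * b) (e-lower b k h) ⟩
      (N + 8 * b) * (N * e (k + b)) ≡⟨ lem′ (N + 8 * b) N (e (k + b)) ⟩
      N * (e (k + b) * (N + 8 * b)) ∎)
      where
      lem : ∀ a n → n * (a * n) ≡ n * n * a
      lem = solve-∀
      lem′ : ∀ a n x → a * (n * x) ≡ n * (x * a)
      lem′ = solve-∀
      d = N ∸ b
      dN : d + b ≡ N
      dN = m∸n+n≡m b≤N
      b≤d : b ≤ d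
      b≤d = +-cancelʳ-≤ b _ _ (≤-trans (+-mono-≤ b≤H b≤H) (≤-reflexive (trans (sym NH) (sym dN))))
      key : N * N ≤ (N + 8 * b) * d
      key = subst (λ x → x * x ≤ (x + 8 * b) * d) dN (≤-trans (≤-reflexive (lemA d b)) (≤-trans (+-monoʳ-≤ (d * d) (≤-trans (+-monoʳ-≤ (2 * (b * d)) (*-monoʳ-≤ b b≤d)) (≤-trans (m≤m+n (2 * (b * d) + b * d) (6 * (b * d))) (≤-reflexive (lemB d b)))))
            (≤-reflexive (lemC d b))))
        where
        lemA : ∀ d b → (d + b) * (d + b) ≡ d * d + (2 * (b * d) + b * b)
        lemA = solve-∀
        lemB : ∀ d b → 2 * (b * d) + b * d + 6 * (b * d) ≡ 9 * (b * d)
        lemB = solve-∀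
        lemC : ∀ d b → d * d + 9 * (b * d) ≡ (d + b + 8 * b) * d
        lemC = solve-∀
    go (no b≰H) = *-cancelˡ-≤ (N * N) {{m*n≢0 N N}} (begin
      N * N * (e k * N) ≡⟨ lem N (e k) ⟩
      N * N * N * e k ≤⟨ *-monoˡ-≤ (e k) key ⟩
      (N + 8 * b) * ((N ∸ b₂) * (N ∸ b₁)) * e k ≡⟨ lem₁ (N + 8 * b) (N ∸ b₂) (N ∸ b₁) (e k) ⟩
      (N + 8 * b) * ((N ∸ b₂) * ((N ∸ b₁) * e k)) ≤⟨ *-monoʳ-≤ (N + 8 * b) (*-monoʳ-≤ (N ∸ b₂) (e-lower b₁ k (≤-trans (+-monoʳ-≤ k (≤-trans (m≤m+n b₁ b₂) (≤-reflexive bb))) h))) ⟩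
      (N + 8 * b) * ((N ∸ b₂) * (N * e (k + b₁))) ≡⟨ lem₂ (N + 8 * b) (N ∸ b₂) N (e (k + b₁)) ⟩
      (N + 8 * b) * N * ((N ∸ b₂) * e (k + b₁)) ≤⟨ *-monoʳ-≤ ((N + 8 * b) * N) (e-lower b₂ (k + b₁) (≤-trans (≤-reflexive kbb) h)) ⟩
      (N + 8 * b) * N * (N * e (k + b₁ + b₂)) ≡⟨ trans (lem₃ (N + 8 * b) N (e (k + b₁ + b₂))) (cong (λ x → N * N * (e x * (N + 8 * b))) kbb) ⟩
      N * N * (e (k + b) * (N + 8 * b)) ∎)
      where
      b₁ = ⌊ b /2⌋
      b₂ = ⌈ b /2⌉
      bb : b₁ + b₂ ≡ b
      bb = ⌊n/2⌋+⌈n/2⌉≡n b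
      kbb : k + b₁ + b₂ ≡ k + b
      kbb = trans (+-assoc k b₁ b₂) (cong (k +_) bb)
      lem : ∀ n a → n * n * (a * n) ≡ n * n * n * a
      lem = solve-∀
      lem₁ : ∀ a b c d → a * (b * c) * d ≡ a * (b * (c * d))
      lem₁ = solve-∀
      lem₂ : ∀ a b c d → a * (b * (c * d)) ≡ a * c * (b * d)
      lem₂ = solve-∀
      lem₃ : ∀ a n x → a * n * (n * x) ≡ n * n * (x * a)
      lem₃ = solve-∀
      ⌈H+H⌉ : ∀ H → ⌈ H + H /2⌉ ≡ H
      ⌈H+H⌉ zero = refl
      ⌈H+H⌉ (suc H) = trans (cong (λ x → ⌈ suc x /2⌉) (+-suc H H)) (cong suc (⌈H+H⌉ H))
      b₂≤H : b₂ ≤ H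
      b₂≤H = ≤-trans (⌈n/2⌉-mono (≤-trans b≤N (≤-reflexive NH))) (≤-reflexive (⌈H+H⌉ H))
      b₁≤H : b₁ ≤ H
      b₁≤H = ≤-trans (⌊n/2⌋≤⌈n/2⌉ b) b₂≤H
      far : ∀ x → x ≤ H → H ≤ N ∸ x
      far x q = ≤-trans (≤-reflexive (sym (trans (cong (_∸ H) NH) (m+n∸n≡m H H)))) (∸-monoʳ-≤ N q)
      key : N * N * N ≤ (N + 8 * b) * ((N ∸ b₂) * (N ∸ b₁))
      key = ≤-trans (≤-trans (≤-reflexive (trans (cong (λ x → x * x * x) NH) (lemA H))) (≤-trans (*-monoˡ-≤ (H * H) (m≤m+n (8 * H) (2 * H))) (≤-reflexive (cong (_* (H * H)) (lemB H)))))
            (*-mono-≤ (+-mono-≤ (≤-reflexive (sym NH)) (*-monoʳ-≤ 8 (<⇒≤ (≰⇒> b≰H)))) (*-mono-≤ (far b₂ b₂≤H) (far b₁ b₁≤H)))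
        where lemA : ∀ H → (H + H) * (H + H) * (H + H) ≡ 8 * H * (H * H)
              lemA = solve-∀
              lemB : ∀ H → 8 * H + 2 * H ≡ H + H + 8 * H
              lemB = solve-∀

  ∑₂ : (n : ℕ) → (Fin n → Fin n → ℕ) → ℕ
  ∑₂ zero    f = 0
  ∑₂ (suc n) f = ∑ (fin n) (λ j → f zero (suc j)) + ∑₂ n (λ i j → f (suc i) (suc j))

  np : ℕ → ℕ
  np zero = 0
  np (suc n) = n + np n

  row-exp : ∀ n (a : Fin n → ℕ) b → b + ∑ (fin n) a ≤ Kx → ∏ n (λ j → N ∸ a j) * e b ≤ N ^ n * e (b + ∑ (fin n) a)
  row-exp zero a b h = ≤-reflexive (cong (λ x → 1 * e x) (sym (+-identityʳ b)))
  row-exp (suc n) a b h = begin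
    (N ∸ a zero) * ∏ n (λ j → N ∸ a (suc j)) * e b ≡⟨ lem (N ∸ a zero) (∏ n (λ j → N ∸ a (suc j))) (e b) ⟩
    (N ∸ a zero) * e b * ∏ n (λ j → N ∸ a (suc j)) ≤⟨ *-monoˡ-≤ _ (e-lower (a zero) b (≤-trans (+-monoʳ-≤ b (m≤m+n (a zero) _)) h)) ⟩
    N * e (b + a zero) * ∏ n (λ j → N ∸ a (suc j)) ≡⟨ lem′ N (e (b + a zero)) (∏ n (λ j → N ∸ a (suc j))) ⟩
    N * (∏ n (λ j → N ∸ a (suc j)) * e (b + a zero)) ≤⟨ *-monoʳ-≤ N (row-exp n (a ∘ suc) (b + a zero) (≤-trans (≤-reflexive (+-assoc b _ _)) h)) ⟩
    N * (N ^ n * e (b + a zero + ∑ (fin n) (a ∘ suc))) ≡⟨ trans (sym (*-assoc N (N ^ n) _)) (cong (λ x → N * N ^ n * e x) (+-assoc b (a zero) _)) ⟩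
    N ^ suc n * e (b + (a zero + ∑ (fin n) (a ∘ suc))) ∎
    where
    open ≤-Reasoning
    lem : ∀ a b c → a * b * c ≡ a * c * b
    lem = solve-∀
    lem′ : ∀ a b c → a * b * c ≡ a * (c * b)
    lem′ = solve-∀

  -- Each factor obeys 1 - a/N ≤ (1 - 1/N)^a, so only the sum of the `a i j` matters.
  pair-exp : ∀ n (a : Fin n → Fin n → ℕ) b → b + ∑₂ n a ≤ Kx → ∏₂ n (λ i j → N ∸ a i j) * e b ≤ N ^ np n * e (b + ∑₂ n a)
  pair-exp zero a b h = ≤-reflexive (cong (λ x → 1 * e x) (sym (+-identityʳ b)))
  pair-exp (suc n) a b h = begin
    P * Q * e b ≡⟨ lem P Q (e b) ⟩
    P * e b * Q ≤⟨ *-monoˡ-≤ Q (row-exp n (λ j → a zero (suc j)) b (≤-trans (+-monoʳ-≤ b (m≤m+n A _)) h)) ⟩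
    N ^ n * e (b + A) * Q ≡⟨ lem′ (N ^ n) (e (b + A)) Q ⟩
    N ^ n * (Q * e (b + A)) ≤⟨ *-monoʳ-≤ (N ^ n) (pair-exp n (λ i j → a (suc i) (suc j)) (b + A) (≤-trans (≤-reflexive (+-assoc b A _)) h)) ⟩
    N ^ n * (N ^ np n * e (b + A + A′)) ≡⟨ trans (sym (*-assoc (N ^ n) (N ^ np n) _)) (cong₂ (λ x y → x * e y) (sym (^-distribˡ-+-* N n (np n))) (+-assoc b A A′)) ⟩
    N ^ np (suc n) * e (b + (A + A′)) ∎
    where
    open ≤-Reasoning
    P = ∏ n (λ j → N ∸ a zero (suc j))
    Q = ∏₂ n (λ i j → N ∸ a (suc i) (suc j))
    A = ∑ (fin n) (λ j → a zero (suc j))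
    A′ = ∑₂ n (λ i j → a (suc i) (suc j))
    lem : ∀ a b c → a * b * c ≡ a * c * b
    lem = solve-∀
    lem′ : ∀ a b c → a * b * c ≡ a * (c * b)
    lem′ = solve-∀

  ∑₂-mono : ∀ n {f g : Fin n → Fin n → ℕ} → (∀ i j → i Fin.< j → f i j ≤ g i j) → ∑₂ n f ≤ ∑₂ n g
  ∑₂-mono zero h = z≤n
  ∑₂-mono (suc n) h = +-mono-≤ (∑-mono (fin n) λ j → h zero (suc j) (s≤s z≤n)) (∑₂-mono n λ i j q → h (suc i) (suc j) (s≤s q))

  ∑₂-+ : ∀ n (f g : Fin n → Fin n → ℕ) → ∑₂ n (λ i j → f i j + g i j) ≡ ∑₂ n f + ∑₂ n g
  ∑₂-+ zero f g = refl
  ∑₂-+ (suc n) f g = trans (cong₂ _+_ (∑-+ (fin n) _ _) (∑₂-+ n _ _)) (lem (∑ (fin n) (λ j → f zero (suc j))) (∑ (fin n) (λ j → g zero (suc j))) (∑₂ n (λ i j → f (suc i) (suc j))) (∑₂ n (λ i j → g (suc i) (suc j))))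
    where lem : ∀ a b c d → a + b + (c + d) ≡ a + c + (b + d)
          lem = solve-∀

  ∑₂-double : ∀ n (g : Fin n → Fin n → ℕ) → (∀ i j → g i j ≡ g j i) → 2 * ∑₂ n g + ∑ (fin n) (λ i → g i i) ≡ ∑ (fin n) (λ i → ∑ (fin n) (g i))
  ∑₂-double zero g s = refl
  ∑₂-double (suc n) g s = begin
    2 * (A + B) + (g zero zero + D) ≡⟨ lem A B (g zero zero) D ⟩
    g zero zero + A + (A + (2 * B + D)) ≡⟨ cong (g zero zero + A +_) (cong₂ _+_ (∑-cong (fin n) λ i → s zero (suc i)) (∑₂-double n (λ i j → g (suc i) (suc j)) λ i j → s (suc i) (suc j))) ⟩
    g zero zero + A + (∑ (fin n) (λ i → g (suc i) zero) + ∑ (fin n) (λ i → ∑ (fin n) (λ j → g (suc i) (suc j)))) ≡⟨ cong (g zero zero + A +_) (sym (∑-+ (fin n) _ _)) ⟩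
    g zero zero + A + ∑ (fin n) (λ i → g (suc i) zero + ∑ (fin n) (λ j → g (suc i) (suc j))) ∎
    where
    open ≡-Reasoning
    A = ∑ (fin n) (λ j → g zero (suc j))
    B = ∑₂ n (λ i j → g (suc i) (suc j))
    D = ∑ (fin n) (λ i → g (suc i) (suc i))
    lem : ∀ a b c d → 2 * (a + b) + (c + d) ≡ c + a + (a + (2 * b + d))
    lem = solve-∀

∏₂-double : ∀ n (g : Fin n → Fin n → ℕ) → (∀ i j → g i j ≡ g j i) → ∏₂ n g * ∏₂ n g * ∏ n (λ i → g i i) ≡ ∏ n (λ i → ∏ n (g i))
∏₂-double zero g s = refl
∏₂-double (suc n) g s = begin
  A * B * (A * B) * (g zero zero * D) ≡⟨ lem A B (g zero zero) D ⟩
  g zero zero * A * (A * (B * B * D)) ≡⟨ cong (g zero zero * A *_) (cong₂ _*_ (∏-cong n λ i → s zero (suc i)) (∏₂-double n (λ i j → g (suc i) (suc j)) λ i j → s (suc i) (suc j))) ⟩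
  g zero zero * A * (∏ n (λ i → g (suc i) zero) * ∏ n (λ i → ∏ n (λ j → g (suc i) (suc j)))) ≡⟨ cong (g zero zero * A *_) (sym (∏-* n _ _)) ⟩
  g zero zero * A * ∏ n (λ i → g (suc i) zero * ∏ n (λ j → g (suc i) (suc j))) ∎
  where
  open ≡-Reasoning
  A = ∏ n (λ j → g zero (suc j))
  B = ∏₂ n (λ i j → g (suc i) (suc j))
  D = ∏ n (λ i → g (suc i) (suc i))
  lem : ∀ a b c d → a * b * (a * b) * (c * d) ≡ c * a * (a * (b * b * d))
  lem = solve-∀

argmin : ∀ n {p} {P : Fin n → Set p} (P? : ∀ j → Dec (P j)) (f : Fin n → ℕ) → ∃ P → ∃ λ j → P j × ∀ k → P k → f j ≤ f k
argmin (suc n) {P = P} P? f (j₀ , p₀) = go (FinP.any? (λ j → P? (suc j)))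
  where
  go : Dec (∃ λ j → P (suc j)) → ∃ λ j → P j × ∀ k → P k → f j ≤ f k
  go (no ¬r) = zero , p0 j₀ p₀ , λ { zero _ → ≤-refl ; (suc k) p → ⊥-elim (¬r (k , p)) }
    where p0 : ∀ j → P j → P zero
          p0 zero p = p
          p0 (suc j) p = ⊥-elim (¬r (j , p))
  go (yes r) with argmin n (λ j → P? (suc j)) (λ j → f (suc j)) r | P? zero
  ... | j , pj , mj | no ¬p = suc j , pj , λ { zero p → ⊥-elim (¬p p) ; (suc k) p → mj k p }
  ... | j , pj , mj | yes p with f zero ≤? f (suc j)
  ...   | yes le = zero , p , λ { zero _ → ≤-refl ; (suc k) q → ≤-trans le (mj k q) }
  ...   | no gt = suc j , pj , λ { zero _ → <⇒≤ (≰⇒> gt) ; (suc k) q → mj k q }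

-- (2h - 1)!!, the number of perfect matchings of 2h persons.
dfac : ℕ → ℕ
dfac zero    = 1
dfac (suc h) = suc (h + h) * dfac h

∑-vec-cons : ∀ L n (f : Vec (Fin L) (suc n) → ℕ) → ∑ (vec (fin L) (suc n)) f ≡ ∑ (vec (fin L) n) λ Z → ∑ (fin L) λ a → f (a ∷ Z)
∑-vec-cons L n f = ∑-swap (fin L) (vec (fin L) n) (λ a Z → f (a ∷ Z))

rank : ∀ {L n} → Vec (Fin L) n → Fin n → ℕ
rank Z i = suc (toℕ (lookup Z i))

count< : ∀ L u → u ≤ L → ∑ (fin L) (λ a → 𝟙 (suc (toℕ a) ≤? u)) ≡ u
count< L zero h = ∑-zero (fin L) λ a → 𝟙-no (suc (toℕ a) ≤? 0) λ ()
count< (suc L) (suc u) (s≤s h) = cong₂ _+_ (𝟙-yes (1 ≤? suc u) (s≤s z≤n)) (trans (∑-cong (fin L) λ a → 𝟙-cong (suc (suc (toℕ a)) ≤? suc u) (suc (toℕ a) ≤? u) ℕ.s≤s⁻¹ s≤s) (count< L u h))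

-- Score matrices with a prescribed stable matching

-- Scores lie in Fin L, N₁ + 1 = L².  A cycle of length at most ℓ is short; σ bounds the sum of the partners' ranks from below,
-- R the rank of the best alternative of a person and K the number of persons on short cycles from above, with rare
-- exceptions.  J is the number of short cycles aimed at, and 1 / G bounds the probability of the exceptions.
record Parameters (n L : ℕ) : Set where
  field
    cycleWeights : CycleWeights
  open CycleWeights cycleWeights public
  field
    n/2 n-1 N₁ N/2 K R R₁ σ J G jj κc c₁ c₂ : ℕ
    nh : n ≡ n/2 + n/2
    nm : n ≡ suc n-1
    LN : suc N₁ ≡ L * L
    NH : suc N₁ ≡ N/2 + N/2
    RL : 100 * (R * R) ≤ L * L
    L>0 : 0 < L
    8Rσ : 8 * R ≤ σ
    σ>0 : 0 < σ
    c₁≡ : c₁ ≡ 49 * 49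
    c₂≡ : c₂ ≡ 50 * 50
    hcond : 20 * c₂ * (suc J * D) ≤ 9 * c₁ * ∑ℕ ℓ (λ k → wt (suc k))
    g₁ : G * (128 * R) ≤ σ
    g₂ : G * (786 * (n * (ℓ * ℓ)) * (R * R)) ≤ σ * σ
    g₃ : G * (3 * R * (n * ℓ)) ≤ σ * suc K
    g₄ : G * (50 * (R * R) * (K * K)) ≤ 49 * (L * L)
  cyc : ℕ
  cyc = (ℓ + ℓ) * (ℓ + ℓ) + (suc ℓ + (ℓ + (suc ℓ + ℓ)))
  field
    g₅ : G * (suc J * ((128 + 30 * cyc) * R)) ≤ σ
    c-large : n * (suc N₁ + 32) + 40 * (suc N₁ + n * L) ≤ (n + κc) * suc N₁
    RR : R ≡ suc R₁
    R≤L : R ≤ L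
    jN : jj * suc N₁ + R₁ * (L + L) ≤ R₁ * σ
    jj-large : G * (n * L) ≤ 2 ^ jj
    σ-small : G * suc n * (dfac n/2 * σ ^ n) ≤ n-1 ! * suc N₁ ^ n/2
    J-large : G * suc J ≤ 2 ^ J
    n²≤L : n * n ≤ L
    2n³≤L : 2 * (n * (n * n)) ≤ L

  n>0 : 0 < n
  n>0 = ≤-trans (s≤s z≤n) (≤-reflexive (sym nm))

dfac>0 : ∀ h → 0 < dfac h
dfac>0 zero = s≤s z≤n
dfac>0 (suc h) = ≤-trans (dfac>0 h) (m≤m+n (dfac h) _)

module Planting {n L : ℕ} (p : Parameters n L) (matching : Matching n) where

  open Parameters p
  open Matching matching

  -- at X i j is the score that i gives to j; lower is better.
  Mat : Set
  Mat = Vec (Vec (Fin L) n) n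

  uMat : U
  uMat = vec (vec (fin L) n) n

  at : Mat → Fin n → Fin n → Fin L
  at X i j = lookup (lookup X i) j

  Th : Set
  Th = Vec (Fin L) n

  uTh : U
  uTh = vec (fin L) n

  Perm : Set
  Perm = Vec (Fin n) n

  uPerm : U
  uPerm = vec (fin n) n

  Pairs : Set₁
  Pairs = Fin n → Fin n → Fin L → Fin L → Set

  count-pairs : (C : Pairs) (C? : ∀ i j a b → Dec (C i j a b)) →
    ∑ uMat (λ X → ∏₂ n λ i j → 𝟙 (C? i j (at X i j) (at X j i))) ≡ L ^ n * ∏₂ n (λ i j → ∑ (fin L) λ a → ∑ (fin L) λ b → 𝟙 (C? i j a b))
  count-pairs C C? = trans (matrix-sum (fin L) n (λ i j a b → 𝟙 (C? i j a b))) (cong (λ x → x ^ n * ∏₂ n (λ i j → ∑ (fin L) λ a → ∑ (fin L) λ b → 𝟙 (C? i j a b))) (card-fin L))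

  Sym : Pairs → Set
  Sym C = ∀ i j a b → C i j a b → C j i b a

  all-pairs : ∀ (C : Pairs) (C? : ∀ i j a b → Dec (C i j a b)) → Sym C → ∀ X →
    0 < ∏₂ n (λ i j → 𝟙 (C? i j (at X i j) (at X j i))) → ∀ i j → i ≢ j → C i j (at X i j) (at X j i)
  all-pairs C C? sy X h i j i≢j with FinP.<-cmp i j
  ... | tri< i<j _ _ = 𝟙-pos (C? i j _ _) (∏₂-pos n h i j i<j)
  ... | tri≈ _ e _ = ⊥-elim (i≢j e)
  ... | tri> _ _ j<i = sy j i _ _ (𝟙-pos (C? j i _ _) (∏₂-pos n h j i j<i))

  κ : (C : Pairs) (C? : ∀ i j a b → Dec (C i j a b)) → Fin n → Fin n → ℕ
  κ C C? i j = ∑ (fin L) λ a → ∑ (fin L) λ b → 𝟙 (C? i j a b)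

  κ-sym : ∀ (C : Pairs) (C? : ∀ i j a b → Dec (C i j a b)) → Sym C → ∀ i j → κ C C? i j ≡ κ C C? j i
  κ-sym C C? sy i j = trans (∑-cong (fin L) λ a → ∑-cong (fin L) λ b → 𝟙-cong (C? i j a b) (C? j i b a) (sy i j a b) (sy j i b a)) (∑-swap (fin L) (fin L) _)

  κ≤L² : ∀ (C : Pairs) (C? : ∀ i j a b → Dec (C i j a b)) i j → κ C C? i j ≤ L * L
  κ≤L² C C? i j = ≤-trans (∑-mono (fin L) λ a → ∑-mono (fin L) λ b → 𝟙≤1 (C? i j a b))
    (≤-reflexive (trans (∑-cong (fin L) λ a → trans (∑-constF L 1) (*-identityʳ L)) (∑-constF L L)))

  κ-cong : ∀ (C C′ : Pairs) (C? : ∀ i j a b → Dec (C i j a b)) (C′? : ∀ i j a b → Dec (C′ i j a b)) i j →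
    (∀ a b → C i j a b → C′ i j a b) → (∀ a b → C′ i j a b → C i j a b) → κ C C? i j ≡ κ C′ C′? i j
  κ-cong C C′ C? C′? i j f g = ∑-cong (fin L) λ a → ∑-cong (fin L) λ b → 𝟙-cong (C? i j a b) (C′? i j a b) (f a b) (g a b)

  -- Thresholds Z (score of the partner), Y (score of the best accepting alternative) and the alternatives s.
  module Cells (Z Y : Th) (s : Perm) where

    z y : Fin n → Fin L
    z = lookup Z
    y = lookup Y

    Free : Pairs
    Free i j a b = ¬ (a Fin.≤ y i × b Fin.≤ z j) × ¬ (b Fin.≤ y j × a Fin.≤ z i)

    opaque
      free? : ∀ i j a b → Dec (Free i j a b)
      free? i j a b = ¬? ((a FinP.≤? y i) ×-dec (b FinP.≤? z j)) ×-dec ¬? ((b FinP.≤? y j) ×-dec (a FinP.≤? z i))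

    -- What stability of `M`, with own scores `Z`, best accepting alternatives `s` and their scores
    -- `Y`, asks of the two scores between `i` and `j`. All conditions concern one pair, so the
    -- number of matrices is a product over pairs.
    Cell : Pairs
    Cell i j a b = (j ≡ M i → a ≡ z i × b ≡ z j) × (lookup s i ≡ j → a ≡ y i × b Fin.≤ z j) × (lookup s j ≡ i → b ≡ y j × a Fin.≤ z i) ×
                   (j ≢ M i → lookup s i ≢ j → lookup s j ≢ i → Free i j a b)

    opaque
      cell? : ∀ i j a b → Dec (Cell i j a b)
      cell? i j a b = ((j ≟F M i) →-dec ((a ≟F z i) ×-dec (b ≟F z j))) ×-dec ((lookup s i ≟F j) →-dec ((a ≟F y i) ×-dec (b FinP.≤? z j))) ×-dec
        ((lookup s j ≟F i) →-dec ((b ≟F y j) ×-dec (a FinP.≤? z i))) ×-dec (¬? (j ≟F M i) →-dec (¬? (lookup s i ≟F j) →-dec (¬? (lookup s j ≟F i) →-dec free? i j a b)))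

    M-flip : ∀ {i j} → i ≡ M j → j ≡ M i
    M-flip {i} {j} e = trans (sym (MM j)) (cong M (sym e))

    cell-sym : Sym Cell
    cell-sym i j a b (p , q , r , f) = (λ e → let x , x′ = p (M-flip e) in x′ , x) , r , q ,
      λ n₁ n₂ n₃ → let g , g′ = f (λ e → n₁ (M-flip e)) n₃ n₂ in g′ , g

    match : Mat → ℕ
    match X = ∏₂ n λ i j → 𝟙 (cell? i j (at X i j) (at X j i))

    match≤1 : ∀ X → match X ≤ 1
    match≤1 X = ∏₂-≤1 n λ i j _ → 𝟙≤1 (cell? i j _ _)

    match-cell : ∀ X → 0 < match X → ∀ i j → i ≢ j → Cell i j (at X i j) (at X j i)
    match-cell = all-pairs Cell cell? cell-sym

    cell-match : ∀ X → (∀ i j → i ≢ j → Cell i j (at X i j) (at X j i)) → match X ≡ 1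
    cell-match X h = ∏₂-1 n λ i j i<j → 𝟙-yes (cell? i j _ _) (h i j (FinP.<⇒≢ i<j))

    mass : ℕ
    mass = L ^ n * ∏₂ n (κ Cell cell?)

    mass-count : ∑ uMat match ≡ mass
    mass-count = count-pairs Cell cell?

    module _ (yR : ∀ i → suc (toℕ (y i)) ≤ R) (zR : ∀ i → suc (toℕ (z i)) ≤ R) where

      count-le : ∀ i j → ∑ (fin L) (λ a → ∑ (fin L) λ b → 𝟙 ((a FinP.≤? y i) ×-dec (b FinP.≤? z j))) ≤ R * R
      count-le i j = ≤-trans (≤-reflexive (trans (count-rect L (FinP._≤? y i) (FinP._≤? z j)) (cong₂ _*_ (count≤ L (y i)) (count≤ L (z j))))) (*-mono-≤ (yR i) (zR j))

      free-many : ∀ i j → L * L ≤ κ Free free? i j + (R * R + R * R)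
      free-many i j = begin
        L * L ≡⟨ sym (trans (∑-cong (fin L) λ a → trans (∑-constF L 1) (*-identityʳ L)) (∑-constF L L)) ⟩
        ∑ (fin L) (λ a → ∑ (fin L) λ b → 1) ≤⟨ ∑-mono (fin L) (λ a → ∑-mono (fin L) λ b → each a b) ⟩
        ∑ (fin L) (λ a → ∑ (fin L) λ b → 𝟙 (free? i j a b) + (A a b + B a b)) ≡⟨ trans (∑-cong (fin L) λ a → trans (∑-+ (fin L) _ _) (cong (∑ (fin L) (λ b → 𝟙 (free? i j a b)) +_) (∑-+ (fin L) _ _)))
             (trans (∑-+ (fin L) _ _) (cong (κ Free free? i j +_) (∑-+ (fin L) _ _))) ⟩
        κ Free free? i j + (∑ (fin L) (λ a → ∑ (fin L) (A a)) + ∑ (fin L) (λ a → ∑ (fin L) (B a))) ≤⟨ +-monoʳ-≤ (κ Free free? i j) (+-mono-≤ (count-le i j)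
              (≤-trans (≤-reflexive (∑-swap (fin L) (fin L) B)) (count-le j i))) ⟩
        κ Free free? i j + (R * R + R * R) ∎
        where
        open ≤-Reasoning
        A B : Fin L → Fin L → ℕ
        A a b = 𝟙 ((a FinP.≤? y i) ×-dec (b FinP.≤? z j))
        B a b = 𝟙 ((b FinP.≤? y j) ×-dec (a FinP.≤? z i))
        each : ∀ a b → 1 ≤ 𝟙 (free? i j a b) + (A a b + B a b)
        each a b = go ((a FinP.≤? y i) ×-dec (b FinP.≤? z j)) ((b FinP.≤? y j) ×-dec (a FinP.≤? z i)) (free? i j a b)
          where
          go : ∀ {P Q : Set} (d : Dec P) (e : Dec Q) (f : Dec (¬ P × ¬ Q)) → 1 ≤ 𝟙 f + (𝟙 d + 𝟙 e)
          go _ _ (yes _) = s≤s z≤n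
          go (yes _) _ (no _) = s≤s z≤n
          go (no _) (yes _) (no _) = s≤s z≤n
          go (no ¬p) (no ¬q) (no ¬f) = ⊥-elim (¬f (¬p , ¬q))

      -- The origin of 49/50: the two forbidden rectangles have at most `R * R` points each,
      -- together at most a fiftieth of the square.
      free-98 : 100 * (R * R) ≤ L * L → ∀ i j → 49 * (L * L) ≤ 50 * κ Free free? i j
      free-98 h i j = +-cancelʳ-≤ (L * L) _ _ (begin
        49 * (L * L) + L * L ≡⟨ lem (L * L) ⟩
        50 * (L * L) ≤⟨ *-monoʳ-≤ 50 (free-many i j) ⟩
        50 * (κ Free free? i j + (R * R + R * R)) ≡⟨ lem′ (κ Free free? i j) (R * R) ⟩
        50 * κ Free free? i j + 100 * (R * R) ≤⟨ +-monoʳ-≤ (50 * κ Free free? i j) h ⟩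
        50 * κ Free free? i j + L * L ∎)
        where
        open ≤-Reasoning
        lem : ∀ a → 49 * a + a ≡ 50 * a
        lem = solve-∀
        lem′ : ∀ a b → 50 * (a + (b + b)) ≡ 50 * a + 100 * b
        lem′ = solve-∀

      -- A clash: both a and b would rather have each other than their alternatives.
      Clash : Fin n → Fin n → Mat → Set
      Clash p q X = at X p q Fin.< y p × at X q p Fin.< y q

      clash? : ∀ p q X → Dec (Clash p q X)
      clash? p q X = (at X p q FinP.<? y p) ×-dec (at X q p FinP.<? y q)

      -- A clash replaces one free factor, at least 49/50 of `L * L`, by at most `R * R` choices. If
      -- one of the two persons is the alternative of the other, a score equals its threshold and no
      -- clash occurs.
      clash-mass : 100 * (R * R) ≤ L * L → ∀ p q → p ≢ q → q ≢ M p → 49 * (L * L) * ∑ uMat (λ X → match X * 𝟙 (clash? p q X)) ≤ 50 * (R * R) * mass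
      clash-mass h p q p≢q q≢M = go (lookup s p ≟F q) (lookup s q ≟F p)
        where
        open ≤-Reasoning
        none : (∀ X → 0 < match X → ¬ Clash p q X) → 49 * (L * L) * ∑ uMat (λ X → match X * 𝟙 (clash? p q X)) ≤ 50 * (R * R) * mass
        none k = ≤-trans (≤-reflexive (trans (cong (49 * (L * L) *_) (∑-zero uMat λ X → zero! X (match X) refl)) (*-zeroʳ (49 * (L * L))))) z≤n
          where zero! : ∀ X m → match X ≡ m → match X * 𝟙 (clash? p q X) ≡ 0
                zero! X zero e = cong (_* 𝟙 (clash? p q X)) e
                zero! X (suc m) e = trans (cong (match X *_) (𝟙-no (clash? p q X) (k X (≤-trans (s≤s z≤n) (≤-reflexive (sym e)))))) (*-zeroʳ (match X))
        C′ : Pairs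
        C′ i j a b = Cell i j a b × ((i ≡ p × j ≡ q) → a Fin.< y p × b Fin.< y q) × ((i ≡ q × j ≡ p) → b Fin.< y p × a Fin.< y q)
        c′? : ∀ i j a b → Dec (C′ i j a b)
        c′? i j a b = cell? i j a b ×-dec (((i ≟F p) ×-dec (j ≟F q)) →-dec ((a FinP.<? y p) ×-dec (b FinP.<? y q))) ×-dec (((i ≟F q) ×-dec (j ≟F p)) →-dec ((b FinP.<? y p) ×-dec (a FinP.<? y q)))
        c′-sym : Sym C′
        c′-sym i j a b (c , f , g) = cell-sym i j a b c , (λ (e , e′) → g (e′ , e)) , (λ (e , e′) → f (e′ , e))
        below : ∀ X → match X * 𝟙 (clash? p q X) ≤ ∏₂ n λ i j → 𝟙 (c′? i j (at X i j) (at X j i))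
        below X = ≤-trans (≤-reflexive (*-comm (match X) _)) (𝟙*≤ (clash? p q X) λ cl → ∏₂-mono n λ i j _ → 𝟙-mono (cell? i j _ _) (c′? i j _ _)
           λ c → c , (λ { (refl , refl) → cl }) , (λ { (refl , refl) → cl }))
        κ′pq : κ C′ c′? p q ≤ R * R
        κ′pq = ≤-trans (∑-mono (fin L) λ a → ∑-mono (fin L) λ b → 𝟙-mono (c′? p q a b) ((a FinP.≤? y p) ×-dec (b FinP.≤? y q)) λ (_ , f , _) →
                 let u , v = f (refl , refl) in <⇒≤ u , <⇒≤ v)
               (≤-trans (≤-reflexive (trans (count-rect L (FinP._≤? y p) (FinP._≤? y q)) (cong₂ _*_ (count≤ L (y p)) (count≤ L (y q))))) (*-mono-≤ (yR p) (yR q)))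
        go : Dec (lookup s p ≡ q) → Dec (lookup s q ≡ p) → 49 * (L * L) * ∑ uMat (λ X → match X * 𝟙 (clash? p q X)) ≤ 50 * (R * R) * mass
        go (yes e) _ = none λ X m (u , _) → FinP.<⇒≢ u (proj₁ (proj₁ (proj₂ (match-cell X m p q p≢q)) e))
        go (no _) (yes e) = none λ X m (_ , v) → FinP.<⇒≢ v (proj₁ (proj₁ (proj₂ (proj₂ (match-cell X m p q p≢q))) e))
        go (no n₁) (no n₂) = begin
          49 * (L * L) * ∑ uMat (λ X → match X * 𝟙 (clash? p q X)) ≤⟨ *-monoʳ-≤ (49 * (L * L)) (≤-trans (∑-mono uMat below) (≤-reflexive (count-pairs C′ c′?))) ⟩
          49 * (L * L) * (L ^ n * ∏₂ n (κ C′ c′?)) ≤⟨ *-monoˡ-≤ _ (free-98 h p q) ⟩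
          50 * κ Free free? p q * (L ^ n * ∏₂ n (κ C′ c′?)) ≡⟨ cong (λ x → 50 * x * (L ^ n * ∏₂ n (κ C′ c′?))) (sym cellfree) ⟩
          50 * κ Cell cell? p q * (L ^ n * ∏₂ n (κ C′ c′?)) ≡⟨ lem (κ Cell cell? p q) (L ^ n) (∏₂ n (κ C′ c′?)) ⟩
          50 * L ^ n * (∏₂ n (κ C′ c′?) * κ Cell cell? p q) ≡⟨ cong (50 * L ^ n *_) (∏₂-change-sym n (κ C′ c′?) (κ Cell cell?) (κ-sym C′ c′? c′-sym) (κ-sym Cell cell? cell-sym) p q p≢q
                λ i j ne ne′ → κ-cong C′ Cell c′? cell? i j (λ _ _ → proj₁) (λ _ _ c → c , (λ x → ⊥-elim (ne x)) , (λ x → ⊥-elim (ne′ x)))) ⟩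
          50 * L ^ n * (∏₂ n (κ Cell cell?) * κ C′ c′? p q) ≤⟨ *-monoʳ-≤ (50 * L ^ n) (*-monoʳ-≤ (∏₂ n (κ Cell cell?)) κ′pq) ⟩
          50 * L ^ n * (∏₂ n (κ Cell cell?) * (R * R)) ≡⟨ lem″ (L ^ n) (∏₂ n (κ Cell cell?)) (R * R) ⟩
          50 * (R * R) * mass ∎
          where
          lem : ∀ a b c → 50 * a * (b * c) ≡ 50 * b * (c * a)
          lem = solve-∀
          lem″ : ∀ a b c → 50 * a * (b * c) ≡ 50 * c * (a * b)
          lem″ = solve-∀
          cellfree : κ Cell cell? p q ≡ κ Free free? p q
          cellfree = κ-cong Cell Free cell? free? p q (λ _ _ (_ , _ , _ , f) → f q≢M n₁ n₂)
            (λ _ _ f → (λ e → ⊥-elim (q≢M e)) , (λ e → ⊥-elim (n₁ e)) , (λ e → ⊥-elim (n₂ e)) , λ _ _ _ → f)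

  legal? : ∀ s → Dec (Legal s)
  legal? s = FinP.all? λ i → ¬? (lookup s i ≟F i) ×-dec ¬? (lookup s i ≟F M i) ×-dec ¬? (lookup s (lookup s i) ≟F i)

  -- The alternatives are nearly independent

  module Weights (Z Y : Th) (yR : ∀ i → suc (toℕ (lookup Y i)) ≤ R) (zR : ∀ i → suc (toℕ (lookup Z i)) ≤ R) where

    open Cells Z Y

    ẑ : Fin n → ℕ
    ẑ i = suc (toℕ (lookup Z i))

    κs : Perm → Fin n → Fin n → ℕ
    κs s = κ (Cell s) (cell? s)

    -- The score given by `v` is prescribed, the one received must be an acceptance. So `mass s` is
    -- close to a constant times the product of the `ẑ (s v)`.
    κ-chosen : ∀ s → Legal s → ∀ v → κs s v (lookup s v) ≡ ẑ (lookup s v)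
    κ-chosen s Ls v = trans (∑-cong (fin L) λ a → ∑-cong (fin L) λ b → 𝟙-cong (cell? s v j a b) ((a ≟F lookup Y v) ×-dec (b FinP.≤? lookup Z j))
          (λ (_ , q , _) → q refl)
          (λ q → (λ e → ⊥-elim (proj₁ (proj₂ (Ls v)) e)) , (λ _ → q) , (λ e → ⊥-elim (proj₂ (proj₂ (Ls v)) e)) , (λ _ ne _ → ⊥-elim (ne refl))))
        (trans (count-rect L (_≟F lookup Y v) (FinP._≤? lookup Z j)) (trans (cong₂ _*_ (count≡ L (lookup Y v)) (count≤ L (lookup Z j))) (*-identityˡ _)))
      where j = lookup s v

    κ-free : ∀ s i j → j ≢ M i → lookup s i ≢ j → lookup s j ≢ i → κs s i j ≡ κ (Free s) (free? s) i j
    κ-free s i j n₁ n₂ n₃ = κ-cong (Cell s) (Free s) (cell? s) (free? s) i j (λ _ _ (_ , _ , _ , f) → f n₁ n₂ n₃)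
            (λ _ _ f → (λ e → ⊥-elim (n₁ e)) , (λ e → ⊥-elim (n₂ e)) , (λ e → ⊥-elim (n₃ e)) , λ _ _ _ → f)

    κ-same : ∀ s s′ i j → lookup s i ≡ lookup s′ i ⊎ (lookup s i ≢ j × lookup s′ i ≢ j) → lookup s j ≡ lookup s′ j ⊎ (lookup s j ≢ i × lookup s′ j ≢ i) → κs s i j ≡ κs s′ i j
    κ-same s s′ i j h k = κ-cong (Cell s) (Cell s′) (cell? s) (cell? s′) i j (λ a b → to s s′ a b (swp h) (swp k)) (λ a b → to s′ s a b (flp h) (flp k))
      where
      Same : Perm → Perm → Fin n → Fin n → Set
      Same s s′ i j = (lookup s i ≡ j → lookup s′ i ≡ j) × (lookup s′ i ≡ j → lookup s i ≡ j)
      swp : ∀ {i j} → lookup s i ≡ lookup s′ i ⊎ (lookup s i ≢ j × lookup s′ i ≢ j) → Same s s′ i j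
      swp (inj₁ e) = (λ q → trans (sym e) q) , (λ q → trans e q)
      swp (inj₂ (f , g)) = (λ q → ⊥-elim (f q)) , (λ q → ⊥-elim (g q))
      flp : ∀ {i j} → lookup s i ≡ lookup s′ i ⊎ (lookup s i ≢ j × lookup s′ i ≢ j) → Same s′ s i j
      flp h = proj₂ (swp h) , proj₁ (swp h)
      to : ∀ s s′ a b → Same s s′ i j → Same s s′ j i → Cell s i j a b → Cell s′ i j a b
      to s s′ a b (f , f′) (g , g′) (p , q , r , fr) = p , (λ e → q (f′ e)) , (λ e → r (g′ e)) , λ n₁ n₂ n₃ → fr n₁ (λ e → n₂ (f e)) (λ e → n₃ (g e))

    -- Two pairs matter. That of `v` and `j₀` turns from `ẑ j₀` choices into a free one, at least
    -- 49/50 of `L * L`; that of `v` and `j` from at most `L * L` into `ẑ j`. The family `H` has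
    -- only the first change made.
    mass-resample : ∀ s v j → Legal s → Legal (s [ v ]≔ j) → 49 * (mass s * ẑ j) ≤ 50 * (mass (s [ v ]≔ j) * ẑ (lookup s v))
    mass-resample s v j Ls Ls′ with j ≟F lookup s v
    ... | yes refl = *-mono-≤ {49} {50} (n≤1+n 49) (≤-reflexive (cong (λ x → mass x * ẑ (lookup s v)) (sym (vec-ext _ _ same))))
      where
      same : ∀ i → lookup (s [ v ]≔ lookup s v) i ≡ lookup s i
      same i with i ≟F v
      ... | yes refl = upd-same s i _
      ... | no ne = upd-other s v _ ne
    ... | no j≢j₀ = *-cancelʳ-≤ _ _ (L * L) {{>-nonZero (*-mono-≤ L>0 L>0)}} (begin
      49 * (mass s * ẑ j) * (L * L) ≡⟨ lem₁ (L ^ n) P (ẑ j) (L * L) ⟩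
      L ^ n * (P * ẑ j * (49 * (L * L))) ≤⟨ *-monoʳ-≤ (L ^ n) (*-monoʳ-≤ (P * ẑ j) (free-98 s′ yR zR RL v j₀)) ⟩
      L ^ n * (P * ẑ j * (50 * U₀)) ≡⟨ cong (L ^ n *_) (lem₂ P (ẑ j) U₀) ⟩
      L ^ n * (50 * (P * U₀ * ẑ j)) ≡⟨ cong (λ x → L ^ n * (50 * x)) chain ⟩
      L ^ n * (50 * (P′ * U₁ * ẑ j₀)) ≤⟨ *-monoʳ-≤ (L ^ n) (*-monoʳ-≤ 50 (*-monoˡ-≤ (ẑ j₀) (*-monoʳ-≤ P′ (κ≤L² (Cell s) (cell? s) v j)))) ⟩
      L ^ n * (50 * (P′ * (L * L) * ẑ j₀)) ≡⟨ lem₃ (L ^ n) P′ (L * L) (ẑ j₀) ⟩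
      50 * (mass s′ * ẑ j₀) * (L * L) ∎)
      where
      open ≤-Reasoning
      s′ = s [ v ]≔ j
      j₀ = lookup s v
      P = ∏₂ n (κs s)
      P′ = ∏₂ n (κs s′)
      U₀ = κ (Free s′) (free? s′) v j₀
      U₁ = κs s v j
      lem₁ : ∀ a b c d → 49 * (a * b * c) * d ≡ a * (b * c * (49 * d))
      lem₁ = solve-∀
      lem₂ : ∀ a b c → a * b * (50 * c) ≡ 50 * (a * c * b)
      lem₂ = solve-∀
      lem₃ : ∀ a b c d → a * (50 * (b * c * d)) ≡ 50 * (a * b * d) * c
      lem₃ = solve-∀
      s′v : lookup s′ v ≡ j
      s′v = upd-same s v j
      s′o : ∀ {i} → i ≢ v → lookup s′ i ≡ lookup s i
      s′o = upd-other s v j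
      v≢j₀ : v ≢ j₀
      v≢j₀ e = proj₁ (Ls v) (sym e)
      v≢j : v ≢ j
      v≢j e = proj₁ (Ls′ v) (trans s′v (sym e))
      Hit₀ : Fin n → Fin n → Set
      Hit₀ a b = (a ≡ v × b ≡ j₀) ⊎ (a ≡ j₀ × b ≡ v)
      hit₀? : ∀ a b → Dec (Hit₀ a b)
      hit₀? a b = ((a ≟F v) ×-dec (b ≟F j₀)) ⊎-dec ((a ≟F j₀) ×-dec (b ≟F v))
      pick : ∀ {A : Set} → Dec A → ℕ → ℕ → ℕ
      pick (yes _) x y = x
      pick (no _) x y = y
      pick-yes : ∀ {A : Set} (d : Dec A) {x y} → A → pick d x y ≡ x
      pick-yes (yes _) _ = refl
      pick-yes (no ¬a) a = ⊥-elim (¬a a)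
      pick-no : ∀ {A : Set} (d : Dec A) {x y} → ¬ A → pick d x y ≡ y
      pick-no (yes a) ¬a = ⊥-elim (¬a a)
      pick-no (no _) _ = refl
      H : Fin n → Fin n → ℕ
      H a b = pick (hit₀? a b) (κs s′ a b) (κs s a b)
      κss : ∀ s i j → κs s i j ≡ κs s j i
      κss s = κ-sym (Cell s) (cell? s) (cell-sym s)
      H-sym : ∀ a b → H a b ≡ H b a
      H-sym a b with hit₀? a b | hit₀? b a
      ... | yes _ | yes _ = κss s′ a b
      ... | no _ | no _ = κss s a b
      ... | yes (inj₁ x) | no ¬h = ⊥-elim (¬h (inj₂ (proj₂ x , proj₁ x)))
      ... | yes (inj₂ x) | no ¬h = ⊥-elim (¬h (inj₁ (proj₂ x , proj₁ x)))
      ... | no ¬h | yes (inj₁ x) = ⊥-elim (¬h (inj₂ (proj₂ x , proj₁ x)))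
      ... | no ¬h | yes (inj₂ x) = ⊥-elim (¬h (inj₁ (proj₂ x , proj₁ x)))
      U₀-eq : H v j₀ ≡ U₀
      U₀-eq = trans (pick-yes (hit₀? v j₀) (inj₁ (refl , refl))) (κ-free s′ v j₀ (proj₁ (proj₂ (Ls v))) (λ e → j≢j₀ (trans (sym s′v) e))
                (λ e → proj₂ (proj₂ (Ls v)) (trans (sym (s′o (v≢j₀ ∘ sym))) e)))
      first : P * U₀ ≡ ∏₂ n H * ẑ j₀
      first = trans (cong (P *_) (sym U₀-eq)) (trans (∏₂-change-sym n (κs s) H (κss s) H-sym v j₀ v≢j₀ λ a b ne ne′ → sym (pick-no (hit₀? a b) λ { (inj₁ x) → ne x ; (inj₂ x) → ne′ x }))
                (cong (∏₂ n H *_) (κ-chosen s Ls v)))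
      Hvj : H v j ≡ U₁
      Hvj = pick-no (hit₀? v j) λ { (inj₁ x) → j≢j₀ (proj₂ x) ; (inj₂ x) → v≢j₀ (proj₁ x) }
      second : ∏₂ n H * ẑ j ≡ P′ * U₁
      second = trans (cong (∏₂ n H *_) (sym (trans (cong (κs s′ v) (sym s′v)) (trans (κ-chosen s′ Ls′ v) (cong ẑ s′v)))))
        (trans (∏₂-change-sym n H (κs s′) H-sym (κss s′) v j v≢j agree) (cong (P′ *_) Hvj))
        where
        agree : ∀ a b → ¬ (a ≡ v × b ≡ j) → ¬ (a ≡ j × b ≡ v) → H a b ≡ κs s′ a b
        agree a b ne ne′ with hit₀? a b
        ... | yes _ = refl
        ... | no ¬h = κ-same s s′ a b (side a b (λ e e′ → ¬h (inj₁ (e , e′))) (λ e e′ → ne (e , e′)))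
                                      (side b a (λ e e′ → ¬h (inj₂ (e′ , e))) (λ e e′ → ne′ (e′ , e)))
          where
          side : ∀ a b → (a ≡ v → b ≢ j₀) → (a ≡ v → b ≢ j) → lookup s a ≡ lookup s′ a ⊎ (lookup s a ≢ b × lookup s′ a ≢ b)
          side a b f g with a ≟F v
          ... | yes refl = inj₂ ((λ e → f refl (sym e)) , λ e → g refl (trans (sym e) s′v))
          ... | no a≢v = inj₁ (sym (s′o a≢v))
      chain : P * U₀ * ẑ j ≡ P′ * U₁ * ẑ j₀
      chain = trans (cong (_* ẑ j) first) (trans (lem (∏₂ n H) (ẑ j₀) (ẑ j)) (cong (_* ẑ j₀) second))
        where lem : ∀ a b c → a * b * c ≡ a * c * b
              lem = solve-∀

  module R′ (s : Perm) = Rot matching cycleWeights s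

  yy : Perm → ℕ
  yy s = ∑ (fin n) (R′.Yv s) / D

  opaque
    sh? : ∀ s a → Dec (R′.Short s a)
    sh? s a = R′.short? s a

  links : Perm → ℕ
  links s = ∑ (fin n) λ a → 𝟙 (sh? s a) * 𝟙 (sh? s (M a))

  shorts : Perm → ℕ
  shorts s = ∑ (fin n) λ a → 𝟙 (sh? s a)

  Clashing : Th → Mat → Fin n → Fin n → Set
  Clashing Y X a b = b ≢ a × b ≢ M a × at X a b Fin.< lookup Y a × at X b a Fin.< lookup Y b

  clashing? : ∀ Y X a b → Dec (Clashing Y X a b)
  clashing? Y X a b = ¬? (b ≟F a) ×-dec ¬? (b ≟F M a) ×-dec (at X a b FinP.<? lookup Y a) ×-dec (at X b a FinP.<? lookup Y b)

  clashes : Th → Perm → Mat → ℕ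
  clashes Y s X = ∑ (fin n) λ a → ∑ (fin n) λ b → 𝟙 (sh? s a) * 𝟙 (sh? s b) * 𝟙 (clashing? Y X a b)

  -- What can keep the rotations from acting independently. Clashes enter only if at most `K`
  -- persons are on short cycles, so that `K * K` bounds the number of pairs to inspect.
  bad : Th → Perm → Mat → ℕ
  bad Y s X = 𝟙 (1 ≤? links s) + (𝟙 (suc K ≤? shorts s) + 𝟙 (shorts s ≤? K) * clashes Y s X)

  module Fixed (Z Y : Th) (yR : ∀ i → suc (toℕ (lookup Y i)) ≤ R) (zR : ∀ i → suc (toℕ (lookup Z i)) ≤ R)
    (σS : σ ≤ ∑ (fin n) (λ i → suc (toℕ (lookup Z i)))) where

    open Weights Z Y yR zR
    open Cells Z Y

    W : Perm → ℕ
    W s = 𝟙 (legal? s) * mass s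

    W-legal : ∀ s → W s ≢ 0 → Legal s
    W-legal s h with legal? s
    ... | yes l = l
    ... | no _ = ⊥-elim (h refl)

    W-res : ∀ s v j → Legal s → Legal (s [ v ]≔ j) → 49 * (W s * ẑ j) ≤ 50 * (W (s [ v ]≔ j) * ẑ (lookup s v))
    W-res s v j l l′ = subst₂ (λ a b → 49 * (a * ẑ j) ≤ 50 * (b * ẑ (lookup s v))) (sym (unit s l)) (sym (unit (s [ v ]≔ j) l′)) (mass-resample s v j l l′)
      where unit : ∀ s → Legal s → W s ≡ mass s
            unit s l = trans (cong (_* mass s) (𝟙-yes (legal? s) l)) (*-identityˡ _)

    private
      8RS = ≤-trans 8Rσ σS
      S>0 = ≤-trans σ>0 σS

    weighting : Weighting n
    weighting = record
      { matching = matching ; cycleWeights = cycleWeights ; n>0 = n>0 ; z = ẑ ; R = R ; z≤R = zR ; z>0 = λ _ → s≤s z≤n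
      ; w = W ; legal = W-legal ; 8R≤S = 8RS ; S>0 = S>0 ; res = W-res }

    module Dm = Switching weighting
    module Lk = Dm.Linked ℓ

    open Dm using (μ; T₁; μ-mono; μ-+; μ-*; μ-∑; S; evc; nl?; 𝟙NL)

    yy≡y : ∀ s → Dm.y s ≡ yy s
    yy≡y s = Dm.y-def s

    sh-cong : ∀ s a → 𝟙 (sh? s a) ≡ 𝟙 (Lk.short? s a)
    sh-cong s a = 𝟙-cong (sh? s a) (Lk.short? s a) id id

    scale : ∀ a {m b c t} → 0 < a → a * m ≤ b * t → G * b ≤ a * c → G * m ≤ c * t
    scale a {m} {b} {c} {t} a>0 h k = *-cancelˡ-≤ a {{>-nonZero a>0}} (begin
      a * (G * m) ≡⟨ lem a G m ⟩
      G * (a * m) ≤⟨ *-monoʳ-≤ G h ⟩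
      G * (b * t) ≡⟨ sym (*-assoc G b t) ⟩
      G * b * t ≤⟨ *-monoˡ-≤ t k ⟩
      a * c * t ≡⟨ *-assoc a c t ⟩
      a * (c * t) ∎)
      where open ≤-Reasoning
            lem : ∀ a g m → a * (g * m) ≡ g * (a * m)
            lem = solve-∀

    heavy-small : G * μ (λ s → 𝟙 (¬? (nl? s))) ≤ 1 * T₁
    heavy-small = scale σ σ>0 (≤-trans (*-monoˡ-≤ _ σS) Dm.heavy-mass) (≤-trans g₁ (≤-reflexive (sym (*-identityʳ σ))))

    rough-small : G * (suc J * μ (λ s → 𝟙 (¬? (Dm.calm? s)))) ≤ 1 * T₁
    rough-small = scale σ σ>0 (begin
      σ * (suc J * μ (λ s → 𝟙 (¬? (Dm.calm? s)))) ≤⟨ *-monoˡ-≤ _ σS ⟩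
      S * (suc J * μ (λ s → 𝟙 (¬? (Dm.calm? s)))) ≡⟨ lem S (suc J) _ ⟩
      suc J * (S * μ (λ s → 𝟙 (¬? (Dm.calm? s)))) ≤⟨ *-monoʳ-≤ (suc J) Dm.rough-mass ⟩
      suc J * ((128 + 30 * evc) * (R * T₁)) ≡⟨ lem′ (suc J) (128 + 30 * evc) R T₁ ⟩
      suc J * ((128 + 30 * evc) * R) * T₁ ∎) (≤-trans g₅ (≤-reflexive (sym (*-identityʳ σ))))
      where
      open ≤-Reasoning
      lem : ∀ a b c → a * (b * c) ≡ b * (a * c)
      lem = solve-∀
      lem′ : ∀ a b c d → a * (b * (c * d)) ≡ a * (b * c) * d
      lem′ = solve-∀

    descend : G * μ (λ s → 2 ^ (J ∸ yy s)) ≤ (G * suc J + 2 ^ J) * T₁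
    descend = begin
      G * μ (λ s → 2 ^ (J ∸ yy s)) ≡⟨ cong (G *_) (∑-cong Dm.uX λ s → cong (λ x → W s * 2 ^ (J ∸ x)) (sym (yy≡y s))) ⟩
      G * μ (λ s → 2 ^ (J ∸ Dm.y s)) ≤⟨ *-monoʳ-≤ G (Dm.descent c₁ c₂ (≤-trans (s≤s z≤n) (≤-reflexive (sym c₂≡))) cw J hcond) ⟩
      G * (suc J * (T₁ + 2 ^ J * m)) ≡⟨ lem G (suc J) T₁ (2 ^ J) m ⟩
      G * suc J * T₁ + 2 ^ J * (G * (suc J * m)) ≤⟨ +-monoʳ-≤ (G * suc J * T₁) (*-monoʳ-≤ (2 ^ J) rough-small) ⟩
      G * suc J * T₁ + 2 ^ J * (1 * T₁) ≡⟨ lem′ (G * suc J) T₁ (2 ^ J) ⟩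
      (G * suc J + 2 ^ J) * T₁ ∎
      where
      open ≤-Reasoning
      m = μ (λ s → 𝟙 (¬? (Dm.calm? s)))
      cw : ∀ s u → Dm.bd s u ≡ 0 → ∀ k₁ → 1 ≤ k₁ → suc k₁ ≤ ℓ → Legal s → c₁ * W s ≤ c₂ * W (Dm.sw u (Dm.it s (suc k₁) u) s)
      cw s u g k₁ a b l = Dm.Split.Lawful.weight s u g k₁ a b l c₁ c₂ c₁≡ c₂≡
      lem : ∀ g j t p m → g * (j * (t + p * m)) ≡ g * j * t + p * (g * (j * m))
      lem = solve-∀
      lem′ : ∀ a t p → a * t + p * (1 * t) ≡ (a + p) * t
      lem′ = solve-∀

    light-event : ∀ (E : Perm → ℕ) (F : Perm → ℕ) → (∀ s → E s ≤ 1) → (∀ s → E s ≤ F s) → G * μ (λ s → 𝟙NL s * F s) ≤ 1 * T₁ → G * μ E ≤ 2 * T₁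
    light-event E F E1 EF h = begin
      G * μ E ≤⟨ *-monoʳ-≤ G (μ-mono λ s _ → pt s) ⟩
      G * μ (λ s → 𝟙 (¬? (nl? s)) + 𝟙NL s * F s) ≡⟨ trans (cong (G *_) (μ-+ _ _)) (*-distribˡ-+ G _ _) ⟩
      G * μ (λ s → 𝟙 (¬? (nl? s))) + G * μ (λ s → 𝟙NL s * F s) ≤⟨ +-mono-≤ heavy-small h ⟩
      1 * T₁ + 1 * T₁ ≡⟨ lem T₁ ⟩
      2 * T₁ ∎
      where
      open ≤-Reasoning
      lem : ∀ t → 1 * t + 1 * t ≡ 2 * t
      lem = solve-∀
      pt : ∀ s → E s ≤ 𝟙 (¬? (nl? s)) + 𝟙NL s * F s
      pt s with nl? s
      ... | yes _ = ≤-trans (EF s) (≤-reflexive (sym (+-identityʳ (F s))))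
      ... | no _ = E1 s

    links-small : G * μ (λ s → 𝟙 (1 ≤? links s)) ≤ 2 * T₁
    links-small = light-event (λ s → 𝟙 (1 ≤? links s)) links (λ s → 𝟙≤1 (1 ≤? links s)) (λ s → 𝟙≤ (1 ≤? links s) id)
      (scale (σ * σ) (*-mono-≤ σ>0 σ>0) (begin
        σ * σ * μ (λ s → 𝟙NL s * links s) ≤⟨ *-monoˡ-≤ _ (*-mono-≤ σS σS) ⟩
        S * S * μ (λ s → 𝟙NL s * links s) ≡⟨ *-assoc S S _ ⟩
        S * (S * μ (λ s → 𝟙NL s * links s)) ≡⟨ cong (λ x → S * (S * x)) (∑-cong Dm.uX λ s → cong (λ x → W s * (𝟙NL s * x)) (∑-cong (fin n) λ a → cong₂ _*_ (sh-cong s a) (sh-cong s (M a)))) ⟩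
        S * (S * μ (λ s → 𝟙NL s * Lk.linkedN s)) ≤⟨ Lk.linked-mass ⟩
        786 * (n * (ℓ * ℓ)) * (R * R) * T₁ ∎)
        (≤-trans g₂ (≤-reflexive (sym (*-identityʳ (σ * σ))))))
      where open ≤-Reasoning

    shorts-small : G * μ (λ s → 𝟙 (suc K ≤? shorts s)) ≤ 2 * T₁
    shorts-small = light-event (λ s → 𝟙 (suc K ≤? shorts s)) (λ s → 𝟙 (suc K ≤? shorts s)) (λ s → 𝟙≤1 (suc K ≤? shorts s)) (λ s → ≤-refl)
      (scale (σ * suc K) (*-mono-≤ σ>0 (s≤s (z≤n {K}))) (begin
        σ * suc K * μ (λ s → 𝟙NL s * 𝟙 (suc K ≤? shorts s)) ≡⟨ trans (*-assoc σ (suc K) _) (cong (σ *_) (sym (μ-* (suc K) _))) ⟩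
        σ * μ (λ s → suc K * (𝟙NL s * 𝟙 (suc K ≤? shorts s))) ≤⟨ *-mono-≤ σS (μ-mono λ s _ → each s) ⟩
        S * μ (λ s → 𝟙NL s * Lk.shortN s) ≤⟨ Lk.short-mass ⟩
        3 * R * (n * ℓ) * T₁ ∎) (≤-trans g₃ (≤-reflexive (sym (*-identityʳ (σ * suc K))))))
      where
      open ≤-Reasoning
      lem : ∀ a b c → a * (b * c) ≡ b * (c * a)
      lem = solve-∀
      each : ∀ s → suc K * (𝟙NL s * 𝟙 (suc K ≤? shorts s)) ≤ 𝟙NL s * Lk.shortN s
      each s = begin
        suc K * (𝟙NL s * 𝟙 (suc K ≤? shorts s)) ≡⟨ lem (suc K) (𝟙NL s) _ ⟩
        𝟙NL s * (𝟙 (suc K ≤? shorts s) * suc K) ≤⟨ *-monoʳ-≤ (𝟙NL s) (𝟙*≤ (suc K ≤? shorts s) id) ⟩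
        𝟙NL s * shorts s ≡⟨ cong (𝟙NL s *_) (∑-cong (fin n) (sh-cong s)) ⟩
        𝟙NL s * Lk.shortN s ∎

    module PerS (s : Perm) where

      weigh : ∀ c → ∑ uMat (λ X → 𝟙 (legal? s) * match s X * c) ≡ W s * c
      weigh c = trans (∑-*ʳ uMat c _) (cong (_* c) (trans (∑-*ˡ uMat (𝟙 (legal? s)) _) (cong (𝟙 (legal? s) *_) (mass-count s))))

      clash-sum : 49 * (L * L) * ∑ uMat (λ X → 𝟙 (legal? s) * match s X * (𝟙 (shorts s ≤? K) * clashes Y s X)) ≤ 50 * (R * R) * (K * K) * W s
      clash-sum = begin
        49 * (L * L) * ∑ uMat (λ X → 𝟙 (legal? s) * match s X * (𝟙 (shorts s ≤? K) * clashes Y s X))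
          ≡⟨ cong (49 * (L * L) *_) (trans (∑-cong uMat (λ X → trans (lem₀ (𝟙 (legal? s)) (match s X) (𝟙 (shorts s ≤? K)) (clashes Y s X)) (cong (c₀ *_) (expand X))))
               (trans (∑-*ˡ uMat c₀ _) (cong (c₀ *_) (trans (∑-swap uMat (fin n) _) (∑-cong (fin n) λ a → trans (∑-swap uMat (fin n) _) (∑-cong (fin n) λ b → ∑-*ˡ uMat (𝟙 (sh? s a) * 𝟙 (sh? s b)) _)))))) ⟩
        49 * (L * L) * (c₀ * ∑ (fin n) (λ a → ∑ (fin n) λ b → 𝟙 (sh? s a) * 𝟙 (sh? s b) * ∑ uMat (λ X → match s X * 𝟙 (clashing? Y X a b))))
          ≡⟨ trans (lem₁ (49 * (L * L)) c₀ _) (cong (c₀ *_) (trans (sym (∑-*ˡ (fin n) (49 * (L * L)) _)) (∑-cong (fin n) λ a → trans (sym (∑-*ˡ (fin n) (49 * (L * L)) _)) (∑-cong (fin n) λ b → lem₁ (49 * (L * L)) (𝟙 (sh? s a) * 𝟙 (sh? s b)) _)))) ⟩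
        c₀ * ∑ (fin n) (λ a → ∑ (fin n) λ b → 𝟙 (sh? s a) * 𝟙 (sh? s b) * (49 * (L * L) * ∑ uMat (λ X → match s X * 𝟙 (clashing? Y X a b))))
          ≤⟨ *-monoʳ-≤ c₀ (∑-mono (fin n) λ a → ∑-mono (fin n) λ b → *-monoʳ-≤ (𝟙 (sh? s a) * 𝟙 (sh? s b)) (pair a b (b ≟F a) (b ≟F M a))) ⟩
        c₀ * ∑ (fin n) (λ a → ∑ (fin n) λ b → 𝟙 (sh? s a) * 𝟙 (sh? s b) * Q) ≡⟨ cong (c₀ *_) (trans (∑-cong (fin n) λ a → trans (∑-*ʳ (fin n) Q _) (cong (_* Q) (∑-*ˡ (fin n) (𝟙 (sh? s a)) _)))
             (trans (∑-*ʳ (fin n) Q _) (cong (_* Q) (∑-*ʳ (fin n) (shorts s) _)))) ⟩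
        c₀ * (shorts s * shorts s * Q) ≡⟨ lem₂ (𝟙 (legal? s)) (𝟙 (shorts s ≤? K)) (shorts s) Q ⟩
        𝟙 (shorts s ≤? K) * (𝟙 (legal? s) * (shorts s * shorts s * Q)) ≤⟨ 𝟙*≤ (shorts s ≤? K) (λ h → *-monoʳ-≤ (𝟙 (legal? s)) (*-monoˡ-≤ Q (*-mono-≤ h h))) ⟩
        𝟙 (legal? s) * (K * K * Q) ≡⟨ lem₃ (𝟙 (legal? s)) (K * K) (R * R) (mass s) ⟩
        50 * (R * R) * (K * K) * W s ∎
        where
        open ≤-Reasoning
        c₀ = 𝟙 (legal? s) * 𝟙 (shorts s ≤? K)
        Q = 50 * (R * R) * mass s
        lem₀ : ∀ a b c d → a * b * (c * d) ≡ a * c * (b * d)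
        lem₀ = solve-∀
        lem₁ : ∀ a b c → a * (b * c) ≡ b * (a * c)
        lem₁ = solve-∀
        lem₂ : ∀ a b c d → a * b * (c * c * d) ≡ b * (a * (c * c * d))
        lem₂ = solve-∀
        lem₃ : ∀ l k r m → l * (k * (50 * r * m)) ≡ 50 * r * k * (l * m)
        lem₃ = solve-∀
        expand : ∀ X → match s X * clashes Y s X ≡ ∑ (fin n) λ a → ∑ (fin n) λ b → 𝟙 (sh? s a) * 𝟙 (sh? s b) * (match s X * 𝟙 (clashing? Y X a b))
        expand X = trans (sym (∑-*ˡ (fin n) (match s X) _)) (∑-cong (fin n) λ a → trans (sym (∑-*ˡ (fin n) (match s X) _)) (∑-cong (fin n) λ b → lem₁ (match s X) (𝟙 (sh? s a) * 𝟙 (sh? s b)) _))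
        never : ∀ a b → (∀ X → ¬ Clashing Y X a b) → 49 * (L * L) * ∑ uMat (λ X → match s X * 𝟙 (clashing? Y X a b)) ≤ Q
        never a b h = ≤-trans (≤-reflexive (trans (cong (49 * (L * L) *_) (∑-zero uMat λ X → trans (cong (match s X *_) (𝟙-no (clashing? Y X a b) (h X))) (*-zeroʳ (match s X)))) (*-zeroʳ (49 * (L * L))))) z≤n
        pair : ∀ a b → Dec (b ≡ a) → Dec (b ≡ M a) → 49 * (L * L) * ∑ uMat (λ X → match s X * 𝟙 (clashing? Y X a b)) ≤ Q
        pair a b (yes e) _ = never a b λ X c → proj₁ c e
        pair a b (no _) (yes e) = never a b λ X c → proj₁ (proj₂ c) e
        pair a b (no b≢a) (no b≢M) = ≤-trans (*-monoʳ-≤ (49 * (L * L)) (∑-mono uMat λ X → *-monoʳ-≤ (match s X) (𝟙-mono (clashing? Y X a b) (clash? s yR zR a b X) λ (_ , _ , c) → c)))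
              (clash-mass s yR zR RL a b (b≢a ∘ sym) b≢M)

    clash-small : G * ∑ uPerm (λ s → ∑ uMat λ X → 𝟙 (legal? s) * match s X * (𝟙 (shorts s ≤? K) * clashes Y s X)) ≤ 1 * T₁
    clash-small = scale (49 * (L * L)) (*-mono-≤ {1} {49} (s≤s z≤n) (*-mono-≤ L>0 L>0)) (begin
      49 * (L * L) * ∑ uPerm (λ s → ∑ uMat λ X → 𝟙 (legal? s) * match s X * (𝟙 (shorts s ≤? K) * clashes Y s X)) ≡⟨ sym (∑-*ˡ uPerm (49 * (L * L)) _) ⟩
      ∑ uPerm (λ s → 49 * (L * L) * ∑ uMat λ X → 𝟙 (legal? s) * match s X * (𝟙 (shorts s ≤? K) * clashes Y s X)) ≤⟨ ∑-mono uPerm (λ s → PerS.clash-sum s) ⟩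
      ∑ uPerm (λ s → 50 * (R * R) * (K * K) * W s) ≡⟨ trans (∑-*ˡ uPerm (50 * (R * R) * (K * K)) W) (cong (50 * (R * R) * (K * K) *_) (∑-cong uPerm λ s → sym (*-identityʳ (W s)))) ⟩
      50 * (R * R) * (K * K) * T₁ ∎) (≤-trans g₄ (≤-reflexive (sym (*-identityʳ (49 * (L * L))))))
      where open ≤-Reasoning

    total : G * ∑ uPerm (λ s → ∑ uMat λ X → 𝟙 (legal? s) * match s X * (2 ^ (J ∸ yy s) + 2 ^ J * bad Y s X)) ≤ (G * suc J + 6 * 2 ^ J) * ∑ uPerm W
    total = begin
      G * ∑ uPerm (λ s → ∑ uMat λ X → 𝟙 (legal? s) * match s X * (2 ^ (J ∸ yy s) + 2 ^ J * bad Y s X))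
        ≡⟨ cong (G *_) (trans (∑-cong uPerm split) (trans (∑-+ uPerm _ _) (cong (A +_) (trans (∑-*ˡ uPerm (2 ^ J) _) (cong (2 ^ J *_) (trans (∑-+ uPerm _ _) (cong (B +_) (∑-+ uPerm _ _)))))))) ⟩
      G * (A + 2 ^ J * (B + (C + E))) ≡⟨ lem G A (2 ^ J) B C E ⟩
      G * A + 2 ^ J * (G * B + (G * C + G * E)) ≤⟨ +-mono-≤ descend (*-monoʳ-≤ (2 ^ J) (+-mono-≤ links-small (+-mono-≤ shorts-small clash-small))) ⟩
      (G * suc J + 2 ^ J) * T₁ + 2 ^ J * (2 * T₁ + (2 * T₁ + 1 * T₁)) ≡⟨ lem′ (G * suc J) (2 ^ J) T₁ ⟩
      -- The 6 is 1 from rough maps, 2 from links, 2 from too many persons on short cycles and 1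
      -- from clashes.
      (G * suc J + 6 * 2 ^ J) * T₁ ≡⟨ cong ((G * suc J + 6 * 2 ^ J) *_) (∑-cong uPerm λ s → *-identityʳ (W s)) ⟩
      (G * suc J + 6 * 2 ^ J) * ∑ uPerm W ∎
      where
      open ≤-Reasoning
      A = μ (λ s → 2 ^ (J ∸ yy s))
      B = μ (λ s → 𝟙 (1 ≤? links s))
      C = μ (λ s → 𝟙 (suc K ≤? shorts s))
      E = ∑ uPerm (λ s → ∑ uMat λ X → 𝟙 (legal? s) * match s X * (𝟙 (shorts s ≤? K) * clashes Y s X))
      lem : ∀ g a p b c e → g * (a + p * (b + (c + e))) ≡ g * a + p * (g * b + (g * c + g * e))
      lem = solve-∀
      lem′ : ∀ a p t → (a + p) * t + p * (2 * t + (2 * t + 1 * t)) ≡ (a + 6 * p) * t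
      lem′ = solve-∀
      dist : ∀ m a p b c e → m * (a + p * (b + (c + e))) ≡ m * a + p * (m * b + (m * c + m * e))
      dist = solve-∀
      split : ∀ s → ∑ uMat (λ X → 𝟙 (legal? s) * match s X * (2 ^ (J ∸ yy s) + 2 ^ J * bad Y s X)) ≡
        W s * 2 ^ (J ∸ yy s) + 2 ^ J * (W s * 𝟙 (1 ≤? links s) + (W s * 𝟙 (suc K ≤? shorts s) + ∑ uMat λ X → 𝟙 (legal? s) * match s X * (𝟙 (shorts s ≤? K) * clashes Y s X)))
      split s = trans (∑-cong uMat λ X → dist (𝟙 (legal? s) * match s X) (2 ^ (J ∸ yy s)) (2 ^ J) (𝟙 (1 ≤? links s)) (𝟙 (suc K ≤? shorts s)) (𝟙 (shorts s ≤? K) * clashes Y s X))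
        (trans (∑-+ uMat _ _) (cong₂ _+_ (PerS.weigh s (2 ^ (J ∸ yy s))) (trans (∑-*ˡ uMat (2 ^ J) _) (cong (2 ^ J *_) (trans (∑-+ uMat _ _)
          (cong₂ _+_ (PerS.weigh s (𝟙 (1 ≤? links s))) (trans (∑-+ uMat _ _) (cong (_+ ∑ uMat (λ X → 𝟙 (legal? s) * match s X * (𝟙 (shorts s ≤? K) * clashes Y s X))) (PerS.weigh s (𝟙 (suc K ≤? shorts s)))))))))))

  -- Thresholds and alternatives read off from a matrix

  sc : Mat → Fin n → Fin n → ℕ
  sc X a b = toℕ (at X a b)

  Distinct : Mat → Set
  Distinct X = ∀ i j k → j ≢ i → k ≢ i → at X i j ≡ at X i k → j ≡ k

  -- Stability with weak inequalities. For distinct scores it follows from stability, by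
  -- `stable-strong`, and unlike distinctness it is a condition on pairs.
  Strong : Mat → Set
  Strong X = ∀ i j → j ≢ i → j ≢ M i → ¬ (at X i j Fin.≤ at X i (M i) × at X j i Fin.≤ at X j (M j))

  strong? : ∀ X → Dec (Strong X)
  strong? X = FinP.all? λ i → FinP.all? λ j → ¬? (j ≟F i) →-dec (¬? (j ≟F M i) →-dec ¬? ((at X i j FinP.≤? at X i (M i)) ×-dec (at X j i FinP.≤? at X j (M j))))

  -- Nobody acceptable to i, and accepting i, within the first R scores of i.
  Fail : Fin n → Mat → Set
  Fail i X = ∀ j → j ≢ i → j ≢ M i → ¬ (suc (toℕ (at X i j)) ≤ R × at X j i Fin.≤ at X j (M j))

  fail? : ∀ i X → Dec (Fail i X)
  fail? i X = FinP.all? λ j → ¬? (j ≟F i) →-dec (¬? (j ≟F M i) →-dec ¬? ((suc (toℕ (at X i j)) ≤? R) ×-dec (at X j i FinP.≤? at X j (M j))))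

  total-rank : Mat → ℕ
  total-rank X = ∑ (fin n) λ i → suc (toℕ (at X i (M i)))

  Dom : Th → Th → Set
  Dom Z Y = ∀ i → lookup Z i Fin.< lookup Y i × suc (toℕ (lookup Y i)) ≤ R

  dom? : ∀ Z Y → Dec (Dom Z Y)
  dom? Z Y = FinP.all? λ i → (lookup Z i FinP.<? lookup Y i) ×-dec (suc (toℕ (lookup Y i)) ≤? R)

  Good : Mat → Th → Th → Perm → Set
  Good X Z Y s = Dom Z Y × Legal s × 0 < Cells.match Z Y s X

  good? : ∀ X Z Y s → Dec (Good X Z Y s)
  good? X Z Y s = dom? Z Y ×-dec legal? s ×-dec (0 <? Cells.match Z Y s X)

  module _ (X : Mat) (Z Y : Th) (s : Perm) (gd : Good X Z Y s) where
    open Cells Z Y s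

    private
      D′ = proj₁ gd
      Ls = proj₁ (proj₂ gd)
      cell : ∀ i j → i ≢ j → Cell i j (at X i j) (at X j i)
      cell = match-cell X (proj₂ (proj₂ gd))

    g-Z : ∀ i → at X i (M i) ≡ z i
    g-Z i = proj₁ (proj₁ (cell i (M i) (M≢ i ∘ sym)) refl)

    g-Y : ∀ i → at X i (lookup s i) ≡ y i
    g-Y i = proj₁ (proj₁ (proj₂ (cell i (lookup s i) (proj₁ (Ls i) ∘ sym))) refl)

    g-acc : ∀ i → at X (lookup s i) i Fin.≤ z (lookup s i)
    g-acc i = proj₂ (proj₁ (proj₂ (cell i (lookup s i) (proj₁ (Ls i) ∘ sym))) refl)

    g-strong : Strong X
    g-strong i j j≢i j≢M (p , q) = go (lookup s i ≟F j) (lookup s j ≟F i)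
      where
      p′ : at X i j Fin.≤ z i
      p′ = subst (at X i j Fin.≤_) (g-Z i) p
      q′ : at X j i Fin.≤ z j
      q′ = subst (at X j i Fin.≤_) (g-Z j) q
      go : Dec (lookup s i ≡ j) → Dec (lookup s j ≡ i) → ⊥
      go (yes refl) _ = <⇒≱ (proj₁ (D′ i)) (subst (Fin._≤ z i) (g-Y i) p′)
      go (no _) (yes refl) = <⇒≱ (proj₁ (D′ j)) (subst (Fin._≤ z j) (g-Y j) q′)
      go (no a) (no b) = proj₁ (proj₂ (proj₂ (proj₂ (cell i j (j≢i ∘ sym)))) j≢M a b) (≤-trans p′ (<⇒≤ (proj₁ (D′ i))) , q′)

    g-best : ∀ a j → j ≢ a → j ≢ M a → j ≢ lookup s a → at X j a Fin.≤ at X j (M j) → at X a (lookup s a) Fin.< at X a j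
    g-best a j j≢a j≢M j≢s q = go (lookup s j ≟F a)
      where
      q′ : at X j a Fin.≤ z j
      q′ = subst (at X j a Fin.≤_) (g-Z j) q
      go : Dec (lookup s j ≡ a) → at X a (lookup s a) Fin.< at X a j
      go (yes refl) = ⊥-elim (<⇒≱ (proj₁ (D′ j)) (subst (Fin._≤ z j) (g-Y j) q′))
      go (no b) = subst (Fin._< at X a j) (sym (g-Y a)) (≰⇒> λ le → proj₁ (proj₂ (proj₂ (proj₂ (cell a j (j≢a ∘ sym)))) j≢M (λ e → j≢s (sym e)) b) (le , q′))

  -- `Z` is read off along `M`, and `s i` is strictly the best among those accepting `i`: a second
  -- candidate would have to beat it and be beaten by it.
  good-unique : ∀ X Z Y s Z′ Y′ s′ → Good X Z Y s → Good X Z′ Y′ s′ → Z ≡ Z′ × Y ≡ Y′ × s ≡ s′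
  good-unique X Z Y s Z′ Y′ s′ g g′ = eZ , vec-ext Y Y′ (λ i → trans (sym (g-Y X Z Y s g i)) (trans (cong (at X i) (es i)) (g-Y X Z′ Y′ s′ g′ i))) , vec-ext s s′ es
    where
    eZ : Z ≡ Z′
    eZ = vec-ext Z Z′ λ i → trans (sym (g-Z X Z Y s g i)) (g-Z X Z′ Y′ s′ g′ i)
    half : ∀ Z Y s Z′ Y′ s′ → Good X Z Y s → Good X Z′ Y′ s′ → ∀ i → lookup s i ≢ lookup s′ i → at X i (lookup s i) Fin.< at X i (lookup s′ i)
    half Z Y s Z′ Y′ s′ g g′ i ne = g-best X Z Y s g i (lookup s′ i) (proj₁ (proj₁ (proj₂ g′) i)) (proj₁ (proj₂ (proj₁ (proj₂ g′) i))) (ne ∘ sym)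
      (subst (at X (lookup s′ i) i Fin.≤_) (sym (g-Z X Z′ Y′ s′ g′ (lookup s′ i))) (g-acc X Z′ Y′ s′ g′ i))
    es : ∀ i → lookup s i ≡ lookup s′ i
    es i with lookup s i ≟F lookup s′ i
    ... | yes e = e
    ... | no ne = ⊥-elim (<-asym (half Z Y s Z′ Y′ s′ g g′ i ne) (half Z′ Y′ s′ Z Y s g′ g i (ne ∘ sym)))

  -- `s i` has the least score among those accepting `i`; without `Fail` there is one of rank at
  -- most `R`. Two persons choosing each other would accept each other, against `Strong`.
  good-exists : ∀ X → Distinct X → Strong X → (∀ i → ¬ Fail i X) → ∃ λ Z → ∃ λ Y → ∃ λ s → Good X Z Y s
  good-exists X ds st nf = Z , Y , s , dom , leg , ≤-reflexive (sym (Cells.cell-match Z Y s X cellOK))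
    where
    Acc : Fin n → Fin n → Set
    Acc i j = j ≢ i × j ≢ M i × at X j i Fin.≤ at X j (M j)
    acc? : ∀ i j → Dec (Acc i j)
    acc? i j = ¬? (j ≟F i) ×-dec ¬? (j ≟F M i) ×-dec (at X j i FinP.≤? at X j (M j))
    wit : ∀ i → ∃ λ j → Acc i j × suc (toℕ (at X i j)) ≤ R
    wit i with FinP.any? (λ j → acc? i j ×-dec (suc (toℕ (at X i j)) ≤? R))
    ... | yes w = w
    ... | no ¬w = ⊥-elim (nf i λ j a b (c , d) → ¬w (j , (a , b , d) , c))
    best : ∀ i → ∃ λ j → Acc i j × ∀ k → Acc i k → sc X i j ≤ sc X i k
    best i = argmin n (acc? i) (sc X i) (proj₁ (wit i) , proj₁ (proj₂ (wit i)))
    b : Fin n → Fin n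
    b i = proj₁ (best i)
    bA : ∀ i → Acc i (b i)
    bA i = proj₁ (proj₂ (best i))
    s : Perm
    s = tabulate b
    Z Y : Th
    Z = tabulate λ i → at X i (M i)
    Y = tabulate λ i → at X i (b i)
    sE : ∀ i → lookup s i ≡ b i
    sE = VecP.lookup∘tabulate b
    ZE : ∀ i → lookup Z i ≡ at X i (M i)
    ZE = VecP.lookup∘tabulate _
    YE : ∀ i → lookup Y i ≡ at X i (b i)
    YE = VecP.lookup∘tabulate _
    above : ∀ i j → Acc i j → at X i (M i) Fin.< at X i j
    above i j (p , q , r) = ≰⇒> λ le → st i j p q (le , r)
    dom : Dom Z Y
    dom i = subst₂ Fin._<_ (sym (ZE i)) (sym (YE i)) (above i (b i) (bA i)) ,
      ≤-trans (s≤s (≤-trans (≤-reflexive (cong toℕ (YE i))) (proj₂ (proj₂ (best i)) (proj₁ (wit i)) (proj₁ (proj₂ (wit i)))))) (proj₂ (proj₂ (wit i)))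
    noMut : ∀ i → b (b i) ≢ i
    noMut i e = <⇒≱ (above (b i) i (subst (Acc (b i)) e (bA (b i)))) (proj₂ (proj₂ (bA i)))
    leg : Legal s
    leg i = subst (_≢ i) (sym (sE i)) (proj₁ (bA i)) , subst (_≢ M i) (sym (sE i)) (proj₁ (proj₂ (bA i))) ,
      λ e → noMut i (trans (sym (trans (cong (lookup s) (sE i)) (sE (b i)))) e)
    open Cells Z Y s using (Cell; Free)
    freeOK : ∀ i j → i ≢ j → j ≢ M i → lookup s i ≢ j → ¬ (at X i j Fin.≤ lookup Y i × at X j i Fin.≤ lookup Z j)
    freeOK i j i≢j j≢M s≢ (p , q) = s≢ (trans (sE i) (ds i (b i) j (proj₁ (bA i)) (i≢j ∘ sym)
        (FinP.toℕ-injective (≤-antisym (proj₂ (proj₂ (best i)) j (i≢j ∘ sym , j≢M , subst (at X j i Fin.≤_) (ZE j) q)) (subst (at X i j Fin.≤_) (YE i) p)))))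
    cellOK : ∀ i j → i ≢ j → Cell i j (at X i j) (at X j i)
    cellOK i j i≢j =
      (λ { refl → sym (ZE i) , trans (cong (at X (M i)) (sym (MM i))) (sym (ZE (M i))) }) ,
      (λ { refl → trans (cong (at X i) (sE i)) (sym (YE i)) , subst₂ (λ u v → at X u i Fin.≤ v) (sym (sE i)) (trans (sym (ZE (b i))) (cong (lookup Z) (sym (sE i)))) (proj₂ (proj₂ (bA i))) }) ,
      (λ { refl → trans (cong (at X j) (sE j)) (sym (YE j)) , subst₂ (λ u v → at X u j Fin.≤ v) (sym (sE j)) (trans (sym (ZE (b j))) (cong (lookup Z) (sym (sE j)))) (proj₂ (proj₂ (bA j))) }) ,
      λ n₁ n₂ n₃ → freeOK i j i≢j n₁ n₂ , freeOK j i (i≢j ∘ sym) (λ e → n₁ (trans (sym (MM j)) (cong M (sym e)))) n₃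

  stables : Mat → ℕ
  stables X = ∑ uPerm λ N → 𝟙 (stableFor? (sc X) N)

  total-rankZ : Th → ℕ
  total-rankZ Z = ∑ (fin n) λ i → suc (toℕ (lookup Z i))

  term : Mat → Th → Th → Perm → ℕ
  term X Z Y s = 𝟙 (legal? s) * Cells.match Z Y s X * (2 ^ (J ∸ yy s) + 2 ^ J * bad Y s X)

  guard : Th → Th → ℕ
  guard Z Y = 𝟙 (dom? Z Y) * 𝟙 (σ ≤? total-rankZ Z)

  -- Chosen so that `stables X * cost X` reaches `2 ^ J`: an exceptional event is charged `2 ^ J`,
  -- and `y` independent rotations give `2 ^ y` stable matchings against a charge of `2 ^ (J ∸ y)`.
  cost : Mat → ℕ
  cost X = 2 ^ J * (∑ (fin n) (λ i → 𝟙 (fail? i X)) + 𝟙 (suc (total-rank X) ≤? σ)) +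
           ∑ uTh λ Z → ∑ uTh λ Y → guard Z Y * ∑ uPerm (term X Z Y)

  cost-bound : ∀ X → Distinct X → Strong X → 1 ≤ stables X → 2 ^ J ≤ stables X * cost X
  cost-bound X ds st m≥1 = go (FinP.any? (λ i → fail? i X)) (suc (total-rank X) ≤? σ)
    where
    A = ∑ (fin n) (λ i → 𝟙 (fail? i X))
    B = 𝟙 (suc (total-rank X) ≤? σ)
    C = ∑ uTh λ Z → ∑ uTh λ Y → guard Z Y * ∑ uPerm (term X Z Y)
    early : 1 ≤ A + B → 2 ^ J ≤ stables X * cost X
    early h = ≤-trans (≤-reflexive (sym (*-identityʳ (2 ^ J)))) (≤-trans (*-monoʳ-≤ (2 ^ J) h) (≤-trans (m≤m+n _ C) (≤-trans (≤-reflexive (sym (*-identityˡ _))) (*-monoˡ-≤ (cost X) m≥1))))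
    go : Dec (∃ λ i → Fail i X) → Dec (suc (total-rank X) ≤ σ) → 2 ^ J ≤ stables X * cost X
    go (yes (i , f)) _ = early (≤-trans (≤-trans (≤-reflexive (sym (𝟙-yes (fail? i X) f))) (f≤∑ (fin n) (λ i → 𝟙 (fail? i X)) i)) (m≤m+n A B))
    go (no _) (yes h) = early (≤-trans (≤-reflexive (sym (𝟙-yes (suc (total-rank X) ≤? σ) h))) (m≤n+m B A))
    go (no nf) (no ns) = main (good-exists X ds st λ i f → nf (i , f))
      where
      main : (∃ λ Z → ∃ λ Y → ∃ λ s → Good X Z Y s) → 2 ^ J ≤ stables X * cost X
      main (Z , Y , s , gd@(dm , lg , mt)) = fin-step (bad Y s X) refl
        where
        open ≤-Reasoning
        tr : total-rank X ≡ total-rankZ Z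
        tr = ∑-cong (fin n) λ i → cong (suc ∘ toℕ) (g-Z X Z Y s gd i)
        guard1 : guard Z Y ≡ 1
        guard1 = cong₂ _*_ (𝟙-yes (dom? Z Y) dm) (𝟙-yes (σ ≤? total-rankZ Z) (≤-trans (ℕ.s≤s⁻¹ (≰⇒> ns)) (≤-reflexive tr)))
        val = 2 ^ (J ∸ yy s) + 2 ^ J * bad Y s X
        val≤ : val ≤ cost X
        val≤ = begin
          val ≡⟨ sym (*-identityˡ val) ⟩
          1 * val ≤⟨ *-monoˡ-≤ val (≤-trans mt (≤-reflexive (sym (trans (cong (_* Cells.match Z Y s X) (𝟙-yes (legal? s) lg)) (*-identityˡ _))))) ⟩
          term X Z Y s ≤⟨ f≤∑ uPerm (term X Z Y) s ⟩
          ∑ uPerm (term X Z Y) ≡⟨ sym (trans (cong (_* ∑ uPerm (term X Z Y)) guard1) (*-identityˡ _)) ⟩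
          guard Z Y * ∑ uPerm (term X Z Y) ≤⟨ f≤∑ uTh (λ Y → guard Z Y * ∑ uPerm (term X Z Y)) Y ⟩
          ∑ uTh (λ Y → guard Z Y * ∑ uPerm (term X Z Y)) ≤⟨ f≤∑ uTh (λ Z → ∑ uTh λ Y → guard Z Y * ∑ uPerm (term X Z Y)) Z ⟩
          C ≤⟨ m≤n+m C _ ⟩
          cost X ∎
        fin-step : ∀ b → bad Y s X ≡ b → 2 ^ J ≤ stables X * cost X
        fin-step (suc b) e = begin
          2 ^ J ≡⟨ sym (*-identityʳ (2 ^ J)) ⟩
          2 ^ J * 1 ≤⟨ *-monoʳ-≤ (2 ^ J) (≤-trans (s≤s z≤n) (≤-reflexive (sym e))) ⟩
          2 ^ J * bad Y s X ≤⟨ m≤n+m _ (2 ^ (J ∸ yy s)) ⟩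
          val ≤⟨ val≤ ⟩
          cost X ≡⟨ sym (*-identityˡ _) ⟩
          1 * cost X ≤⟨ *-monoˡ-≤ (cost X) m≥1 ⟩
          stables X * cost X ∎
        fin-step zero e = begin
          -- The truncated difference also covers more than `J` cycles.
          2 ^ J ≤⟨ ^-monoʳ-≤ 2 (m≤n+m∸n J (yy s)) ⟩
          2 ^ (yy s + (J ∸ yy s)) ≡⟨ ^-distribˡ-+-* 2 (yy s) (J ∸ yy s) ⟩
          2 ^ yy s * 2 ^ (J ∸ yy s) ≤⟨ *-mono-≤ rc (≤-trans (m≤m+n _ _) val≤) ⟩
          stables X * cost X ∎
          where
          b₁ : links s ≡ 0
          b₁ = none (links s) refl
            where none : ∀ l → links s ≡ l → links s ≡ 0
                  none zero q = q
                  none (suc l) q = ⊥-elim (1+n≢0 (trans (sym (𝟙-yes (1 ≤? links s) (≤-trans (s≤s z≤n) (≤-reflexive (sym q))))) (m+n≡0⇒m≡0 _ e)))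
          e₂ : 𝟙 (suc K ≤? shorts s) ≡ 0
          e₂ = m+n≡0⇒m≡0 _ (m+n≡0⇒n≡0 (𝟙 (1 ≤? links s)) e)
          shK : shorts s ≤ K
          shK = ℕ.s≤s⁻¹ (≰⇒> λ h → 1+n≢0 (trans (sym (𝟙-yes (suc K ≤? shorts s) h)) e₂))
          b₃ : clashes Y s X ≡ 0
          b₃ = trans (sym (trans (cong (_* clashes Y s X) (𝟙-yes (shorts s ≤? K) shK)) (*-identityˡ _))) (m+n≡0⇒n≡0 (𝟙 (suc K ≤? shorts s)) (m+n≡0⇒n≡0 (𝟙 (1 ≤? links s)) e))
          unl : ∀ a → R′.Short s a → R′.Short s (M a) → ⊥
          unl a h h′ = 1+n≢0 (trans (sym (cong₂ _*_ (𝟙-yes (sh? s a) h) (𝟙-yes (sh? s (M a)) h′))) (n≤0⇒n≡0 (≤-trans (f≤∑ (fin n) (λ a → 𝟙 (sh? s a) * 𝟙 (sh? s (M a))) a) (≤-reflexive b₁))))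
          calm : ∀ a b → R′.Short s a → R′.Short s b → b ≢ a → b ≢ M a → ¬ (sc X a b < sc X a (lookup s a) × sc X b a < sc X b (lookup s b))
          calm a b h h′ n₁ n₂ (p , q) = 1+n≢0 (trans (sym (cong₂ _*_ (cong₂ _*_ (𝟙-yes (sh? s a) h) (𝟙-yes (sh? s b) h′)) (𝟙-yes (clashing? Y X a b)
               (n₁ , n₂ , subst (at X a b Fin.<_) (g-Y X Z Y s gd a) p , subst (at X b a Fin.<_) (g-Y X Z Y s gd b) q))))
             (n≤0⇒n≡0 (≤-trans (f≤∑ (fin n) (λ b → 𝟙 (sh? s a) * 𝟙 (sh? s b) * 𝟙 (clashing? Y X a b)) b)
               (≤-trans (f≤∑ (fin n) (λ a → ∑ (fin n) λ b → 𝟙 (sh? s a) * 𝟙 (sh? s b) * 𝟙 (clashing? Y X a b)) a) (≤-reflexive b₃)))))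
          rc : 2 ^ yy s ≤ stables X
          rc = Rot.RotStable.rot-count matching cycleWeights s (sc X) st (λ a → proj₁ (lg a) , proj₁ (proj₂ (lg a)))
             (λ a → subst (at X (lookup s a) a Fin.≤_) (sym (g-Z X Z Y s gd (lookup s a))) (g-acc X Z Y s gd a))
             (λ a j → g-best X Z Y s gd a j) unl calm (yy s) (m/n*n≤m _ D)

  stable-strong : ∀ X → Distinct X → (∀ a b → b ≢ a → b ≢ M a → ¬ (sc X a b < sc X a (M a) × sc X b a < sc X b (M b))) → Strong X
  stable-strong X ds h i j j≢i j≢M (p , q) = h i j j≢i j≢M
    (≤∧≢⇒< p (λ e → j≢M (ds i j (M i) j≢i (M≢ i) (FinP.toℕ-injective e))) ,
     ≤∧≢⇒< q (λ e → j≢M (trans (sym (MM j)) (cong M (sym (ds j i (M j) (j≢i ∘ sym) (M≢ j) (FinP.toℕ-injective e)))))))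

  planted : ℕ
  planted = ∑ uMat λ X → 𝟙 (strong? X)

  -- By `good-unique` the events for different `Z`, `Y`, `s` are disjoint, and each implies
  -- `Strong`.
  weights≤planted : ∑ uTh (λ Z → ∑ uTh λ Y → 𝟙 (dom? Z Y) * ∑ uPerm λ s → 𝟙 (legal? s) * Cells.mass Z Y s) ≤ planted
  weights≤planted = begin
    ∑ uTh (λ Z → ∑ uTh λ Y → 𝟙 (dom? Z Y) * ∑ uPerm λ s → 𝟙 (legal? s) * Cells.mass Z Y s)
      ≡⟨ ∑-cong uTh (λ Z → ∑-cong uTh λ Y → trans (sym (∑-*ˡ uPerm (𝟙 (dom? Z Y)) _)) (∑-cong uPerm λ s → trans (cong (λ x → 𝟙 (dom? Z Y) * (𝟙 (legal? s) * x)) (sym (Cells.mass-count Z Y s)))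
           (trans (cong (𝟙 (dom? Z Y) *_) (sym (∑-*ˡ uMat (𝟙 (legal? s)) _))) (sym (∑-*ˡ uMat (𝟙 (dom? Z Y)) _))))) ⟩
    ∑ (uTh ⊗ (uTh ⊗ uPerm)) (λ (Z , Y , s) → ∑ uMat λ X → 𝟙 (dom? Z Y) * (𝟙 (legal? s) * Cells.match Z Y s X))
      ≡⟨ ∑-swap (uTh ⊗ (uTh ⊗ uPerm)) uMat _ ⟩
    ∑ uMat (λ X → ∑ (uTh ⊗ (uTh ⊗ uPerm)) λ (Z , Y , s) → 𝟙 (dom? Z Y) * (𝟙 (legal? s) * Cells.match Z Y s X))
      ≤⟨ ∑-mono uMat each ⟩
    planted ∎
    where
    open ≤-Reasoning
    ind : ∀ X Z Y s → 𝟙 (dom? Z Y) * (𝟙 (legal? s) * Cells.match Z Y s X) ≤ 𝟙 (good? X Z Y s)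
    ind X Z Y s = 𝟙*≤ (dom? Z Y) λ d → 𝟙*≤ (legal? s) λ l → lem (Cells.match Z Y s X) refl d l
      where lem : ∀ m → Cells.match Z Y s X ≡ m → Dom Z Y → Legal s → Cells.match Z Y s X ≤ 𝟙 (good? X Z Y s)
            lem zero e _ _ = ≤-trans (≤-reflexive e) z≤n
            lem (suc m) e d l = ≤-trans (Cells.match≤1 Z Y s X) (≤-reflexive (sym (𝟙-yes (good? X Z Y s) (d , l , ≤-trans (s≤s z≤n) (≤-reflexive (sym e))))))
    each : ∀ X → ∑ (uTh ⊗ (uTh ⊗ uPerm)) (λ (Z , Y , s) → 𝟙 (dom? Z Y) * (𝟙 (legal? s) * Cells.match Z Y s X)) ≤ 𝟙 (strong? X)
    each X = ≤-trans (∑-mono (uTh ⊗ (uTh ⊗ uPerm)) λ (Z , Y , s) → ind X Z Y s) (go (strong? X))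
      where
      go : (d : Dec (Strong X)) → ∑ (uTh ⊗ (uTh ⊗ uPerm)) (λ (Z , Y , s) → 𝟙 (good? X Z Y s)) ≤ 𝟙 d
      go (yes _) = ∑-unique≤1 (uTh ⊗ (uTh ⊗ uPerm)) (λ (Z , Y , s) → good? X Z Y s) λ (Z , Y , s) (Z′ , Y′ , s′) g g′ →
        let a , b , c = good-unique X Z Y s Z′ Y′ s′ g g′ in cong₂ _,_ a (cong₂ _,_ b c)
      go (no ¬st) = ≤-reflexive (∑-zero (uTh ⊗ (uTh ⊗ uPerm)) λ (Z , Y , s) → 𝟙-no (good? X Z Y s) λ g → ¬st (g-strong X Z Y s g))

  main-sum : G * ∑ uMat (λ X → ∑ uTh λ Z → ∑ uTh λ Y → guard Z Y * ∑ uPerm (term X Z Y)) ≤ (G * suc J + 6 * 2 ^ J) * planted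
  main-sum = begin
    G * ∑ uMat (λ X → ∑ uTh λ Z → ∑ uTh λ Y → guard Z Y * ∑ uPerm (term X Z Y))
      ≡⟨ cong (G *_) (trans (∑-swap uMat (uTh ⊗ uTh) (λ X (Z , Y) → guard Z Y * ∑ uPerm (term X Z Y))) (∑-cong (uTh ⊗ uTh) λ (Z , Y) → trans (∑-*ˡ uMat (guard Z Y) _) (cong (guard Z Y *_) (∑-swap uMat uPerm (λ X s → term X Z Y s))))) ⟩
    G * ∑ (uTh ⊗ uTh) (λ (Z , Y) → guard Z Y * ∑ uPerm λ s → ∑ uMat λ X → term X Z Y s) ≡⟨ sym (∑-*ˡ (uTh ⊗ uTh) G _) ⟩
    ∑ (uTh ⊗ uTh) (λ (Z , Y) → G * (guard Z Y * ∑ uPerm λ s → ∑ uMat λ X → term X Z Y s)) ≤⟨ ∑-mono (uTh ⊗ uTh) (λ (Z , Y) → each Z Y) ⟩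
    ∑ (uTh ⊗ uTh) (λ (Z , Y) → H * (𝟙 (dom? Z Y) * ∑ uPerm λ s → 𝟙 (legal? s) * Cells.mass Z Y s)) ≡⟨ ∑-*ˡ (uTh ⊗ uTh) H _ ⟩
    H * ∑ (uTh ⊗ uTh) (λ (Z , Y) → 𝟙 (dom? Z Y) * ∑ uPerm λ s → 𝟙 (legal? s) * Cells.mass Z Y s) ≤⟨ *-monoʳ-≤ H weights≤planted ⟩
    H * planted ∎
    where
    open ≤-Reasoning
    H = G * suc J + 6 * 2 ^ J
    lem : ∀ g a b c → g * (a * b * c) ≡ a * (b * (g * c))
    lem = solve-∀
    lem′ : ∀ a b c → a * (b * c) ≡ b * (a * c)
    lem′ = solve-∀
    each : ∀ Z Y → G * (guard Z Y * ∑ uPerm (λ s → ∑ uMat λ X → term X Z Y s)) ≤ H * (𝟙 (dom? Z Y) * ∑ uPerm λ s → 𝟙 (legal? s) * Cells.mass Z Y s)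
    each Z Y = begin
      G * (guard Z Y * ∑ uPerm (λ s → ∑ uMat λ X → term X Z Y s)) ≡⟨ lem G (𝟙 (dom? Z Y)) (𝟙 (σ ≤? total-rankZ Z)) _ ⟩
      𝟙 (dom? Z Y) * (𝟙 (σ ≤? total-rankZ Z) * (G * ∑ uPerm (λ s → ∑ uMat λ X → term X Z Y s)))
        ≤⟨ 𝟙*≤𝟙* (dom? Z Y) (λ d → 𝟙*≤ (σ ≤? total-rankZ Z) λ h →
             Fixed.total Z Y (λ i → proj₂ (d i)) (λ i → ≤-trans (s≤s (<⇒≤ (proj₁ (d i)))) (proj₂ (d i))) h) ⟩
      𝟙 (dom? Z Y) * (H * ∑ uPerm λ s → 𝟙 (legal? s) * Cells.mass Z Y s) ≡⟨ lem′ (𝟙 (dom? Z Y)) H _ ⟩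
      H * (𝟙 (dom? Z Y) * ∑ uPerm λ s → 𝟙 (legal? s) * Cells.mass Z Y s) ∎

  -- The expected number of stable matchings

  Kx : ℕ
  -- Room for `asum u + Sq u`, both of which are at most (nL)².
  Kx = n * L * (n * L) + n * L * (n * L)

  open Exp N₁ Kx public

  cell : (Fin n → ℕ) → Fin n → Fin n → ℕ
  cell u i j with j ≟F M i
  ... | yes _ = 0
  ... | no _ = u i * u j

  cell-yes : ∀ u i j → j ≡ M i → cell u i j ≡ 0
  cell-yes u i j e with j ≟F M i
  ... | yes _ = refl
  ... | no ne = ⊥-elim (ne e)

  cell-no : ∀ u i j → j ≢ M i → cell u i j ≡ u i * u j
  cell-no u i j ne with j ≟F M i
  ... | yes e = ⊥-elim (ne e)
  ... | no _ = refl

  -- By `count-req` and `pair-exp`, the probability that no unmatched pair blocks is bounded by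
  -- about exp(- asum u / N).
  asum : (Fin n → ℕ) → ℕ
  asum u = ∑₂ n (cell u)

  M-flip : ∀ {i j} → i ≡ M j → j ≡ M i
  M-flip {i} {j} e = trans (sym (MM j)) (cong M (sym e))

  mm : (Fin n → ℕ) → Fin n → Fin n → ℕ
  mm u i j = 𝟙 (j ≟F M i) * (u i * u j)

  mm-sym : ∀ u i j → mm u i j ≡ mm u j i
  mm-sym u i j = cong₂ _*_ (𝟙-cong (j ≟F M i) (i ≟F M j) M-flip M-flip) (*-comm (u i) (u j))

  uu : (Fin n → ℕ) → Fin n → Fin n → ℕ
  uu u i j = u i * u j

  cell+mm : ∀ u i j → cell u i j + mm u i j ≡ uu u i j
  cell+mm u i j with j ≟F M i
  ... | yes _ = +-identityʳ _
  ... | no _ = +-identityʳ _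

  asum+ : ∀ u → asum u + ∑₂ n (mm u) ≡ ∑₂ n (uu u)
  asum+ u = trans (sym (∑₂-+ n (cell u) (mm u))) (∑₂-cong n λ i j → cell+mm u i j)
    where
    ∑₂-cong : ∀ n {f g : Fin n → Fin n → ℕ} → (∀ i j → f i j ≡ g i j) → ∑₂ n f ≡ ∑₂ n g
    ∑₂-cong zero h = refl
    ∑₂-cong (suc n) h = cong₂ _+_ (∑-cong (fin n) λ j → h zero (suc j)) (∑₂-cong n λ i j → h (suc i) (suc j))

  Su Sq : (Fin n → ℕ) → ℕ
  Su u = ∑ (fin n) u
  Sq u = ∑ (fin n) (λ i → u i * u i)

  uu-double : ∀ u → 2 * ∑₂ n (uu u) + Sq u ≡ Su u * Su u
  uu-double u = trans (∑₂-double n (uu u) (λ i j → *-comm (u i) (u j))) (trans (∑-cong (fin n) λ i → ∑-*ˡ (fin n) (u i) u) (∑-*ʳ (fin n) (Su u) u))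

  mm-double : ∀ u → 2 * ∑₂ n (mm u) ≤ Sq u
  mm-double u = begin
    2 * ∑₂ n (mm u) ≤⟨ m≤m+n _ _ ⟩
    2 * ∑₂ n (mm u) + ∑ (fin n) (λ i → mm u i i) ≡⟨ ∑₂-double n (mm u) (mm-sym u) ⟩
    ∑ (fin n) (λ i → ∑ (fin n) (mm u i)) ≡⟨ ∑-cong (fin n) (λ i → ∑-δ (fin n) (λ j → u i * u j) (M i)) ⟩
    ∑ (fin n) (λ i → u i * u (M i)) ≤⟨ *-cancelˡ-≤ 2 (begin
        2 * ∑ (fin n) (λ i → u i * u (M i)) ≡⟨ sym (∑-*ˡ (fin n) 2 _) ⟩
        ∑ (fin n) (λ i → 2 * (u i * u (M i))) ≤⟨ ∑-mono (fin n) (λ i → amgm (u i) (u (M i))) ⟩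
        ∑ (fin n) (λ i → u i * u i + u (M i) * u (M i)) ≡⟨ ∑-+ (fin n) _ _ ⟩
        Sq u + ∑ (fin n) (λ i → u (M i) * u (M i)) ≡⟨ cong (Sq u +_) (∑-bij (fin n) (fin n) M M MM MM (λ i → u i * u i)) ⟩
        Sq u + Sq u ≡⟨ cong (Sq u +_) (sym (+-identityʳ (Sq u))) ⟩
        2 * Sq u ∎) ⟩
    Sq u ∎
    where
    open ≤-Reasoning
    amgm : ∀ a b → 2 * (a * b) ≤ a * a + b * b
    amgm a b with ≤-total a b
    ... | inj₁ q = subst (λ x → 2 * (a * x) ≤ a * a + x * x) (m+[n∸m]≡n q) (≤-trans (m≤m+n _ ((b ∸ a) * (b ∸ a))) (≤-reflexive (lem a (b ∸ a))))
      where lem : ∀ a d → 2 * (a * (a + d)) + d * d ≡ a * a + (a + d) * (a + d)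
            lem = solve-∀
    ... | inj₂ q = subst (λ x → 2 * (x * b) ≤ x * x + b * b) (m+[n∸m]≡n q) (≤-trans (m≤m+n _ ((a ∸ b) * (a ∸ b))) (≤-reflexive (lem b (a ∸ b))))
      where lem : ∀ b d → 2 * ((b + d) * b) + d * d ≡ (b + d) * (b + d) + b * b
            lem = solve-∀

  tri2 : ∀ S → 2 * tri S + S ≡ S * S
  tri2 zero = refl
  tri2 (suc S) = trans (lem (tri S) S) (trans (cong (λ x → x + (S + suc S)) (tri2 S)) (lem′ S))
    where lem : ∀ t s → 2 * (t + s) + suc s ≡ 2 * t + s + (s + suc s)
          lem = solve-∀
          lem′ : ∀ s → s * s + (s + suc s) ≡ suc s * suc s
          lem′ = solve-∀

  -- Makes the exponent a function of the total rank alone. The squares and the matched pairs, twice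
  -- whose sum is at most that of the squares, are given away; `e-recover` pays for this person by
  -- person.
  tri≤ : ∀ u → tri (Su u) ≤ asum u + Sq u
  tri≤ u = *-cancelˡ-≤ 2 (begin
    2 * tri (Su u) ≤⟨ m≤m+n _ (Su u) ⟩
    2 * tri (Su u) + Su u ≡⟨ trans (tri2 (Su u)) (sym (uu-double u)) ⟩
    2 * ∑₂ n (uu u) + Sq u ≡⟨ cong (λ x → 2 * x + Sq u) (sym (asum+ u)) ⟩
    2 * (asum u + ∑₂ n (mm u)) + Sq u ≡⟨ lem (asum u) (∑₂ n (mm u)) (Sq u) ⟩
    2 * asum u + (2 * ∑₂ n (mm u) + Sq u) ≤⟨ +-monoʳ-≤ (2 * asum u) (+-monoˡ-≤ (Sq u) (mm-double u)) ⟩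
    2 * asum u + (Sq u + Sq u) ≡⟨ lem′ (asum u) (Sq u) ⟩
    2 * (asum u + Sq u) ∎)
    where
    open ≤-Reasoning
    lem : ∀ a b c → 2 * (a + b) + c ≡ 2 * a + (2 * b + c)
    lem = solve-∀
    lem′ : ∀ a c → 2 * a + (c + c) ≡ 2 * (a + c)
    lem′ = solve-∀

  module _ (u : Fin n → ℕ) (u≤L : ∀ i → u i ≤ L) where

    Su≤ : Su u ≤ n * L
    Su≤ = ≤-trans (∑-mono (fin n) u≤L) (≤-reflexive (∑-constF n L))

    asum≤ : asum u ≤ n * L * (n * L)
    asum≤ = begin
      asum u ≤⟨ ≤-trans (m≤m+n _ (∑₂ n (mm u))) (≤-reflexive (asum+ u)) ⟩
      ∑₂ n (uu u) ≤⟨ ≤-trans (m≤m+n _ _) (m≤m+n (2 * ∑₂ n (uu u)) (Sq u)) ⟩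
      2 * ∑₂ n (uu u) + Sq u ≡⟨ uu-double u ⟩
      Su u * Su u ≤⟨ *-mono-≤ Su≤ Su≤ ⟩
      n * L * (n * L) ∎
      where open ≤-Reasoning

    Sq≤ : Sq u ≤ n * L * (n * L)
    Sq≤ = ≤-trans (≤-trans (m≤n+m (Sq u) (2 * ∑₂ n (uu u))) (≤-reflexive (uu-double u))) (*-mono-≤ Su≤ Su≤)

  Req : Th → (Fin n → ℕ) → Pairs
  Req Z u i j a b = (j ≡ M i → a ≡ lookup Z i × b ≡ lookup Z j) × (j ≢ M i → ¬ (suc (toℕ a) ≤ u i × suc (toℕ b) ≤ u j))

  opaque
    req? : ∀ Z u i j a b → Dec (Req Z u i j a b)
    req? Z u i j a b = ((j ≟F M i) →-dec ((a ≟F lookup Z i) ×-dec (b ≟F lookup Z j))) ×-dec (¬? (j ≟F M i) →-dec ¬? ((suc (toℕ a) ≤? u i) ×-dec (suc (toℕ b) ≤? u j)))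

  mf : Fin n → Fin n → ℕ
  mf i j with j ≟F M i
  ... | yes _ = N
  ... | no _ = 1

  mf-yes : ∀ i j → j ≡ M i → mf i j ≡ N
  mf-yes i j e with j ≟F M i
  ... | yes _ = refl
  ... | no ne = ⊥-elim (ne e)

  mf-no : ∀ i j → j ≢ M i → mf i j ≡ 1
  mf-no i j ne with j ≟F M i
  ... | yes e = ⊥-elim (ne e)
  ... | no _ = refl

  mf-sym : ∀ i j → mf i j ≡ mf j i
  mf-sym i j = go (j ≟F M i)
    where go : Dec (j ≡ M i) → mf i j ≡ mf j i
          go (yes e) = trans (mf-yes i j e) (sym (mf-yes j i (M-flip (trans e refl))))
          go (no ne) = trans (mf-no i j ne) (sym (mf-no j i λ e → ne (M-flip e)))

  -- Each matched pair contributes 1 instead of N = L², which the n diagonal entries make up for.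
  diag-matched : L ^ n ≤ ∏₂ n mf
  diag-matched = ≮⇒≥ λ lt → <⇒≱ (*-mono-< lt lt) (≤-reflexive (begin
    L ^ n * L ^ n ≡⟨ sym (^-distrib-* L L n) ⟩
    (L * L) ^ n ≡⟨ cong (_^ n) (sym LN) ⟩
    N ^ n ≡⟨ sym (trans (∏-cong n row) (∏-const n N)) ⟩
    ∏ n (λ i → ∏ n (mf i)) ≡⟨ sym (∏₂-double n mf mf-sym) ⟩
    ∏₂ n mf * ∏₂ n mf * ∏ n (λ i → mf i i) ≡⟨ trans (cong (∏₂ n mf * ∏₂ n mf *_) (∏-1 n λ i → mf-no i i (M≢ i ∘ sym))) (*-identityʳ _) ⟩
    ∏₂ n mf * ∏₂ n mf ∎))
    where
    open ≡-Reasoning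
    row : ∀ i → ∏ n (mf i) ≡ N
    row i = begin
      ∏ n (mf i) ≡⟨ sym (*-identityʳ _) ⟩
      ∏ n (mf i) * 1 ≡⟨ ∏-change n (mf i) (λ _ → 1) (M i) (λ j ne → mf-no i j ne) ⟩
      ∏ n (λ _ → 1) * mf i (M i) ≡⟨ cong₂ _*_ (∏-1 n λ _ → refl) (mf-yes i (M i) refl) ⟩
      1 * N ≡⟨ *-identityˡ N ⟩
      N ∎

  count-req : ∀ Z u → (∀ i → u i ≤ L) → ∑ uMat (λ X → ∏₂ n λ i j → 𝟙 (req? Z u i j (at X i j) (at X j i))) ≤ ∏₂ n (λ i j → N ∸ cell u i j)
  count-req Z u u≤L = begin
    ∑ uMat (λ X → ∏₂ n λ i j → 𝟙 (req? Z u i j (at X i j) (at X j i))) ≡⟨ count-pairs (Req Z u) (req? Z u) ⟩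
    L ^ n * ∏₂ n kk ≤⟨ *-monoˡ-≤ (∏₂ n kk) diag-matched ⟩
    ∏₂ n mf * ∏₂ n kk ≡⟨ sym (∏₂-* n mf kk) ⟩
    ∏₂ n (λ i j → mf i j * kk i j) ≤⟨ ∏₂-mono n (λ i j _ → each i j (j ≟F M i)) ⟩
    ∏₂ n (λ i j → N ∸ cell u i j) ∎
    where
    open ≤-Reasoning
    kk : Fin n → Fin n → ℕ
    kk = κ (Req Z u) (req? Z u)
    each : ∀ i j → Dec (j ≡ M i) → mf i j * kk i j ≤ N ∸ cell u i j
    each i j (yes e) = ≤-reflexive (trans (cong₂ _*_ (mf-yes i j e) one) (trans (*-identityʳ N) (cong (N ∸_) (sym (cell-yes u i j e)))))
      where
      one : kk i j ≡ 1
      one = trans (∑-cong (fin L) λ a → ∑-cong (fin L) λ b → 𝟙-cong (req? Z u i j a b) ((a ≟F lookup Z i) ×-dec (b ≟F lookup Z j)) (λ r → proj₁ r e) (λ q → (λ _ → q) , λ ne → ⊥-elim (ne e)))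
        (trans (count-rect L (_≟F lookup Z i) (_≟F lookup Z j)) (cong₂ _*_ (count≡ L (lookup Z i)) (count≡ L (lookup Z j))))
    each i j (no ne) = ≤-reflexive (trans (cong (_* kk i j) (mf-no i j ne)) (trans (*-identityˡ (kk i j)) (sym (trans (cong (N ∸_) (cell-no u i j ne)) (trans (cong (_∸ u i * u j) (sym tot)) (m+n∸n≡m (kk i j) (u i * u j)))))))
      where
      r : ∀ a b → Dec (suc (toℕ a) ≤ u i × suc (toℕ b) ≤ u j)
      r a b = (suc (toℕ a) ≤? u i) ×-dec (suc (toℕ b) ≤? u j)
      part : ∀ a b → 𝟙 (req? Z u i j a b) + 𝟙 (r a b) ≡ 1
      part a b = go (req? Z u i j a b) (r a b)
        where go : (d : Dec (Req Z u i j a b)) (f : Dec (suc (toℕ a) ≤ u i × suc (toℕ b) ≤ u j)) → 𝟙 d + 𝟙 f ≡ 1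
              go (yes q) (yes p) = ⊥-elim (proj₂ q ne p)
              go (yes _) (no _) = refl
              go (no _) (yes _) = refl
              go (no nq) (no np) = ⊥-elim (nq ((λ e → ⊥-elim (ne e)) , λ _ → np))
      tot : kk i j + u i * u j ≡ N
      tot = begin-equality
        kk i j + u i * u j ≡⟨ cong (kk i j +_) (sym (trans (count-rect L (λ (a : Fin L) → suc (toℕ a) ≤? u i) (λ (b : Fin L) → suc (toℕ b) ≤? u j)) (cong₂ _*_ (count< L (u i) (u≤L i)) (count< L (u j) (u≤L j))))) ⟩
        kk i j + ∑ (fin L) (λ a → ∑ (fin L) λ b → 𝟙 (r a b)) ≡⟨ sym (trans (∑-cong (fin L) λ a → ∑-+ (fin L) _ _) (∑-+ (fin L) _ _)) ⟩
        ∑ (fin L) (λ a → ∑ (fin L) λ b → 𝟙 (req? Z u i j a b) + 𝟙 (r a b)) ≡⟨ ∑-cong (fin L) (λ a → ∑-cong (fin L) λ b → part a b) ⟩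
        ∑ (fin L) (λ a → ∑ (fin L) λ b → 1) ≡⟨ trans (∑-cong (fin L) λ a → trans (∑-constF L 1) (*-identityʳ L)) (∑-constF L L) ⟩
        L * L ≡⟨ sym LN ⟩
        N ∎

  own : Mat → Th
  own X = tabulate λ i → at X i (M i)

  -- Union bound over the own scores Z.
  cover : ∀ {p} {E : Mat → Set p} (E? : ∀ X → Dec (E X)) (gz : Th → ℕ) (u : Th → Fin n → ℕ) → (∀ Z i → u Z i ≤ L) →
    (∀ X → E X → 1 ≤ gz (own X) × ∀ i j → i ≢ j → Req (own X) (u (own X)) i j (at X i j) (at X j i)) →
    ∑ uMat (λ X → 𝟙 (E? X)) * N ^ Kx ≤ N ^ np n * ∑ uTh (λ Z → gz Z * e (asum (u Z)))
  cover E? gz u u≤L h = begin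
    ∑ uMat (λ X → 𝟙 (E? X)) * N ^ Kx ≤⟨ *-monoˡ-≤ (N ^ Kx) (∑-mono uMat pt) ⟩
    ∑ uMat (λ X → ∑ uTh λ Z → gz Z * pr Z X) * N ^ Kx ≡⟨ cong (_* N ^ Kx) (trans (∑-swap uMat uTh _) (∑-cong uTh λ Z → ∑-*ˡ uMat (gz Z) (pr Z))) ⟩
    ∑ uTh (λ Z → gz Z * ∑ uMat (pr Z)) * N ^ Kx ≡⟨ sym (∑-*ʳ uTh (N ^ Kx) _) ⟩
    ∑ uTh (λ Z → gz Z * ∑ uMat (pr Z) * N ^ Kx) ≤⟨ ∑-mono uTh each ⟩
    ∑ uTh (λ Z → N ^ np n * (gz Z * e (asum (u Z)))) ≡⟨ ∑-*ˡ uTh (N ^ np n) _ ⟩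
    N ^ np n * ∑ uTh (λ Z → gz Z * e (asum (u Z))) ∎
    where
    open ≤-Reasoning
    pr : Th → Mat → ℕ
    pr Z X = ∏₂ n λ i j → 𝟙 (req? Z (u Z) i j (at X i j) (at X j i))
    pt : ∀ X → 𝟙 (E? X) ≤ ∑ uTh λ Z → gz Z * pr Z X
    pt X = 𝟙≤ (E? X) λ ex → let g , r = h X ex in ≤-trans (*-mono-≤ g (≤-reflexive (sym (∏₂-1 n λ i j i<j → 𝟙-yes (req? (own X) (u (own X)) i j (at X i j) (at X j i)) (r i j (FinP.<⇒≢ i<j))))))
      (f≤∑ uTh (λ Z → gz Z * pr Z X) (own X))
    each : ∀ Z → gz Z * ∑ uMat (pr Z) * N ^ Kx ≤ N ^ np n * (gz Z * e (asum (u Z)))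
    each Z = begin
      gz Z * ∑ uMat (pr Z) * N ^ Kx ≤⟨ *-monoˡ-≤ (N ^ Kx) (*-monoʳ-≤ (gz Z) (count-req Z (u Z) (u≤L Z))) ⟩
      gz Z * ∏₂ n (λ i j → N ∸ cell (u Z) i j) * N ^ Kx ≡⟨ trans (*-assoc (gz Z) _ _) (cong (λ x → gz Z * (∏₂ n (λ i j → N ∸ cell (u Z) i j) * x)) (sym (*-identityˡ (N ^ Kx)))) ⟩
      gz Z * (∏₂ n (λ i j → N ∸ cell (u Z) i j) * e 0) ≤⟨ *-monoʳ-≤ (gz Z) (pair-exp n (cell (u Z)) 0 (≤-trans (asum≤ (u Z) (u≤L Z)) (m≤m+n _ _))) ⟩
      gz Z * (N ^ np n * e (asum (u Z))) ≡⟨ lem (gz Z) (N ^ np n) (e (asum (u Z))) ⟩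
      N ^ np n * (gz Z * e (asum (u Z))) ∎
      where lem : ∀ a b c → a * (b * c) ≡ b * (a * c)
            lem = solve-∀

  rank≤L : ∀ (Z : Th) i → rank Z i ≤ L
  rank≤L Z i = FinP.toℕ<n (lookup Z i)

  EE : ℕ
  EE = ∑ uTh (λ Z → e (asum (rank Z)))

  nL : ℕ
  nL = n * L

  -- A discrete Gaussian exp(- S²/2N), cut off beyond the largest possible total rank.
  h : ℕ → ℕ
  h S = 𝟙 (S ≤? nL) * e (tri S)

  B : ℕ
  B = suc nL + L

  open Op B

  sup-h : Sup h
  sup-h r le = cong (_* e (tri r)) (𝟙-no (r ≤? nL) λ q → <⇒≱ (≤-trans (m≤m+n (suc nL) L) le) q)

  N′ : ℕ
  N′ = N + nL

  tri-Kx : ∀ S → S ≤ nL → tri S ≤ nL * nL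
  tri-Kx S q = ≤-trans (≤-trans (m≤m+n (tri S) _) (≤-trans (m≤m+n (2 * tri S) S) (≤-reflexive (tri2 S)))) (*-mono-≤ q q)

  -- The discrete form of - h′ = S h / N. By `e-upper` the ratio of consecutive values is at most
  -- N/(N+S), and `N′` bounds N + S uniformly; at the cut S ≤ N′ suffices.
  h-diff : ∀ S → S * h S + N′ * h (suc S) ≤ N′ * h S
  h-diff S = go (S ≤? nL) (suc S ≤? nL)
    where
    open ≤-Reasoning
    E = e (tri S)
    E′ = e (tri S + S)
    go : (d : Dec (S ≤ nL)) (d′ : Dec (suc S ≤ nL)) → S * (𝟙 d * E) + N′ * (𝟙 d′ * E′) ≤ N′ * (𝟙 d * E)
    go (no q) (yes q′) = ⊥-elim (q (≤-trans (n≤1+n S) q′))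
    go (no _) (no _) = ≤-reflexive (trans (cong₂ _+_ (*-zeroʳ S) (*-zeroʳ N′)) (sym (*-zeroʳ N′)))
    go (yes q) (no _) = ≤-trans (≤-reflexive (trans (cong (S * (1 * E) +_) (*-zeroʳ N′)) (+-identityʳ _))) (*-monoˡ-≤ (1 * E) (≤-trans q (m≤n+m nL N)))
    go (yes q) (yes q′) = subst₂ (λ a b → S * a + N′ * b ≤ N′ * a) (sym (*-identityˡ E)) (sym (*-identityˡ E′)) (begin
      S * E + N′ * E′ ≡⟨ cong (λ x → S * E + x * E′) (sym Nd) ⟩
      S * E + (N + S + d) * E′ ≡⟨ lem S E N d E′ ⟩
      S * E + E′ * (N + S) + d * E′ ≤⟨ +-mono-≤ (+-monoʳ-≤ (S * E) (e-upper S (tri S) kx)) (*-monoʳ-≤ d (e-mono (tri S) S kx)) ⟩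
      S * E + N * E + d * E ≡⟨ trans (lem′ S E N d) (cong (_* E) Nd) ⟩
      N′ * E ∎)
      where
      d = nL ∸ S
      Nd : N + S + d ≡ N′
      Nd = trans (+-assoc N S d) (cong (N +_) (m+[n∸m]≡n q))
      kx : tri S + S ≤ Kx
      kx = ≤-trans (tri-Kx (suc S) q′) (m≤m+n _ _)
      lem : ∀ s e n d e′ → s * e + (n + s + d) * e′ ≡ s * e + e′ * (n + s) + d * e′
      lem = solve-∀
      lem′ : ∀ s e n d → s * e + n * e + d * e ≡ (n + s + d) * e
      lem′ = solve-∀

  h10 : h 1 ≤ h 0
  h10 = ≤-trans (*-monoˡ-≤ (e 0) (𝟙≤1 (1 ≤? nL))) (≤-reflexive (cong (_* e 0) (sym (𝟙-yes (0 ≤? nL) z≤n))))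

  J2 : ∀ m → suc m * Ks (suc (suc m)) h 0 ≤ N′ * Ks m h 0
  J2 = J-step h N′ sup-h h-diff h10

  -- Gaussian moments: the 2k-fold integral of exp(- x²/2N) from 0 to infinity is N^k / (2k - 1)!!.
  -- This double factorial cancels the number of matchings.
  J-even : ∀ k → Ks (k + k) h 0 * dfac k ≤ N′ ^ k * N ^ Kx
  J-even zero = ≤-trans (≤-reflexive (*-identityʳ (h 0))) (≤-trans (*-monoˡ-≤ (e 0) (𝟙≤1 (0 ≤? nL))) (≤-reflexive (lem (N ^ Kx))))
    where lem : ∀ a → 1 * (1 * a) ≡ 1 * a
          lem = solve-∀
  J-even (suc k) = begin
    Ks (suc k + suc k) h 0 * (suc (k + k) * dfac k) ≡⟨ trans (cong (λ x → Ks x h 0 * (suc (k + k) * dfac k)) (cong suc (+-suc k k))) (lem (Ks (suc (suc (k + k))) h 0) (suc (k + k)) (dfac k)) ⟩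
    suc (k + k) * Ks (suc (suc (k + k))) h 0 * dfac k ≤⟨ *-monoˡ-≤ (dfac k) (J2 (k + k)) ⟩
    N′ * Ks (k + k) h 0 * dfac k ≡⟨ *-assoc N′ (Ks (k + k) h 0) (dfac k) ⟩
    N′ * (Ks (k + k) h 0 * dfac k) ≤⟨ *-monoʳ-≤ N′ (J-even k) ⟩
    N′ * (N′ ^ k * N ^ Kx) ≡⟨ sym (*-assoc N′ (N′ ^ k) (N ^ Kx)) ⟩
    N′ ^ suc k * N ^ Kx ∎
    where
    open ≤-Reasoning
    lem : ∀ a b c → a * (b * c) ≡ b * a * c
    lem = solve-∀

  wgt : ℕ → ℕ
  wgt t = N + 8 * (t * t)

  ∑-as-Os : ∀ m (f : ℕ → ℕ) S₀ → ∑ (vec (fin L) m) (λ Z → ∏ m (λ i → wgt (rank Z i)) * f (S₀ + ∑ (fin m) (rank Z))) ≡ Os m L N f S₀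
  ∑-as-Os zero f S₀ = trans (*-identityˡ _) (cong f (+-identityʳ S₀))
  ∑-as-Os (suc m) f S₀ = begin
    ∑ (vec (fin L) (suc m)) (λ Z → ∏ (suc m) (λ i → wgt (rank Z i)) * f (S₀ + ∑ (fin (suc m)) (rank Z)))
      ≡⟨ ∑-vec-cons L m (λ Z → ∏ (suc m) (λ i → wgt (rank Z i)) * f (S₀ + ∑ (fin (suc m)) (rank Z))) ⟩
    ∑ (vec (fin L) m) (λ Z → ∑ (fin L) λ a → wgt (suc (toℕ a)) * P Z * f (S₀ + (suc (toℕ a) + Σt Z)))
      ≡⟨ ∑-cong (vec (fin L) m) (λ Z → trans (∑-cong (fin L) λ a → trans (lem (wgt (suc (toℕ a))) (P Z) _) (cong (λ x → P Z * (wgt (suc (toℕ a)) * f x)) (lem′ S₀ (suc (toℕ a)) (Σt Z)))) (∑-*ˡ (fin L) (P Z) _)) ⟩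
    ∑ (vec (fin L) m) (λ Z → P Z * O L N f (S₀ + Σt Z)) ≡⟨ ∑-as-Os m (O L N f) S₀ ⟩
    Os (suc m) L N f S₀ ∎
    where
    open ≡-Reasoning
    P : Vec (Fin L) m → ℕ
    P Z = ∏ m (λ i → wgt (rank Z i))
    Σt : Vec (Fin L) m → ℕ
    Σt Z = ∑ (fin m) (rank Z)
    lem : ∀ a b c → a * b * c ≡ b * (a * c)
    lem = solve-∀
    lem′ : ∀ a b c → a + (b + c) ≡ a + c + b
    lem′ = solve-∀

  recover-all : ∀ m (b : Fin m → ℕ) k → (∀ i → b i ≤ N) → k + ∑ (fin m) b ≤ Kx → e k * N ^ m ≤ e (k + ∑ (fin m) b) * ∏ m (λ i → N + 8 * b i)
  recover-all zero b k _ _ = ≤-reflexive (cong (λ x → e x * 1) (sym (+-identityʳ k)))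
  recover-all (suc m) b k bN q = begin
    e k * (N * N ^ m) ≡⟨ sym (*-assoc (e k) N _) ⟩
    e k * N * N ^ m ≤⟨ *-monoˡ-≤ (N ^ m) (e-recover N/2 NH k (b zero) (bN zero) (≤-trans (+-monoʳ-≤ k (m≤m+n (b zero) _)) q)) ⟩
    e (k + b zero) * (N + 8 * b zero) * N ^ m ≡⟨ lem (e (k + b zero)) (N + 8 * b zero) (N ^ m) ⟩
    (N + 8 * b zero) * (e (k + b zero) * N ^ m) ≤⟨ *-monoʳ-≤ (N + 8 * b zero) (recover-all m (b ∘ suc) (k + b zero) (bN ∘ suc) (≤-trans (≤-reflexive (+-assoc k _ _)) q)) ⟩
    (N + 8 * b zero) * (e (k + b zero + ∑ (fin m) (b ∘ suc)) * ∏ m (λ i → N + 8 * b (suc i))) ≡⟨ trans (lem′ (N + 8 * b zero) (e (k + b zero + ∑ (fin m) (b ∘ suc))) (∏ m (λ i → N + 8 * b (suc i)))) (cong (λ x → e x * ((N + 8 * b zero) * ∏ m (λ i → N + 8 * b (suc i)))) (+-assoc k (b zero) _)) ⟩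
    e (k + (b zero + ∑ (fin m) (b ∘ suc))) * ((N + 8 * b zero) * ∏ m (λ i → N + 8 * b (suc i))) ∎
    where
    open ≤-Reasoning
    lem : ∀ a b c → a * b * c ≡ b * (a * c)
    lem = solve-∀
    lem′ : ∀ a b c → a * (b * c) ≡ b * (a * c)
    lem′ = solve-∀

  -- Adding `Sq` to the exponent costs `wgt` per person; then `tri≤` leaves a function of the total
  -- rank, which is summed coordinate by coordinate.
  EE-Os : EE * N ^ n ≤ Os n L N h 0
  EE-Os = begin
    EE * N ^ n ≡⟨ sym (∑-*ʳ uTh (N ^ n) _) ⟩
    ∑ uTh (λ Z → e (asum (rank Z)) * N ^ n) ≤⟨ ∑-mono uTh each ⟩
    ∑ uTh (λ Z → ∏ n (λ i → wgt (rank Z i)) * h (0 + Su (rank Z))) ≡⟨ ∑-as-Os n h 0 ⟩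
    Os n L N h 0 ∎
    where
    open ≤-Reasoning
    each : ∀ Z → e (asum (rank Z)) * N ^ n ≤ ∏ n (λ i → wgt (rank Z i)) * h (Su (rank Z))
    each Z = begin
      e (asum u) * N ^ n ≤⟨ recover-all n (λ i → u i * u i) (asum u) (λ i → ≤-trans (*-mono-≤ (uL i) (uL i)) (≤-reflexive (sym LN))) kx ⟩
      e (asum u + Sq u) * P ≤⟨ *-monoˡ-≤ P (e-anti (tri≤ u) kx) ⟩
      e (tri (Su u)) * P ≡⟨ trans (*-comm _ P) (cong (P *_) (sym (trans (cong (_* e (tri (Su u))) (𝟙-yes (Su u ≤? nL) (Su≤ u uL))) (*-identityˡ _)))) ⟩
      P * h (Su u) ∎
      where
      u = rank Z
      uL = rank≤L Z
      P = ∏ n (λ i → wgt (u i))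
      kx : asum u + Sq u ≤ Kx
      kx = +-mono-≤ (asum≤ u uL) (Sq≤ u uL)

  -- Per coordinate the factor is at most 1 + c/n times `N`, and the n-th power of 1 + c/n is at
  -- most `4 ^ c`. So the mean stays bounded.
  EE-bound : ∀ k → n ≡ k + k → 0 < n → ∀ c → n * (N + 32) + 40 * N′ ≤ (n + c) * N → EE * dfac k ≤ 4 ^ c * (N′ ^ k * N ^ Kx)
  EE-bound k nk n>0 c hyp = ≤-trans (*-monoˡ-≤ (dfac k) main) (≤-trans (≤-reflexive (trans (*-assoc (4 ^ c) _ _) (cong (λ x → 4 ^ c * (Ks x h 0 * dfac k)) nk))) (*-monoʳ-≤ (4 ^ c) (J-even k)))
    where
    open ≤-Reasoning
    main : EE ≤ 4 ^ c * Ks n h 0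
    main = *-cancelˡ-≤ (n ^ n * N ^ n) {{m*n≢0 (n ^ n) (N ^ n) {{m^n≢0 n n {{>-nonZero n>0}}}} {{m^n≢0 N n}}}} (begin
      n ^ n * N ^ n * EE ≡⟨ lem (n ^ n) (N ^ n) EE ⟩
      n ^ n * (EE * N ^ n) ≤⟨ *-monoʳ-≤ (n ^ n) EE-Os ⟩
      n ^ n * Os n L N h 0 ≤⟨ Os-bound h sup-h N N′ L n (m≤n+m L (suc nL)) J2 n 0 ≤-refl ⟩
      (n * (N + 32) + 40 * N′) ^ n * Ks n h 0 ≤⟨ *-monoˡ-≤ (Ks n h 0) (^-monoˡ-≤ n hyp) ⟩
      ((n + c) * N) ^ n * Ks n h 0 ≡⟨ cong (_* Ks n h 0) (^-distrib-* (n + c) N n) ⟩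
      (n + c) ^ n * N ^ n * Ks n h 0 ≤⟨ *-monoˡ-≤ (Ks n h 0) (*-monoˡ-≤ (N ^ n) (pow-shift n c)) ⟩
      4 ^ c * n ^ n * N ^ n * Ks n h 0 ≡⟨ lem′ (4 ^ c) (n ^ n) (N ^ n) (Ks n h 0) ⟩
      n ^ n * N ^ n * (4 ^ c * Ks n h 0) ∎)
      where
      lem : ∀ a b c → a * b * c ≡ a * (c * b)
      lem = solve-∀
      lem′ : ∀ a b c d → a * b * c * d ≡ b * c * (a * d)
      lem′ = solve-∀

  own-look : ∀ X i → lookup (own X) i ≡ at X i (M i)
  own-look X i = VecP.lookup∘tabulate _ i

  own-matched : ∀ X i j → j ≡ M i → at X i j ≡ lookup (own X) i × at X j i ≡ lookup (own X) j
  own-matched X i _ refl = sym (own-look X i) , trans (cong (at X (M i)) (sym (MM i))) (sym (own-look X (M i)))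

  below-own : ∀ X i (a : Fin L) → suc (toℕ a) ≤ rank (own X) i → a Fin.≤ at X i (M i)
  below-own X i a h = ≤-trans (ℕ.s≤s⁻¹ h) (≤-reflexive (cong toℕ (own-look X i)))

  strong-req : ∀ X → Strong X → ∀ i j → i ≢ j → Req (own X) (rank (own X)) i j (at X i j) (at X j i)
  strong-req X st i j i≢j = own-matched X i j , λ ne (p , q) → st i j (i≢j ∘ sym) ne (below-own X i _ p , below-own X j _ q)

  planted-EE : ∑ uMat (λ X → 𝟙 (strong? X)) * N ^ Kx ≤ N ^ np n * EE
  planted-EE = ≤-trans (cover strong? (λ _ → 1) rank rank≤L λ X st → ≤-refl , strong-req X st)
    (≤-reflexive (cong (N ^ np n *_) (∑-cong uTh λ Z → *-identityˡ (e (asum (rank Z))))))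

  cell-sym : ∀ u i j → cell u i j ≡ cell u j i
  cell-sym u i j = go (j ≟F M i)
    where go : Dec (j ≡ M i) → cell u i j ≡ cell u j i
          go (yes q) = trans (cell-yes u i j q) (sym (cell-yes u j i (M-flip q)))
          go (no q) = trans (cell-no u i j q) (trans (*-comm (u i) (u j)) (sym (cell-no u j i λ r → q (M-flip r))))

  ∑₂-row : ∀ n (g : Fin n → Fin n → ℕ) → (∀ i j → g i j ≡ g j i) → ∀ i₀ → ∑ (fin n) (λ j → 𝟙 (¬? (j ≟F i₀)) * g i₀ j) ≤ ∑₂ n g
  ∑₂-row (suc n) g s zero = ≤-trans (∑-mono (fin n) λ j → ≤-trans (*-monoˡ-≤ (g zero (suc j)) (𝟙≤1 (¬? (suc j ≟F zero)))) (≤-reflexive (*-identityˡ (g zero (suc j))))) (m≤m+n _ _)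
  ∑₂-row (suc n) g s (suc i₀) = +-mono-≤ (≤-trans (*-monoˡ-≤ (g (suc i₀) zero) (𝟙≤1 (¬? (zero ≟F suc i₀)))) (≤-trans (≤-reflexive (trans (*-identityˡ (g (suc i₀) zero)) (s (suc i₀) zero))) (f≤∑ (fin n) (λ j → g zero (suc j)) i₀)))
    (≤-trans (∑-mono (fin n) λ j → *-monoˡ-≤ (g (suc i₀) (suc j)) (𝟙-mono (¬? (suc j ≟F suc i₀)) (¬? (j ≟F i₀)) λ ne q → ne (cong suc q))) (∑₂-row n (λ i j → g (suc i) (suc j)) (λ i j → s (suc i) (suc j)) i₀))

  a₀ : Fin L
  a₀ = fromℕ< L>0

  a₀0 : toℕ a₀ ≡ 0
  a₀0 = FinP.toℕ-fromℕ< L>0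

  -- Persons without a good alternative

  module Failing (i₀ : Fin n) where

    Eᶠ : Mat → Set
    Eᶠ X = Strong X × Fail i₀ X × σ ≤ total-rank X

    eᶠ? : ∀ X → Dec (Eᶠ X)
    eᶠ? X = strong? X ×-dec fail? i₀ X ×-dec (σ ≤? total-rank X)

    -- When `i₀` fails, `i₀` gives rank above `R` to everyone accepting `i₀`, apart from the
    -- partner. The pairs then satisfy the requirement for own rank `R`, whatever `Z` says at `i₀`.
    u : Th → Fin n → ℕ
    u Z j with j ≟F i₀
    ... | yes _ = R
    ... | no _ = rank Z j

    u-yes : ∀ Z → u Z i₀ ≡ R
    u-yes Z with i₀ ≟F i₀
    ... | yes _ = refl
    ... | no ne = ⊥-elim (ne refl)

    u-no : ∀ Z j → j ≢ i₀ → u Z j ≡ rank Z j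
    u-no Z j ne with j ≟F i₀
    ... | yes q = ⊥-elim (ne q)
    ... | no _ = refl

    u≤L : ∀ Z i → u Z i ≤ L
    u≤L Z i with i ≟F i₀
    ... | yes _ = R≤L
    ... | no _ = rank≤L Z i

    gz : Th → ℕ
    gz Z = 𝟙 (σ ≤? Su (rank Z))

    own-rank : ∀ X → Su (rank (own X)) ≡ total-rank X
    own-rank X = ∑-cong (fin n) λ i → cong (suc ∘ toℕ) (own-look X i)

    req : ∀ X → Eᶠ X → 1 ≤ gz (own X) × ∀ i j → i ≢ j → Req (own X) (u (own X)) i j (at X i j) (at X j i)
    req X (st , fl , rk) = ≤-reflexive (sym (𝟙-yes (σ ≤? Su (rank (own X))) (≤-trans rk (≤-reflexive (sym (own-rank X)))))) ,
      λ i j i≢j → own-matched X i j , λ ne (p , q) → go i j i≢j ne p q (i ≟F i₀) (j ≟F i₀)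
      where
      go : ∀ i j → i ≢ j → j ≢ M i → suc (toℕ (at X i j)) ≤ u (own X) i → suc (toℕ (at X j i)) ≤ u (own X) j → Dec (i ≡ i₀) → Dec (j ≡ i₀) → ⊥
      go i j i≢j ne p q (yes refl) (yes refl) = i≢j refl
      go i j i≢j ne p q (yes refl) (no b) = fl j b ne (≤-trans p (≤-reflexive (u-yes (own X))) , below-own X j _ (≤-trans q (≤-reflexive (u-no (own X) j b))))
      go i j i≢j ne p q (no a) (yes refl) = fl i a (λ r → ne (M-flip r)) (≤-trans q (≤-reflexive (u-yes (own X))) , below-own X i _ (≤-trans p (≤-reflexive (u-no (own X) i a))))
      go i j i≢j ne p q (no a) (no b) = st i j (i≢j ∘ sym) ne (below-own X i _ (≤-trans p (≤-reflexive (u-no (own X) i a))) , below-own X j _ (≤-trans q (≤-reflexive (u-no (own X) j b))))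

    module _ (Z : Th) (hσ : σ ≤ Su (rank Z)) where

      -- The reference, in which `i₀` has the best own score, rank 1. It forgets one coordinate of
      -- `Z`, hence the factor `L` in `fail-bound`.
      Z₀ : Th
      Z₀ = Z [ i₀ ]≔ a₀

      v : Fin n → ℕ
      v = rank Z₀

      v-i₀ : v i₀ ≡ 1
      v-i₀ = cong suc (trans (cong toℕ (upd-same Z i₀ a₀)) a₀0)

      v-o : ∀ j → j ≢ i₀ → v j ≡ rank Z j
      v-o j ne = cong (suc ∘ toℕ) (upd-other Z i₀ a₀ ne)

      v≤u : ∀ j → v j ≤ u Z j
      v≤u j = go (j ≟F i₀)
        where go : Dec (j ≡ i₀) → v j ≤ u Z j
              go (yes refl) = ≤-trans (≤-reflexive v-i₀) (≤-trans (s≤s z≤n) (≤-reflexive (sym (trans (u-yes Z) RR))))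
              go (no ne) = ≤-reflexive (trans (v-o j ne) (sym (u-no Z j ne)))

      cell-mono : ∀ i j → cell v i j ≤ cell (u Z) i j
      cell-mono i j = go (j ≟F M i)
        where go : Dec (j ≡ M i) → cell v i j ≤ cell (u Z) i j
              go (yes q) = ≤-trans (≤-reflexive (cell-yes v i j q)) z≤n
              go (no q) = subst₂ _≤_ (sym (cell-no v i j q)) (sym (cell-no (u Z) i j q)) (*-mono-≤ (v≤u i) (v≤u j))

      ex : Fin n → Fin n → ℕ
      ex i j = cell (u Z) i j ∸ cell v i j

      rest : ℕ
      rest = ∑ (fin n) (λ j → 𝟙 (¬? (j ≟F i₀)) * (𝟙 (¬? (j ≟F M i₀)) * rank Z j))

      rank≤ : Su (rank Z) ≤ rest + (L + L)
      rank≤ = begin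
        Su (rank Z) ≤⟨ ∑-mono (fin n) each ⟩
        ∑ (fin n) (λ j → 𝟙 (¬? (j ≟F i₀)) * (𝟙 (¬? (j ≟F M i₀)) * rank Z j) + (𝟙 (j ≟F i₀) * rank Z j + 𝟙 (j ≟F M i₀) * rank Z j))
          ≡⟨ trans (∑-+ (fin n) _ _) (cong (rest +_) (trans (∑-+ (fin n) _ _) (cong₂ _+_ (∑-δ (fin n) (rank Z) i₀) (∑-δ (fin n) (rank Z) (M i₀))))) ⟩
        rest + (rank Z i₀ + rank Z (M i₀)) ≤⟨ +-monoʳ-≤ rest (+-mono-≤ (rank≤L Z i₀) (rank≤L Z (M i₀))) ⟩
        rest + (L + L) ∎
        where
        open ≤-Reasoning
        each : ∀ j → rank Z j ≤ 𝟙 (¬? (j ≟F i₀)) * (𝟙 (¬? (j ≟F M i₀)) * rank Z j) + (𝟙 (j ≟F i₀) * rank Z j + 𝟙 (j ≟F M i₀) * rank Z j)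
        each j = go (j ≟F i₀) (j ≟F M i₀) (rank Z j)
          where
          go : ∀ {P Q : Set} (d : Dec P) (f : Dec Q) t → t ≤ 𝟙 (¬? d) * (𝟙 (¬? f) * t) + (𝟙 d * t + 𝟙 f * t)
          go (yes _) f t = ≤-trans (≤-reflexive (sym (*-identityˡ t))) (m≤m+n (1 * t) (𝟙 f * t))
          go (no _) (yes _) t = ≤-reflexive (sym (+-identityʳ t))
          go (no _) (no _) t = ≤-trans (≤-reflexive (lem t)) (m≤m+n (1 * (1 * t)) 0)
            where lem : ∀ t → t ≡ 1 * (1 * t)
                  lem = solve-∀

      -- Raising the rank of `i₀` from 1 to `R` adds `R₁` times the ranks of all persons but `i₀`
      -- and `M i₀`; the two omitted ranks are at most `L` each.
      gain : jj * N ≤ ∑₂ n ex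
      gain = ≤-trans (+-cancelʳ-≤ (R₁ * (L + L)) _ _ (≤-trans jN (≤-trans (*-monoʳ-≤ R₁ (≤-trans hσ rank≤)) (≤-reflexive (*-distribˡ-+ R₁ rest (L + L))))))
        (≤-trans (≤-trans (≤-reflexive (sym (∑-*ˡ (fin n) R₁ _))) (∑-mono (fin n) λ j → each j (j ≟F i₀) (j ≟F M i₀)))
          (∑₂-row n ex (λ i j → cong₂ _∸_ (cell-sym (u Z) i j) (cell-sym v i j)) i₀))
        where
        each : ∀ j (d : Dec (j ≡ i₀)) (f : Dec (j ≡ M i₀)) → R₁ * (𝟙 (¬? d) * (𝟙 (¬? f) * rank Z j)) ≤ 𝟙 (¬? d) * ex i₀ j
        each j (yes _) f = ≤-reflexive (*-zeroʳ R₁)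
        each j (no _) (yes _) = ≤-trans (≤-reflexive (*-zeroʳ R₁)) z≤n
        each j (no a) (no b) = ≤-reflexive (trans (lem R₁ (rank Z j)) (trans (sym (m+n∸n≡m (R₁ * rank Z j) (rank Z j))) (trans (cong₂ _∸_ cu cv) (sym (*-identityˡ (ex i₀ j))))))
          where
          lem : ∀ r t → r * (1 * (1 * t)) ≡ r * t
          lem = solve-∀
          lem′ : ∀ r t → r * t + t ≡ suc r * t
          lem′ = solve-∀
          cu : R₁ * rank Z j + rank Z j ≡ cell (u Z) i₀ j
          cu = trans (lem′ R₁ (rank Z j)) (sym (trans (cell-no (u Z) i₀ j b) (cong₂ _*_ (trans (u-yes Z) RR) (u-no Z j a))))
          cv : rank Z j ≡ cell v i₀ j
          cv = sym (trans (cell-no v i₀ j b) (trans (cong₂ _*_ v-i₀ (v-o j a)) (*-identityˡ (rank Z j))))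

      asum-gain : asum v + jj * N ≤ asum (u Z)
      asum-gain = ≤-trans (+-monoʳ-≤ (asum v) gain) (≤-trans (≤-reflexive (sym (∑₂-+ n (cell v) ex))) (∑₂-mono n λ i j _ → ≤-reflexive (m+[n∸m]≡n (cell-mono i j))))

      e-gain : 2 ^ jj * e (asum (u Z)) ≤ e (asum v)
      e-gain = ≤-trans (*-monoʳ-≤ (2 ^ jj) (e-anti asum-gain kx)) (e-halve jj (asum v) (≤-trans asum-gain kx))
        where
        kx : asum (u Z) ≤ Kx
        kx = ≤-trans (asum≤ (u Z) (u≤L Z)) (m≤m+n _ _)

    fail-bound : 2 ^ jj * (∑ uMat (λ X → 𝟙 (eᶠ? X)) * N ^ Kx) ≤ N ^ np n * (L * EE)
    fail-bound = begin
      2 ^ jj * (∑ uMat (λ X → 𝟙 (eᶠ? X)) * N ^ Kx) ≤⟨ *-monoʳ-≤ (2 ^ jj) (cover eᶠ? gz u u≤L req) ⟩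
      2 ^ jj * (N ^ np n * ∑ uTh (λ Z → gz Z * e (asum (u Z)))) ≡⟨ lem (2 ^ jj) (N ^ np n) _ ⟩
      N ^ np n * (2 ^ jj * ∑ uTh (λ Z → gz Z * e (asum (u Z)))) ≡⟨ cong (N ^ np n *_) (sym (∑-*ˡ uTh (2 ^ jj) _)) ⟩
      N ^ np n * ∑ uTh (λ Z → 2 ^ jj * (gz Z * e (asum (u Z)))) ≤⟨ *-monoʳ-≤ (N ^ np n) (∑-mono uTh each) ⟩
      N ^ np n * ∑ uTh (λ Z → ∑ (fin L) λ a → f (Z [ i₀ ]≔ a)) ≡⟨ cong (N ^ np n *_) (∑-bij (uTh ⊗ fin L) (uTh ⊗ fin L) g g gg gg (λ (Z , a) → f Z)) ⟩
      N ^ np n * ∑ uTh (λ Z → ∑ (fin L) λ a → f Z) ≡⟨ cong (N ^ np n *_) (trans (∑-cong uTh λ Z → ∑-constF L (f Z)) (∑-*ˡ uTh L f)) ⟩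
      N ^ np n * (L * EE) ∎
      where
      open ≤-Reasoning
      f : Th → ℕ
      f Z = e (asum (rank Z))
      lem : ∀ a b c → a * (b * c) ≡ b * (a * c)
      lem = solve-∀
      g : Th × Fin L → Th × Fin L
      g (Z , a) = Z [ i₀ ]≔ a , lookup Z i₀
      gg : ∀ p → g (g p) ≡ p
      gg (Z , a) = cong₂ _,_ (upd-upd Z i₀ a) (upd-same Z i₀ a)
      each : ∀ Z → 2 ^ jj * (gz Z * e (asum (u Z))) ≤ ∑ (fin L) λ a → f (Z [ i₀ ]≔ a)
      each Z = ≤-trans (≤-reflexive (lem (2 ^ jj) (gz Z) _)) (𝟙*≤ (σ ≤? Su (rank Z)) λ q → ≤-trans (e-gain Z q) (f≤∑ (fin L) (λ a → f (Z [ i₀ ]≔ a)) a₀))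

  -- Matrices of small total rank

  Eˢ : Mat → Set
  Eˢ X = Strong X × suc (total-rank X) ≤ σ

  eˢ? : ∀ X → Dec (Eˢ X)
  eˢ? X = strong? X ×-dec (suc (total-rank X) ≤? σ)

  module Small where
    module O₂ = Op (σ + L)

    g : ℕ → ℕ
    g S = 𝟙 (suc S ≤? σ)

    sup-g : O₂.Sup g
    sup-g r le = 𝟙-no (suc r ≤? σ) λ q → <⇒≱ q (≤-trans (m≤m+n σ L) le)

    g-bound : ∀ S → S * g S ≤ σ * g S
    g-bound S with suc S ≤? σ
    ... | yes q = *-monoˡ-≤ 1 (≤-trans (n≤1+n S) q)
    ... | no _ = ≤-reflexive (trans (*-zeroʳ S) (sym (*-zeroʳ σ)))

    Ks-comm : ∀ m f S → O₂.Ks m (O₂.K f) S ≡ O₂.K (O₂.Ks m f) S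
    Ks-comm zero f S = refl
    Ks-comm (suc m) f S = O₂.K-cong (Ks-comm m f) S

    tuples : ∀ m (f : ℕ → ℕ) S₀ → ∑ (vec (fin L) m) (λ Z → f (S₀ + ∑ (fin m) (rank Z))) ≤ O₂.Ks m f S₀
    tuples zero f S₀ = ≤-reflexive (cong f (+-identityʳ S₀))
    tuples (suc m) f S₀ = begin
      ∑ (vec (fin L) (suc m)) (λ Z → f (S₀ + ∑ (fin (suc m)) (rank Z))) ≡⟨ ∑-vec-cons L m (λ Z → f (S₀ + ∑ (fin (suc m)) (rank Z))) ⟩
      ∑ (vec (fin L) m) (λ Z → ∑ (fin L) λ a → f (S₀ + (suc (toℕ a) + ∑ (fin m) (rank Z)))) ≤⟨ ∑-mono (vec (fin L) m) (λ Z → ≤-trans (≤-reflexive (∑-cong (fin L) λ a → cong f (lem S₀ (toℕ a) (∑ (fin m) (rank Z)))))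
           (O₂.∑ℕ-extend L (λ d → f (suc (S₀ + ∑ (fin m) (rank Z) + d))) (m≤n+m L σ))) ⟩
      ∑ (vec (fin L) m) (λ Z → O₂.K f (S₀ + ∑ (fin m) (rank Z))) ≤⟨ tuples m (O₂.K f) S₀ ⟩
      O₂.Ks m (O₂.K f) S₀ ≡⟨ Ks-comm m f S₀ ⟩
      O₂.Ks (suc m) f S₀ ∎
      where
      open ≤-Reasoning
      lem : ∀ a b c → a + (suc b + c) ≡ suc (a + c + b)
      lem = solve-∀

    count-below : ∀ T c → ∑ℕ T (λ d → 𝟙 (suc (suc d) ≤? c)) ≤ c
    count-below zero c = z≤n
    count-below (suc T) zero = ≤-reflexive (∑-zero (fin (suc T)) λ i → 𝟙-no (suc (suc (toℕ i)) ≤? 0) λ ())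
    count-below (suc T) (suc c) = +-mono-≤ (𝟙≤1 (2 ≤? suc c)) (≤-trans (∑-mono (fin T) λ i → 𝟙-mono (suc (suc (suc (toℕ i))) ≤? suc c) (suc (suc (toℕ i)) ≤? c) ℕ.s≤s⁻¹) (count-below T c))

    -- Tuples of ranks with total below `σ` are counted by the simplex bound; `J-bounded` supplies
    -- each step.
    tuple-bound : ∀ m → O₂.Ks (suc m) g 0 * m ! ≤ σ ^ suc m
    tuple-bound zero = ≤-trans (≤-reflexive (*-identityʳ _)) (≤-trans (count-below (σ + L) σ) (≤-reflexive (sym (*-identityʳ σ))))
    tuple-bound (suc m) = begin
      O₂.Ks (suc (suc m)) g 0 * (suc m * m !) ≡⟨ lem (O₂.Ks (suc (suc m)) g 0) (suc m) (m !) ⟩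
      suc m * O₂.Ks (suc (suc m)) g 0 * m ! ≤⟨ *-monoˡ-≤ (m !) (O₂.J-bounded g σ sup-g g-bound (suc m)) ⟩
      σ * O₂.Ks (suc m) g 0 * m ! ≡⟨ *-assoc σ (O₂.Ks (suc m) g 0) (m !) ⟩
      σ * (O₂.Ks (suc m) g 0 * m !) ≤⟨ *-monoʳ-≤ σ (tuple-bound m) ⟩
      σ * σ ^ suc m ∎
      where
      open ≤-Reasoning
      lem : ∀ a b c → a * (b * c) ≡ b * a * c
      lem = solve-∀

    small-bound : ∀ m → n ≡ suc m → ∑ uMat (λ X → 𝟙 (eˢ? X)) * m ! ≤ N ^ np n * σ ^ n
    small-bound m nm = ≤-trans (*-monoˡ-≤ (m !) main) (≤-trans (≤-reflexive (*-assoc (N ^ np n) _ _)) (*-monoʳ-≤ (N ^ np n) (subst (λ x → O₂.Ks x g 0 * m ! ≤ σ ^ x) (sym nm) (tuple-bound m))))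
      where
      open ≤-Reasoning
      gz : Th → ℕ
      gz Z = g (Su (rank Z))
      main : ∑ uMat (λ X → 𝟙 (eˢ? X)) ≤ N ^ np n * O₂.Ks n g 0
      main = *-cancelʳ-≤ _ _ (N ^ Kx) {{m^n≢0 N Kx}} (begin
        ∑ uMat (λ X → 𝟙 (eˢ? X)) * N ^ Kx ≤⟨ cover eˢ? gz rank rank≤L (λ X (st , rk) → ≤-reflexive (sym (𝟙-yes (suc (Su (rank (own X))) ≤? σ)
               (≤-trans (s≤s (≤-reflexive (∑-cong (fin n) λ i → cong (suc ∘ toℕ) (own-look X i)))) rk))) , strong-req X st) ⟩
        N ^ np n * ∑ uTh (λ Z → gz Z * e (asum (rank Z))) ≤⟨ *-monoʳ-≤ (N ^ np n) (∑-mono uTh λ Z → *-monoʳ-≤ (gz Z) (e-anti {0} z≤n (≤-trans (asum≤ (rank Z) (rank≤L Z)) (m≤m+n _ _)))) ⟩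
        N ^ np n * ∑ uTh (λ Z → gz Z * e 0) ≡⟨ cong (N ^ np n *_) (∑-*ʳ uTh (e 0) gz) ⟩
        N ^ np n * (∑ uTh gz * e 0) ≡⟨ trans (cong (λ x → N ^ np n * (∑ uTh gz * x)) (*-identityˡ (N ^ Kx))) (sym (*-assoc (N ^ np n) _ _)) ⟩
        N ^ np n * ∑ uTh gz * N ^ Kx ≤⟨ *-monoˡ-≤ (N ^ Kx) (*-monoʳ-≤ (N ^ np n) (tuples n g 0)) ⟩
        N ^ np n * O₂.Ks n g 0 * N ^ Kx ∎)

  -- The total cost of one matching

  Pb : ℕ
  Pb = 4 ^ κc * (N ^ np n * N′ ^ n/2)

  private
    instance
      Nx : NonZero (N ^ Kx)
      Nx = m^n≢0 N Kx

    EE≤ : EE * dfac n/2 ≤ 4 ^ κc * (N′ ^ n/2 * N ^ Kx)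
    EE≤ = EE-bound n/2 nh n>0 κc c-large

    -- Turns an estimate by a multiple of `EE` into one by `Pb`, the common yardstick.
    lift : ∀ a b → a * N ^ Kx ≤ N ^ np n * (b * EE) → a * dfac n/2 ≤ b * Pb
    lift a b hyp = *-cancelʳ-≤ (a * dfac n/2) (b * Pb) (N ^ Kx) (begin
      a * dfac n/2 * N ^ Kx ≡⟨ lem₁ a (dfac n/2) (N ^ Kx) ⟩
      a * N ^ Kx * dfac n/2 ≤⟨ *-monoˡ-≤ (dfac n/2) hyp ⟩
      N ^ np n * (b * EE) * dfac n/2 ≡⟨ lem₂ (N ^ np n) b EE (dfac n/2) ⟩
      N ^ np n * b * (EE * dfac n/2) ≤⟨ *-monoʳ-≤ (N ^ np n * b) EE≤ ⟩
      N ^ np n * b * (4 ^ κc * (N′ ^ n/2 * N ^ Kx)) ≡⟨ lem₃ (N ^ np n) b (4 ^ κc) (N′ ^ n/2) (N ^ Kx) ⟩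
      b * Pb * N ^ Kx ∎)
      where
      open ≤-Reasoning
      lem₁ : ∀ a b c → a * b * c ≡ a * c * b
      lem₁ = solve-∀
      lem₂ : ∀ a b c d → a * (b * c) * d ≡ a * b * (c * d)
      lem₂ = solve-∀
      lem₃ : ∀ a b c d e → a * b * (c * (d * e)) ≡ b * (c * (a * d)) * e
      lem₃ = solve-∀

    Fc : Fin n → ℕ
    Fc i = ∑ uMat λ X → 𝟙 (Failing.eᶠ? i X)

    Sc : ℕ
    Sc = ∑ uMat λ X → 𝟙 (eˢ? X)

    Pc : ℕ
    Pc = ∑ uMat λ X → 𝟙 (strong? X)

    planted≤ : Pc * dfac n/2 ≤ Pb
    planted≤ = ≤-trans (lift Pc 1 (≤-trans planted-EE (≤-reflexive (cong (N ^ np n *_) (sym (*-identityˡ EE)))))) (≤-reflexive (*-identityˡ Pb))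

    fail≤ : ∀ i → n * (G * (Fc i * dfac n/2)) ≤ Pb
    fail≤ i = *-cancelˡ-≤ L {{>-nonZero L>0}} (begin
      L * (n * (G * (Fc i * dfac n/2))) ≡⟨ lem L n G (Fc i * dfac n/2) ⟩
      G * (n * L) * (Fc i * dfac n/2) ≤⟨ *-monoˡ-≤ (Fc i * dfac n/2) jj-large ⟩
      2 ^ jj * (Fc i * dfac n/2) ≡⟨ sym (*-assoc (2 ^ jj) (Fc i) (dfac n/2)) ⟩
      2 ^ jj * Fc i * dfac n/2 ≤⟨ lift (2 ^ jj * Fc i) L (≤-trans (≤-reflexive (*-assoc (2 ^ jj) (Fc i) (N ^ Kx))) (Failing.fail-bound i)) ⟩
      L * Pb ∎)
      where
      open ≤-Reasoning
      lem : ∀ a b c d → a * (b * (c * d)) ≡ c * (b * a) * d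
      lem = solve-∀

    N≤N′ : N ≤ N′
    N≤N′ = m≤m+n N _

    small≤ : G * suc n * (Sc * dfac n/2) ≤ Pb
    small≤ = ≤-trans (*-cancelʳ-≤ (G * suc n * (Sc * dfac n/2)) (N ^ np n * N ^ n/2) (n-1 !) {{n-1 !≢0}} (begin
      G * suc n * (Sc * dfac n/2) * n-1 ! ≡⟨ lem₁ (G * suc n) Sc (dfac n/2) (n-1 !) ⟩
      G * suc n * dfac n/2 * (Sc * n-1 !) ≤⟨ *-monoʳ-≤ (G * suc n * dfac n/2) (Small.small-bound n-1 nm) ⟩
      G * suc n * dfac n/2 * (N ^ np n * σ ^ n) ≡⟨ lem₂ (G * suc n) (dfac n/2) (N ^ np n) (σ ^ n) ⟩
      N ^ np n * (G * suc n * (dfac n/2 * σ ^ n)) ≤⟨ *-monoʳ-≤ (N ^ np n) σ-small ⟩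
      N ^ np n * (n-1 ! * N ^ n/2) ≡⟨ lem₃ (N ^ np n) (n-1 !) (N ^ n/2) ⟩
      N ^ np n * N ^ n/2 * n-1 ! ∎))
      (≤-trans (*-monoʳ-≤ (N ^ np n) (^-monoˡ-≤ n/2 N≤N′)) (≤-trans (≤-reflexive (sym (*-identityˡ _))) (*-monoˡ-≤ (N ^ np n * N′ ^ n/2) (m^n>0 4 κc))))
      where
      open ≤-Reasoning
      lem₁ : ∀ a b c d → a * (b * c) * d ≡ a * c * (b * d)
      lem₁ = solve-∀
      lem₂ : ∀ a b c d → a * b * (c * d) ≡ c * (a * (b * d))
      lem₂ = solve-∀
      lem₃ : ∀ a b c → a * (b * c) ≡ a * c * b
      lem₃ = solve-∀

    rest : Mat → ℕ
    rest X = ∑ uTh λ Z → ∑ uTh λ Y → guard Z Y * ∑ uPerm (term X Z Y)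

    failing : Mat → ℕ
    failing X = ∑ (fin n) λ i → 𝟙 (Failing.eᶠ? i X)

    -- One copy is charged in `cost` itself, and `n` more for the persons whose failure is put down
    -- to a small total rank.
    tiny : Mat → ℕ
    tiny X = suc n * 𝟙 (eˢ? X)

    split : ∀ X → 𝟙 (strong? X) * cost X ≤ 2 ^ J * (failing X + tiny X) + rest X
    split X = 𝟙*≤ (strong? X) λ st → +-monoˡ-≤ (rest X) (*-monoʳ-≤ (2 ^ J) (begin
      ∑ (fin n) (λ i → 𝟙 (fail? i X)) + 𝟙 (suc (total-rank X) ≤? σ)
        ≤⟨ +-mono-≤ (∑-mono (fin n) λ i → one st i (suc (total-rank X) ≤? σ)) (𝟙-mono (suc (total-rank X) ≤? σ) (eˢ? X) λ q → st , q) ⟩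
      ∑ (fin n) (λ i → 𝟙 (Failing.eᶠ? i X) + 𝟙 (eˢ? X)) + 𝟙 (eˢ? X) ≡⟨ cong (_+ 𝟙 (eˢ? X)) (trans (∑-+ (fin n) (λ i → 𝟙 (Failing.eᶠ? i X)) (λ _ → 𝟙 (eˢ? X))) (cong (failing X +_) (∑-constF n (𝟙 (eˢ? X))))) ⟩
      failing X + n * 𝟙 (eˢ? X) + 𝟙 (eˢ? X) ≡⟨ trans (+-assoc (failing X) _ _) (cong (failing X +_) (+-comm (n * 𝟙 (eˢ? X)) (𝟙 (eˢ? X)))) ⟩
      failing X + tiny X ∎))
      where
      open ≤-Reasoning
      one : Strong X → ∀ i → Dec (suc (total-rank X) ≤ σ) → 𝟙 (fail? i X) ≤ 𝟙 (Failing.eᶠ? i X) + 𝟙 (eˢ? X)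
      one st i (yes q) = ≤-trans (𝟙≤1 (fail? i X)) (≤-trans (≤-reflexive (sym (𝟙-yes (eˢ? X) (st , q)))) (m≤n+m (𝟙 (eˢ? X)) (𝟙 (Failing.eᶠ? i X))))
      one st i (no ¬q) = ≤-trans (𝟙-mono (fail? i X) (Failing.eᶠ? i X) λ f → st , f , ℕ.s≤s⁻¹ (≰⇒> ¬q)) (m≤m+n _ _)

    failing-total : G * (∑ uMat failing * dfac n/2) ≤ Pb
    failing-total = *-cancelˡ-≤ n {{>-nonZero n>0}} (begin
      n * (G * (∑ uMat failing * dfac n/2)) ≡⟨ cong (λ x → n * (G * (x * dfac n/2))) (∑-swap uMat (fin n) (λ X i → 𝟙 (Failing.eᶠ? i X))) ⟩
      n * (G * (∑ (fin n) Fc * dfac n/2)) ≡⟨ cong (λ x → n * (G * x)) (sym (∑-*ʳ (fin n) (dfac n/2) Fc)) ⟩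
      n * (G * ∑ (fin n) (λ i → Fc i * dfac n/2)) ≡⟨ cong (n *_) (sym (∑-*ˡ (fin n) G (λ i → Fc i * dfac n/2))) ⟩
      n * ∑ (fin n) (λ i → G * (Fc i * dfac n/2)) ≡⟨ sym (∑-*ˡ (fin n) n (λ i → G * (Fc i * dfac n/2))) ⟩
      ∑ (fin n) (λ i → n * (G * (Fc i * dfac n/2))) ≤⟨ ∑-mono (fin n) fail≤ ⟩
      ∑ (fin n) (λ _ → Pb) ≡⟨ ∑-constF n Pb ⟩
      n * Pb ∎)
      where open ≤-Reasoning

  strong-cost : dfac n/2 * (G * ∑ uMat (λ X → 𝟙 (strong? X) * cost X)) ≤ 9 * 2 ^ J * Pb
  strong-cost = begin
    dfac n/2 * (G * ∑ uMat (λ X → 𝟙 (strong? X) * cost X)) ≤⟨ *-monoʳ-≤ (dfac n/2) (*-monoʳ-≤ G (∑-mono uMat split)) ⟩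
    dfac n/2 * (G * ∑ uMat (λ X → 2 ^ J * (failing X + tiny X) + rest X)) ≡⟨ cong (λ x → dfac n/2 * (G * x)) sums ⟩
    dfac n/2 * (G * (2 ^ J * (∑ uMat failing + suc n * Sc) + ∑ uMat rest)) ≡⟨ lem₁ (dfac n/2) G (2 ^ J) (∑ uMat failing) (suc n) Sc (∑ uMat rest) ⟩
    2 ^ J * (G * (∑ uMat failing * dfac n/2) + G * suc n * (Sc * dfac n/2)) + dfac n/2 * (G * ∑ uMat rest)
      ≤⟨ +-mono-≤ (*-monoʳ-≤ (2 ^ J) (+-mono-≤ failing-total small≤)) (*-monoʳ-≤ (dfac n/2) main-sum) ⟩
    2 ^ J * (Pb + Pb) + dfac n/2 * ((G * suc J + 6 * 2 ^ J) * Pc) ≡⟨ cong (2 ^ J * (Pb + Pb) +_) (lem₂ (dfac n/2) (G * suc J + 6 * 2 ^ J) Pc) ⟩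
    2 ^ J * (Pb + Pb) + (G * suc J + 6 * 2 ^ J) * (Pc * dfac n/2) ≤⟨ +-monoʳ-≤ (2 ^ J * (Pb + Pb)) (*-mono-≤ (+-monoˡ-≤ (6 * 2 ^ J) J-large) planted≤) ⟩
    -- The 9 is 2 for failures and small total rank, 1 from `J-large` and 6 from `main-sum`.
    2 ^ J * (Pb + Pb) + (2 ^ J + 6 * 2 ^ J) * Pb ≡⟨ lem₃ (2 ^ J) Pb ⟩
    9 * 2 ^ J * Pb ∎
    where
    open ≤-Reasoning
    sums : ∑ uMat (λ X → 2 ^ J * (failing X + tiny X) + rest X) ≡ 2 ^ J * (∑ uMat failing + suc n * Sc) + ∑ uMat rest
    sums = trans (∑-+ uMat (λ X → 2 ^ J * (failing X + tiny X)) rest) (cong (_+ ∑ uMat rest) (trans (∑-*ˡ uMat (2 ^ J) (λ X → failing X + tiny X))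
      (cong (2 ^ J *_) (trans (∑-+ uMat failing tiny) (cong (∑ uMat failing +_) (∑-*ˡ uMat (suc n) (λ X → 𝟙 (eˢ? X))))))))
    lem₁ : ∀ d g j f n s r → d * (g * (j * (f + n * s) + r)) ≡ j * (g * (f * d) + g * n * (s * d)) + d * (g * r)
    lem₁ = solve-∀
    lem₂ : ∀ a b c → a * (b * c) ≡ b * (c * a)
    lem₂ = solve-∀
    lem₃ : ∀ a b → a * (b + b) + (a + 6 * a) * b ≡ 9 * a * b
    lem₃ = solve-∀

  -- `N ^ (np n + n/2)` is `L ^ (n * n)`, the number of all matrices. By `n²≤L`, passing from `N` to
  -- `N′` costs only a factor 4.
  Pb≤ : Pb ≤ 4 ^ κc * (4 * L ^ (n * n))
  Pb≤ = *-monoʳ-≤ (4 ^ κc) (begin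
    N ^ np n * N′ ^ n/2 ≤⟨ *-monoʳ-≤ (N ^ np n) N′≤ ⟩
    N ^ np n * (4 * N ^ n/2) ≡⟨ lem (N ^ np n) 4 (N ^ n/2) ⟩
    4 * (N ^ np n * N ^ n/2) ≡⟨ cong (4 *_) (trans (sym (^-distribˡ-+-* N (np n) n/2)) (trans (cong (_^ (np n + n/2)) N≡) (trans (^-*-assoc L 2 (np n + n/2)) (cong (L ^_) (trans (lem₂ (np n) n/2) (np-double n n/2 nh)))))) ⟩
    4 * L ^ (n * n) ∎)
    where
    open ≤-Reasoning
    lem : ∀ a b c → a * (b * c) ≡ b * (a * c)
    lem = solve-∀
    lem₂ : ∀ a b → 2 * (a + b) ≡ a + a + (b + b)
    lem₂ = solve-∀
    N≡ : N ≡ L ^ 2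
    N≡ = trans LN (cong (L *_) (sym (*-identityʳ L)))
    np-row : ∀ n → np n + np n + n ≡ n * n
    np-row zero = refl
    np-row (suc n) = trans (lem₃ n (np n)) (trans (cong (λ x → x + n + suc n) (np-row n)) (lem₄ n))
      where
      lem₃ : ∀ n p → n + p + (n + p) + suc n ≡ p + p + n + n + suc n
      lem₃ = solve-∀
      lem₄ : ∀ n → n * n + n + suc n ≡ suc n * suc n
      lem₄ = solve-∀
    np-double : ∀ n h → n ≡ h + h → np n + np n + (h + h) ≡ n * n
    np-double n h e = trans (cong (np n + np n +_) (sym e)) (np-row n)
    N′≤ : N′ ^ n/2 ≤ 4 * N ^ n/2
    N′≤ = *-cancelˡ-≤ (n ^ n/2) {{m^n≢0 n n/2 {{>-nonZero n>0}}}} (begin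
      n ^ n/2 * N′ ^ n/2 ≡⟨ sym (^-distrib-* n N′ n/2) ⟩
      (n * N′) ^ n/2 ≤⟨ ^-monoˡ-≤ n/2 (≤-trans (≤-reflexive (*-distribˡ-+ n N (n * L))) (≤-trans (+-monoʳ-≤ (n * N) (≤-trans (≤-reflexive (sym (*-assoc n n L))) (≤-trans (*-monoˡ-≤ L n²≤L) (≤-reflexive (sym LN))))) (≤-reflexive (+-comm (n * N) N)))) ⟩
      (suc n * N) ^ n/2 ≡⟨ ^-distrib-* (suc n) N n/2 ⟩
      suc n ^ n/2 * N ^ n/2 ≤⟨ *-monoˡ-≤ (N ^ n/2) (pow-suc n n/2 (≤-trans (m≤m+n n/2 n/2) (≤-reflexive (sym nh)))) ⟩
      4 * n ^ n/2 * N ^ n/2 ≡⟨ lem₅ (n ^ n/2) (N ^ n/2) ⟩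
      n ^ n/2 * (4 * N ^ n/2) ∎)
      where lem₅ : ∀ a b → 4 * a * b ≡ a * (4 * b)
            lem₅ = solve-∀

-- From rankings to scores

bit : Bool → ℕ
bit true = 1
bit false = 0

module Matchings {n : ℕ} where

  uP : U
  uP = vec (fin n) n

  -- A perfect matching of the persons in `c` with all others fixed; the induction passes through
  -- these partial matchings.
  Par : (Fin n → Bool) → Vec (Fin n) n → Set
  Par c N = ∀ i → (c i ≡ true → c (lookup N i) ≡ true × lookup N (lookup N i) ≡ i × lookup N i ≢ i) × (c i ≡ false → lookup N i ≡ i)

  private
    _≟B_ : (a b : Bool) → Dec (a ≡ b)
    true ≟B true = yes refl
    true ≟B false = no λ ()
    false ≟B true = no λ ()
    false ≟B false = yes refl

  par? : ∀ c N → Dec (Par c N)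
  par? c N = FinP.all? λ i → ((c i ≟B true) →-dec ((c (lookup N i) ≟B true) ×-dec (lookup N (lookup N i) ≟F i) ×-dec ¬? (lookup N i ≟F i))) ×-dec ((c i ≟B false) →-dec (lookup N i ≟F i))

  size : (Fin n → Bool) → ℕ
  size c = ∑ (fin n) (λ i → bit (c i))

  drop : (Fin n → Bool) → Fin n → Fin n → Fin n → Bool
  drop c i₀ j i with i ≟F i₀ | i ≟F j
  ... | yes _ | _ = false
  ... | no _ | yes _ = false
  ... | no _ | no _ = c i

  drop-i : ∀ c i₀ j → drop c i₀ j i₀ ≡ false
  drop-i c i₀ j with i₀ ≟F i₀
  ... | yes _ = refl
  ... | no ne = ⊥-elim (ne refl)

  drop-j : ∀ c i₀ j → drop c i₀ j j ≡ false
  drop-j c i₀ j with j ≟F i₀ | j ≟F j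
  ... | yes _ | _ = refl
  ... | no _ | yes _ = refl
  ... | no _ | no ne = ⊥-elim (ne refl)

  drop-o : ∀ c i₀ j i → i ≢ i₀ → i ≢ j → drop c i₀ j i ≡ c i
  drop-o c i₀ j i a b with i ≟F i₀ | i ≟F j
  ... | yes p | _ = ⊥-elim (a p)
  ... | no _ | yes q = ⊥-elim (b q)
  ... | no _ | no _ = refl

  drop-size : ∀ c i₀ j → c i₀ ≡ true → c j ≡ true → j ≢ i₀ → size c ≡ suc (suc (size (drop c i₀ j)))
  drop-size c i₀ j ci cj j≢ = trans (∑-cong (fin n) each) (trans (∑-+ (fin n) _ _) (cong₂ _+_ (δ1 i₀) (trans (∑-+ (fin n) _ _) (cong (_+ size (drop c i₀ j)) (δ1 j)))))
    where
    δ1 : ∀ a → ∑ (fin n) (λ i → 𝟙 (i ≟F a) * 1) ≡ 1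
    δ1 a = ∑-δ (fin n) (λ _ → 1) a
    each : ∀ i → bit (c i) ≡ 𝟙 (i ≟F i₀) * 1 + (𝟙 (i ≟F j) * 1 + bit (drop c i₀ j i))
    each i with i ≟F i₀ | i ≟F j
    ... | yes refl | yes refl = ⊥-elim (j≢ refl)
    ... | yes refl | no _ = cong bit ci
    ... | no _ | yes refl = cong bit cj
    ... | no _ | no _ = refl

  -- A chosen person of `c` has 2k + 1 possible partners, and removing the pair leaves 2k persons.
  count : ∀ k c → size c ≡ k + k → ∑ uP (λ N → 𝟙 (par? c N)) ≤ dfac k
  count zero c e = ∑-unique≤1 uP (par? c) λ N N′ p p′ → vec-ext N N′ λ i → trans (proj₂ (p i) (off i)) (sym (proj₂ (p′ i) (off i)))
    where
    off : ∀ i → c i ≡ false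
    off i = go (c i) refl
      where go : ∀ b → c i ≡ b → c i ≡ false
            go false q = q
            go true q = ⊥-elim (1+n≢0 (n≤0⇒n≡0 (≤-trans (≤-reflexive (sym (cong bit q))) (≤-trans (f≤∑ (fin n) (λ i → bit (c i)) i) (≤-reflexive e)))))
  count (suc k) c e = begin
    ∑ uP (λ N → 𝟙 (par? c N)) ≡⟨ ∑-cong uP (λ N → sym (∑-δ (fin n) (λ _ → 𝟙 (par? c N)) (lookup N i₀))) ⟩
    ∑ uP (λ N → ∑ (fin n) λ j → 𝟙 (j ≟F lookup N i₀) * 𝟙 (par? c N)) ≡⟨ ∑-swap uP (fin n) _ ⟩
    ∑ (fin n) (λ j → ∑ uP λ N → 𝟙 (j ≟F lookup N i₀) * 𝟙 (par? c N)) ≡⟨ ∑-cong (fin n) (λ j → ∑-cong uP λ N → sym (𝟙-× (j ≟F lookup N i₀) (par? c N))) ⟩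
    ∑ (fin n) (λ j → ∑ uP λ N → 𝟙 ((j ≟F lookup N i₀) ×-dec par? c N)) ≤⟨ ∑-mono (fin n) (λ j → each j (j ≟F i₀) (c j) refl) ⟩
    ∑ (fin n) (λ j → bit (off j) * dfac k) ≡⟨ ∑-*ʳ (fin n) (dfac k) _ ⟩
    size off * dfac k ≡⟨ cong (_* dfac k) off-size ⟩
    dfac (suc k) ∎
    where
    open ≤-Reasoning
    found : ∃ λ i → 0 < bit (c i)
    found = ∑-pos (fin n) (λ i → bit (c i)) (≤-trans (s≤s z≤n) (≤-reflexive (sym e)))
    i₀ : Fin n
    i₀ = proj₁ found
    ci₀ : c i₀ ≡ true
    ci₀ = go (c i₀) (proj₂ found)
      where go : ∀ b → 0 < bit b → b ≡ true
            go true _ = refl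
    off : Fin n → Bool
    off = drop c i₀ i₀
    off-size : size off ≡ suc (k + k)
    off-size = suc-injective (trans (sym (trans (∑-cong (fin n) eachi) (trans (∑-+ (fin n) _ _) (cong (_+ size off) (∑-δ (fin n) (λ _ → 1) i₀))))) (trans e (cong suc (+-suc k k))))
      where
      eachi : ∀ i → bit (c i) ≡ 𝟙 (i ≟F i₀) * 1 + bit (off i)
      eachi i with i ≟F i₀
      ... | yes refl = cong bit ci₀
      ... | no _ = refl
    offj : ∀ j → j ≢ i₀ → off j ≡ c j
    offj j ne = drop-o c i₀ i₀ j ne ne
    none : ∀ j → (∀ N → Par c N → j ≢ lookup N i₀) → ∑ uP (λ N → 𝟙 ((j ≟F lookup N i₀) ×-dec par? c N)) ≤ bit (off j) * dfac k
    none j h = ≤-trans (≤-reflexive (∑-zero uP λ N → 𝟙-no ((j ≟F lookup N i₀) ×-dec par? c N) λ (q , p) → h N p q)) z≤n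
    each : ∀ j → Dec (j ≡ i₀) → ∀ b → c j ≡ b → ∑ uP (λ N → 𝟙 ((j ≟F lookup N i₀) ×-dec par? c N)) ≤ bit (off j) * dfac k
    each j (yes q) b cj = none j λ N p r → proj₂ (proj₂ (proj₁ (p i₀) ci₀)) (trans (sym r) q)
    each j (no _) false cj = none j λ N p r → true≢false (trans (sym (proj₁ (proj₁ (p i₀) ci₀))) (trans (cong c (sym r)) cj))
      where true≢false : true ≡ false → ⊥
            true≢false ()
    each j (no j≢) true cj = ≤-trans (∑-inj uP uP (λ N → (j ≟F lookup N i₀) ×-dec par? c N) (par? c′) g ok inj)
        (≤-trans (count k c′ (suc-injective (suc-injective (trans (sym (drop-size c i₀ j ci₀ cj j≢)) (trans e (cong suc (+-suc k k)))))))
          (≤-reflexive (sym (trans (cong (λ b → bit b * dfac k) (trans (offj j j≢) cj)) (*-identityˡ _)))))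
      where
      c′ : Fin n → Bool
      c′ = drop c i₀ j
      g : Vec (Fin n) n → Vec (Fin n) n
      g N = (N [ i₀ ]≔ i₀) [ j ]≔ j
      g-j : ∀ N → lookup (g N) j ≡ j
      g-j N = upd-same (N [ i₀ ]≔ i₀) j j
      g-i : ∀ N → lookup (g N) i₀ ≡ i₀
      g-i N = trans (upd-other (N [ i₀ ]≔ i₀) j j (j≢ ∘ sym)) (upd-same N i₀ i₀)
      g-o : ∀ N i → i ≢ i₀ → i ≢ j → lookup (g N) i ≡ lookup N i
      g-o N i a b = trans (upd-other (N [ i₀ ]≔ i₀) j j b) (upd-other N i₀ i₀ a)
      ok : ∀ N → (j ≡ lookup N i₀ × Par c N) → Par c′ (g N)
      ok N (jN , p) i = go (i ≟F i₀) (i ≟F j)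
        where
        go : Dec (i ≡ i₀) → Dec (i ≡ j) → (c′ i ≡ true → c′ (lookup (g N) i) ≡ true × lookup (g N) (lookup (g N) i) ≡ i × lookup (g N) i ≢ i) × (c′ i ≡ false → lookup (g N) i ≡ i)
        go (yes refl) _ = (λ t → ⊥-elim (tf (trans (sym t) (drop-i c i₀ j)))) , λ _ → g-i N
          where tf : true ≡ false → ⊥
                tf ()
        go (no _) (yes refl) = (λ t → ⊥-elim (tf (trans (sym t) (drop-j c i₀ j)))) , λ _ → g-j N
          where tf : true ≡ false → ⊥
                tf ()
        go (no a) (no b) = act , λ f → trans (g-o N i a b) (proj₂ (p i) (trans (sym (drop-o c i₀ j i a b)) f))
          where
          act : c′ i ≡ true → c′ (lookup (g N) i) ≡ true × lookup (g N) (lookup (g N) i) ≡ i × lookup (g N) i ≢ i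
          act t = let ci = trans (sym (drop-o c i₀ j i a b)) t
                      x , y , w = proj₁ (p i) ci
                      m = g-o N i a b
                      m≢i₀ : lookup N i ≢ i₀
                      m≢i₀ q = b (trans (sym y) (trans (cong (lookup N) q) (sym jN)))
                      m≢j : lookup N i ≢ j
                      m≢j q = a (trans (sym y) (trans (cong (lookup N) (trans q jN)) (proj₁ (proj₂ (proj₁ (p i₀) ci₀)))))
                  in trans (cong c′ m) (trans (drop-o c i₀ j _ m≢i₀ m≢j) x) ,
                     trans (cong (lookup (g N)) m) (trans (g-o N _ m≢i₀ m≢j) y) , λ q → w (trans (sym m) q)
      inj : ∀ N N′ → (j ≡ lookup N i₀ × Par c N) → (j ≡ lookup N′ i₀ × Par c N′) → g N ≡ g N′ → N ≡ N′
      inj N N′ (q , p) (q′ , p′) eq = vec-ext N N′ λ i → go i (i ≟F i₀) (i ≟F j)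
        where
        go : ∀ i → Dec (i ≡ i₀) → Dec (i ≡ j) → lookup N i ≡ lookup N′ i
        go i (yes refl) _ = trans (sym q) q′
        go i (no _) (yes refl) = trans (back N q p) (sym (back N′ q′ p′))
          where back : ∀ N → i ≡ lookup N i₀ → Par c N → lookup N i ≡ i₀
                back N q p = trans (cong (lookup N) q) (proj₁ (proj₂ (proj₁ (p i₀) ci₀)))
        go i (no a) (no b) = trans (sym (g-o N i a b)) (trans (cong (λ v → lookup v i) eq) (g-o N′ i a b))

  matchings≤ : ∀ k → n ≡ k + k → ∑ uP (λ N → 𝟙 (isMatching? N)) ≤ dfac k
  matchings≤ k nk = ≤-trans (∑-mono uP λ N → 𝟙-mono (isMatching? N) (par? (λ _ → true) N) λ m i → (λ _ → refl , m i) , λ ())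
    (count k (λ _ → true) (trans (card-fin n) nk))

-- Lengths of filtered lists as sums

lsum : ∀ {A : Set} → List A → (A → ℕ) → ℕ
lsum []       f = 0
lsum (x ∷ xs) f = f x + lsum xs f

length-filter : ∀ {A : Set} {p} {P : A → Set p} (P? : ∀ a → Dec (P a)) xs → length (filter P? xs) ≡ lsum xs (λ a → 𝟙 (P? a))
length-filter P? [] = refl
length-filter P? (x ∷ xs) with P? x
... | yes _ = cong suc (length-filter P? xs)
... | no _ = length-filter P? xs

lsum-++ : ∀ {A : Set} (xs ys : List A) f → lsum (xs ++ ys) f ≡ lsum xs f + lsum ys f
lsum-++ [] ys f = refl
lsum-++ (x ∷ xs) ys f = trans (cong (f x +_) (lsum-++ xs ys f)) (sym (+-assoc (f x) _ _))

lsum-map : ∀ {A B : Set} (g : A → B) xs f → lsum (List.map g xs) f ≡ lsum xs (λ a → f (g a))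
lsum-map g [] f = refl
lsum-map g (x ∷ xs) f = cong (f (g x) +_) (lsum-map g xs f)

lsum-concatMap : ∀ {A B : Set} (g : A → List B) xs f → lsum (concatMap g xs) f ≡ lsum xs (λ a → lsum (g a) f)
lsum-concatMap g [] f = refl
lsum-concatMap g (x ∷ xs) f = trans (lsum-++ (g x) (concatMap g xs) f) (cong (lsum (g x) f +_) (lsum-concatMap g xs f))

lsum-cong : ∀ {A : Set} (xs : List A) {f g : A → ℕ} → (∀ a → f a ≡ g a) → lsum xs f ≡ lsum xs g
lsum-cong [] h = refl
lsum-cong (x ∷ xs) h = cong₂ _+_ (h x) (lsum-cong xs h)

lsum-tabulate : ∀ n {A : Set} (g : Fin n → A) f → lsum (List.tabulate g) f ≡ ∑ (fin n) (λ i → f (g i))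
lsum-tabulate zero g f = refl
lsum-tabulate (suc n) g f = cong (f (g zero) +_) (lsum-tabulate n (g ∘ suc) f)

lsum-allVecs : ∀ u (xs : List (El u)) → (∀ f → lsum xs f ≡ ∑ u f) → ∀ k f → lsum (allVecs xs k) f ≡ ∑ (vec u k) f
lsum-allVecs u xs h zero f = +-identityʳ _
lsum-allVecs u xs h (suc k) f = trans (lsum-concatMap (λ x → List.map (x ∷_) (allVecs xs k)) xs f) (trans (lsum-cong xs λ x → trans (lsum-map (x ∷_) (allVecs xs k) f) (lsum-allVecs u xs h k (λ v → f (x ∷ v))))
  (h _))

uProfile : ℕ → U
uProfile n = vec (vec (fin n) (n ∸ 1)) n

lsum-profiles : ∀ n f → lsum (allProfiles n) f ≡ ∑ (uProfile n) f
lsum-profiles n = lsum-allVecs (vec (fin n) (n ∸ 1)) (allVecs (List.allFin n) (n ∸ 1)) (lsum-allVecs (fin n) (List.allFin n) (lsum-tabulate n id) (n ∸ 1)) n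

validCount-∑ : ∀ n → validCount n ≡ ∑ (uProfile n) (λ P → 𝟙 (validProfile? P))
validCount-∑ n = trans (length-filter validProfile? (allProfiles n)) (lsum-profiles n _)

stableCount-∑ : ∀ n → stableCount n ≡ ∑ (uProfile n) (λ P → 𝟙 (validProfile? P ×-dec hasStableMatching? P))
stableCount-∑ n = trans (length-filter (λ P → validProfile? P ×-dec hasStableMatching? P) (allProfiles n)) (lsum-profiles n _)

injective-surjective : ∀ {n} (f : Fin n → Fin n) → (∀ i j → f i ≡ f j → i ≡ j) → ∀ j → ∃ λ i → f i ≡ j
injective-surjective {suc n} f inj j with FinP.any? (λ i → f i ≟F j)
... | yes e = e
... | no ¬e = ⊥-elim (<⇒≱ (n<1+n n) (FinP.injective⇒≤ {f = λ i → punchOut (λ q → ¬e (i , sym q))} λ {i} {i′} q → inj i i′ (FinP.punchOut-injective (λ q → ¬e (i , sym q)) (λ q → ¬e (i′ , sym q)) q)))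

-- Uniform scores induce uniform rankings

module Tr (k L : ℕ) where

  n : ℕ
  n = suc k

  Row : Set
  Row = Vec (Fin L) n

  uRow : U
  uRow = vec (fin L) n

  Mat : Set
  Mat = Vec Row n

  uMat : U
  uMat = vec uRow n

  RList : Set
  RList = Vec (Fin n) k

  Sorted : RList → Row → Set
  Sorted l r = ∀ p q → p Fin.< q → lookup r (lookup l p) Fin.< lookup r (lookup l q)

  sorted? : ∀ l r → Dec (Sorted l r)
  sorted? l r = FinP.all? λ p → FinP.all? λ q → (p FinP.<? q) →-dec (lookup r (lookup l p) FinP.<? lookup r (lookup l q))

  module Valid (i : Fin n) (l : RList) (v : ValidList i l) where

    -- With `i` put in front, a valid list becomes an injective, hence surjective, map of all
    -- persons.
    π : Fin n → Fin n
    π zero = i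
    π (suc p) = lookup l p

    π-inj : ∀ a b → π a ≡ π b → a ≡ b
    π-inj zero zero _ = refl
    π-inj zero (suc b) e = ⊥-elim (proj₂ v b (sym e))
    π-inj (suc a) zero e = ⊥-elim (proj₂ v a e)
    π-inj (suc a) (suc b) e = cong suc (proj₁ v a b e)

    π-sur : ∀ j → ∃ λ a → π a ≡ j
    π-sur = injective-surjective π π-inj

    listed : ∀ j → j ≢ i → ∃ λ p → lookup l p ≡ j
    listed j ne with π-sur j
    ... | zero , e = ⊥-elim (ne (sym e))
    ... | suc p , e = p , e

  Inc : Row → Set
  Inc (_ ∷ w) = ∀ p q → p Fin.< q → lookup w p Fin.< lookup w q

  inc? : ∀ r → Dec (Inc r)
  inc? (_ ∷ w) = FinP.all? λ p → FinP.all? λ q → (p FinP.<? q) →-dec (lookup w p FinP.<? lookup w q)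

  -- Common to all rankings, by `sorted-count`; this is the uniformity of the induced ranking. It
  -- cancels between `stable≤` and `distinct≤valid`.
  c₀ : ℕ
  c₀ = ∑ uRow (λ r → 𝟙 (inc? r))

  -- Reading a row in the order `i`, then `l`, is a bijection of rows that turns sorted by `l` into
  -- increasing.
  sorted-count : ∀ i l → ValidList i l → ∑ uRow (λ r → 𝟙 (sorted? l r)) ≡ c₀
  sorted-count i l v = trans (∑-cong uRow λ r → 𝟙-cong (sorted? l r) (inc? (g r)) (to r) (from r)) (∑-bij uRow uRow g h hg gh (λ r → 𝟙 (inc? r)))
    where
    open Valid i l v
    g h : Row → Row
    g r = tabulate (λ a → lookup r (π a))
    h r = tabulate (λ j → lookup r (proj₁ (π-sur j)))
    hg : ∀ r → h (g r) ≡ r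
    hg r = vec-ext (h (g r)) r λ j → trans (VecP.lookup∘tabulate (λ j → lookup (g r) (proj₁ (π-sur j))) j) (trans (VecP.lookup∘tabulate (λ a → lookup r (π a)) (proj₁ (π-sur j))) (cong (lookup r) (proj₂ (π-sur j))))
    gh : ∀ r → g (h r) ≡ r
    gh r = vec-ext (g (h r)) r λ a → trans (VecP.lookup∘tabulate (λ a → lookup (h r) (π a)) a) (trans (VecP.lookup∘tabulate (λ j → lookup r (proj₁ (π-sur j))) (π a)) (cong (lookup r) (π-inj (proj₁ (π-sur (π a))) a (proj₂ (π-sur (π a))))))
    lk : ∀ r p → lookup (tabulate (λ a → lookup r (π (suc a)))) p ≡ lookup r (lookup l p)
    lk r p = VecP.lookup∘tabulate _ p
    to : ∀ r → Sorted l r → Inc (g r)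
    to r s p q pq = subst₂ Fin._<_ (sym (lk r p)) (sym (lk r q)) (s p q pq)
    from : ∀ r → Inc (g r) → Sorted l r
    from r s p q pq = subst₂ Fin._<_ (lk r p) (lk r q) (s p q pq)

  -- Induction on the position. After equal beginnings each list has the current entry of the other
  -- at this place or later; if it came later in `l`, the score at this place would be smaller than
  -- itself.
  sorted-unique : ∀ i l l′ r → ValidList i l → ValidList i l′ → Sorted l r → Sorted l′ r → l ≡ l′
  sorted-unique i l l′ r v v′ s s′ = vec-ext l l′ λ p → go (suc (toℕ p)) p ≤-refl
    where
    half : ∀ l l′ → ValidList i l → ValidList i l′ → Sorted l r → ∀ p → (∀ q → q Fin.< p → lookup l q ≡ lookup l′ q) →
      ∃ λ q → lookup l q ≡ lookup l′ p × p Fin.≤ q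
    half l l′ v v′ s p ih with Valid.listed i l v (lookup l′ p) (proj₂ v′ p)
    ... | q , e = q , e , ≮⇒≥ λ q<p → <-irrefl (cong toℕ (proj₁ v′ q p (trans (sym (ih q q<p)) e))) q<p
    mono : ∀ l → Sorted l r → ∀ p q → p Fin.≤ q → lookup r (lookup l p) Fin.≤ lookup r (lookup l q)
    mono l s p q h with p ≟F q
    ... | yes refl = ≤-refl
    ... | no ne = <⇒≤ (s p q (≤∧≢⇒< h λ e → ne (FinP.toℕ-injective e)))
    go : ∀ b p → toℕ p < b → lookup l p ≡ lookup l′ p
    go (suc b) p (s≤s pb) with half l l′ v v′ s p (λ q q<p → go b q (≤-trans q<p pb)) | half l′ l v′ v s′ p (λ q q<p → sym (go b q (≤-trans q<p pb)))
    ... | q , e , p≤q | q′ , e′ , p≤q′ with p ≟F q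
    ...   | yes refl = e
    ...   | no ne = ⊥-elim (<⇒≱ (s p q (≤∧≢⇒< p≤q λ x → ne (FinP.toℕ-injective x)))
            (≤-trans (≤-reflexive (cong (λ x → toℕ (lookup r x)) e)) (≤-trans (mono l′ s′ p q′ p≤q′) (≤-reflexive (cong (λ x → toℕ (lookup r x)) e′)))))

  DistRow : Fin n → Row → Set
  DistRow i r = ∀ j m → j ≢ i → m ≢ i → lookup r j ≡ lookup r m → j ≡ m

  module _ (r : Row) where

    key : Fin n → ℕ
    key j = toℕ (lookup r j)

    insert : ∀ {m} → Fin n → Vec (Fin n) m → Vec (Fin n) (suc m)
    insert x [] = x ∷ []
    insert x (y ∷ ys) with key x ≤? key y
    ... | yes _ = x ∷ y ∷ ys
    ... | no _ = y ∷ insert x ys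

    isort : ∀ {m} → Vec (Fin n) m → Vec (Fin n) m
    isort [] = []
    isort (x ∷ xs) = insert x (isort xs)

    insert-all : ∀ {m} (P : Fin n → Set) x (ys : Vec (Fin n) m) → P x → (∀ p → P (lookup ys p)) → ∀ p → P (lookup (insert x ys) p)
    insert-all P x [] px h zero = px
    insert-all P x (y ∷ ys) px h p with key x ≤? key y
    insert-all P x (y ∷ ys) px h zero | yes _ = px
    insert-all P x (y ∷ ys) px h (suc p) | yes _ = h p
    insert-all P x (y ∷ ys) px h zero | no _ = h zero
    insert-all P x (y ∷ ys) px h (suc p) | no _ = insert-all P x ys px (h ∘ suc) p

    isort-all : ∀ {m} (P : Fin n → Set) (xs : Vec (Fin n) m) → (∀ p → P (lookup xs p)) → ∀ p → P (lookup (isort xs) p)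
    isort-all P (x ∷ xs) h = insert-all P x (isort xs) (h zero) (isort-all P xs (h ∘ suc))

    Up : ∀ {m} → Vec (Fin n) m → Set
    Up {m} ys = ∀ (p q : Fin m) → p Fin.< q → key (lookup ys p) < key (lookup ys q)

    insert-up : ∀ {m} x (ys : Vec (Fin n) m) → Up ys → (∀ p → key x ≢ key (lookup ys p)) → Up (insert x ys)
    insert-up x [] u ne zero zero ()
    insert-up x (y ∷ ys) u ne p q pq with key x ≤? key y
    insert-up x (y ∷ ys) u ne zero (suc zero) _ | yes h = ≤∧≢⇒< h (ne zero)
    insert-up x (y ∷ ys) u ne zero (suc (suc q)) _ | yes h = ≤-<-trans h (u zero (suc q) (s≤s z≤n))
    insert-up x (y ∷ ys) u ne (suc p) (suc q) (s≤s pq) | yes h = u p q pq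
    insert-up x (y ∷ ys) u ne zero (suc q) _ | no h = insert-all (λ j → key y < key j) x ys (≰⇒> h) (λ p → u zero (suc p) (s≤s z≤n)) q
    insert-up x (y ∷ ys) u ne (suc p) (suc q) (s≤s pq) | no h = insert-up x ys (λ a b ab → u (suc a) (suc b) (s≤s ab)) (ne ∘ suc) p q pq

    isort-up : ∀ {m} (xs : Vec (Fin n) m) → (∀ p q → p Fin.< q → key (lookup xs p) ≢ key (lookup xs q)) → Up (isort xs)
    isort-up [] h ()
    isort-up (x ∷ xs) h = insert-up x (isort xs) (isort-up xs λ p q pq → h (suc p) (suc q) (s≤s pq)) (isort-all (λ j → key x ≢ key j) xs λ p → h zero (suc p) (s≤s z≤n))

  sorted-exists : ∀ i r → DistRow i r → ∃ λ l → ValidList i l × Sorted l r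
  sorted-exists i r d = l , (inj , avoid) , up
    where
    others : RList
    others = tabulate (punchIn i)
    lk : ∀ p → lookup others p ≡ punchIn i p
    lk p = VecP.lookup∘tabulate _ p
    l : RList
    l = isort r others
    up : Sorted l r
    up = isort-up r others λ p q pq e → FinP.<⇒≢ pq (FinP.punchIn-injective i p q (d (punchIn i p) (punchIn i q) (FinP.punchInᵢ≢i i p) (FinP.punchInᵢ≢i i q)
        (FinP.toℕ-injective (subst₂ (λ a b → key r a ≡ key r b) (lk p) (lk q) e))))
    avoid : ∀ p → lookup l p ≢ i
    avoid = isort-all r (_≢ i) others λ p e → FinP.punchInᵢ≢i i p (trans (sym (lk p)) e)
    inj : ∀ p q → lookup l p ≡ lookup l q → p ≡ q
    inj p q e with FinP.<-cmp p q
    ... | tri< h _ _ = ⊥-elim (<-irrefl (cong (key r) e) (up p q h))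
    ... | tri≈ _ h _ = h
    ... | tri> _ _ h = ⊥-elim (<-irrefl (cong (key r) (sym e)) (up q p h))

  Distinct : Mat → Set
  Distinct X = ∀ i → DistRow i (lookup X i)

  distinct? : ∀ X → Dec (Distinct X)
  distinct? X = FinP.all? λ i → FinP.all? λ j → FinP.all? λ m → ¬? (j ≟F i) →-dec (¬? (m ≟F i) →-dec ((lookup (lookup X i) j ≟F lookup (lookup X i) m) →-dec (j ≟F m)))

  sc : Mat → Fin n → Fin n → ℕ
  sc X a b = toℕ (lookup (lookup X a) b)

  AllSorted : Profile n → Mat → Set
  AllSorted P X = ∀ i → Sorted (lookup P i) (lookup X i)

  row-count : ∀ P → ValidProfile P → ∑ uMat (λ X → ∏ n (λ i → 𝟙 (sorted? (lookup P i) (lookup X i)))) ≡ c₀ ^ n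
  row-count P v = trans (∑-∏ uRow n (λ i r → 𝟙 (sorted? (lookup P i) r))) (trans (∏-cong n λ i → sorted-count i (lookup P i) (v i)) (∏-const n c₀))

  all-sorted? : ∀ P X → Dec (AllSorted P X)
  all-sorted? P X = FinP.all? λ i → sorted? (lookup P i) (lookup X i)

  ∏-𝟙 : ∀ m {p} {P : Fin m → Set p} (P? : ∀ i → Dec (P i)) {q} {Q : Set q} (Q? : Dec Q) → (Q → ∀ i → P i) → ((∀ i → P i) → Q) → ∏ m (λ i → 𝟙 (P? i)) ≡ 𝟙 Q?
  ∏-𝟙 zero P? Q? f g = sym (𝟙-yes Q? (g λ ()))
  ∏-𝟙 (suc m) {P = P} P? Q? f g = trans (cong (𝟙 (P? zero) *_) (∏-𝟙 m (λ i → P? (suc i)) (FinP.all? (λ i → P? (suc i))) id id))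
    (trans (sym (𝟙-× (P? zero) (FinP.all? (λ i → P? (suc i))))) (𝟙-cong (P? zero ×-dec FinP.all? (λ i → P? (suc i))) Q? (λ (a , b) → g (all a b)) (λ q → f q zero , λ i → f q (suc i))))
    where all : P zero → (∀ i → P (suc i)) → ∀ i → P i
          all a b zero = a
          all a b (suc i) = b i

  row-count′ : ∀ P → ValidProfile P → ∑ uMat (λ X → 𝟙 (all-sorted? P X)) ≡ c₀ ^ n
  row-count′ P v = trans (∑-cong uMat λ X → sym (∏-𝟙 n (λ i → sorted? (lookup P i) (lookup X i)) (all-sorted? P X) id id)) (row-count P v)

  Solvable : Mat → Set
  Solvable X = Distinct X × ∃ λ N → StableFor (sc X) N

  stables : Mat → ℕ
  stables X = ∑ (vec (fin n) n) λ N → 𝟙 (stableFor? (sc X) N)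

  solvable? : ∀ X → Dec (Solvable X)
  solvable? X = distinct? X ×-dec ∃Vec? n (stableFor? (sc X))

  sorted-distinct : ∀ P X → ValidProfile P → AllSorted P X → Distinct X
  sorted-distinct P X v s i j m j≢i m≢i e with Valid.listed i (lookup P i) (v i) j j≢i | Valid.listed i (lookup P i) (v i) m m≢i
  ... | p , refl | q , refl with FinP.<-cmp p q
  ...   | tri< h _ _ = ⊥-elim (FinP.<⇒≢ (s i p q h) e)
  ...   | tri≈ _ refl _ = refl
  ...   | tri> _ _ h = ⊥-elim (FinP.<⇒≢ (s i q p h) (sym e))

  prefers : ∀ P X → ValidProfile P → AllSorted P X → ∀ i j m → j ≢ i → m ≢ i → sc X i j < sc X i m → Prefers P i j m
  prefers P X v s i j m j≢i m≢i h with Valid.listed i (lookup P i) (v i) j j≢i | Valid.listed i (lookup P i) (v i) m m≢i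
  ... | p , refl | q , refl with FinP.<-cmp p q
  ...   | tri< pq _ _ = p , q , pq , refl , refl
  ...   | tri≈ _ refl _ = ⊥-elim (<-irrefl refl h)
  ...   | tri> _ _ qp = ⊥-elim (<-asym h (s i q p qp))

  stable-transfer : ∀ P X → ValidProfile P → AllSorted P X → HasStableMatching P → Solvable X
  stable-transfer P X v s (N , m , st) = sorted-distinct P X v s , N , m , λ a b b≢a b≢N (h , h′) → st a b b≢N
    (prefers P X v s a b (lookup N a) b≢a (proj₂ (m a)) h , prefers P X v s b a (lookup N b) (b≢a ∘ sym) (proj₂ (m b)) h′)

  stable≤ : stableCount n * c₀ ^ n ≤ ∑ uMat (λ X → 𝟙 (solvable? X))
  stable≤ = begin
    stableCount n * c₀ ^ n ≡⟨ trans (cong (_* c₀ ^ n) (stableCount-∑ n)) (sym (∑-*ʳ (uProfile n) (c₀ ^ n) (λ P → 𝟙 (good? P)))) ⟩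
    ∑ (uProfile n) (λ P → 𝟙 (good? P) * c₀ ^ n) ≤⟨ ∑-mono (uProfile n) (λ P → 𝟙*≤𝟙* (good? P) λ g → ≤-reflexive (sym (row-count′ P (proj₁ g)))) ⟩
    ∑ (uProfile n) (λ P → 𝟙 (good? P) * ∑ uMat λ X → 𝟙 (all-sorted? P X)) ≡⟨ trans (∑-cong (uProfile n) λ P → sym (∑-*ˡ uMat (𝟙 (good? P)) (λ X → 𝟙 (all-sorted? P X)))) (∑-swap (uProfile n) uMat (λ P X → 𝟙 (good? P) * 𝟙 (all-sorted? P X))) ⟩
    ∑ uMat (λ X → ∑ (uProfile n) λ P → 𝟙 (good? P) * 𝟙 (all-sorted? P X)) ≤⟨ ∑-mono uMat each ⟩
    ∑ uMat (λ X → 𝟙 (solvable? X)) ∎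
    where
    open ≤-Reasoning
    good? : ∀ P → Dec (ValidProfile P × HasStableMatching P)
    good? P = validProfile? P ×-dec hasStableMatching? P
    each : ∀ X → ∑ (uProfile n) (λ P → 𝟙 (good? P) * 𝟙 (all-sorted? P X)) ≤ 𝟙 (solvable? X)
    each X = ≤-trans (≤-reflexive (∑-cong (uProfile n) λ P → sym (𝟙-× (good? P) (all-sorted? P X)))) (go (solvable? X))
      where
      go : (d : Dec (Solvable X)) → ∑ (uProfile n) (λ P → 𝟙 (good? P ×-dec all-sorted? P X)) ≤ 𝟙 d
      go (yes _) = ∑-unique≤1 (uProfile n) (λ P → good? P ×-dec all-sorted? P X) λ P P′ (g , s) (g′ , s′) →
        vec-ext P P′ λ i → sorted-unique i (lookup P i) (lookup P′ i) (lookup X i) (proj₁ g i) (proj₁ g′ i) (s i) (s′ i)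
      go (no ¬s) = ≤-reflexive (∑-zero (uProfile n) λ P → 𝟙-no (good? P ×-dec all-sorted? P X) λ (g , s) → ¬s (stable-transfer P X (proj₁ g) s (proj₂ g)))

  distinct≤valid : ∑ uMat (λ X → 𝟙 (distinct? X)) ≤ validCount n * c₀ ^ n
  distinct≤valid = begin
    ∑ uMat (λ X → 𝟙 (distinct? X)) ≤⟨ ∑-mono uMat (λ X → 𝟙≤ (distinct? X) λ d → each X d) ⟩
    ∑ uMat (λ X → ∑ (uProfile n) λ P → 𝟙 (validProfile? P) * 𝟙 (all-sorted? P X)) ≡⟨ trans (∑-swap uMat (uProfile n) (λ X P → 𝟙 (validProfile? P) * 𝟙 (all-sorted? P X))) (∑-cong (uProfile n) λ P → ∑-*ˡ uMat (𝟙 (validProfile? P)) (λ X → 𝟙 (all-sorted? P X))) ⟩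
    ∑ (uProfile n) (λ P → 𝟙 (validProfile? P) * ∑ uMat λ X → 𝟙 (all-sorted? P X)) ≤⟨ ∑-mono (uProfile n) (λ P → 𝟙*≤𝟙* (validProfile? P) λ v → ≤-reflexive (row-count′ P v)) ⟩
    ∑ (uProfile n) (λ P → 𝟙 (validProfile? P) * c₀ ^ n) ≡⟨ trans (∑-*ʳ (uProfile n) (c₀ ^ n) (λ P → 𝟙 (validProfile? P))) (cong (_* c₀ ^ n) (sym (validCount-∑ n))) ⟩
    validCount n * c₀ ^ n ∎
    where
    open ≤-Reasoning
    each : ∀ X → Distinct X → 1 ≤ ∑ (uProfile n) λ P → 𝟙 (validProfile? P) * 𝟙 (all-sorted? P X)
    each X d = ≤-trans (≤-reflexive (sym (cong₂ _*_ (𝟙-yes (validProfile? P) v) (𝟙-yes (all-sorted? P X) s)))) (f≤∑ (uProfile n) (λ P → 𝟙 (validProfile? P) * 𝟙 (all-sorted? P X)) P)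
      where
      ex : ∀ i → ∃ λ l → ValidList i l × Sorted l (lookup X i)
      ex i = sorted-exists i (lookup X i) (d i)
      P : Profile n
      P = tabulate (λ i → proj₁ (ex i))
      Pi : ∀ i → lookup P i ≡ proj₁ (ex i)
      Pi i = VecP.lookup∘tabulate (λ i → proj₁ (ex i)) i
      v : ValidProfile P
      v i = subst (ValidList i) (sym (Pi i)) (proj₁ (proj₂ (ex i)))
      s : AllSorted P X
      s i = subst (λ l → Sorted l (lookup X i)) (sym (Pi i)) (proj₂ (proj₂ (ex i)))

  c₀-pos : 0 < ∑ uMat (λ X → 𝟙 (distinct? X)) → 0 < c₀ ^ n
  c₀-pos h = go (c₀ ^ n) refl
    where go : ∀ m → c₀ ^ n ≡ m → 0 < c₀ ^ n
          go zero e = ⊥-elim (n≮0 (≤-trans h (≤-trans distinct≤valid (≤-reflexive (trans (cong (validCount n *_) e) (*-zeroʳ (validCount n)))))))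
          go (suc m) e = ≤-trans (s≤s z≤n) (≤-reflexive (sym e))

  all-mats : card uMat ≡ L ^ (n * n)
  all-mats = trans (card-vec uRow n) (trans (cong (_^ n) (trans (card-vec (fin L) n) (cong (_^ n) (card-fin L)))) (^-*-assoc L n n))

  -- Exchanging the entry with a fresh score turns a tie into the event that a free score takes a
  -- given value.
  tie-count : ∀ i j m → j ≢ m → L * ∑ uMat (λ X → 𝟙 (lookup (lookup X i) j ≟F lookup (lookup X i) m)) ≡ card uMat
  tie-count i j m j≢m = begin
    L * ∑ uMat (λ X → 𝟙 (eq X)) ≡⟨ sym (∑-*ˡ uMat L (λ X → 𝟙 (eq X))) ⟩
    ∑ uMat (λ X → L * 𝟙 (eq X)) ≡⟨ ∑-cong uMat (λ X → sym (∑-constF L (𝟙 (eq X)))) ⟩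
    ∑ uMat (λ X → ∑ (fin L) λ a → 𝟙 (eq X)) ≡⟨ ∑-cong uMat (λ X → ∑-cong (fin L) λ a → 𝟙-cong (eq X) (lookup (lookup X i) j ≟F lookup (lookup (put X a) i) m) (λ e → trans e (sym (put-m X a))) (λ e → trans e (put-m X a))) ⟩
    ∑ uMat (λ X → ∑ (fin L) λ a → 𝟙 (lookup (lookup X i) j ≟F lookup (lookup (put X a) i) m)) ≡⟨ ∑-bij (uMat ⊗ fin L) (uMat ⊗ fin L) g g gg gg (λ (X , a) → 𝟙 (a ≟F lookup (lookup X i) m)) ⟩
    ∑ uMat (λ X → ∑ (fin L) λ a → 𝟙 (a ≟F lookup (lookup X i) m)) ≡⟨ ∑-cong uMat (λ X → trans (∑-cong (fin L) λ a → sym (*-identityʳ (𝟙 (a ≟F lookup (lookup X i) m)))) (∑-δ (fin L) (λ _ → 1) (lookup (lookup X i) m))) ⟩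
    card uMat ∎
    where
    open ≡-Reasoning
    eq : ∀ X → Dec (lookup (lookup X i) j ≡ lookup (lookup X i) m)
    eq X = lookup (lookup X i) j ≟F lookup (lookup X i) m
    put : Mat → Fin L → Mat
    put X a = X [ i ]≔ (lookup X i [ j ]≔ a)
    put-i : ∀ X a → lookup (put X a) i ≡ lookup X i [ j ]≔ a
    put-i X a = upd-same X i _
    put-m : ∀ X a → lookup (lookup (put X a) i) m ≡ lookup (lookup X i) m
    put-m X a = trans (cong (λ v → lookup v m) (put-i X a)) (upd-other (lookup X i) j a (j≢m ∘ sym))
    g : Mat × Fin L → Mat × Fin L
    g (X , a) = put X a , lookup (lookup X i) j
    gg : ∀ p → g (g p) ≡ p
    gg (X , a) = cong₂ _,_ (vec-ext _ _ λ b → go b (b ≟F i)) (trans (cong (λ v → lookup v j) (put-i X a)) (upd-same (lookup X i) j a))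
      where
      x = lookup (lookup X i) j
      go : ∀ b → Dec (b ≡ i) → lookup (put (put X a) x) b ≡ lookup X b
      go b (yes refl) = trans (upd-same (put X a) b _) (trans (cong (_[ j ]≔ x) (put-i X a)) (upd-upd (lookup X b) j a))
      go b (no ne) = trans (upd-other (put X a) i _ ne) (upd-other X i _ ne)

  -- Union bound over n³ triples, each giving a tie with probability at most 1/L.
  distinct-many : 2 * (n * (n * n)) ≤ L → L ^ (n * n) ≤ 2 * ∑ uMat (λ X → 𝟙 (distinct? X))
  distinct-many hL = *-cancelˡ-≤ L {{>-nonZero (≤-trans (s≤s z≤n) hL)}} (+-cancelʳ-≤ (L * A) _ _ (begin
    L * A + L * A ≡⟨ lem₀ L A ⟩
    2 * (L * A) ≤⟨ *-monoʳ-≤ 2 (*-monoʳ-≤ L (≤-trans (≤-reflexive (sym all-mats)) (∑-mono uMat pt))) ⟩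
    2 * (L * ∑ uMat (λ X → 𝟙 (distinct? X) + ties X)) ≡⟨ cong (λ x → 2 * (L * x)) (∑-+ uMat (λ X → 𝟙 (distinct? X)) ties) ⟩
    2 * (L * (D + ∑ uMat ties)) ≡⟨ lem₁ L D (∑ uMat ties) ⟩
    L * (2 * D) + 2 * (L * ∑ uMat ties) ≤⟨ +-monoʳ-≤ (L * (2 * D)) (≤-trans (*-monoʳ-≤ 2 tie-sum) (≤-trans (≤-reflexive (sym (*-assoc 2 (n * (n * n)) A))) (*-monoˡ-≤ A hL))) ⟩
    L * (2 * D) + L * A ∎))
    where
    open ≤-Reasoning
    A = L ^ (n * n)
    D = ∑ uMat (λ X → 𝟙 (distinct? X))
    lem₀ : ∀ a b → a * b + a * b ≡ 2 * (a * b)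
    lem₀ = solve-∀
    lem₁ : ∀ l a b → 2 * (l * (a + b)) ≡ l * (2 * a) + 2 * (l * b)
    lem₁ = solve-∀
    tie : Fin n → Fin n → Fin n → Mat → ℕ
    tie i j m X = 𝟙 (¬? (j ≟F m)) * 𝟙 (lookup (lookup X i) j ≟F lookup (lookup X i) m)
    ties : Mat → ℕ
    ties X = ∑ (fin n) λ i → ∑ (fin n) λ j → ∑ (fin n) λ m → tie i j m X
    pt : ∀ X → 1 ≤ 𝟙 (distinct? X) + ties X
    pt X = go (distinct? X)
      where
      go : (d : Dec (Distinct X)) → 1 ≤ 𝟙 d + ties X
      go (yes _) = s≤s z≤n
      go (no ¬d) with FinP.any? (λ i → FinP.any? λ j → FinP.any? λ m → ¬? (j ≟F m) ×-dec (lookup (lookup X i) j ≟F lookup (lookup X i) m))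
      ... | yes (i , j , m , ne , e) = ≤-trans (≤-reflexive (sym (cong₂ _*_ (𝟙-yes (¬? (j ≟F m)) ne) (𝟙-yes (lookup (lookup X i) j ≟F lookup (lookup X i) m) e))))
           (≤-trans (f≤∑ (fin n) (λ m → tie i j m X) m) (≤-trans (f≤∑ (fin n) (λ j → ∑ (fin n) λ m → tie i j m X) j) (f≤∑ (fin n) (λ i → ∑ (fin n) λ j → ∑ (fin n) λ m → tie i j m X) i)))
      ... | no ¬e = ⊥-elim (¬d λ i j m _ _ e → decide i j m e (j ≟F m))
        where decide : ∀ i j m → lookup (lookup X i) j ≡ lookup (lookup X i) m → Dec (j ≡ m) → j ≡ m
              decide i j m e (yes q) = q
              decide i j m e (no ne) = ⊥-elim (¬e (i , j , m , ne , e))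
    one : ∀ i j m → Dec (j ≡ m) → L * ∑ uMat (tie i j m) ≤ A
    one i j m (yes refl) = ≤-trans (≤-reflexive (trans (cong (L *_) (∑-zero uMat λ X → cong (_* 𝟙 (lookup (lookup X i) j ≟F lookup (lookup X i) j)) (𝟙-no (¬? (j ≟F j)) λ ne → ne refl))) (*-zeroʳ L))) z≤n
    one i j m (no ne) = ≤-trans (*-monoʳ-≤ L (∑-mono uMat λ X → ≤-trans (*-monoˡ-≤ (𝟙 (lookup (lookup X i) j ≟F lookup (lookup X i) m)) (𝟙≤1 (¬? (j ≟F m)))) (≤-reflexive (*-identityˡ _))))
      (≤-reflexive (trans (tie-count i j m ne) all-mats))
    tie-sum : L * ∑ uMat ties ≤ n * (n * n) * A
    tie-sum = begin
      L * ∑ uMat ties ≡⟨ cong (L *_) (trans (∑-swap uMat (fin n) (λ X i → ∑ (fin n) λ j → ∑ (fin n) λ m → tie i j m X)) (∑-cong (fin n) λ i → trans (∑-swap uMat (fin n) (λ X j → ∑ (fin n) λ m → tie i j m X)) (∑-cong (fin n) λ j → ∑-swap uMat (fin n) (λ X m → tie i j m X)))) ⟩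
      L * ∑ (fin n) (λ i → ∑ (fin n) λ j → ∑ (fin n) λ m → ∑ uMat (tie i j m)) ≡⟨ trans (sym (∑-*ˡ (fin n) L (λ i → ∑ (fin n) λ j → ∑ (fin n) λ m → ∑ uMat (tie i j m)))) (∑-cong (fin n) λ i → trans (sym (∑-*ˡ (fin n) L (λ j → ∑ (fin n) λ m → ∑ uMat (tie i j m)))) (∑-cong (fin n) λ j → sym (∑-*ˡ (fin n) L (λ m → ∑ uMat (tie i j m))))) ⟩
      ∑ (fin n) (λ i → ∑ (fin n) λ j → ∑ (fin n) λ m → L * ∑ uMat (tie i j m)) ≤⟨ ∑-mono (fin n) (λ i → ∑-mono (fin n) λ j → ∑-mono (fin n) λ m → one i j m (j ≟F m)) ⟩
      ∑ (fin n) (λ i → ∑ (fin n) λ j → ∑ (fin n) λ m → A) ≡⟨ trans (∑-cong (fin n) {λ i → ∑ (fin n) λ j → ∑ (fin n) λ m → A} {λ i → n * (n * A)} λ i → trans (∑-cong (fin n) {λ j → ∑ (fin n) λ m → A} {λ j → n * A} λ j → ∑-constF n A) (∑-constF n (n * A))) (∑-constF n (n * (n * A))) ⟩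
      n * (n * (n * A)) ≡⟨ lem₂ n A ⟩
      n * (n * n) * A ∎
      where lem₂ : ∀ n a → n * (n * (n * a)) ≡ n * (n * n) * a
            lem₂ = solve-∀

-- Double counting over all matchings

module Combine (k L : ℕ) (p : Parameters (suc k) L) where

  open Parameters p
  open Tr k L

  private
    uN : U
    uN = vec (fin n) n

    as-matching : ∀ N → IsMatching N → Matching n
    as-matching N mt = record { M = lookup N ; MM = λ i → proj₁ (mt i) ; M≢ = λ i → proj₂ (mt i) }

    costs : Vec (Fin n) n → Mat → ℕ
    costs N X = go (isMatching? N)
      where go : Dec (IsMatching N) → ℕ
            go (yes mt) = 𝟙 (Planting.strong? p (as-matching N mt) X) * Planting.cost p (as-matching N mt) X
            go (no _) = 0

    Pb : ℕ
    Pb = 4 ^ κc * (4 * L ^ (n * n))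

    costs-sum : ∀ N → dfac n/2 * (G * ∑ uMat (costs N)) ≤ 𝟙 (isMatching? N) * (9 * 2 ^ J * Pb)
    costs-sum N with isMatching? N
    ... | yes mt = ≤-trans (Planting.strong-cost p (as-matching N mt)) (≤-trans (*-monoʳ-≤ (9 * 2 ^ J) (Planting.Pb≤ p (as-matching N mt))) (≤-reflexive (sym (*-identityˡ (9 * 2 ^ J * Pb)))))
    ... | no _ = ≤-reflexive (trans (cong (λ x → dfac n/2 * (G * x)) (∑-zero uMat {λ _ → 0} λ _ → refl)) (trans (cong (dfac n/2 *_) (*-zeroʳ G)) (*-zeroʳ (dfac n/2))))

    stable-cost : ∀ X → Distinct X → 1 ≤ stables X → ∀ N → 𝟙 (stableFor? (sc X) N) * 2 ^ J ≤ stables X * costs N X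
    stable-cost X d s N = 𝟙*≤ (stableFor? (sc X) N) λ st → go st
      where
      go : StableFor (sc X) N → 2 ^ J ≤ stables X * costs N X
      go st with isMatching? N
      ... | no ¬m = ⊥-elim (¬m (proj₁ st))
      ... | yes mt = ≤-trans (Planting.cost-bound p (as-matching N mt) X d strong s) (*-monoʳ-≤ (stables X) (≤-reflexive (sym (trans (cong (_* Planting.cost p (as-matching N mt) X) (𝟙-yes (Planting.strong? p (as-matching N mt) X) strong)) (*-identityˡ (Planting.cost p (as-matching N mt) X))))))
        where strong = Planting.stable-strong p (as-matching N mt) X d (proj₂ st)

    -- Each stable matching of `X` pays at least `2 ^ J` divided by their number; summing over them
    -- removes this unknown number.
    solvable-cost : ∀ X → 𝟙 (solvable? X) * 2 ^ J ≤ ∑ uN (λ N → costs N X)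
    solvable-cost X = 𝟙*≤ (solvable? X) λ (d , N , st) → bound d (≤-trans (≤-reflexive (sym (𝟙-yes (stableFor? (sc X) N) st))) (f≤∑ uN (λ N → 𝟙 (stableFor? (sc X) N)) N))
      where
      bound : Distinct X → 1 ≤ stables X → 2 ^ J ≤ ∑ uN (λ N → costs N X)
      bound d s = *-cancelˡ-≤ (stables X) {{>-nonZero s}} (begin
        stables X * 2 ^ J ≡⟨ sym (∑-*ʳ uN (2 ^ J) (λ N → 𝟙 (stableFor? (sc X) N))) ⟩
        ∑ uN (λ N → 𝟙 (stableFor? (sc X) N) * 2 ^ J) ≤⟨ ∑-mono uN (stable-cost X d s) ⟩
        ∑ uN (λ N → stables X * costs N X) ≡⟨ ∑-*ˡ uN (stables X) (λ N → costs N X) ⟩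
        stables X * ∑ uN (λ N → costs N X) ∎)
        where open ≤-Reasoning

    Solv : ℕ
    Solv = ∑ uMat λ X → 𝟙 (solvable? X)

    total : ℕ
    total = ∑ uN λ N → ∑ uMat (costs N)

    solvable-total : Solv * 2 ^ J ≤ total
    solvable-total = ≤-trans (≤-reflexive (sym (∑-*ʳ uMat (2 ^ J) (λ X → 𝟙 (solvable? X))))) (≤-trans (∑-mono uMat solvable-cost) (≤-reflexive (∑-swap uMat uN (λ X N → costs N X))))

    total≤ : dfac n/2 * (G * total) ≤ dfac n/2 * (9 * 2 ^ J * Pb)
    total≤ = begin
      dfac n/2 * (G * total) ≡⟨ cong (dfac n/2 *_) (sym (∑-*ˡ uN G (λ N → ∑ uMat (costs N)))) ⟩
      dfac n/2 * ∑ uN (λ N → G * ∑ uMat (costs N)) ≡⟨ sym (∑-*ˡ uN (dfac n/2) (λ N → G * ∑ uMat (costs N))) ⟩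
      ∑ uN (λ N → dfac n/2 * (G * ∑ uMat (costs N))) ≤⟨ ∑-mono uN costs-sum ⟩
      ∑ uN (λ N → 𝟙 (isMatching? N) * (9 * 2 ^ J * Pb)) ≡⟨ ∑-*ʳ uN (9 * 2 ^ J * Pb) (λ N → 𝟙 (isMatching? N)) ⟩
      ∑ uN (λ N → 𝟙 (isMatching? N)) * (9 * 2 ^ J * Pb) ≤⟨ *-monoˡ-≤ (9 * 2 ^ J * Pb) (Matchings.matchings≤ n/2 nh) ⟩
      dfac n/2 * (9 * 2 ^ J * Pb) ∎
      where open ≤-Reasoning

    solvable≤ : G * Solv ≤ 9 * Pb
    solvable≤ = *-cancelˡ-≤ (2 ^ J) {{m^n≢0 2 J}} (begin
      2 ^ J * (G * Solv) ≡⟨ lem₁ (2 ^ J) G Solv ⟩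
      G * (Solv * 2 ^ J) ≤⟨ *-monoʳ-≤ G solvable-total ⟩
      G * total ≤⟨ *-cancelˡ-≤ (dfac n/2) {{>-nonZero (dfac>0 n/2)}} total≤ ⟩
      9 * 2 ^ J * Pb ≡⟨ lem₂ (2 ^ J) Pb ⟩
      2 ^ J * (9 * Pb) ∎)
      where
      open ≤-Reasoning
      lem₁ : ∀ a b c → a * (b * c) ≡ b * (c * a)
      lem₁ = solve-∀
      lem₂ : ∀ a b → 9 * a * b ≡ a * (9 * b)
      lem₂ = solve-∀

  private
    stable-fraction′ : G * stableCount n ≤ 72 * 4 ^ κc * validCount n
    stable-fraction′ = *-cancelʳ-≤ (G * stableCount n) (72 * 4 ^ κc * validCount n) (c₀ ^ n) {{>-nonZero (c₀-pos dpos)}} (begin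
      G * stableCount n * c₀ ^ n ≡⟨ *-assoc G (stableCount n) (c₀ ^ n) ⟩
      G * (stableCount n * c₀ ^ n) ≤⟨ *-monoʳ-≤ G stable≤ ⟩
      G * Solv ≤⟨ solvable≤ ⟩
      9 * (4 ^ κc * (4 * L ^ (n * n))) ≤⟨ *-monoʳ-≤ 9 (*-monoʳ-≤ (4 ^ κc) (*-monoʳ-≤ 4 (distinct-many 2n³≤L))) ⟩
      9 * (4 ^ κc * (4 * (2 * Dn))) ≡⟨ lem (4 ^ κc) Dn ⟩
      -- The 72 is 9 from the costs, 4 from `Pb≤` and 2 for the matrices with ties.
      72 * 4 ^ κc * Dn ≤⟨ *-monoʳ-≤ (72 * 4 ^ κc) distinct≤valid ⟩
      72 * 4 ^ κc * (validCount n * c₀ ^ n) ≡⟨ sym (*-assoc (72 * 4 ^ κc) (validCount n) (c₀ ^ n)) ⟩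
      72 * 4 ^ κc * validCount n * c₀ ^ n ∎)
      where
      open ≤-Reasoning
      Dn : ℕ
      Dn = ∑ uMat λ X → 𝟙 (distinct? X)
      lem : ∀ a b → 9 * (a * (4 * (2 * b))) ≡ 72 * a * b
      lem = solve-∀
      dpos : 0 < Dn
      dpos = go Dn refl
        where go : ∀ d → Dn ≡ d → 0 < Dn
              go (suc d) e = ≤-trans (s≤s z≤n) (≤-reflexive (sym e))
              go zero e = ⊥-elim (<⇒≱ (m^n>0 L {{>-nonZero L>0}} (n * n)) (≤-trans (distinct-many 2n³≤L) (≤-reflexive (cong (2 *_) e))))

  stable-fraction : G * stableCount (suc k) ≤ 72 * 4 ^ κc * validCount (suc k)
  stable-fraction = subst (λ a → G * stableCount a ≤ 72 * 4 ^ κc * validCount a) {x = n} {y = suc k} refl stable-fraction′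

-- The choice of parameters

module Harmonic (ℓ : ℕ) where

  -- With D = ℓ! all the weights D/k for k ≤ ℓ are integers.
  wt : ℕ → ℕ
  wt zero = 0
  wt (suc zero) = 0
  wt (suc (suc k)) = ℓ ! / suc (suc k)

  wt-spec : ∀ k → 2 ≤ k → k ≤ ℓ → k * wt k ≡ ℓ !
  wt-spec (suc zero) (s≤s ()) _
  wt-spec (suc (suc k)) _ h = m*[n/m]≡n (∣-trans (m∣m*n (suc k !)) (m≤n⇒m!∣n! h))

  ∑ℕ-split : ∀ a b (f : ℕ → ℕ) → ∑ℕ (a + b) f ≡ ∑ℕ a f + ∑ℕ b (λ k → f (a + k))
  ∑ℕ-split zero b f = refl
  ∑ℕ-split (suc a) b f = trans (cong (f 0 +_) (∑ℕ-split a b (f ∘ suc))) (sym (+-assoc (f 0) _ _))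

  -- Each dyadic block of weights has sum at least D / 2.
  harmonic : ∀ m → 2 ^ m ≤ ℓ → m * ℓ ! ≤ 2 * ∑ℕ (2 ^ m) (λ k → wt (suc k))
  harmonic zero _ = z≤n
  harmonic (suc m) h = begin
    ℓ ! + m * ℓ ! ≤⟨ +-mono-≤ block (harmonic m (≤-trans (m≤m+n x _) h)) ⟩
    2 * B + 2 * A ≡⟨ lem B A ⟩
    2 * (A + B) ≡⟨ cong (2 *_) (trans (sym (∑ℕ-split x x (λ k → wt (suc k)))) (cong (λ y → ∑ℕ (x + y) (λ k → wt (suc k))) (sym (+-identityʳ x)))) ⟩
    2 * ∑ℕ (2 ^ suc m) (λ k → wt (suc k)) ∎
    where
    open ≤-Reasoning
    x = 2 ^ m
    instance
      xn : NonZero x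
      xn = m^n≢0 2 m
    A = ∑ℕ x (λ k → wt (suc k))
    B = ∑ℕ x (λ k → wt (suc (x + k)))
    lem : ∀ a b → 2 * a + 2 * b ≡ 2 * (b + a)
    lem = solve-∀
    lem′ : ∀ x b → 2 * x * b ≡ x * (2 * b)
    lem′ = solve-∀
    each : ∀ t → t < x → ℓ ! ≤ 2 * x * wt (suc (x + t))
    each t h′ = ≤-trans (≤-reflexive (sym (wt-spec (suc (x + t)) (s≤s (≤-trans (m^n>0 2 m) (m≤m+n x t))) (≤-trans le h)))) (*-monoˡ-≤ (wt (suc (x + t))) le)
      where le : suc (x + t) ≤ 2 * x
            le = ≤-trans (≤-reflexive (sym (+-suc x t))) (+-monoʳ-≤ x (≤-trans h′ (m≤m+n x 0)))
    block : ℓ ! ≤ 2 * B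
    block = *-cancelˡ-≤ x (begin
      x * ℓ ! ≡⟨ sym (∑-constF x (ℓ !)) ⟩
      ∑ℕ x (λ _ → ℓ !) ≤⟨ ∑ℕ-mono x each ⟩
      ∑ℕ x (λ t → 2 * x * wt (suc (x + t))) ≡⟨ ∑-*ˡ (fin x) (2 * x) (λ t → wt (suc (x + toℕ t))) ⟩
      2 * x * B ≡⟨ lem′ x B ⟩
      x * (2 * B) ∎)

-- Induction with (1 + 1/n)^n ≤ 4.
n^n≤4^n*n! : ∀ n → n ^ n ≤ 4 ^ n * n !
n^n≤4^n*n! zero = ≤-refl
n^n≤4^n*n! (suc n) = begin
  suc n * suc n ^ n ≤⟨ *-monoʳ-≤ (suc n) (≤-trans (pow-suc n n ≤-refl) (*-monoʳ-≤ 4 (n^n≤4^n*n! n))) ⟩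
  suc n * (4 * (4 ^ n * n !)) ≡⟨ lem (suc n) (4 ^ n) (n !) ⟩
  4 * 4 ^ n * (suc n * n !) ∎
  where
  open ≤-Reasoning
  lem : ∀ a b c → a * (4 * (b * c)) ≡ 4 * b * (a * c)
  lem = solve-∀

double-factorial : ∀ h → (h + h) ! ≡ dfac h * (2 ^ h * h !)
double-factorial zero = refl
double-factorial (suc h) = trans (cong (λ x → suc x * x !) (+-suc h h)) (trans (cong (λ x → suc (suc (h + h)) * (suc (h + h) * x)) (double-factorial h)) (lem h (suc (h + h)) (dfac h) (2 ^ h) (h !)))
  where lem : ∀ h s d t f → suc (suc (h + h)) * (s * (d * (t * f))) ≡ s * d * (2 * t * (suc h * f))
        lem = solve-∀

-- With σ = xL the powers of `L` cancel. As n! is (2h - 1)!! 2^h h! and h! is at least (h/4)^h,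
-- there remains 4x² against `n`, both to the power `h`.
small-factorial : ∀ {h n m} → n ≡ h + h → n ≡ suc m → ∀ G x L → G * suc n * n * (4 * (x * x)) ^ h ≤ n ^ h →
  G * suc n * (dfac h * (x * L) ^ n) ≤ m ! * (L * L) ^ h
small-factorial {h} {n} {m} nh nm G x L hyp = *-cancelˡ-≤ (n * 4 ^ h) {{>-nonZero (*-mono-< {0} {n} {0} n>0 (m^n>0 4 h))}} (begin
  n * 4 ^ h * (G * suc n * (dfac h * (x * L) ^ n)) ≡⟨ cong (λ y → n * 4 ^ h * (G * suc n * (dfac h * y))) (trans (^-distrib-* x L n) (cong₂ _*_ (sq x) (sq L))) ⟩
  n * 4 ^ h * (G * suc n * (dfac h * ((x * x) ^ h * (L * L) ^ h))) ≡⟨ lem₁ n (4 ^ h) (G * suc n) (dfac h) ((x * x) ^ h) ((L * L) ^ h) ⟩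
  G * suc n * n * (4 ^ h * (x * x) ^ h) * (dfac h * (L * L) ^ h) ≡⟨ cong (λ y → G * suc n * n * y * (dfac h * (L * L) ^ h)) (sym (^-distrib-* 4 (x * x) h)) ⟩
  G * suc n * n * (4 * (x * x)) ^ h * (dfac h * (L * L) ^ h) ≤⟨ *-monoˡ-≤ (dfac h * (L * L) ^ h) (≤-trans hyp nn) ⟩
  2 ^ h * (4 ^ h * h !) * (dfac h * (L * L) ^ h) ≡⟨ lem₂ (2 ^ h) (4 ^ h) (h !) (dfac h) ((L * L) ^ h) ⟩
  4 ^ h * (dfac h * (2 ^ h * h !)) * (L * L) ^ h ≡⟨ cong (λ y → 4 ^ h * y * (L * L) ^ h) (trans (sym (double-factorial h)) (trans (cong _! (trans (sym nh) nm)) (cong (_* m !) (sym nm)))) ⟩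
  4 ^ h * (n * m !) * (L * L) ^ h ≡⟨ lem₃ (4 ^ h) n (m !) ((L * L) ^ h) ⟩
  n * 4 ^ h * (m ! * (L * L) ^ h) ∎)
  where
  open ≤-Reasoning
  n>0 : 0 < n
  n>0 = ≤-trans (s≤s z≤n) (≤-reflexive (sym nm))
  sq : ∀ y → y ^ n ≡ (y * y) ^ h
  sq y = trans (cong (y ^_) nh) (trans (^-distribˡ-+-* y h h) (sym (^-distrib-* y y h)))
  nn : n ^ h ≤ 2 ^ h * (4 ^ h * h !)
  nn = ≤-trans (≤-reflexive (trans (cong (_^ h) (trans nh (cong (h +_) (sym (+-identityʳ h))))) (^-distrib-* 2 h h))) (*-monoʳ-≤ (2 ^ h) (n^n≤4^n*n! h))
  lem₁ : ∀ n f G d x l → n * f * (G * (d * (x * l))) ≡ G * n * (f * x) * (d * l)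
  lem₁ = solve-∀
  lem₂ : ∀ a b c d e → a * (b * c) * (d * e) ≡ b * (d * (a * c)) * e
  lem₂ = solve-∀
  lem₃ : ∀ a b c d → a * (b * c) * d ≡ b * a * (c * d)
  lem₃ = solve-∀

n≤2^n : ∀ n → n ≤ 2 ^ n
n≤2^n zero = z≤n
n≤2^n (suc n) = ≤-trans (+-mono-≤ (m^n>0 2 n) (n≤2^n n)) (+-monoʳ-≤ (2 ^ n) (m≤m+n (2 ^ n) 0))

harmonic-scale : ∀ a c₂ d x f c₁ e S → e * x ≤ 2 * S → 2 * a * c₂ * d ≤ f * c₁ * e → a * c₂ * (d * x) ≤ f * c₁ * S
harmonic-scale a c₂ d x f c₁ e S h h′ = *-cancelˡ-≤ 2 (begin
  2 * (a * c₂ * (d * x)) ≡⟨ lem₁ a c₂ d x ⟩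
  2 * a * c₂ * d * x ≤⟨ *-monoˡ-≤ x h′ ⟩
  f * c₁ * e * x ≡⟨ *-assoc (f * c₁) e x ⟩
  f * c₁ * (e * x) ≤⟨ *-monoʳ-≤ (f * c₁) h ⟩
  f * c₁ * (2 * S) ≡⟨ lem₂ (f * c₁) S ⟩
  2 * (f * c₁ * S) ∎)
  where
  open ≤-Reasoning
  lem₁ : ∀ a c d x → 2 * (a * c * (d * x)) ≡ 2 * a * c * d * x
  lem₁ = solve-∀
  lem₂ : ∀ a b → a * (2 * b) ≡ 2 * (a * b)
  lem₂ = solve-∀

-- p i stands for g ^ i.
module Build (g r w n h m c c₁ c₂ jj J R₁ : ℕ) (p : ℕ → ℕ)
  (p+ : ∀ i j → p i * p j ≡ p (i + j)) (p0 : p 0 ≡ 1) (p1 : p 1 ≡ g) (p≤ : ∀ {i j} → i ≤ j → p i ≤ p j)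
  (p^ : ∀ i j → p i ^ j ≡ p (i * j)) (p2 : ∀ i → p i ≡ 2 ^ (r * (5 * i)))
  (r≥4 : 4 ≤ r) (w≥ : 1000 ≤ w) (ww : w * w ≤ g)
  (nh : n ≡ h + h) (nm : n ≡ suc m) (n≥ : p 80 ≤ n) (n≤ : n ≤ w * p 80)
  (c≡ : c ≡ 81) (c₁≡ : c₁ ≡ 49 * 49) (c₂≡ : c₂ ≡ 50 * 50) (gj : g ≡ 4 * jj) (Jr : suc J ≡ 28 * r)
  (RR : 2 * (n * (n * n)) ≡ suc R₁) where

  -- `Q` serves as `R`. A typical total rank is about √n L with n about g^80, so `σ` lies below it
  -- by a factor of about g. On average at least about σR/L² = g persons of rank at most `R` accept
  -- a given person, so failing is exponentially rare in g. Short cycles contain about nℓR/σ ≤ g^30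
  -- persons, well below g^35.
  Q L σ ℓ : ℕ
  Q = 2 * (n * (n * n))
  L = p 38 * Q
  σ = p 39 * L
  ℓ = p 26

  -- Monomials in g as lists of exponents: comparing two of them becomes comparing two numerals.
  Ps : List ℕ → ℕ
  Ps = foldr (λ i a → p i * a) 1

  Ps-sum : ∀ xs → Ps xs ≡ p (sum xs)
  Ps-sum [] = sym p0
  Ps-sum (x ∷ xs) = trans (cong (p x *_) (Ps-sum xs)) (p+ x (sum xs))

  Ps-mono : ∀ xs ys → sum xs ≤ sum ys → Ps xs ≤ Ps ys
  Ps-mono xs ys le = ≤-trans (≤-reflexive (Ps-sum xs)) (≤-trans (p≤ le) (≤-reflexive (sym (Ps-sum ys))))

  w≤g : w ≤ g
  w≤g = ≤-trans (≤-trans (≤-reflexive (sym (*-identityʳ w))) (*-monoʳ-≤ w (≤-trans (s≤s z≤n) w≥))) ww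

  lit : ∀ a → a ≤ 1000 → a ≤ p 1
  lit a h = ≤-trans h (≤-trans w≥ (≤-trans w≤g (≤-reflexive (sym p1))))

  p>0 : ∀ i → 0 < p i
  p>0 i = ≤-trans (≤-reflexive (sym p0)) (p≤ z≤n)

  n≤p81 : n ≤ p 81
  n≤p81 = ≤-trans n≤ (≤-trans (*-monoˡ-≤ (p 80) w≤g) (≤-reflexive (trans (cong (_* p 80) (sym p1)) (p+ 1 80))))

  3n≤p81 : 3 * n ≤ p 81
  3n≤p81 = ≤-trans (*-monoʳ-≤ 3 n≤) (≤-trans (≤-reflexive (sym (*-assoc 3 w (p 80)))) (≤-trans (*-monoˡ-≤ (p 80) (≤-trans (*-monoˡ-≤ w (≤-trans (≤ᵇ⇒≤ 3 1000 tt) w≥)) ww)) (≤-reflexive (trans (cong (_* p 80) (sym p1)) (p+ 1 80)))))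

  g≤n : p 1 ≤ n
  g≤n = ≤-trans (p≤ (≤ᵇ⇒≤ 1 80 tt)) n≥

  1000≤n : 1000 ≤ n
  1000≤n = ≤-trans (lit 1000 ≤-refl) g≤n

  n>0 : 0 < n
  n>0 = ≤-trans (s≤s z≤n) 1000≤n

  n≤nn : n ≤ n * n
  n≤nn = ≤-trans (≤-reflexive (sym (*-identityʳ n))) (*-monoʳ-≤ n n>0)

  nnn≤L : 2 * (n * (n * n)) ≤ L
  nnn≤L = ≤-trans (≤-reflexive (sym (*-identityˡ Q))) (*-monoˡ-≤ Q (p>0 38))

  nn≤L : n * n ≤ L
  nn≤L = ≤-trans (≤-trans (≤-reflexive (sym (*-identityˡ (n * n)))) (≤-trans (*-monoˡ-≤ (n * n) n>0) (m≤m+n (n * (n * n)) _))) nnn≤L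

  n≤L : n ≤ L
  n≤L = ≤-trans n≤nn nn≤L

  L>0 : 0 < L
  L>0 = ≤-trans n>0 n≤L

  instance
    L≢0 : NonZero L
    L≢0 = >-nonZero L>0

  LL>0 : 0 < L * L
  LL>0 = *-mono-< {0} {L} {0} {L} L>0 L>0

  Q≥ : ∀ a → a ≤ 1000 → a ≤ Q
  Q≥ a h = ≤-trans (≤-trans h 1000≤n) (≤-trans n≤nn (≤-trans (≤-trans (≤-reflexive (sym (*-identityˡ (n * n)))) (*-monoˡ-≤ (n * n) n>0)) (m≤m+n (n * (n * n)) _)))

  N₁ : ℕ
  N₁ = pred (L * L)

  LN : suc N₁ ≡ L * L
  LN = suc-pred (L * L) {{>-nonZero LL>0}}

  NH : suc N₁ ≡ p 38 * (n * (n * n)) * L + p 38 * (n * (n * n)) * L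
  NH = trans LN (lem (p 38) (n * (n * n)) L)
    where lem : ∀ a q l → a * (2 * q) * l ≡ a * q * l + a * q * l
          lem = solve-∀

  RL : 100 * (Q * Q) ≤ L * L
  RL = ≤-trans (*-monoˡ-≤ (Q * Q) (lit 100 (≤ᵇ⇒≤ 100 1000 tt))) (≤-trans (*-monoˡ-≤ (Q * Q) (≤-trans (≤-reflexive (sym (*-identityʳ (p 1)))) (Ps-mono (1 ∷ []) (38 ∷ 38 ∷ []) (≤ᵇ⇒≤ 1 76 tt)))) (≤-reflexive (lem (p 38) Q)))
    where lem : ∀ a q → a * (a * 1) * (q * q) ≡ a * q * (a * q)
          lem = solve-∀

  σQ : σ ≡ Ps (39 ∷ 38 ∷ []) * Q
  σQ = lem (p 39) (p 38) Q
    where lem : ∀ a b q → a * (b * q) ≡ a * (b * 1) * q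
          lem = solve-∀

  8Rσ : 8 * Q ≤ σ
  8Rσ = ≤-trans (*-monoˡ-≤ Q (≤-trans (lit 8 (≤ᵇ⇒≤ 8 1000 tt)) (≤-trans (≤-reflexive (sym (*-identityʳ (p 1)))) (Ps-mono (1 ∷ []) (39 ∷ 38 ∷ []) (≤ᵇ⇒≤ 1 77 tt))))) (≤-reflexive (sym σQ))

  σ>0 : 0 < σ
  σ>0 = ≤-trans L>0 (≤-trans (≤-reflexive (sym (*-identityˡ L))) (*-monoˡ-≤ L (p>0 39)))

  g₁ : p 5 * (128 * Q) ≤ σ
  g₁ = begin
    p 5 * (128 * Q) ≤⟨ *-monoʳ-≤ (p 5) (*-monoˡ-≤ Q (lit 128 (≤ᵇ⇒≤ 128 1000 tt))) ⟩
    p 5 * (p 1 * Q) ≡⟨ lem (p 5) (p 1) Q ⟩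
    Ps (5 ∷ 1 ∷ []) * Q ≤⟨ *-monoˡ-≤ Q (Ps-mono (5 ∷ 1 ∷ []) (39 ∷ 38 ∷ []) (≤ᵇ⇒≤ 6 77 tt)) ⟩
    Ps (39 ∷ 38 ∷ []) * Q ≡⟨ sym σQ ⟩
    σ ∎
    where
    open ≤-Reasoning
    lem : ∀ a b q → a * (b * q) ≡ a * (b * 1) * q
    lem = solve-∀

  g₂ : p 5 * (786 * (n * (ℓ * ℓ)) * (Q * Q)) ≤ σ * σ
  g₂ = begin
    p 5 * (786 * (n * (ℓ * ℓ)) * (Q * Q)) ≤⟨ *-monoʳ-≤ (p 5) (*-monoˡ-≤ (Q * Q) (*-mono-≤ (lit 786 (≤ᵇ⇒≤ 786 1000 tt)) (*-monoˡ-≤ (ℓ * ℓ) n≤p81))) ⟩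
    p 5 * (p 1 * (p 81 * (p 26 * p 26)) * (Q * Q)) ≡⟨ lem (p 5) (p 1) (p 81) (p 26) Q ⟩
    Ps (5 ∷ 1 ∷ 81 ∷ 26 ∷ 26 ∷ []) * (Q * Q) ≤⟨ *-monoˡ-≤ (Q * Q) (Ps-mono (5 ∷ 1 ∷ 81 ∷ 26 ∷ 26 ∷ []) (39 ∷ 38 ∷ 39 ∷ 38 ∷ []) (≤ᵇ⇒≤ 139 154 tt)) ⟩
    Ps (39 ∷ 38 ∷ 39 ∷ 38 ∷ []) * (Q * Q) ≡⟨ lem′ (p 39) (p 38) Q ⟩
    σ * σ ∎
    where
    open ≤-Reasoning
    lem : ∀ a b c d q → a * (b * (c * (d * d)) * (q * q)) ≡ a * (b * (c * (d * (d * 1)))) * (q * q)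
    lem = solve-∀
    lem′ : ∀ a b q → a * (b * (a * (b * 1))) * (q * q) ≡ a * (b * q) * (a * (b * q))
    lem′ = solve-∀

  -- Markov's inequality for the persons on short cycles. The exponents are tight: 5 + 81 + 26 = 39
  -- + 38 + 35.
  g₃ : p 5 * (3 * Q * (n * ℓ)) ≤ σ * suc (p 35)
  g₃ = begin
    p 5 * (3 * Q * (n * ℓ)) ≡⟨ lem₀ (p 5) Q n ℓ ⟩
    p 5 * ((3 * n) * (ℓ * 1)) * Q ≤⟨ *-monoˡ-≤ Q (*-monoʳ-≤ (p 5) (*-monoˡ-≤ (ℓ * 1) 3n≤p81)) ⟩
    Ps (5 ∷ 81 ∷ 26 ∷ []) * Q ≤⟨ *-monoˡ-≤ Q (Ps-mono (5 ∷ 81 ∷ 26 ∷ []) (39 ∷ 38 ∷ 35 ∷ []) (≤ᵇ⇒≤ 112 112 tt)) ⟩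
    Ps (39 ∷ 38 ∷ 35 ∷ []) * Q ≡⟨ lem (p 39) (p 38) (p 35) Q ⟩
    σ * p 35 ≤⟨ *-monoʳ-≤ σ (n≤1+n (p 35)) ⟩
    σ * suc (p 35) ∎
    where
    open ≤-Reasoning
    lem₀ : ∀ a q n l → a * (3 * q * (n * l)) ≡ a * (3 * n * (l * 1)) * q
    lem₀ = solve-∀
    lem : ∀ a b c q → a * (b * (c * 1)) * q ≡ a * (b * q) * c
    lem = solve-∀

  -- Tight as well: 5 + 1 + 35 + 35 = 38 + 38. This limits `K` to g^35 and, through `g₃`, `ℓ` to
  -- g^26.
  g₄ : p 5 * (50 * (Q * Q) * (p 35 * p 35)) ≤ 49 * (L * L)
  g₄ = begin
    p 5 * (50 * (Q * Q) * (p 35 * p 35)) ≤⟨ *-monoʳ-≤ (p 5) (*-monoˡ-≤ (p 35 * p 35) (*-monoˡ-≤ (Q * Q) (lit 50 (≤ᵇ⇒≤ 50 1000 tt)))) ⟩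
    p 5 * (p 1 * (Q * Q) * (p 35 * p 35)) ≡⟨ lem (p 5) (p 1) (p 35) (Q * Q) ⟩
    Ps (5 ∷ 1 ∷ 35 ∷ 35 ∷ []) * (Q * Q) ≤⟨ *-monoˡ-≤ (Q * Q) (Ps-mono (5 ∷ 1 ∷ 35 ∷ 35 ∷ []) (38 ∷ 38 ∷ []) (≤ᵇ⇒≤ 76 76 tt)) ⟩
    Ps (38 ∷ 38 ∷ []) * (Q * Q) ≡⟨ lem′ (p 38) Q ⟩
    L * L ≤⟨ m≤m+n (L * L) _ ⟩
    49 * (L * L) ∎
    where
    open ≤-Reasoning
    lem : ∀ a b c q → a * (b * q * (c * c)) ≡ a * (b * (c * (c * 1))) * q
    lem = solve-∀
    lem′ : ∀ a q → a * (a * 1) * (q * q) ≡ a * q * (a * q)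
    lem′ = solve-∀

  evc : ℕ
  evc = (ℓ + ℓ) * (ℓ + ℓ) + (suc ℓ + (ℓ + (suc ℓ + ℓ)))

  evc≤ : 128 + 30 * evc ≤ p 1 * (ℓ * ℓ)
  evc≤ = begin
    128 + 30 * evc ≡⟨ lem ℓ ⟩
    120 * (ℓ * ℓ) + (120 * ℓ + 188) ≤⟨ +-monoʳ-≤ (120 * (ℓ * ℓ)) (+-mono-≤ (*-monoʳ-≤ 120 ℓ≤) (≤-trans (≤-reflexive (sym (*-identityʳ 188))) (*-monoʳ-≤ 188 (≤-trans (p>0 26) ℓ≤)))) ⟩
    120 * (ℓ * ℓ) + (120 * (ℓ * ℓ) + 188 * (ℓ * ℓ)) ≡⟨ lem′ (ℓ * ℓ) ⟩
    428 * (ℓ * ℓ) ≤⟨ *-monoˡ-≤ (ℓ * ℓ) (lit 428 (≤ᵇ⇒≤ 428 1000 tt)) ⟩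
    p 1 * (ℓ * ℓ) ∎
    where
    open ≤-Reasoning
    ℓ≤ : ℓ ≤ ℓ * ℓ
    ℓ≤ = ≤-trans (≤-reflexive (sym (*-identityʳ ℓ))) (*-monoʳ-≤ ℓ (p>0 26))
    lem : ∀ l → 128 + 30 * ((l + l) * (l + l) + (suc l + (l + (suc l + l)))) ≡ 120 * (l * l) + (120 * l + 188)
    lem = solve-∀
    lem′ : ∀ x → 120 * x + (120 * x + 188 * x) ≡ 428 * x
    lem′ = solve-∀

  r≤p1 : r ≤ p 1
  r≤p1 = ≤-trans (n≤2^n r) (≤-trans (^-monoʳ-≤ 2 (≤-trans (≤-reflexive (sym (*-identityʳ r))) (*-monoʳ-≤ r (s≤s z≤n)))) (≤-reflexive (sym (p2 1))))

  J≤ : suc J ≤ p 1 * p 1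
  J≤ = ≤-trans (≤-reflexive Jr) (*-mono-≤ (lit 28 (≤ᵇ⇒≤ 28 1000 tt)) r≤p1)

  g₅ : p 5 * (suc J * ((128 + 30 * evc) * Q)) ≤ σ
  g₅ = begin
    p 5 * (suc J * ((128 + 30 * evc) * Q)) ≤⟨ *-monoʳ-≤ (p 5) (*-mono-≤ J≤ (*-monoˡ-≤ Q evc≤)) ⟩
    p 5 * (p 1 * p 1 * (p 1 * (p 26 * p 26) * Q)) ≡⟨ lem (p 5) (p 1) (p 26) Q ⟩
    Ps (5 ∷ 1 ∷ 1 ∷ 1 ∷ 26 ∷ 26 ∷ []) * Q ≤⟨ *-monoˡ-≤ Q (Ps-mono (5 ∷ 1 ∷ 1 ∷ 1 ∷ 26 ∷ 26 ∷ []) (39 ∷ 38 ∷ []) (≤ᵇ⇒≤ 60 77 tt)) ⟩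
    Ps (39 ∷ 38 ∷ []) * Q ≡⟨ sym σQ ⟩
    σ ∎
    where
    open ≤-Reasoning
    lem : ∀ a b c q → a * (b * b * (b * (c * c) * q)) ≡ a * (b * (b * (b * (c * (c * 1))))) * q
    lem = solve-∀

  -- 81 = 40 + 1 + 40: the 40 of `O-bound`, then 32n ≤ L² and 40nL ≤ 40L².
  c-large : n * (suc N₁ + 32) + 40 * (suc N₁ + n * L) ≤ (n + c) * suc N₁
  c-large = subst₂ (λ N c → n * (N + 32) + 40 * (N + n * L) ≤ (n + c) * N) (sym LN) (sym c≡) (begin
    n * (L * L + 32) + 40 * (L * L + n * L) ≡⟨ lem n L (L * L) ⟩
    n * (L * L) + 40 * (L * L) + (32 * n + 40 * (n * L)) ≤⟨ +-monoʳ-≤ (n * (L * L) + 40 * (L * L)) (+-mono-≤ (≤-trans (*-monoˡ-≤ n (≤-trans (≤ᵇ⇒≤ 32 1000 tt) 1000≤n)) (≤-trans nn≤L (≤-trans (≤-reflexive (sym (*-identityʳ L))) (*-monoʳ-≤ L L>0)))) (*-monoʳ-≤ 40 (*-monoˡ-≤ L n≤L))) ⟩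
    n * (L * L) + 40 * (L * L) + (L * L + 40 * (L * L)) ≡⟨ lem′ n (L * L) ⟩
    (n + 81) * (L * L) ∎)
    where
    open ≤-Reasoning
    lem : ∀ n l x → n * (x + 32) + 40 * (x + n * l) ≡ n * x + 40 * x + (32 * n + 40 * (n * l))
    lem = solve-∀
    lem′ : ∀ n x → n * x + 40 * x + (x + 40 * x) ≡ (n + 81) * x
    lem′ = solve-∀

  R≤L : Q ≤ L
  R≤L = nnn≤L

  -- A unit of `jj` costs L² = g^38 QL, whereas `R₁ * σ` is about g^39 QL. About g units fit, and
  -- `jj` is g/4.
  jN : jj * suc N₁ + R₁ * (L + L) ≤ R₁ * σ
  jN = *-cancelˡ-≤ 4 (begin
    4 * (jj * suc N₁ + R₁ * (L + L)) ≡⟨ cong (λ x → 4 * (jj * x + R₁ * (L + L))) LN ⟩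
    4 * (jj * (p 38 * Q * L) + R₁ * (L + L)) ≡⟨ lem jj (p 38) Q L R₁ ⟩
    (4 * jj * p 38 * Q + 8 * R₁) * L ≤⟨ *-monoˡ-≤ L (+-mono-≤ (*-mono-≤ (≤-reflexive (trans (cong (_* p 38) (trans (sym gj) (sym p1))) (p+ 1 38))) Q≤2R) (*-monoˡ-≤ R₁ (≤-trans (lit 8 (≤ᵇ⇒≤ 8 1000 tt)) (p≤ (≤ᵇ⇒≤ 1 39 tt))))) ⟩
    (p 39 * (2 * R₁) + p 39 * R₁) * L ≤⟨ m≤m+n _ (p 39 * R₁ * L) ⟩
    (p 39 * (2 * R₁) + p 39 * R₁) * L + p 39 * R₁ * L ≡⟨ lem′ (p 39) R₁ L ⟩
    4 * (R₁ * σ) ∎)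
    where
    open ≤-Reasoning
    lem : ∀ j p q l r → 4 * (j * (p * q * l) + r * (l + l)) ≡ (4 * j * p * q + 8 * r) * l
    lem = solve-∀
    lem′ : ∀ p r l → (p * (2 * r) + p * r) * l + p * r * l ≡ 4 * (r * (p * l))
    lem′ = solve-∀
    Q≤2R : Q ≤ 2 * R₁
    Q≤2R = ≤-trans (≤-reflexive RR) (+-mono-≤ (ℕ.s≤s⁻¹ (≤-trans (Q≥ 2 (≤ᵇ⇒≤ 2 1000 tt)) (≤-reflexive RR))) (m≤m+n R₁ 0))

  -- A fixed power of g against an exponential of g/4.
  jj-large : p 5 * (n * L) ≤ 2 ^ jj
  jj-large = begin
    p 5 * (n * (p 38 * (2 * (n * (n * n))))) ≤⟨ *-monoʳ-≤ (p 5) (*-mono-≤ n≤p81 (*-monoʳ-≤ (p 38) (*-mono-≤ (lit 2 (≤ᵇ⇒≤ 2 1000 tt)) (*-mono-≤ n≤p81 (*-mono-≤ n≤p81 n≤p81))))) ⟩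
    p 5 * (p 81 * (p 38 * (p 1 * (p 81 * (p 81 * p 81))))) ≡⟨ cong (λ x → p 5 * (p 81 * (p 38 * (p 1 * (p 81 * (p 81 * x)))))) (sym (*-identityʳ (p 81))) ⟩
    Ps (5 ∷ 81 ∷ 38 ∷ 1 ∷ 81 ∷ 81 ∷ 81 ∷ []) ≡⟨ Ps-sum (5 ∷ 81 ∷ 38 ∷ 1 ∷ 81 ∷ 81 ∷ 81 ∷ []) ⟩
    p 368 ≡⟨ p2 368 ⟩
    2 ^ (r * 1840) ≤⟨ ^-monoʳ-≤ 2 exponent′ ⟩
    2 ^ jj ∎
    where
    open ≤-Reasoning
    exponent′ : r * 1840 ≤ jj
    exponent : 4 * (r * 1840) ≤ 4 * jj
    exponent = begin
      4 * (r * 1840) ≡⟨ lem 4 r 1840 ⟩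
      r * 7360 ≤⟨ *-mono-≤ (n≤2^n r) (≤-trans (≤ᵇ⇒≤ 7360 (2 ^ (4 * 4)) tt) (^-monoʳ-≤ 2 (*-monoˡ-≤ 4 r≥4))) ⟩
      2 ^ r * 2 ^ (r * 4) ≡⟨ sym (^-distribˡ-+-* 2 r (r * 4)) ⟩
      2 ^ (r + r * 4) ≡⟨ cong (2 ^_) (sym (*-suc r 4)) ⟩
      2 ^ (r * 5) ≡⟨ sym (p2 1) ⟩
      p 1 ≡⟨ trans p1 gj ⟩
      4 * jj ∎
      where lem : ∀ a b c → a * (b * c) ≡ b * (a * c)
            lem = solve-∀
    exponent′ = *-cancelˡ-≤ 4 exponent

  -- 28 = 25 + 3: g^5 is 2^(25r), and 2^(3r) pays for the factor 56r.
  J-large : p 5 * suc J ≤ 2 ^ J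
  J-large = *-cancelˡ-≤ 2 (begin
    2 * (p 5 * suc J) ≡⟨ cong₂ (λ x y → 2 * (x * y)) (p2 5) Jr ⟩
    2 * (2 ^ (r * 25) * (28 * r)) ≡⟨ lem 2 (2 ^ (r * 25)) 28 r ⟩
    2 ^ (r * 25) * (56 * r) ≤⟨ *-monoʳ-≤ (2 ^ (r * 25)) (*-mono-≤ (≤-trans (≤ᵇ⇒≤ 56 (2 ^ (4 * 2)) tt) (^-monoʳ-≤ 2 (*-monoˡ-≤ 2 r≥4))) (n≤2^n r)) ⟩
    2 ^ (r * 25) * (2 ^ (r * 2) * 2 ^ r) ≡⟨ cong (2 ^ (r * 25) *_) (sym (^-distribˡ-+-* 2 (r * 2) r)) ⟩
    2 ^ (r * 25) * 2 ^ (r * 2 + r) ≡⟨ sym (^-distribˡ-+-* 2 (r * 25) (r * 2 + r)) ⟩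
    2 ^ (r * 25 + (r * 2 + r)) ≡⟨ cong (2 ^_) (trans (lem′ r) (sym Jr)) ⟩
    2 ^ suc J ∎)
    where
    open ≤-Reasoning
    lem : ∀ a b c d → a * (b * (c * d)) ≡ b * (a * c * d)
    lem = solve-∀
    lem′ : ∀ r → r * 25 + (r * 2 + r) ≡ 28 * r
    lem′ = solve-∀

  -- 4 (g^39)² is at most g^79 while `n` is at least g^80; the surplus g^h beats the polynomial
  -- factor g^168.
  σ-small : p 5 * suc n * (dfac h * σ ^ n) ≤ m ! * suc N₁ ^ h
  σ-small = ≤-trans (small-factorial {h} {n} {m} nh nm (p 5) (p 39) L (begin
    p 5 * suc n * n * (4 * (p 39 * p 39)) ^ h ≤⟨ *-mono-≤ (*-mono-≤ (*-monoʳ-≤ (p 5) sn) n≤p81) (^-monoˡ-≤ h (≤-trans (*-mono-≤ (lit 4 (≤ᵇ⇒≤ 4 1000 tt)) (≤-reflexive (p+ 39 39))) (≤-reflexive (p+ 1 78)))) ⟩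
    p 5 * (p 1 * p 81) * p 81 * p 79 ^ h ≡⟨ cong (_* p 79 ^ h) (lem (p 5) (p 1) (p 81)) ⟩
    Ps (5 ∷ 1 ∷ 81 ∷ 81 ∷ []) * p 79 ^ h ≡⟨ cong₂ _*_ (Ps-sum (5 ∷ 1 ∷ 81 ∷ 81 ∷ [])) (p^ 79 h) ⟩
    p 168 * p (79 * h) ≤⟨ *-monoˡ-≤ (p (79 * h)) (p≤ h≥) ⟩
    p h * p (79 * h) ≡⟨ p+ h (79 * h) ⟩
    p (80 * h) ≡⟨ sym (p^ 80 h) ⟩
    p 80 ^ h ≤⟨ ^-monoˡ-≤ h n≥ ⟩
    n ^ h ∎)) (≤-reflexive (cong (λ x → m ! * x ^ h) (sym LN)))
    where
    open ≤-Reasoning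
    lem : ∀ a b c → a * (b * c) * c ≡ a * (b * (c * (c * 1)))
    lem = solve-∀
    sn : suc n ≤ p 1 * p 81
    sn = ≤-trans (≤-trans (+-mono-≤ n>0 (m≤m+n n 0)) (≤-reflexive refl)) (*-mono-≤ (lit 2 (≤ᵇ⇒≤ 2 1000 tt)) n≤p81)
    h≥ : 168 ≤ h
    h≥ = *-cancelˡ-≤ 2 (≤-trans (≤-trans (≤ᵇ⇒≤ (2 * 168) 1000 tt) 1000≤n) (≤-reflexive (trans nh (cong (h +_) (sym (+-identityʳ h))))))

  open Harmonic ℓ

  harmonic-large : 20 * c₂ * (suc J * ℓ !) ≤ 9 * c₁ * ∑ℕ ℓ (λ k → wt (suc k))
  harmonic-large = ≤-trans (≤-reflexive (cong (20 * c₂ *_) (trans (cong (_* ℓ !) Jr) (*-assoc 28 r (ℓ !)))))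
    (harmonic-scale 20 c₂ 28 (r * ℓ !) 9 c₁ 130 (∑ℕ ℓ (λ k → wt (suc k)))
      (≤-trans (≤-reflexive (lem 130 r (ℓ !))) (subst (λ x → r * 130 * ℓ ! ≤ 2 * ∑ℕ x (λ k → wt (suc k))) (sym (p2 26)) (harmonic (r * 130) (≤-reflexive (sym (p2 26))))))
      -- 2800000 ≤ 2809170. As ℓ is 2^(130r) and a dyadic block gives half of `D`, there is room for
      -- 28r cycles but not for 29r.
      (subst₂ (λ c₁ c₂ → 2 * 20 * c₂ * 28 ≤ 9 * c₁ * 130) (sym c₁≡) (sym c₂≡) (≤ᵇ⇒≤ (2 * 20 * (50 * 50) * 28) (9 * (49 * 49) * 130) tt)))
    where lem : ∀ a b c → a * (b * c) ≡ b * a * c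
          lem = solve-∀

  parameters : Parameters n L
  parameters = record
    { cycleWeights = record { ℓ = ℓ ; D = ℓ ! ; D≢0 = ℓ !≢0 ; wt = wt ; wt1 = refl ; wtD = wt-spec }
    ; n/2 = h ; n-1 = m ; N₁ = N₁ ; N/2 = p 38 * (n * (n * n)) * L ; K = p 35 ; R = Q ; R₁ = R₁ ; σ = σ ; J = J ; G = p 5 ; jj = jj
    ; κc = c ; c₁ = c₁ ; c₂ = c₂
    ; nh = nh ; nm = nm ; LN = LN ; NH = NH ; RL = RL ; L>0 = L>0 ; 8Rσ = 8Rσ ; σ>0 = σ>0 ; c₁≡ = c₁≡ ; c₂≡ = c₂≡
    ; hcond = harmonic-large ; g₁ = g₁ ; g₂ = g₂ ; g₃ = g₃ ; g₄ = g₄ ; g₅ = g₅ ; c-large = c-large ; RR = RR ; R≤L = R≤L ; jN = jN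
    ; jj-large = jj-large ; σ-small = σ-small ; J-large = J-large ; n²≤L = nn≤L ; 2n³≤L = nnn≤L }

-- From scales to all large n

bracket : ∀ w → 2 ≤ w → ∀ n → ∃ λ r → w ^ r ≤ suc n × suc n < w * w ^ r
bracket w w≥ zero = 0 , ≤-refl , ≤-trans w≥ (≤-reflexive (sym (*-identityʳ w)))
bracket w w≥ (suc n) with bracket w w≥ n
... | r , lo , hi with suc (suc n) <? w * w ^ r
...   | yes q = r , ≤-trans lo (n≤1+n _) , q
...   | no ¬q = suc r , ≮⇒≥ ¬q , ≤-trans (s≤s hi) (≤-trans (+-mono-≤ (m^n>0 w {{w≢0}} (suc r)) (m≤m+n (w ^ suc r) 0)) (*-monoˡ-≤ (w ^ suc r) w≥))
  where w≢0 = >-nonZero (≤-trans (s≤s z≤n) w≥)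

-- The origin of 17: with G = g^5 and n at most w g^80 the fraction is of order n^(-1/16), and 5 ·
-- 17 = 80 + 5 leaves g^5 for the constants C^17 w.
fraction-bound : ∀ s v n C w g G {t α β} → G * s ≤ C * v → n ≤ w * g ^ β → G ≡ g ^ α → C ^ t * w ≤ g ^ α → 0 < g → α + β ≡ α * t → s ^ t * n ≤ v ^ t
fraction-bound s v n C w g G {t} {α} {β} le n≤ G≡ Cw g>0 αβ = *-cancelˡ-≤ (G ^ t) {{m^n≢0 G t {{G≢0}}}} (begin
  G ^ t * (s ^ t * n) ≡⟨ sym (*-assoc (G ^ t) (s ^ t) n) ⟩
  G ^ t * s ^ t * n ≡⟨ cong (_* n) (sym (^-distrib-* G s t)) ⟩
  (G * s) ^ t * n ≤⟨ *-mono-≤ (^-monoˡ-≤ t le) n≤ ⟩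
  (C * v) ^ t * (w * g ^ β) ≡⟨ cong (_* (w * g ^ β)) (^-distrib-* C v t) ⟩
  C ^ t * v ^ t * (w * g ^ β) ≡⟨ lem (C ^ t) (v ^ t) w (g ^ β) ⟩
  C ^ t * w * g ^ β * v ^ t ≤⟨ *-monoˡ-≤ (v ^ t) (*-monoˡ-≤ (g ^ β) Cw) ⟩
  g ^ α * g ^ β * v ^ t ≡⟨ cong (_* v ^ t) (trans (sym (^-distribˡ-+-* g α β)) (trans (cong (g ^_) αβ) (trans (sym (^-*-assoc g α t)) (cong (_^ t) (sym G≡))))) ⟩
  G ^ t * v ^ t ∎)
  where
  open ≤-Reasoning
  G≢0 : NonZero G
  G≢0 = subst NonZero (sym G≡) (m^n≢0 g α {{>-nonZero g>0}})
  lem : ∀ a b c d → a * b * (c * d) ≡ a * c * d * b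
  lem = solve-∀

module Threshold (w c c₁ c₂ : ℕ) (w≡ : w ≡ 2 ^ 400) (w≥ : 1000 ≤ w) (c≡ : c ≡ 81) (c₁≡ : c₁ ≡ 49 * 49) (c₂≡ : c₂ ≡ 50 * 50) where

  C r₀ : ℕ
  C = 72 * 4 ^ c
  -- Since r ≤ g, this makes w² and C^17 w both at most g.
  r₀ = 4 + (w * w + C ^ 17 * w)

  w≢0 : NonZero w
  w≢0 = >-nonZero (≤-trans (s≤s z≤n) w≥)

  module Scale (r k h : ℕ) (r≥ : r₀ ≤ r) (nh : suc k ≡ h + h) (lo : w ^ r ≤ suc k) (hi : suc k ≤ w * w ^ r) where

    g : ℕ
    g = 2 ^ (r * 5)

    g>0 : 0 < g
    g>0 = m^n>0 2 (r * 5)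

    p : ℕ → ℕ
    p i = g ^ i

    r≤g : r ≤ g
    r≤g = ≤-trans (n≤2^n r) (^-monoʳ-≤ 2 (≤-trans (≤-reflexive (sym (*-identityʳ r))) (*-monoʳ-≤ r (s≤s z≤n))))

    r≥4 : 4 ≤ r
    r≥4 = ≤-trans (m≤m+n 4 (w * w + C ^ 17 * w)) r≥

    ww≤g : w * w ≤ g
    ww≤g = ≤-trans (≤-trans (m≤m+n (w * w) (C ^ 17 * w)) (m≤n+m (w * w + C ^ 17 * w) 4)) (≤-trans r≥ r≤g)

    Cw≤g : C ^ 17 * w ≤ g
    Cw≤g = ≤-trans (≤-trans (m≤n+m (C ^ 17 * w) (w * w)) (m≤n+m (w * w + C ^ 17 * w) 4)) (≤-trans r≥ r≤g)

    -- The value 2^400 of `w` is chosen for this: (2^400)^r = (2^(5r))^80.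
    p80 : w ^ r ≡ p 80
    p80 = trans (cong (_^ r) w≡) (trans (^-*-assoc 2 400 r) (trans (cong (2 ^_) (trans (*-comm 400 r) (sym (*-assoc r 5 80)))) (sym (^-*-assoc 2 (r * 5) 80))))

    e : ℕ
    e = r * 5 ∸ 2

    gj : g ≡ 4 * 2 ^ e
    gj = trans (cong (2 ^_) (sym (m+[n∸m]≡n {2} {r * 5} (≤-trans (≤-trans (≤ᵇ⇒≤ 2 4 tt) r≥4) (≤-trans (≤-reflexive (sym (*-identityʳ r))) (*-monoʳ-≤ r (s≤s z≤n))))))) (^-distribˡ-+-* 2 2 e)

    J : ℕ
    J = pred (28 * r)

    pos-pred : ∀ a → 0 < a → suc (pred a) ≡ a
    pos-pred (suc a) _ = refl

    Jr : suc J ≡ 28 * r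
    Jr = pos-pred (28 * r) (≤-trans (≤-trans (s≤s z≤n) r≥4) (m≤m+n r (27 * r)))

    Q : ℕ
    Q = 2 * (suc k * (suc k * suc k))

    RR : Q ≡ suc (pred Q)
    RR = sym (pos-pred Q (s≤s z≤n))

    module P = Build g r w (suc k) h k c c₁ c₂ (2 ^ e) J (pred Q) p (λ i j → sym (^-distribˡ-+-* g i j)) refl (*-identityʳ g) (^-monoʳ-≤ g {{>-nonZero g>0}})
      (^-*-assoc g) (λ i → trans (^-*-assoc 2 (r * 5) i) (cong (2 ^_) (*-assoc r 5 i))) r≥4 w≥ ww≤g nh refl (≤-trans (≤-reflexive (sym p80)) lo) (≤-trans hi (≤-reflexive (cong (w *_) p80))) c≡ c₁≡ c₂≡ gj Jr RR

    fraction : stableCount (suc k) ^ 17 * suc k ≤ validCount (suc k) ^ 17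
    fraction = fraction-bound (stableCount (suc k)) (validCount (suc k)) (suc k) C w g (p 5) {17} {5} {80} (Combine.stable-fraction k P.L P.parameters) (≤-trans hi (≤-reflexive (cong (w *_) p80))) refl
      (≤-trans Cw≤g (≤-trans (≤-reflexive (sym (*-identityʳ g))) (^-monoʳ-≤ g {{>-nonZero g>0}} {1} {5} (s≤s z≤n)))) g>0 refl

  eventually : ∃ λ N → ∀ n → N ≤ n → 2 ∣ n → stableCount n ^ 17 * n ≤ validCount n ^ 17
  eventually = w ^ r₀ , bound
    where
    bound : ∀ n → w ^ r₀ ≤ n → 2 ∣ n → stableCount n ^ 17 * n ≤ validCount n ^ 17
    bound zero N≤ _ = ⊥-elim (<⇒≱ (m^n>0 w {{w≢0}} r₀) N≤)
    bound (suc k) N≤ (divides h nh) = at-scale (bracket w (≤-trans (≤ᵇ⇒≤ 2 1000 tt) w≥) k)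
      where
      at-scale : (∃ λ r → w ^ r ≤ suc k × suc k < w * w ^ r) → stableCount (suc k) ^ 17 * suc k ≤ validCount (suc k) ^ 17
      at-scale (r , lo , hi) = Scale.fraction r k h (≮⇒≥ λ q → <⇒≱ hi (≤-trans (^-monoʳ-≤ w {{w≢0}} q) N≤))
        (trans nh (trans (*-comm h 2) (cong (h +_) (+-identityʳ h)))) lo (<⇒≤ hi)

theorem1p1 : ∃ λ (N : ℕ) → ∀ (n : ℕ) → N ≤ n → 2 ∣ n →
    stableCount n ^ 17 * n ≤ validCount n ^ 17
theorem1p1 = Threshold.eventually (2 ^ 400) 81 (49 * 49) (50 * 50) refl (≤ᵇ⇒≤ 1000 (2 ^ 400) tt) refl refl refl
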